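{- Let $S$ and $T$ be shifted Young tableaux (entries in $X$) such that $T$ extends $S$, and let the shifted tableau switching transform $(S,T)$ into $({}^ST,S_T)$. Then: (a) the shifted tableau switching transforms $({}^ST,S_T)$ into $(S,T)$; (b) if $T$ is an LRS tableau, then so is ${}^ST$; (c) if $S$ is an LRS tableau, then so is $S_T$.
   Context: Shifted shapes: for a strict partition $\lambda$, $S(\lambda)=\{(i,j):1\le i\le\ell(\lambda),\ i\le j\le\lambda_i+i-1\}$ (matrix coordinates), main diagonal $\{(i,i)\}$, $\lambda/\mu=S(\lambda)\setminus S(\mu)$; $\lambda/\mu$ extends $\mu/\nu$ when $\nu\subseteq\mu\subseteq\lambda$, and a filling extends another if its shape does. Letters $X=\{1'<1<2'<2<\cdots\}$; $|x|$ is $x$ with prime removed; bold $\mathbf{k}$ means $k$ or $k'$. A shifted Young tableau (SYT): filling of a skew shifted shape by $X$, weakly increasing along rows and columns, each column containing at most one unprimed $k$, each row at most one $k'$. The reading word $w(T)$ reads entries from right to left in each row, starting with the top row. Lattice property: for a word $w=w_1\cdots w_n$ in $X$, let $\hat w$ be obtained by reading $w$ from right to left and replacing each $k$ by $(k+1)'$ and each $k'$ by $k$. Let $w\hat w=a_1\cdots a_{2n}$ and let $m_i(j)$ be the number of occurrences of the unprimed letter $i$ among $a_1\cdots a_j$ ($m_i(0)=0$). $w$ satisfies the lattice property if for all $i\ge2$ and $0\le j<2n$, whenever $m_i(j)=m_{i-1}(j)$, $a_{j+1}$ is neither $i$ nor $i'$. An LRS word is a word satisfying the lattice property such that, for each $i$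 occurring in $|w|$, the rightmost $i$ of $|w|$ is unprimed in $w$. An LRS tableau is an SYT whose reading word is an LRS word. Switches on a filling whose boxes are labelled $\mathbf{a}$-boxes (entries $a,a'$) or $\mathbf{b}$-boxes (entries $b,b'$); at an $\mathbf{a}$-box $c=(i,j)$ with entry $\alpha$, $E=(i,j+1)$, $S=(i+1,j)$ (entries move with labels): (S3) $j=i$, $E$ a $\mathbf{b}$-box with entry $b'$, $(i+1,i+1)$ a $\mathbf{b}$-box with entry $\beta$: new entries $\beta$ at $(i,i)$, $b$ at $(i,i+1)$ ($\mathbf{b}$-boxes), $\alpha$ at $(i+1,i+1)$. (S4) $j=i+1$, $\alpha=a$, $(i,i)$ an $\mathbf{a}$-box with entry $\alpha_0$, $S=(i+1,i+1)$ a $\mathbf{b}$-box with entry $\beta$, $E$ not a $\mathbf{b}$-box: new entries $\beta$ at $(i,i)$, $a'$ at $(i,i+1)$, $\alpha_0$ at $(i+1,i+1)$. (S7) as (S4) but $E$ a $\mathbf{b}$-box with entry $b$ (unchanged). (S5) $E,S$ both $\mathbf{b}$-boxes, $E$ entry $b'$: interchange $c,E$. (S6) $E,S$ both $\mathbf{b}$-boxes, $E$ entry $b$, not (S7): interchange $c,S$. (S1) only $E$ a $\mathbf{b}$-box, not (S3): interchange $c,E$. (S2) only $S$ a $\mathbf{b}$-box, not (S4): interchange $c,S$. A filling is fully switched if no $\mathbf{a}$-box has a $\mathbf{b}$-box as east or south neighbor. Otherwise $\Box(U)$ is the easternmost $\mathbf{a}$-box with entry $a$ having a $\mathbf{b}$-box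 as east or south neighbor, or if none, the southernmost such $\mathbf{a}$-box with entry $a'$; $\sigma(U)$ applies the applicable switch at $\Box(U)$. The shifted switching process on a pair ($\mathbf{a}$-part, $\mathbf{b}$-part) applies $\sigma$ until fully switched. Shifted tableau switching of a pair $(S,T)$ of SYTs with $T$ extending $S$: label boxes by $S$ or $T$; with $m=\max(S)$, $n=\max(T)$, for $i=m,\ldots,1$ and for each $i$, $j=1,\ldots,n$, apply in the current filling the shifted switching process to (current $S$-boxes with entries $\mathbf{i}$, current $T$-boxes with entries $\mathbf{j}$). Finally $S_T$ is the filling of the $S$-labelled boxes, ${}^ST$ that of the $T$-labelled boxes, and the switching sends $(S,T)$ to $({}^ST,S_T)$; components are treated independently. -}

module Defs where

open import Data.Nat using (ℕ; zero; suc; _+_; _*_; _∸_; _≤_; _<_; _≡ᵇ_)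
open import Data.Bool using (Bool; true; false; if_then_else_; _∧_)
open import Data.List using (List; []; _∷_; _++_; map; reverse; concatMap; mapMaybe; upTo; downFrom)
open import Data.Nat.ListAction using (sum)
open import Data.List.Relation.Unary.All using (All)
open import Data.List.Relation.Unary.Linked using (Linked)
open import Data.Maybe using (Maybe; just; nothing)
open import Data.Product using (Σ; _×_; _,_; proj₁; proj₂)
open import Data.Sum using (_⊎_)
open import Relation.Binary.PropositionalEquality using (_≡_; _≢_)
open import Relation.Nullary using (¬_)

-- Letters X = {1' < 1 < 2' < 2 < ...}
-- pr k is k' and un k is k (letters of an SYT are required to have k ≥ 1)

data Letter : Set where
  pr : ℕ → Letter
  un : ℕ → Letter

∣_∣ : Letter → ℕ
∣ pr k ∣ = k
∣ un k ∣ = k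

code : Letter → ℕ
code (pr k) = k + k
code (un k) = suc (k + k)

_≤L_ : Letter → Letter → Set
x ≤L y = code x ≤ code y

IsUnprimed : Letter → Set
IsUnprimed x = Σ ℕ (λ k → x ≡ un k)

-- Strict partitions and shifted shapes (matrix coordinates, 1-based)

Pos : Set
Pos = ℕ × ℕ

StrictPartition : List ℕ → Set
StrictPartition la = All (λ k → 0 < k) la × Linked (λ a b → b < a) la

-- la_i with 1-based index i (0 beyond the length)
part : List ℕ → ℕ → ℕ
part [] _ = 0
part (x ∷ xs) zero = 0
part (x ∷ xs) (suc zero) = x
part (x ∷ xs) (suc (suc n)) = part xs (suc n)

-- (i,j) ∈ S(la) : 1 ≤ i ≤ ℓ(la), i ≤ j ≤ la_i + i - 1
InShape : List ℕ → Pos → Set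
InShape la (i , j) = 1 ≤ i × i ≤ j × j < part la i + i

_⊆ˢ_ : List ℕ → List ℕ → Set
mu ⊆ˢ la = ∀ p → InShape mu p → InShape la p

InSkew : List ℕ → List ℕ → Pos → Set
InSkew la mu p = InShape la p × ¬ InShape mu p

Filling : Set
Filling = Pos → Maybe Letter

HasShape : List ℕ → List ℕ → Filling → Set
HasShape la mu U =
  (∀ p x → U p ≡ just x → InSkew la mu p) ×
  (∀ p → InSkew la mu p → Σ Letter (λ x → U p ≡ just x))

IsSYT : List ℕ → List ℕ → Filling → Set
IsSYT la mu U =
  HasShape la mu U ×
  (∀ p x → U p ≡ just x → 1 ≤ ∣ x ∣) ×
  (∀ i j j' x y → j < j' → U (i , j) ≡ just x → U (i , j') ≡ just y → x ≤L y) ×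
  (∀ i i' j x y → i < i' → U (i , j) ≡ just x → U (i' , j) ≡ just y → x ≤L y) ×
  (∀ i i' j k → U (i , j) ≡ just (un k) → U (i' , j) ≡ just (un k) → i ≡ i') ×
  (∀ i j j' k → U (i , j) ≡ just (pr k) → U (i , j') ≡ just (pr k) → j ≡ j')

readRow : ℕ → Filling → ℕ → List Letter
readRow B U i = mapMaybe (λ j → U (i , j)) (map suc (downFrom B))

readingWord : ℕ → Filling → List Letter
readingWord B U = concatMap (readRow B U) (map suc (upTo B))

hatL : Letter → Letter
hatL (un k) = pr (suc k)
hatL (pr k) = un k

hat : List Letter → List Letter
hat w = map hatL (reverse w)

countUn : ℕ → List Letter → ℕ
countUn i [] = 0
countUn i (pr k ∷ l) = countUn i l
countUn i (un k ∷ l) = if k ≡ᵇ i then suc (countUn i l) else countUn i l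

-- a_1 ... a_{2n} = w ŵ ; pre = a_1 ... a_j, x = a_{j+1}
Lattice : List Letter → Set
Lattice w = ∀ (i : ℕ) (pre : List Letter) (x : Letter) (suf : List Letter) →
  w ++ hat w ≡ pre ++ x ∷ suf → 2 ≤ i →
  countUn i pre ≡ countUn (i ∸ 1) pre → ∣ x ∣ ≢ i

RightmostUnprimed : List Letter → Set
RightmostUnprimed w = ∀ (pre : List Letter) (x : Letter) (suf : List Letter) →
  w ≡ pre ++ x ∷ suf → All (λ y → ∣ y ∣ ≢ ∣ x ∣) suf → IsUnprimed x

IsLRSWord : List Letter → Set
IsLRSWord w = Lattice w × RightmostUnprimed w

-- LRS tableau: an SYT (of some skew shifted shape la/mu) with LRS reading word
-- (the bound sum la exceeds every row and column index of S(la))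
IsLRSTableau : Filling → Set
IsLRSTableau U = Σ (List ℕ) λ la → Σ (List ℕ) λ mu →
  StrictPartition la × StrictPartition mu × mu ⊆ˢ la ×
  IsSYT la mu U × IsLRSWord (readingWord (sum la) U)

data Label : Set where
  SL TL : Label

LFilling : Set
LFilling = Pos → Maybe (Label × Letter)

eqPos : Pos → Pos → Bool
eqPos (i , j) (i' , j') = (i ≡ᵇ i') ∧ (j ≡ᵇ j')

upd : Pos → Maybe (Label × Letter) → LFilling → LFilling
upd p v G q = if eqPos q p then v else G q

swapP : Pos → Pos → LFilling → LFilling
swapP p q G = upd p (G q) (upd q (G p) G)

east south : Pos → Pos
east (i , j) = (i , suc j)
south (i , j) = (suc i , j)

IsABox : ℕ → LFilling → Pos → Set
IsABox a G p = Σ Letter λ x → G p ≡ just (SL , x) × ∣ x ∣ ≡ a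

IsBBox : ℕ → LFilling → Pos → Set
IsBBox b G p = Σ Letter λ x → G p ≡ just (TL , x) × ∣ x ∣ ≡ b

HasBNbr : ℕ → LFilling → Pos → Set
HasBNbr b G c = IsBBox b G (east c) ⊎ IsBBox b G (south c)

FullySwitched : ℕ → ℕ → LFilling → Set
FullySwitched a b G = ∀ c → IsABox a G c → ¬ HasBNbr b G c

CandU CandP : ℕ → ℕ → LFilling → Pos → Set
CandU a b G c = G c ≡ just (SL , un a) × HasBNbr b G c
CandP a b G c = G c ≡ just (SL , pr a) × HasBNbr b G c

IsBox : ℕ → ℕ → LFilling → Pos → Set
IsBox a b G c =
  (CandU a b G c × (∀ c' → CandU a b G c' → proj₂ c' ≤ proj₂ c)) ⊎
  ((∀ c' → ¬ CandU a b G c') × CandP a b G c × (∀ c' → CandP a b G c' → proj₁ c' ≤ proj₁ c))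

-- conditions of (S3), and of (S4)/(S7) (the parts not already implied by the case)
S3cond : ℕ → ℕ → LFilling → Pos → Set
S3cond a b G (i , j) = j ≡ i × G (i , suc j) ≡ just (TL , pr b) × IsBBox b G (suc i , suc i)

S47cond : ℕ → ℕ → LFilling → Pos → Set
S47cond a b G (i , j) = j ≡ suc i × G (i , j) ≡ just (SL , un a) × IsABox a G (i , i)

data SwStep (a b : ℕ) (G : LFilling) : LFilling → Set where
  s3 : ∀ {i α β} → IsBox a b G (i , i) → G (i , i) ≡ just (SL , α) →
       G (i , suc i) ≡ just (TL , pr b) →
       G (suc i , suc i) ≡ just (TL , β) → ∣ β ∣ ≡ b →
       SwStep a b G (upd (i , i) (just (TL , β))
                    (upd (i , suc i) (just (TL , un b))
                    (upd (suc i , suc i) (just (SL , α)) G)))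
  s4 : ∀ {i α₀ β} → IsBox a b G (i , suc i) → G (i , suc i) ≡ just (SL , un a) →
       G (i , i) ≡ just (SL , α₀) → ∣ α₀ ∣ ≡ a →
       G (suc i , suc i) ≡ just (TL , β) → ∣ β ∣ ≡ b →
       ¬ IsBBox b G (i , suc (suc i)) →
       SwStep a b G (upd (i , i) (just (TL , β))
                    (upd (i , suc i) (just (SL , pr a))
                    (upd (suc i , suc i) (just (SL , α₀)) G)))
  s7 : ∀ {i α₀ β} → IsBox a b G (i , suc i) → G (i , suc i) ≡ just (SL , un a) →
       G (i , i) ≡ just (SL , α₀) → ∣ α₀ ∣ ≡ a →
       G (suc i , suc i) ≡ just (TL , β) → ∣ β ∣ ≡ b →
       G (i , suc (suc i)) ≡ just (TL , un b) →
       SwStep a b G (upd (i , i) (just (TL , β))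
                    (upd (i , suc i) (just (SL , pr a))
                    (upd (suc i , suc i) (just (SL , α₀)) G)))
  s5 : ∀ {c} → IsBox a b G c → G (east c) ≡ just (TL , pr b) → IsBBox b G (south c) →
       SwStep a b G (swapP c (east c) G)
  s6 : ∀ {c} → IsBox a b G c → G (east c) ≡ just (TL , un b) → IsBBox b G (south c) →
       ¬ S47cond a b G c →
       SwStep a b G (swapP c (south c) G)
  s1 : ∀ {c} → IsBox a b G c → IsBBox b G (east c) → ¬ IsBBox b G (south c) →
       ¬ S3cond a b G c →
       SwStep a b G (swapP c (east c) G)
  s2 : ∀ {c} → IsBox a b G c → ¬ IsBBox b G (east c) → IsBBox b G (south c) →
       ¬ S47cond a b G c →
       SwStep a b G (swapP c (south c) G)

data Process (a b : ℕ) : LFilling → LFilling → Set where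
  done : ∀ {G} → FullySwitched a b G → Process a b G G
  step : ∀ {G G' H} → SwStep a b G G' → Process a b G' H → Process a b G H

data RunJ (a n : ℕ) : ℕ → LFilling → LFilling → Set where
  stop : ∀ {j G} → n < j → RunJ a n j G G
  go   : ∀ {j G G' H} → j ≤ n → Process a j G G' → RunJ a n (suc j) G' H →
         RunJ a n j G H

data RunI (n : ℕ) : ℕ → LFilling → LFilling → Set where
  base : ∀ {G} → RunI n 0 G G
  next : ∀ {i G G' H} → RunJ (suc i) n 1 G G' → RunI n i G' H → RunI n (suc i) G H

-- m = max(U) : the largest |entry| (0 for the empty filling)
IsMax : Filling → ℕ → Set
IsMax U m = (∀ p x → U p ≡ just x → ∣ x ∣ ≤ m) ×
            (∀ k → (∀ p x → U p ≡ just x → ∣ x ∣ ≤ k) → m ≤ k)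

initL : Filling → Filling → LFilling
initL S T p with S p
... | just x = just (SL , x)
... | nothing with T p
...   | just y = just (TL , y)
...   | nothing = nothing

partL : Label → LFilling → Filling
partL l G p with G p
... | nothing = nothing
... | just (SL , x) with l
...   | SL = just x
...   | TL = nothing
partL l G p | just (TL , x) with l
...   | SL = nothing
...   | TL = just x

-- the shifted tableau switching sends (S,T) to (S',T') = (^S T, S_T)
Switching : Filling → Filling → Filling → Filling → Set
Switching S T S' T' =
  Σ ℕ λ m → Σ ℕ λ n → IsMax S m × IsMax T n ×
  Σ LFilling λ H → RunI n m (initL S T) H ×
    (∀ p → partL TL H p ≡ S' p) × (∀ p → partL SL H p ≡ T' p)

{-# OPTIONS --safe #-}
module Submission where

open import Defs
open import Data.List using (List; []; _∷_; _++_; concatMap; _ʳ++_; map; length; reverse; upTo; filter; mapMaybe; downFrom; [_])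
open import Data.Product using (Σ; ∃; _×_; _,_; proj₁; proj₂)
open import Relation.Binary.PropositionalEquality using (_≡_; refl; sym; trans; cong; cong₂; subst; _≢_; subst₂)
open import Data.Nat using (ℕ; zero; suc; _+_; _≤_; _<_; z≤n; s≤s; _≡ᵇ_; _<ᵇ_)
open import Data.List.Membership.Propositional using (_∈_; _∉_; lose)
open import Data.List.Relation.Unary.Any using (here; there)
open import Data.Product.Properties using (≡-dec)
open import Data.Sum using (_⊎_; inj₁; inj₂; [_,_]′)
open import Data.Empty using (⊥; ⊥-elim)
open import Data.Unit using (⊤; tt)
open import Data.Vec using ([]; _∷_)
open import Relation.Nullary using (¬_; Dec; yes; no)
open import Relation.Nullary.Decidable using (_⊎-dec_)
open import Relation.Binary.Definitions using (tri<; tri≈; tri>)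
open import Data.Bool using (Bool; true; false; T; _∧_; not)
open import Data.List.Relation.Unary.All using (All; []; _∷_)
open import Data.List.Relation.Unary.AllPairs using (AllPairs; []; _∷_)
open import Data.List.Relation.Unary.Linked using (Linked; []; [-]; _∷_)
open import Function using (flip; case_of_)
open import Data.List.Membership.Propositional.Properties using (∈-map⁺; ∈-map⁻; ∈-++⁺ˡ; ∈-++⁺ʳ; ∈-++⁻; ∈-∃++; ∈-concatMap⁺; ∈-concatMap⁻; ∈-upTo⁺; ∈-filter⁺; ∈-filter⁻; ∈-downFrom⁺)
open import Data.Maybe using (Maybe; just; nothing)
open import Data.Maybe.Properties using (just-injective)
open import Data.List.Properties using (++-identityʳ; map-++; ++-assoc; ∷-injectiveˡ; ∷-injectiveʳ; reverse-involutive; length-reverse; length-++; length-map; unfold-reverse; reverse-++; upTo-∷ʳ; concatMap-++; mapMaybe-++; mapMaybe-map)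
open import Data.List.Relation.Unary.All.Properties using (map⁻; ++⁻ˡ; ++⁻ʳ; ++⁺)
open import Data.Nat.ListAction using (sum)
open import Data.Nat.Properties
import Data.List.Relation.Unary.All as All
import Data.List.Relation.Unary.AllPairs as AllPairs
import Data.List.Relation.Unary.AllPairs.Properties as AP
import Data.List.Relation.Unary.Any as Any

-- The boxes of an SYT with letter k or k′ form a band: listed in standardisation order they first descend to the
-- south-west and then ascend to the north-east, and only the letter of the turning point is not determined by
-- the positions. The concatenation of the bands of S and T adds the boxes of S and then those of T one at a time
-- to the inner shape. The switching process moves the boxes of S past those of T one by one, last box first, by
-- the local rule that two consecutive boxes exchange their labels if they are neighbours and commute otherwise;
-- (S3), (S4) and (S7) are exactly the moves that shift a turning point, whose flag (primed or not) is preserved.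
-- Hence the whole run is a grid of local exchanges; the rule is deterministic and symmetric, so the grid read
-- backwards is the run from (ˢT , S_T), which gives (a). For (b) and (c) the lattice property is rewritten as
-- inequalities between numbers of boxes of consecutive bands in given rows (`Lat`), the condition on rightmost
-- letters says that all flags are false, and both are unchanged by moving a single box past consecutive bands.

-- One switch is not always one exchange, and this shapes the simulation. (S3) takes a box past two
-- boxes of the other band. In (S4) and (S7) two boxes of one band move at once, and their two
-- exchanges are not consecutive in the grid: between them stand exchanges of boxes that do not
-- touch, which leave the filling as it is. The simulation therefore follows states, which record
-- how far the travelling box has come in the chain; several states may show the same filling. The
-- boxes of a half-moved band cannot be compared where they stand, because one of them has passed
-- boxes that the other has not. Links between them are stated for the places reached after catching
-- up. Determinism is not argued switch by switch: every run ends in a grid, and grid, directions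
-- and flags leave only one result. In (b) the boxes of S pass the bands whose lattice condition is
-- wanted. For (c) the grid is read backwards, where the boxes of the switched T pass the bands of
-- the switched S and restore those of S; this is why invariance is proved as an equivalence.

-- Linear arithmetic over the natural numbers

module Linear where

  open import Data.Nat using (ℕ; zero; suc; _+_; _*_; _≤_; _<_; z≤n; s≤s; _≤ᵇ_; _<ᵇ_)
  open import Data.Nat.Properties
  open import Data.Nat.Solver using (module +-*-Solver)
  open import Data.Integer as ℤ using (ℤ; +_; -[1+_])
  open import Data.Bool using (Bool; true; false; if_then_else_; _∧_; T)
  open import Data.Bool.Properties using (T-∧)
  open import Data.Fin using (Fin; zero; suc)
  open import Data.List as List using (List; []; _∷_; _++_)
  open import Data.Maybe using (Maybe; just; nothing)
  open import Data.Product using (Σ; _×_; _,_; proj₁; proj₂)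
  open import Data.Empty using (⊥; ⊥-elim)
  open import Data.Unit using (⊤; tt)
  open import Data.Vec as Vec using (Vec; []; _∷_; lookup; allFin; replicate; zipWith)
  open import Data.Vec.N-ary using (N-ary; _$ⁿ_)
  open import Function using (_∘_; Equivalence)
  open import Relation.Binary.PropositionalEquality using (_≡_; refl; sym; trans; cong; cong₂; subst)
  open import Relation.Nullary using (¬_; yes; no)

  infixl 6 _:+_
  infix 4 _:≤_ _:<_ _:≡_
  infix 3 _⊢_

  data Ex (n : ℕ) : Set where
    var  : Fin n → Ex n
    lit  : ℕ → Ex n
    _:+_ : Ex n → Ex n → Ex n

  data Fm (n : ℕ) : Set where
    _:≤_ _:≡_ : Ex n → Ex n → Fm n
    :⊥        : Fm n

  _:<_ : ∀ {n} → Ex n → Ex n → Fm n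
  x :< y = lit 1 :+ x :≤ y

  record Sequent (n : ℕ) : Set where
    constructor _⊢_
    field
      hyps : List (Fm n)
      goal : Fm n

  module _ {n : ℕ} where

    ⟦_⟧ : Ex n → Vec ℕ n → ℕ
    ⟦ var i ⟧ ρ = lookup ρ i
    ⟦ lit k ⟧ ρ = k
    ⟦ x :+ y ⟧ ρ = ⟦ x ⟧ ρ + ⟦ y ⟧ ρ

    Holds : Fm n → Vec ℕ n → Set
    Holds (x :≤ y) ρ = ⟦ x ⟧ ρ ≤ ⟦ y ⟧ ρ
    Holds (x :≡ y) ρ = ⟦ x ⟧ ρ ≡ ⟦ y ⟧ ρ
    Holds :⊥       ρ = ⊥

    Valid : List (Fm n) → Fm n → Vec ℕ n → Set
    Valid []       g ρ = Holds g ρ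
    Valid (h ∷ hs) g ρ = Holds h ρ → Valid hs g ρ

    -- Coefficient vectors; the head entry is the constant term.
    Lin : Set
    Lin = Vec ℕ (suc n)

    dot : ∀ {m} → Vec ℕ m → Vec ℕ m → ℕ
    dot []       []       = 0
    dot (a ∷ as) (x ∷ xs) = a * x + dot as xs

    unit : ∀ {m} → Fin m → Vec ℕ m
    unit zero    = 1 ∷ replicate _ 0
    unit (suc i) = 0 ∷ unit i

    lin : Ex n → Lin
    lin (var i)  = 0 ∷ unit i
    lin (lit k)  = k ∷ replicate _ 0
    lin (x :+ y) = zipWith _+_ (lin x) (lin y)

    dot-0 : ∀ {m} (ρ : Vec ℕ m) → dot (replicate m 0) ρ ≡ 0
    dot-0 []      = refl
    dot-0 (x ∷ ρ) = dot-0 ρ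

    dot-unit : ∀ {m} (i : Fin m) (ρ : Vec ℕ m) → dot (unit i) ρ ≡ lookup ρ i
    dot-unit zero    (x ∷ ρ) = trans (cong₂ _+_ (*-identityˡ x) (dot-0 ρ)) (+-identityʳ x)
    dot-unit (suc i) (x ∷ ρ) = dot-unit i ρ

    dot-+ : ∀ {m} (as bs ρ : Vec ℕ m) → dot (zipWith _+_ as bs) ρ ≡ dot as ρ + dot bs ρ
    dot-+ []       []       []      = refl
    dot-+ (a ∷ as) (b ∷ bs) (x ∷ ρ) = trans (cong (_+_ ((a + b) * x)) (dot-+ as bs ρ))
      (solve 5 (λ a b x p q → (a :+′ b) :* x :+′ (p :+′ q) := (a :* x :+′ p) :+′ (b :* x :+′ q)) refl
        a b x (dot as ρ) (dot bs ρ))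
      where open +-*-Solver renaming (_:+_ to _:+′_)

    dot-* : ∀ {m} k (as ρ : Vec ℕ m) → dot (Vec.map (k *_) as) ρ ≡ k * dot as ρ
    dot-* k []       []      = sym (*-zeroʳ k)
    dot-* k (a ∷ as) (x ∷ ρ) = trans (cong₂ _+_ (*-assoc k a x) (dot-* k as ρ)) (sym (*-distribˡ-+ k (a * x) (dot as ρ)))

    lin-sound : ∀ e ρ → dot (lin e) (1 ∷ ρ) ≡ ⟦ e ⟧ ρ
    lin-sound (var i)  ρ = dot-unit i ρ
    lin-sound (lit k)  ρ = trans (cong₂ _+_ (*-identityʳ k) (dot-0 ρ)) (+-identityʳ k)
    lin-sound (x :+ y) ρ = trans (dot-+ (lin x) (lin y) (1 ∷ ρ)) (cong₂ _+_ (lin-sound x ρ) (lin-sound y ρ))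

    Ineq : Set
    Ineq = Lin × Lin

    HoldsI : Vec ℕ n → Ineq → Set
    HoldsI ρ (l , r) = dot l (1 ∷ ρ) ≤ dot r (1 ∷ ρ)

    AllI : Vec ℕ n → List Ineq → Set
    AllI ρ []       = ⊤
    AllI ρ (c ∷ cs) = HoldsI ρ c × AllI ρ cs

    combine : List ℕ → List Ineq → Ineq
    combine (w ∷ ws) ((l , r) ∷ cs) =
      zipWith _+_ (Vec.map (w *_) l) (proj₁ (combine ws cs)) , zipWith _+_ (Vec.map (w *_) r) (proj₂ (combine ws cs))
    -- The neutral inequality 0 ≤ 0 is never absurd, so an empty list of weights from a failed
    -- search makes the check fail.
    combine _ _ = replicate _ 0 , replicate _ 0

    combine-sound : ∀ ρ ws cs → AllI ρ cs → HoldsI ρ (combine ws cs)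
    combine-sound ρ []       []       _ = ≤-refl
    combine-sound ρ []       (_ ∷ _)  _ = ≤-refl
    combine-sound ρ (_ ∷ _)  []       _ = ≤-refl
    combine-sound ρ (w ∷ ws) ((l , r) ∷ cs) (h , hs)
      rewrite dot-+ (Vec.map (w *_) l) (proj₁ (combine ws cs)) (1 ∷ ρ)
            | dot-+ (Vec.map (w *_) r) (proj₂ (combine ws cs)) (1 ∷ ρ)
            | dot-* w l (1 ∷ ρ) | dot-* w r (1 ∷ ρ)
      = +-mono-≤ (*-monoʳ-≤ w h) (combine-sound ρ ws cs hs)

    _≥ᵇ*_ : ∀ {m} → Vec ℕ m → Vec ℕ m → Bool
    []       ≥ᵇ* []       = true
    (a ∷ as) ≥ᵇ* (b ∷ bs) = (b ≤ᵇ a) ∧ (as ≥ᵇ* bs)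

    ≥*-sound : ∀ {m} (as bs ρ : Vec ℕ m) → T (as ≥ᵇ* bs) → dot bs ρ ≤ dot as ρ
    ≥*-sound []       []       []      _ = z≤n
    ≥*-sound (a ∷ as) (b ∷ bs) (x ∷ ρ) t with Equivalence.to T-∧ t
    ... | t₁ , t₂ = +-mono-≤ (*-monoˡ-≤ x (≤ᵇ⇒≤ b a t₁)) (≥*-sound as bs ρ t₂)

    -- The variables are natural numbers, so it does no harm if coefficients on the left exceed
    -- those on the right; only the constants need a strict gap.
    absurdᵇ : Ineq → Bool
    absurdᵇ ((l ∷ ls) , (r ∷ rs)) = (r <ᵇ l) ∧ (ls ≥ᵇ* rs)

    absurd-sound : ∀ ρ c → T (absurdᵇ c) → ¬ HoldsI ρ c
    absurd-sound ρ ((l ∷ ls) , (r ∷ rs)) t h with Equivalence.to T-∧ t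
    ... | t₁ , t₂ = <-irrefl refl (<-≤-trans
      (+-mono-<-≤ (subst (_< l * 1) (sym (*-identityʳ r)) (subst (r <_) (sym (*-identityʳ l)) (<ᵇ⇒< r l t₁))) (≥*-sound ls rs ρ t₂)) h)

    -- Fourier–Motzkin search for the weights; its correctness is irrelevant since the result is checked.
    FRow : Set
    FRow = List ℤ × List ℕ

    _⊕_ : List ℕ → List ℕ → List ℕ
    []       ⊕ bs       = bs
    as       ⊕ []       = as
    (a ∷ as) ⊕ (b ∷ bs) = a + b ∷ as ⊕ bs

    resolve : ℤ → FRow → ℤ → FRow → FRow
    resolve p (as , ms) q (bs , ns) =
      List.zipWith ℤ._+_ (List.map (q ℤ.*_) as) (List.map (p ℤ.*_) bs) ,
      List.map (ℤ.∣ q ∣ *_) ms ⊕ List.map (ℤ.∣ p ∣ *_) ns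

    split : List FRow → List (ℤ × FRow) × List (ℤ × FRow) × List FRow
    split [] = [] , [] , []
    split (([] , ms) ∷ rs) = split rs
    split ((+ zero ∷ as , ms) ∷ rs) = let p , q , z = split rs in p , q , (as , ms) ∷ z
    split ((a@(+ suc _) ∷ as , ms) ∷ rs) = let p , q , z = split rs in (a , as , ms) ∷ p , q , z
    split ((-[1+ k ] ∷ as , ms) ∷ rs) = let p , q , z = split rs in p , (+ suc k , as , ms) ∷ q , z

    -- Rows with a negative coefficient survive on their own, because the variables are nonnegative.
    eliminate : ℕ → List FRow → List FRow
    eliminate zero    rs = rs
    eliminate (suc k) rs with split rs
    ... | p , q , z = eliminate k
      (List.map proj₂ q ++ z ++ List.concatMap (λ where (a , ra) → List.map (λ where (b , rb) → resolve a ra b rb) q) p)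

    negative : List FRow → List ℕ
    negative [] = []
    negative ((-[1+ _ ] ∷ _ , ms) ∷ rs) = ms
    negative (_ ∷ rs) = negative rs

    units : ℕ → List ℕ
    units zero    = 1 ∷ []
    units (suc k) = 0 ∷ units k

    -- The row of l ≤ r holds the coefficients of r - l with the constant last, and a unit vector
    -- naming the hypothesis. Elimination strips the leading variable and accumulates these vectors
    -- into weights.
    rows : ℕ → List Ineq → List FRow
    rows i [] = []
    rows i ((l ∷ ls , r ∷ rs) ∷ cs) =
      (Vec.toList (zipWith (λ a b → + b ℤ.- + a) ls rs) ++ (+ r ℤ.- + l) ∷ [] , units i) ∷ rows (suc i) cs

    search : List Ineq → List ℕ
    search cs = negative (eliminate n (rows 0 cs))

    ineqs : Fm n → List Ineq
    ineqs (x :≤ y) = (lin x , lin y) ∷ []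
    ineqs (x :≡ y) = (lin x , lin y) ∷ (lin y , lin x) ∷ []
    -- A false hypothesis becomes 1 + x + y + ... ≤ 0, which the check recognises as absurd.
    ineqs :⊥       = (replicate _ 1 , replicate _ 0) ∷ []

    ineqs* : List (Fm n) → List Ineq
    ineqs* []       = []
    ineqs* (h ∷ hs) = ineqs h ++ ineqs* hs

    refutes : List Ineq → Bool
    refutes cs = absurdᵇ (combine (search cs) cs)

    refute : ∀ ρ cs → T (refutes cs) → ¬ AllI ρ cs
    refute ρ cs t hs = absurd-sound ρ (combine (search cs) cs) t (combine-sound ρ (search cs) cs hs)

    entails : List Ineq → Fm n → Bool
    entails cs (x :≤ y) = refutes ((lin (lit 1 :+ y) , lin x) ∷ cs)
    entails cs (x :≡ y) = entails cs (x :≤ y) ∧ entails cs (y :≤ x)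
    entails cs :⊥       = refutes cs

    entails-≤ : ∀ ρ cs x y → T (refutes ((lin (lit 1 :+ y) , lin x) ∷ cs)) → AllI ρ cs → ⟦ x ⟧ ρ ≤ ⟦ y ⟧ ρ
    entails-≤ ρ cs x y t hs = ≮⇒≥ λ y<x → refute ρ _ t
      (≤-trans (≤-reflexive (lin-sound (lit 1 :+ y) ρ)) (≤-trans y<x (≤-reflexive (sym (lin-sound x ρ)))) , hs)

    entails-sound : ∀ ρ cs g → T (entails cs g) → AllI ρ cs → Holds g ρ
    entails-sound ρ cs (x :≤ y) t hs = entails-≤ ρ cs x y t hs
    entails-sound ρ cs (x :≡ y) t hs with Equivalence.to T-∧ t
    ... | t₁ , t₂ = ≤-antisym (entails-≤ ρ cs x y t₁ hs) (entails-≤ ρ cs y x t₂ hs)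
    entails-sound ρ cs :⊥ t hs = refute ρ cs t hs

    AllI-++ : ∀ ρ cs ds → AllI ρ cs → AllI ρ ds → AllI ρ (cs ++ ds)
    AllI-++ ρ []       ds _        hs = hs
    AllI-++ ρ (c ∷ cs) ds (h , h′) hs = h , AllI-++ ρ cs ds h′ hs

    ineqs-sound : ∀ ρ h → Holds h ρ → AllI ρ (ineqs h)
    ineqs-sound ρ (x :≤ y) h = ≤-trans (≤-reflexive (lin-sound x ρ)) (≤-trans h (≤-reflexive (sym (lin-sound y ρ)))) , tt
    ineqs-sound ρ (x :≡ y) h =
      ≤-reflexive (trans (lin-sound x ρ) (trans h (sym (lin-sound y ρ)))) ,
      ≤-reflexive (sym (trans (lin-sound x ρ) (trans h (sym (lin-sound y ρ))))) , tt

    valid : ∀ ρ hs g cs → AllI ρ cs → T (entails (cs ++ ineqs* hs) g) → Valid hs g ρ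
    valid ρ []       g cs as t = entails-sound ρ _ g t (AllI-++ ρ cs [] as tt)
    valid ρ (h ∷ hs) g cs as t = λ p → valid ρ hs g (cs ++ ineqs h) (AllI-++ ρ cs _ as (ineqs-sound ρ h p))
      (subst (λ ds → T (entails ds g)) (assoc cs (ineqs h) (ineqs* hs)) t)
      where
      assoc : ∀ (as bs ds : List Ineq) → as ++ (bs ++ ds) ≡ (as ++ bs) ++ ds
      assoc []       bs ds = refl
      assoc (a ∷ as) bs ds = cong (a ∷_) (assoc as bs ds)

  -- For a concrete sequent the implicit argument normalises to the unit type and is inferred. A
  -- call consists of the values of the variables, the sequent and proofs of its hypotheses.
  lia : ∀ {n} (ρ : Vec ℕ n) (f : N-ary n (Ex n) (Sequent n)) →
    let s = f $ⁿ Vec.map var (allFin n) in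
    {t : T (entails (ineqs* (Sequent.hyps s)) (Sequent.goal s))} → Valid (Sequent.hyps s) (Sequent.goal s) ρ
  lia {n} ρ f {t} = let s = f $ⁿ Vec.map var (allFin n) in valid ρ (Sequent.hyps s) (Sequent.goal s) [] tt t

open Linear using (lia; lit; _:+_; _:≤_; _:<_; _:≡_; :⊥; _⊢_)

-- Grids of local exchanges

-- L a b b′ a′ : moving a to the right past b turns the pair (a , b) into (b′ , a′).
module Grids {X : Set} (L : X → X → X → X → Set) where

  infixr 5 _∷_

  data Row : X → List X → List X → X → Set where
    []  : ∀ {a} → Row a [] [] a
    _∷_ : ∀ {a a₁ a′ b b′ bs bs′} → L a b b′ a₁ → Row a₁ bs bs′ a′ → Row a (b ∷ bs) (b′ ∷ bs′) a′

  data Col : List X → X → X → List X → Set where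
    []  : ∀ {b} → Col [] b b []
    _∷_ : ∀ {a a′ b b₁ b′ as as′} → L a b₁ b′ a′ → Col as b b₁ as′ → Col (a ∷ as) b b′ (a′ ∷ as′)

  -- The head of the list moves last: its row starts from `bs₁`, which is what the other boxes have
  -- left behind. Switching takes up the boxes in this order.
  data Grid : List X → List X → List X → List X → Set where
    []  : ∀ {bs} → Grid [] bs bs []
    _∷_ : ∀ {a a′ as as′ bs bs₁ bs₂} → Row a bs₁ bs₂ a′ → Grid as bs bs₁ as′ → Grid (a ∷ as) bs bs₂ (a′ ∷ as′)

  grid-col : ∀ {as b b′ bs bs′ as′} → Grid as (b ∷ bs) (b′ ∷ bs′) as′ →
    ∃ λ as₁ → Col as b b′ as₁ × Grid as₁ bs bs′ as′
  grid-col [] = _ , [] , []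
  grid-col ((l ∷ r) ∷ g) = let _ , c , g′ = grid-col g in _ , l ∷ c , r ∷ g′

  col-grid : ∀ {as b b′ bs bs′ as₁ as′} → Col as b b′ as₁ → Grid as₁ bs bs′ as′ → Grid as (b ∷ bs) (b′ ∷ bs′) as′
  col-grid []      []      = []
  col-grid (l ∷ c) (r ∷ g) = (l ∷ r) ∷ col-grid c g

  grid-[] : ∀ as → Grid as [] [] as
  grid-[] []       = []
  grid-[] (a ∷ as) = [] ∷ grid-[] as

  module _ (L-sym : ∀ {a b b′ a′} → L a b b′ a′ → L b′ a′ a b) where

    row-sym : ∀ {a bs bs′ a′} → Row a bs bs′ a′ → Col bs′ a′ a bs
    row-sym []      = []
    row-sym (l ∷ r) = L-sym l ∷ row-sym r

    -- The cells stay in place and only change sides: by symmetry of the local rule the row of `a`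
    -- is the column in which the boxes `bs′` pass `a′`. The grid is transposed and reversed at
    -- once.
    grid-sym : ∀ {as bs bs′ as′} → Grid as bs bs′ as′ → Grid bs′ as′ as bs
    grid-sym []      = grid-[] _
    grid-sym (r ∷ g) = col-grid (row-sym r) (grid-sym g)

  module _ (L-fun : ∀ {a b b′ a′ b″ a″} → L a b b′ a′ → L a b b″ a″ → b′ ≡ b″ × a′ ≡ a″) where

    row-fun : ∀ {a bs bs′ a′ bs″ a″} → Row a bs bs′ a′ → Row a bs bs″ a″ → bs′ ≡ bs″ × a′ ≡ a″
    row-fun []      []        = refl , refl
    row-fun (l ∷ r) (l′ ∷ r′) with refl , refl ← L-fun l l′ with refl , refl ← row-fun r r′ = refl , refl

    grid-fun : ∀ {as bs bs′ as′ bs″ as″} → Grid as bs bs′ as′ → Grid as bs bs″ as″ → bs′ ≡ bs″ × as′ ≡ as″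
    grid-fun []      []        = refl , refl
    grid-fun (r ∷ g) (r′ ∷ g′) with refl , refl ← grid-fun g g′ with refl , refl ← row-fun r r′ = refl , refl

  row-++ : ∀ {a a₁ a′ xs xs′ ys ys′} → Row a xs xs′ a₁ → Row a₁ ys ys′ a′ → Row a (xs ++ ys) (xs′ ++ ys′) a′
  row-++ []      s = s
  row-++ (l ∷ r) s = l ∷ row-++ r s

  grid-right : ∀ {as as₁ as′ xs xs′ ys ys′} → Grid as xs xs′ as₁ → Grid as₁ ys ys′ as′ → Grid as (xs ++ ys) (xs′ ++ ys′) as′
  grid-right []      []      = []
  grid-right (r ∷ g) (s ∷ h) = row-++ r s ∷ grid-right g h

  grid-below : ∀ {as as′ cs cs′ bs bs₁ bs₂} → Grid cs bs bs₁ cs′ → Grid as bs₁ bs₂ as′ → Grid (as ++ cs) bs bs₂ (as′ ++ cs′)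
  grid-below g []      = g
  grid-below g (r ∷ h) = r ∷ grid-below g h

-- If the cells of a grid of bands are grids of boxes, pasting them together gives one grid of
-- boxes; so uniqueness need only be known for boxes.
module Flatten {X Y : Set} (L : X → X → X → X → Set) (M : Y → Y → Y → Y → Set) (p : Y → List X)
  (flat : ∀ {A B B′ A′} → M A B B′ A′ → Grids.Grid L (p A) (p B) (p B′) (p A′)) where

  open Grids L using (Grid; grid-[]; grid-right; grid-below)
  open Grids M using ([]; _∷_)

  row-flat : ∀ {A Bs Bs′ A′} → Grids.Row M A Bs Bs′ A′ → Grid (p A) (concatMap p Bs) (concatMap p Bs′) (p A′)
  row-flat []      = grid-[] _
  row-flat (l ∷ r) = grid-right (flat l) (row-flat r)

  grid-flat : ∀ {As Bs Bs′ As′} → Grids.Grid M As Bs Bs′ As′ →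
    Grid (concatMap p As) (concatMap p Bs) (concatMap p Bs′) (concatMap p As′)
  grid-flat []      = Grids.[]
  grid-flat (r ∷ g) = grid-below (grid-flat g) (row-flat r)

-- Positions and chains of boxes

row col : Pos → ℕ
row = proj₁
col = proj₂

infix 4 _⊑_ _↙_ _↗_

Box : Pos → Set
Box p = 1 ≤ row p × row p ≤ col p

_⊑_ _↙_ _↗_ : Pos → Pos → Set
p ⊑ q = row p ≤ row q × col p ≤ col q
x ↙ y = row x < row y × col y ≤ col x
x ↗ y = row y ≤ row x × col x < col y

_≟ₚ_ : (p q : Pos) → Dec (p ≡ q)
_≟ₚ_ = ≡-dec _≟_ _≟_

⊑-refl : ∀ {p} → p ⊑ p
⊑-refl = ≤-refl , ≤-refl

⊑-trans : ∀ {p q r} → p ⊑ q → q ⊑ r → p ⊑ r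
⊑-trans (a , b) (c , d) = ≤-trans a c , ≤-trans b d

⊑-antisym : ∀ {p q} → p ⊑ q → q ⊑ p → p ≡ q
⊑-antisym (a , b) (c , d) = cong₂ _,_ (≤-antisym a c) (≤-antisym b d)

open import Data.List.Membership.DecPropositional _≟ₚ_ using () renaming (_∈?_ to _∈ₚ?_)

Nb : Pos → Pos → Set
Nb p q = (q ≡ east p ⊎ q ≡ south p) ⊎ (p ≡ east q ⊎ p ≡ south q)

nb? : ∀ p q → Dec (Nb p q)
nb? p q = ((q ≟ₚ east p) ⊎-dec (q ≟ₚ south p)) ⊎-dec ((p ≟ₚ east q) ⊎-dec (p ≟ₚ south q))

nb-sym : ∀ {p q} → Nb p q → Nb q p
nb-sym (inj₁ x) = inj₂ x
nb-sym (inj₂ x) = inj₁ x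

-- Switching the labels of two neighbouring boxes, or commuting two boxes that do not touch.
data Swap (a b : Pos) : Pos → Pos → Set where
  touch : Nb a b → Swap a b a b
  apart : ¬ Nb a b → Swap a b b a

swap : ∀ a b → ∃ λ b′ → ∃ λ a′ → Swap a b b′ a′
swap a b with nb? a b
... | yes n = _ , _ , touch n
... | no ¬n = _ , _ , apart ¬n

swap-sym : ∀ {a b b′ a′} → Swap a b b′ a′ → Swap b′ a′ a b
swap-sym (touch n)  = touch n
swap-sym (apart ¬n) = apart λ n → ¬n (nb-sym n)

swap-fun : ∀ {a b b′ a′ b″ a″} → Swap a b b′ a′ → Swap a b b″ a″ → b′ ≡ b″ × a′ ≡ a″
swap-fun (touch _)  (touch _)  = refl , refl
swap-fun (apart _)  (apart _)  = refl , refl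
swap-fun (touch n)  (apart ¬n) = ⊥-elim (¬n n)
swap-fun (apart ¬n) (touch n)  = ⊥-elim (¬n n)

open Grids Swap public

row! : ∀ a bs → ∃ λ bs′ → ∃ λ a′ → Row a bs bs′ a′
row! a [] = _ , _ , []
row! a (b ∷ bs) with _ , a₁ , l ← swap a b with _ , _ , r ← row! a₁ bs = _ , _ , l ∷ r

infixl 5 _∪_

_∪_ : (Pos → Set) → List Pos → Pos → Set
(P ∪ L) q = P q ⊎ q ∈ L

record Down (P : Pos → Set) : Set where
  constructor down
  field close : ∀ {q r} → P q → Box r → r ⊑ q → P r
open Down public

Addable : (Pos → Set) → Pos → Set
Addable P y = Box y × ¬ P y × (∀ r → Box r → r ⊑ y → r ≢ y → P r)

-- Adding the boxes of L to the order ideal P one at a time, through order ideals.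
Chain : (Pos → Set) → List Pos → Set
Chain P []      = ⊤
Chain P (y ∷ L) = Addable P y × Chain (P ∪ (y ∷ [])) L

addable-resp : ∀ {P Q y} → (∀ q → P q → Q q) → (∀ q → Q q → P q) → Addable P y → Addable Q y
addable-resp f g (b , n , h) = b , (λ q → n (g _ q)) , λ r br r⊑y r≢y → f r (h r br r⊑y r≢y)

chain-resp : ∀ {P Q} L → (∀ q → P q → Q q) → (∀ q → Q q → P q) → Chain P L → Chain Q L
chain-resp [] f g c = c
chain-resp (y ∷ L) f g (a , c) = addable-resp f g a ,
  chain-resp L (λ where q (inj₁ p) → inj₁ (f q p) ; q (inj₂ e) → inj₂ e)
               (λ where q (inj₁ p) → inj₁ (g q p) ; q (inj₂ e) → inj₂ e) c

∪-∷ : ∀ {P y} L q → ((P ∪ (y ∷ [])) ∪ L) q → (P ∪ (y ∷ L)) q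
∪-∷ L q (inj₁ (inj₁ p)) = inj₁ p
∪-∷ L q (inj₁ (inj₂ (here e))) = inj₂ (here e)
∪-∷ L q (inj₂ m) = inj₂ (there m)

∪-∷⁻ : ∀ {P y} L q → (P ∪ (y ∷ L)) q → ((P ∪ (y ∷ [])) ∪ L) q
∪-∷⁻ L q (inj₁ p) = inj₁ (inj₁ p)
∪-∷⁻ L q (inj₂ (here e)) = inj₁ (inj₂ (here e))
∪-∷⁻ L q (inj₂ (there m)) = inj₂ m

∪-[] : ∀ {P : Pos → Set} q → (P ∪ []) q → P q
∪-[] q (inj₁ p) = p

chain-++⁻ : ∀ {P} L {M} → Chain P (L ++ M) → Chain P L × Chain (P ∪ L) M
chain-++⁻ [] {M} c = tt , chain-resp M (λ _ → inj₁) ∪-[] c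
chain-++⁻ (y ∷ L) {M} (a , c) with c₁ , c₂ ← chain-++⁻ L c = (a , c₁) , chain-resp M (∪-∷ L) (∪-∷⁻ L) c₂

chain-++⁺ : ∀ {P} L {M} → Chain P L → Chain (P ∪ L) M → Chain P (L ++ M)
chain-++⁺ [] {M} _ c = chain-resp M ∪-[] (λ _ → inj₁) c
chain-++⁺ (y ∷ L) {M} (a , c) d = a , chain-++⁺ L c (chain-resp M (∪-∷⁻ L) (∪-∷ L) d)

-- `L ʳ++ M` serves as a list with a cursor: `L` holds what is already passed, nearest box first.
chain-ʳ⁻ : ∀ {P} L {M} → Chain P (L ʳ++ M) → Chain (P ∪ L) M
chain-ʳ⁻ [] {M} c = chain-resp M (λ _ → inj₁) ∪-[] c
chain-ʳ⁻ {P} (y ∷ L) {M} c with _ , c′ ← chain-ʳ⁻ {P} L {y ∷ M} c =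
  chain-resp M (λ where q (inj₁ (inj₁ p)) → inj₁ p
                        q (inj₁ (inj₂ m)) → inj₂ (there m)
                        q (inj₂ (here e)) → inj₂ (here e))
               (λ where q (inj₁ p) → inj₁ (inj₁ p)
                        q (inj₂ (here e)) → inj₂ (here e)
                        q (inj₂ (there m)) → inj₁ (inj₂ m)) c′

-- The change after the cursor must be possible over every predicate equivalent to `P ∪ L`, since
-- unfolding the prefix box by box produces a union of another shape.
chain-ʳ-map : ∀ {P} L {M N} → (∀ {Q} → (∀ q → (P ∪ L) q → Q q) → (∀ q → Q q → (P ∪ L) q) → Chain Q M → Chain Q N) →
  Chain P (L ʳ++ M) → Chain P (L ʳ++ N)
chain-ʳ-map {P} [] f c = f (λ q → ∪-[] {P} q) (λ _ → inj₁) c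
chain-ʳ-map {P} (y ∷ L) {M} {N} f c = chain-ʳ-map {P} L {y ∷ M} {y ∷ N} inner c
  where
  inner : ∀ {Q} → (∀ q → (P ∪ L) q → Q q) → (∀ q → Q q → (P ∪ L) q) → Chain Q (y ∷ M) → Chain Q (y ∷ N)
  inner g h (a , d) = a , f
    (λ where q (inj₁ p) → inj₁ (g q (inj₁ p))
             q (inj₂ (here e)) → inj₂ (here e)
             q (inj₂ (there m)) → inj₁ (g q (inj₂ m)))
    (λ where q (inj₁ p) → [ inj₁ , (λ m → inj₂ (there m)) ]′ (h q p)
             q (inj₂ (here e)) → inj₂ (here e)
             q (inj₂ (there ()))) d

down-add : ∀ {P y} → Down P → Addable P y → Down (P ∪ (y ∷ []))
close (down-add d _) (inj₁ p) b r⊑q = inj₁ (close d p b r⊑q)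
close (down-add {y = y} d (_ , _ , h)) {r = r} (inj₂ (here refl)) b r⊑y with r ≟ₚ y
... | yes refl = inj₂ (here refl)
... | no r≢y   = inj₁ (h r b r⊑y r≢y)

down-resp : ∀ {P Q} → (∀ q → P q → Q q) → (∀ q → Q q → P q) → Down P → Down Q
close (down-resp f g d) q b r⊑q = f _ (close d (g _ q) b r⊑q)

down-chain : ∀ {P} L → Down P → Chain P L → Down (P ∪ L)
down-chain [] d _ = down-resp (λ _ → inj₁) ∪-[] d
down-chain (y ∷ L) d (a , c) = down-resp (∪-∷ L) (∪-∷⁻ L) (down-chain L (down-add d a) c)

down-ʳ : ∀ {P} L {M} → Down P → Chain P (L ʳ++ M) → Down (P ∪ L)
down-ʳ [] d _ = down-resp (λ _ → inj₁) ∪-[] d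
down-ʳ {P} (y ∷ L) d c = down-resp
  (λ where q (inj₁ (inj₁ p)) → inj₁ p
           q (inj₁ (inj₂ m)) → inj₂ (there m)
           q (inj₂ (here e)) → inj₂ (here e)
           q (inj₂ (there ())))
  (λ where q (inj₁ p) → inj₁ (inj₁ p)
           q (inj₂ (here e)) → inj₂ (here e)
           q (inj₂ (there m)) → inj₁ (inj₂ m))
  (down-add (down-ʳ {P} L d c) (proj₁ (chain-ʳ⁻ {P} L c)))

chain-Box : ∀ {P y} L → Chain P L → y ∈ L → Box y
chain-Box (_ ∷ L) ((b , _) , _) (here refl) = b
chain-Box (_ ∷ L) (_ , c) (there m) = chain-Box L c m

chain-fresh : ∀ {P y} L → Chain P L → y ∈ L → ¬ P y
chain-fresh (_ ∷ L) ((_ , n , _) , _) (here refl) = n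
chain-fresh (_ ∷ L) (_ , c) (there m) = λ p → chain-fresh L c m (inj₁ p)

chain-⋢ : ∀ {P y q} L → Down P → Chain P L → y ∈ L → P q → ¬ y ⊑ q
chain-⋢ L d c m p y⊑q = chain-fresh L c m (close d p (chain-Box L c m) y⊑q)

chain-below : ∀ {P y r} L → Chain P L → y ∈ L → Box r → r ⊑ y → (P ∪ L) r
chain-below {y = y} {r} (_ ∷ L) ((_ , _ , h) , _) (here refl) b r⊑y with r ≟ₚ y
... | yes e = inj₂ (here e)
... | no ne = inj₁ (h r b r⊑y ne)
chain-below {P} (x ∷ L) (_ , c) (there m) b r⊑y = ∪-∷ {P} {x} L _ (chain-below L c m b r⊑y)

addable-unique : ∀ {P a b} → Down P → Addable P a → Addable (P ∪ (a ∷ [])) b → a ≢ b × ¬ b ⊑ a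
addable-unique d (ba , na , ha) (bb , nb , hb) =
  (λ where refl → nb (inj₂ (here refl))) ,
  λ b⊑a → nb (inj₁ (ha _ bb b⊑a λ where refl → nb (inj₂ (here refl))))

-- A box between a and b would have to come between them in the chain.
apart-⋢ : ∀ {P a b} → Down P → Addable P a → Addable (P ∪ (a ∷ [])) b → ¬ Nb a b → ¬ a ⊑ b
apart-⋢ {P} {a = a@(i , j)} {b@(suc i′ , j′)} d aa@((1≤i , i≤j) , na , _) ab@((_ , i′≤j′) , _ , hb) ¬n (i≤ , j≤) with m≤n⇒m<n∨m≡n i≤
... | inj₁ (s≤s i≤i′) = no-way (hb (i′ , j′) (≤-trans 1≤i i≤i′ , ≤-trans (n≤1+n i′) i′≤j′) (n≤1+n i′ , ≤-refl) (λ ()))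
  where
  no-way : (P ∪ (a ∷ [])) (i′ , j′) → ⊥
  no-way (inj₁ p) = na (close d p (1≤i , i≤j) (i≤i′ , j≤))
  no-way (inj₂ (here refl)) = ¬n (inj₁ (inj₂ refl))
apart-⋢ {P} {a = a@(i , j)} {b@(suc i′ , j′)} d aa@((1≤i , i≤j) , na , _) ab@((_ , i′≤j′) , nb , hb) ¬n (i≤ , j≤) | inj₂ refl with m≤n⇒m<n∨m≡n j≤
... | inj₂ refl = nb (inj₂ (here refl))
... | inj₁ (s≤s {n = j″} j≤j″) = no-way (hb (i , j″) (1≤i , ≤-trans i≤j j≤j″) (≤-refl , n≤1+n j″) (λ ()))
  where
  no-way : (P ∪ (a ∷ [])) (i , j″) → ⊥
  no-way (inj₁ p) = na (close d p (1≤i , i≤j) (≤-refl , j≤j″))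
  no-way (inj₂ (here refl)) = ¬n (inj₁ (inj₁ refl))
apart-⋢ {b = (zero , _)} d aa ((() , _) , _) ¬n _

-- Consecutive boxes that do not touch are incomparable, so everything required below `b` is present
-- without `a`.
chain-swap : ∀ {P a b b′ a′ L} → Down P → Chain P (a ∷ b ∷ L) → Swap a b b′ a′ → Chain P (b′ ∷ a′ ∷ L)
chain-swap d c (touch _) = c
chain-swap {P} {a} {b} {L = L} d (aa@(ba , na , ha) , ab@(bb , nb , hb) , c) (apart ¬n) =
  (bb , (λ p → nb (inj₁ p)) , below) , (ba , fresh , λ r br r⊑a r≢a → inj₁ (ha r br r⊑a r≢a)) ,
  chain-resp L (λ _ → exch) (λ _ → exch) c
  where
  below : ∀ r → Box r → r ⊑ b → r ≢ b → P r
  below r br r⊑b r≢b with hb r br r⊑b r≢b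
  ... | inj₁ p = p
  ... | inj₂ (here refl) = ⊥-elim (apart-⋢ d aa ab ¬n r⊑b)
  fresh : ¬ (P ∪ (b ∷ [])) a
  fresh (inj₁ p) = na p
  fresh (inj₂ (here refl)) = nb (inj₂ (here refl))
  exch : ∀ {q x y} → ((P ∪ (x ∷ [])) ∪ (y ∷ [])) q → ((P ∪ (y ∷ [])) ∪ (x ∷ [])) q
  exch (inj₁ (inj₁ p)) = inj₁ (inj₁ p)
  exch (inj₁ (inj₂ m)) = inj₂ m
  exch (inj₂ m)        = inj₁ (inj₂ m)

chain-row : ∀ {P a bs bs′ a′ L} → Down P → Chain P (a ∷ bs ++ L) → Row a bs bs′ a′ → Chain P (bs′ ++ a′ ∷ L)
chain-row d c [] = c
chain-row d c (l ∷ r) with aa , c′ ← chain-swap d c l = aa , chain-row (down-add d aa) c′ r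

chain-grid : ∀ {P as bs bs′ as′ L} → Down P → Chain P (as ++ bs ++ L) → Grid as bs bs′ as′ → Chain P (bs′ ++ as′ ++ L)
chain-grid d c [] = c
chain-grid d (aa , c) (r ∷ g) = chain-row d (aa , chain-grid (down-add d aa) c g) r

-- Bands

-- The boxes of a given letter k, listed in standardisation order, first descend (south-west) and then ascend
-- (north-east). `dn` marks the boxes before the turning point (they carry k′), `up` the boxes after it (they
-- carry k); the letter `vl` of the turning point itself is free, and its flag tells whether it is primed.
data Kind : Set where
  dn up : Kind
  vl    : Bool → Kind

Ent : Set
Ent = Pos × Kind

pos : Ent → Pos
pos = proj₁

kind : Ent → Kind
kind = proj₂

positions : List Ent → List Pos
positions = map pos

Dir : Kind → Pos → Pos → Set
Dir dn     = _↙_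
Dir up     = _↗_
Dir (vl _) = _↗_

Link : Ent → Ent → Set
Link (p , k) (q , _) = Dir k p q

data Ups : List Kind → Set where
  []  : Ups []
  up∷ : ∀ {ks} → Ups ks → Ups (up ∷ ks)

data Turn : List Kind → Set where
  vl∷ : ∀ {b ks} → Ups ks → Turn (vl b ∷ ks)
  dn∷ : ∀ {ks} → Turn ks → Turn (dn ∷ ks)

data Ok : List Kind → Set where
  none : Ok []
  some : ∀ {ks} → Turn ks → Ok ks

record Band (E : List Ent) : Set where
  constructor band
  field
    links : Linked Link E
    kinds : Ok (map kind E)
open Band public

flags : List Ent → List Bool
flags [] = []
flags ((_ , vl b) ∷ E) = b ∷ flags E
flags ((_ , dn) ∷ E) = flags E
flags ((_ , up) ∷ E) = flags E

module _ {A : Set} {R : A → A → Set} where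

  linked-ʳ⁻ : ∀ X {y Y} → Linked R (X ʳ++ (y ∷ Y)) → Linked (flip R) (y ∷ X) × Linked R (y ∷ Y)
  linked-ʳ⁻ [] l = [-] , l
  linked-ʳ⁻ (x ∷ X) l with l₁ , r ∷ l₂ ← linked-ʳ⁻ X l = r ∷ l₁ , l₂

  linked-ʳ⁺ : ∀ X {y Y} → Linked (flip R) (y ∷ X) → Linked R (y ∷ Y) → Linked R (X ʳ++ (y ∷ Y))
  linked-ʳ⁺ [] _ l = l
  linked-ʳ⁺ (x ∷ X) (r ∷ l₁) l₂ = linked-ʳ⁺ X l₁ (r ∷ l₂)

  linked-tail : ∀ {x X} → Linked R (x ∷ X) → Linked R X
  linked-tail [-] = []
  linked-tail (_ ∷ l) = l

  linked-head : ∀ {x y X} → (∀ {z} → z ∈ X → R x z → R y z) → Linked R (x ∷ X) → Linked R (y ∷ X)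
  linked-head f [-] = [-]
  linked-head f (r ∷ l) = f (here refl) r ∷ l

  allPairs-ʳ : ∀ X {Y x y} → AllPairs R (X ʳ++ Y) → x ∈ X → y ∈ Y → R x y
  allPairs-ʳ (x ∷ X) {Y} ps (here refl) n = head-pairs (suffix X ps) n
    where
    suffix : ∀ X {Y} → AllPairs R (X ʳ++ Y) → AllPairs R Y
    suffix [] ps = ps
    suffix (x ∷ X) ps with _ ∷ qs ← suffix X ps = qs
    head-pairs : ∀ {x y Y} → AllPairs R (x ∷ Y) → y ∈ Y → R x y
    head-pairs (p ∷ _) n = All.lookup p n
  allPairs-ʳ (x ∷ X) ps (there m) n = allPairs-ʳ X ps m (there n)

↙-trans : ∀ {x y z} → x ↙ y → y ↙ z → x ↙ z
↙-trans (a , b) (c , d) = <-trans a c , ≤-trans d b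

↗-trans : ∀ {x y z} → x ↗ y → y ↗ z → x ↗ z
↗-trans (a , b) (c , d) = ≤-trans c a , <-trans b d

-- The pairwise form of a band, for `x` before `y`: a box that does not descend is followed only by
-- `up` boxes, and a box that is not `up` is preceded only by `dn` boxes. Thus one kind alone often
-- decides the direction.
record Star (x y : Ent) : Set where
  constructor star
  field
    rising  : kind x ≢ dn → pos x ↗ pos y × kind y ≡ up
    falling : kind y ≢ up → pos x ↙ pos y × kind x ≡ dn
open Star public

allUp : ∀ {y E} → Ups (map kind E) → Linked Link E → y ∈ E → kind y ≡ up
allUp {E = (_ , up) ∷ _} (up∷ us) l (here refl) = refl
allUp {E = (_ , up) ∷ _} (up∷ us) l (there m) = allUp us (linked-tail l) m

rise : ∀ {x E} → kind x ≢ dn → Ups (map kind E) → Linked Link (x ∷ E) → All (λ y → pos x ↗ pos y × kind y ≡ up) E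
rise {E = []} _ _ _ = []
rise {x = _ , dn} ¬d _ _ = ⊥-elim (¬d refl)
rise {x = _ , up}   {(_ , up) ∷ _} ¬d (up∷ us) (r ∷ l) = (r , refl) ∷ All.map (λ (a , b) → ↗-trans r a , b) (rise (λ ()) us l)
rise {x = _ , vl _} {(_ , up) ∷ _} ¬d (up∷ us) (r ∷ l) = (r , refl) ∷ All.map (λ (a , b) → ↗-trans r a , b) (rise (λ ()) us l)

fall : ∀ {x E} → kind x ≡ dn → Turn (map kind E) → Linked Link (x ∷ E) → All (λ y → kind y ≢ up → pos x ↙ pos y × kind x ≡ dn) E
fall {x = _ , dn} {(_ , vl _) ∷ _} refl (vl∷ us) (r ∷ l) =
  (λ _ → r , refl) ∷ All.map (λ (_ , e) n → ⊥-elim (n e)) (rise (λ ()) us l)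
fall {x = _ , dn} {(_ , dn) ∷ _} refl (dn∷ t) (r ∷ l) =
  (λ _ → r , refl) ∷ All.map (λ f n → ↙-trans r (proj₁ (f n)) , refl) (fall refl t l)

rising-stars : ∀ {E} → Ups (map kind E) → Linked Link E → AllPairs Star E
rising-stars {[]} _ _ = []
rising-stars {(_ , up) ∷ _} (up∷ us) l = All.map (λ (a , b) → star (λ _ → a , b) (λ n → ⊥-elim (n b))) (rise (λ ()) us l) ∷ rising-stars us (linked-tail l)

turn-stars : ∀ {E} → Turn (map kind E) → Linked Link E → AllPairs Star E
turn-stars {(_ , vl _) ∷ _} (vl∷ us) l =
  All.map (λ (a , b) → star (λ _ → a , b) (λ n → ⊥-elim (n b))) (rise (λ ()) us l) ∷ rising-stars us (linked-tail l)
turn-stars {(_ , dn) ∷ _} (dn∷ t) l =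
  All.map (λ f → star (λ n → ⊥-elim (n refl)) f) (fall refl t l) ∷ turn-stars t (linked-tail l)

stars : ∀ {E} → Band E → AllPairs Star E
stars {[]} _ = []
stars {_ ∷ _} (band l (some t)) = turn-stars t l

valley : ∀ {E x} → Band E → x ∈ E → kind x ≡ dn → ∃ λ y → y ∈ E × pos x ↙ pos y × kind y ≢ dn × kind y ≢ up
valley {_ ∷ _} (band l (some t)) m e = search′ t l m e
  where
  Result : Ent → List Ent → Set
  Result x E = ∃ λ y → y ∈ E × pos x ↙ pos y × kind y ≢ dn × kind y ≢ up
  first : ∀ {p y E} → Turn (map kind (y ∷ E)) → p ↙ pos y → Linked Link (y ∷ E) → Result (p , dn) (y ∷ E)
  first {y = _ , vl _} (vl∷ _) r _ = _ , here refl , r , (λ ()) , (λ ())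
  first {y = _ , dn} {_ ∷ _} (dn∷ t) r (s ∷ l) with z , m , s′ , n ← first t s l = z , there m , ↙-trans r s′ , n
  search′ : ∀ {E x} → Turn (map kind E) → Linked Link E → x ∈ E → kind x ≡ dn → Result x E
  search′ {(_ , vl _) ∷ _} (vl∷ us) l (here refl) ()
  search′ {(_ , vl _) ∷ _} (vl∷ us) l (there m) e with () ← trans (sym e) (allUp us (linked-tail l) m)
  search′ {(_ , dn) ∷ y ∷ _} (dn∷ t) (r ∷ l) (here refl) e with z , m′ , r′ ← first t r l = z , there m′ , r′
  search′ {(_ , dn) ∷ _} (dn∷ t) l (there m) e with y , m′ , r ← search′ t (linked-tail l) m e = y , there m′ , r

module _ {A : Set} where

  ∈-ʳ⁺ : ∀ (X : List A) {Y y} → y ∈ Y → y ∈ X ʳ++ Y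
  ∈-ʳ⁺ [] m = m
  ∈-ʳ⁺ (x ∷ X) m = ∈-ʳ⁺ X (there m)

  ∈-ʳ⁺ˡ : ∀ {X : List A} {Y y} → y ∈ X → y ∈ X ʳ++ Y
  ∈-ʳ⁺ˡ {x ∷ X} (here refl) = ∈-ʳ⁺ X (here refl)
  ∈-ʳ⁺ˡ {x ∷ X} (there m) = ∈-ʳ⁺ˡ m

  ∈-ʳ⁻ : ∀ (X : List A) {Y y} → y ∈ X ʳ++ Y → y ∈ X ⊎ y ∈ Y
  ∈-ʳ⁻ [] m = inj₂ m
  ∈-ʳ⁻ (x ∷ X) m with ∈-ʳ⁻ X m
  ... | inj₁ m′ = inj₁ (there m′)
  ... | inj₂ (here e) = inj₁ (here e)
  ... | inj₂ (there m′) = inj₂ m′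

  map-ʳ : ∀ {B : Set} (f : A → B) X {Y} → map f (X ʳ++ Y) ≡ map f X ʳ++ map f Y
  map-ʳ f [] = refl
  map-ʳ f (x ∷ X) = map-ʳ f X

-- A descending box has the turning point in a lower row and no further east; from a diagonal box
-- such a position lies outside the shifted plane.
diagonal-not-dn : ∀ {E i k} → Band E → (∀ {y} → y ∈ E → Box (pos y)) → ((i , i) , k) ∈ E → k ≢ dn
diagonal-not-dn b bx m refl with y , m′ , (r , c) , _ ← valley b m refl = <-irrefl refl (<-≤-trans r (≤-trans (proj₂ (bx m′)) c))

-- The only configuration in which moving a box past two consecutive boxes of a band changes their direction.
Hooked : Pos → Pos → Pos → Set
Hooked c x y = row c ≡ col c × x ≡ east c × y ≡ south (east c)

module _ {Q : Pos → Set} (dQ : Down Q) {c x : Pos} (ac : Addable Q c) (ax : Addable (Q ∪ (c ∷ [])) x) where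

  nb-cases : Nb c x → x ≡ east c ⊎ x ≡ south c
  nb-cases (inj₁ e) = e
  nb-cases (inj₂ (inj₁ refl)) = ⊥-elim (proj₂ (addable-unique dQ ac ax) (≤-refl , n≤1+n _))
  nb-cases (inj₂ (inj₂ refl)) = ⊥-elim (proj₂ (addable-unique dQ ac ax) (n≤1+n _ , ≤-refl))

  private
    c⋢ : ∀ {z} → Q z → ¬ c ⊑ z
    c⋢ q c⊑z = proj₁ (proj₂ ac) (close dQ q (proj₁ ac) c⊑z)

    i≤j : row c ≤ col c
    i≤j = proj₂ (proj₁ ac)

    1≤i : 1 ≤ row c
    1≤i = proj₁ (proj₁ ac)

  -- Only boundary cases can fail, and in each of them `c ⊑ z`, although `z` was added before `c`.
  link-before : ∀ k {z} → Nb c x → Q z → Dir k z x → Dir k z c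
  link-before k {z} nb q = inner k (nb-cases nb)
    where
    ↗-east : ∀ {z} → Q z → z ↗ east c → z ↗ c
    ↗-east q (a , s≤s b) = a , ≤∧≢⇒< b λ where refl → c⋢ q (a , ≤-refl)
    ↗-south : ∀ {z} → Q z → z ↗ south c → z ↗ c
    ↗-south q (a , b) = ≤-trans (n≤1+n _) a , b
    inner : ∀ k → x ≡ east c ⊎ x ≡ south c → Dir k z x → Dir k z c
    inner dn (inj₁ refl) (a , b) = a , ≤-trans (n≤1+n _) b
    inner dn (inj₂ refl) (s≤s a , b) = ≤∧≢⇒< a (λ where refl → c⋢ q (≤-refl , b)) , b
    inner up (inj₁ refl) l = ↗-east q l
    inner up (inj₂ refl) l = ↗-south q l
    inner (vl _) (inj₁ refl) l = ↗-east q l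
    inner (vl _) (inj₂ refl) l = ↗-south q l

  module _ {y : Pos} (ay : Addable ((Q ∪ (c ∷ [])) ∪ (x ∷ [])) y) where

    between : ∀ {r} → Box r → r ⊑ y → r ≢ y → c ⊑ r → r ≢ c → r ≡ x
    between br r⊑y r≢y c⊑r r≢c with proj₂ (proj₂ ay) _ br r⊑y r≢y
    ... | inj₁ (inj₁ q) = ⊥-elim (c⋢ q c⊑r)
    ... | inj₁ (inj₂ (here e)) = ⊥-elim (r≢c e)
    ... | inj₂ (here e) = e

    ↗-row : ∀ {r} → row c < r → row y ≤ r → (∀ {s} → row c ≤ s → s < r → (s , col y) ≡ x → ⊥) → col c < col y → row y < r
    ↗-row {suc r} (s≤s i≤r) y≤ n c<y = ≤∧≢⇒< y≤ λ e →
      n i≤r ≤-refl (between (≤-trans 1≤i i≤r , ≤-trans (n≤1+n _) (subst (_≤ col y) e (proj₂ (proj₁ ay))))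
        (≤-trans (n≤1+n _) (≤-reflexive (sym e)) , ≤-refl) (λ f → <-irrefl (cong row f) (≤-reflexive (sym e))) (i≤r , <⇒≤ c<y) (λ f → <-irrefl (cong col (sym f)) c<y))

    -- The critical case has `x` east of `c` and `y` in the column of `x`. The position in the row
    -- of `y` and the column of `c` lies between `c` and `y`, where only `x` was added; this is
    -- absurd unless the position is below the diagonal. Then the position in the column of `y` and
    -- row `col c` gives the same contradiction, unless `c` is on the diagonal: that is the hook.
    link-after : ∀ k → Nb c x → (k ≡ dn → ¬ Hooked c x y) → Dir k x y → Dir k c y
    link-after k nb ¬h = inner k ¬h (nb-cases nb)
      where
      south-↗ : x ≡ south c → x ↗ y → c ↗ y
      south-↗ refl (a , b) = ≤-pred (↗-row {suc (row c)} ≤-refl a (λ _ s< e → <-irrefl (cong row e) s<) b) , b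
      east-↗ : x ≡ east c → x ↗ y → c ↗ y
      east-↗ refl (a , b) = a , ≤-trans (n≤1+n _) b
      inner : ∀ k → (k ≡ dn → ¬ Hooked c x y) → x ≡ east c ⊎ x ≡ south c → Dir k x y → Dir k c y
      inner up     _ (inj₁ e) = east-↗ e
      inner up     _ (inj₂ e) = south-↗ e
      inner (vl _) _ (inj₁ e) = east-↗ e
      inner (vl _) _ (inj₂ e) = south-↗ e
      inner dn ¬h (inj₂ refl) (a , b) = <-trans (n<1+n _) a , b
      inner dn ¬h (inj₁ refl) (a , b) = a , ≤-pred (≤∧≢⇒< b no-way)
        where
        no-way : col y ≢ suc (col c)
        no-way e with row y ≤? col c
        ... | yes y≤ = <-irrefl (cong col (between {row y , col c} (≤-trans 1≤i (<⇒≤ a) , y≤) (≤-refl , ≤-trans (n≤1+n _) (≤-reflexive (sym e)))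
                (λ f → <-irrefl (cong col f) (≤-reflexive (sym e))) (<⇒≤ a , ≤-refl) (λ f → <-irrefl (cong row (sym f)) a))) ≤-refl
        ... | no y≰ with row c ≟ col c
        ...   | yes i≡j = ¬h refl (i≡j , refl , cong₂ _,_ (trans (≤-antisym (≤-trans (proj₂ (proj₁ ay)) (≤-reflexive e)) (≰⇒> y≰)) (cong suc (sym i≡j))) e)
        ...   | no i≢j = i≢j (sym (cong row (between {col c , col y} (≤-trans 1≤i i≤j , ≤-trans (n≤1+n _) (≤-reflexive (sym e)))
                (<⇒≤ (≰⇒> y≰) , ≤-refl) (λ f → <-irrefl (cong row f) (≰⇒> y≰)) (i≤j , ≤-trans (n≤1+n _) (≤-reflexive (sym e))) (λ f → <-irrefl (cong col (sym f)) (≤-reflexive (sym e))))))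

-- Next c Bq N c′ Bq′ : the box at c moves to c′ past an initial piece of the band Bq, leaving the piece N
-- (reversed) behind.
data Next (c : Pos) : List Ent → List Ent → Pos → List Ent → Set where
  apart : ∀ {x k Y} → ¬ Nb c x → Next c ((x , k) ∷ Y) ((x , k) ∷ []) c Y
  touch : ∀ {x k Y} → Nb c x → (∀ {y Z} → Y ≡ y ∷ Z → k ≡ dn → ¬ Hooked c x (pos y)) →
          Next c ((x , k) ∷ Y) ((c , k) ∷ []) x Y
  hook  : ∀ {x y b Y} → Hooked c x y → Next c ((x , dn) ∷ (y , vl b) ∷ Y) ((x , up) ∷ (c , vl b) ∷ []) y Y

hook-nb₁ : ∀ {c x y} → Hooked c x y → Nb c x
hook-nb₁ (_ , e , _) = inj₁ (inj₁ e)

hook-nb₂ : ∀ {c x y} → Hooked c x y → Nb x y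
hook-nb₂ (_ , refl , e) = inj₁ (inj₂ e)

next-chain : ∀ {Q c c′ Bq N Bq′} M → Down Q → Chain Q (c ∷ positions Bq ++ M) → Next c Bq N c′ Bq′ →
  Chain Q (positions N ʳ++ (c′ ∷ positions Bq′ ++ M))
next-chain M dQ c (apart ¬n) = chain-swap dQ c (apart ¬n)
next-chain M dQ c (touch _ _) = c
next-chain M dQ c (hook _) = c

flags-ʳ : ∀ X {Y Z} → flags Y ≡ flags Z → flags (X ʳ++ Y) ≡ flags (X ʳ++ Z)
flags-ʳ [] e = e
flags-ʳ ((_ , dn) ∷ X) e = flags-ʳ X e
flags-ʳ ((_ , up) ∷ X) e = flags-ʳ X e
flags-ʳ ((_ , vl b) ∷ X) e = flags-ʳ X (cong (b ∷_) e)

next-flags : ∀ {c c′ Bq N Bq′} X → Next c Bq N c′ Bq′ → flags ((N ++ X) ʳ++ Bq′) ≡ flags (X ʳ++ Bq)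
next-flags X (apart _) = refl
next-flags X (touch {k = dn} _ _) = flags-ʳ X refl
next-flags X (touch {k = up} _ _) = flags-ʳ X refl
next-flags X (touch {k = vl _} _ _) = flags-ʳ X refl
next-flags X (hook _) = flags-ʳ X refl

ok-ʳ : ∀ X {k K l L} → (Turn (k ∷ K) → Turn (l ∷ L)) → (Ups (k ∷ K) → Ups (l ∷ L)) → Ok (X ʳ++ (k ∷ K)) → Ok (X ʳ++ (l ∷ L))
ok-ʳ [] f g (some t) = some (f t)
ok-ʳ (x ∷ X) {k} {K} {l} {L} f g = ok-ʳ X turn ups
  where
  turn : Turn (x ∷ k ∷ K) → Turn (x ∷ l ∷ L)
  turn (vl∷ us) = vl∷ (g us)
  turn (dn∷ t) = dn∷ (f t)
  ups : Ups (x ∷ k ∷ K) → Ups (x ∷ l ∷ L)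
  ups (up∷ us) = up∷ (g us)

ok-suffix : ∀ X {k K} → Ok (X ʳ++ (k ∷ K)) → Turn (k ∷ K) ⊎ Ups (k ∷ K)
ok-suffix [] (some t) = inj₁ t
ok-suffix (x ∷ X) o with ok-suffix X o
... | inj₁ (vl∷ us) = inj₂ us
... | inj₁ (dn∷ t) = inj₁ t
... | inj₂ (up∷ us) = inj₂ us

ok-ent : ∀ X {e E f F} → (Turn (map kind (e ∷ E)) → Turn (map kind (f ∷ F))) → (Ups (map kind (e ∷ E)) → Ups (map kind (f ∷ F))) →
  Ok (map kind (X ʳ++ (e ∷ E))) → Ok (map kind (X ʳ++ (f ∷ F)))
ok-ent X {e} {E} {f} {F} g h o = subst Ok (sym (map-ʳ kind X)) (ok-ʳ (map kind X) g h (subst Ok (map-ʳ kind X) o))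

module _ {Q : Pos → Set} (dQ : Down Q) where

  -- A box further east in the row of `y` needs the box above it, in the row of `c`. That box is
  -- none of the three just added, and it cannot precede `c`.
  hook-after : ∀ {c x y w} → Addable Q c → Addable (((Q ∪ (c ∷ [])) ∪ (x ∷ [])) ∪ (y ∷ [])) w → Hooked c x y → y ↗ w → x ↗ w
  hook-after {c@(i , .i)} {w = w@(r , s)} ac@(bc , nc , _) aw@(bw , _ , hw) (refl , refl , refl) (a , b) =
    ≤-pred (≤∧≢⇒< a no-way) , b
    where
    no-way : row w ≢ suc i
    no-way refl with hw (i , s) (proj₁ bc , ≤-trans (n≤1+n i) (<⇒≤ b)) (n≤1+n i , ≤-refl) (λ ())
    ... | inj₁ (inj₁ (inj₁ q)) = nc (close dQ q bc (≤-refl , ≤-trans (n≤1+n i) (<⇒≤ b)))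
    ... | inj₁ (inj₁ (inj₂ (here refl))) = <-irrefl refl (≤-trans (n≤1+n (suc i)) b)
    ... | inj₁ (inj₂ (here refl)) = <-irrefl refl b
    ... | inj₂ (here ())

  next-band : ∀ {c c′ Bq N Bq′} X M → (∀ {z} → z ∈ X → Q (pos z)) → Chain Q (c ∷ positions Bq ++ M) →
    Next c Bq N c′ Bq′ → Band (X ʳ++ Bq) → Band ((N ++ X) ʳ++ Bq′)
  next-band X M q ch (apart _) b = b
  next-band X M q (ac , ax , ch) (touch {x} {k} {Y} nb ¬h) (band l o) with linked-ʳ⁻ X l
  ... | l₁ , l₂ = band (linked-ʳ⁺ X (linked-head (λ {z} m r → link-before dQ ac ax (kind z) nb (q m) r) l₁) (after ch ¬h l₂))
                       (ok-ent X {x , k} {Y} (λ { (vl∷ us) → vl∷ us ; (dn∷ t) → dn∷ t }) (λ { (up∷ us) → up∷ us }) o)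
    where
    after : ∀ {Y} → Chain _ (positions Y ++ M) → (∀ {y Z} → Y ≡ y ∷ Z → k ≡ dn → ¬ Hooked _ x (pos y)) →
      Linked Link ((x , k) ∷ Y) → Linked Link ((_ , k) ∷ Y)
    after {[]} _ _ _ = [-]
    after {y ∷ Y} (ay , _) ¬h (r ∷ l) = link-after dQ ac ax ay k nb (¬h refl) r ∷ l
  -- The kinds `dn`, `vl b` at `x`, `y` become `vl b`, `up` at `c`, `x`: the turning point moves to
  -- the corner that `c` leaves and keeps its flag, as in (S3).
  next-band X M q (ac , ax , ay , ch) (hook {x} {y} {b} {Y} h) bd@(band l o) with linked-ʳ⁻ X l
  ... | l₁ , _ ∷ l₂ = band (linked-ʳ⁺ X (linked-head (λ {z} m r → link-before dQ ac ax (kind z) (hook-nb₁ h) (q m) r) l₁) (c↗x h ∷ after ch l₂))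
                       (ok-ent X {x , dn} (λ { (dn∷ (vl∷ us)) → vl∷ (up∷ us) }) (λ ()) o)
    where
    c↗x : ∀ {c x y} → Hooked c x y → c ↗ x
    c↗x (_ , refl , _) = ≤-refl , ≤-refl
    after : ∀ {Y} → Chain _ (positions Y ++ M) → Linked Link ((y , vl b) ∷ Y) → Linked Link ((x , up) ∷ Y)
    after {[]} _ _ = [-]
    after {w ∷ Y} (aw , _) (r ∷ l) = hook-after ac aw h r ∷ l

  -- A touch is refused only for a hook. There `y` is on the diagonal, so it does not descend, and
  -- `up` cannot follow `dn`; hence `y` is the turning point.
  next-total : ∀ {c x k Y} X M → Chain Q (c ∷ positions ((x , k) ∷ Y) ++ M) → Band (X ʳ++ ((x , k) ∷ Y)) →
    (∀ {z} → z ∈ X ʳ++ ((x , k) ∷ Y) → Box (pos z)) → ∃ λ N → ∃ λ c′ → ∃ λ Y′ → Next c ((x , k) ∷ Y) N c′ Y′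
  next-total {c} {x} {k} {Y} X M ch b bx with nb? c x
  ... | no ¬n = _ , _ , _ , apart ¬n
  ... | yes n with k | Y
  ...   | up | Y = _ , _ , _ , touch n (λ _ ())
  ...   | vl _ | Y = _ , _ , _ , touch n (λ _ ())
  ...   | dn | [] = _ , _ , _ , touch n (λ ())
  ...   | dn | (y , ky) ∷ Z with row c ≟ col c | x ≟ₚ east c | y ≟ₚ south (east c)
  ...     | no ¬d | _ | _ = _ , _ , _ , touch n (λ { refl _ (e , _) → ¬d e })
  ...     | yes _ | no ¬e | _ = _ , _ , _ , touch n (λ { refl _ (_ , e , _) → ¬e e })
  ...     | yes _ | yes _ | no ¬f = _ , _ , _ , touch n (λ { refl _ (_ , _ , e) → ¬f e })
  ...     | yes d | yes e | yes f with ky | b | bx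
  ...       | vl _ | _ | _ = _ , _ , _ , hook (d , e , f)
  ...       | dn | b | bx = ⊥-elim (diagonal b bx f)
    where
    diagonal : ∀ {Z} → Band (X ʳ++ ((x , dn) ∷ (y , dn) ∷ Z)) →
      (∀ {z} → z ∈ X ʳ++ ((x , dn) ∷ (y , dn) ∷ Z) → Box (pos z)) → y ≡ south (east c) → ⊥
    diagonal b bx refl = diagonal-not-dn b bx
      (∈-ʳ⁺ X (there (here (cong (λ j → (suc (row c) , suc j) , dn) d)))) refl
  ...       | up | b | _ with ok-suffix (map kind X) (subst Ok (map-ʳ kind X) (kinds b))
  ...         | inj₁ (dn∷ ())
  ...         | inj₂ ()

-- The switching process of two bands

-- A row read from the other end; the passed boxes are listed in reverse order.
data Rowʳ (a : Pos) : List Pos → List Pos → Pos → Set where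
  []  : Rowʳ a [] [] a
  _∷_ : ∀ {X Z c x z c′} → Swap c x z c′ → Rowʳ a X Z c → Rowʳ a (x ∷ X) (z ∷ Z) c′

rowʳ-row : ∀ {a X Z c Y W c′} → Rowʳ a X Z c → Row c Y W c′ → Row a (X ʳ++ Y) (Z ʳ++ W) c′
rowʳ-row [] r = r
rowʳ-row (l ∷ q) r = rowʳ-row q (l ∷ r)

chain-rowʳ : ∀ {Q a X Z c} M → Down Q → Chain Q (a ∷ (X ʳ++ M)) → Rowʳ a X Z c → Chain Q (Z ʳ++ (c ∷ M))
chain-rowʳ M dQ ch [] = ch
chain-rowʳ {Q} {X = x ∷ X} {z ∷ Z} M dQ ch (l ∷ q) with ch′ ← chain-rowʳ {X = X} (x ∷ M) dQ ch q =
  chain-ʳ-map Z (λ f g c → chain-swap (down-resp f g (down-ʳ Z dQ ch′)) c l) ch′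

rowʳ-stays : ∀ {a X Z c} → Rowʳ a X Z c → c ≡ a ⊎ c ∈ X
rowʳ-stays [] = inj₁ refl
rowʳ-stays (touch _ ∷ q) = inj₂ (here refl)
rowʳ-stays (apart _ ∷ q) with rowʳ-stays q
... | inj₁ e = inj₁ e
... | inj₂ m = inj₂ (there m)

-- Two boxes `u`, `c` of the moving band meet the same `x`, first `c`. If both touch it, a bent path
-- `u`, `c`, `x` would need the fourth box of a 2 by 2 square before `x`, where it cannot be, unless
-- its place is below the diagonal: the hooked case. If only one touches, a lost direction would
-- make two consecutive boxes that do not touch comparable.
link-dual : ∀ {Q u c x x₁ x₂ u′ c′} M → Down Q → Chain Q (u ∷ c ∷ x ∷ M) → Swap c x x₁ c′ → Swap u x₁ x₂ u′ →
  ∀ k → Dir k u c → ¬ Hooked u c x → Dir k u′ c′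
link-dual {Q} {u} {c} {x} M dQ (au , ac , ax , _) (touch n) (touch m) k r ¬h = both k r (nb-cases dQ au ac m) (nb-cases (down-add dQ au) ac ax n)
  where
  both↗ : u ↗ c → c ≡ east u ⊎ c ≡ south u → x ≡ east c ⊎ x ≡ south c → c ↗ x
  both↗ r (inj₂ refl) _ = ⊥-elim (<-irrefl refl (proj₂ r))
  both↗ _ (inj₁ refl) (inj₁ refl) = ≤-refl , ≤-refl
  both↗ _ (inj₁ refl) (inj₂ refl) = ⊥-elim (corner′ au ax ¬h)
    where
    corner′ : Addable Q u → Addable ((Q ∪ (u ∷ [])) ∪ (east u ∷ [])) (south (east u)) → ¬ Hooked u (east u) (south (east u)) → ⊥
    corner′ au (_ , _ , hx) ¬h with suc (row u) ≤? col u
    ... | no ≰ = ¬h (≤-antisym (proj₂ (proj₁ au)) (≤-pred (≰⇒> ≰)) , refl , refl)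
    ... | yes ≤ with hx (suc (row u) , col u) (s≤s z≤n , ≤) (≤-refl , n≤1+n _) (λ ())
    ...   | inj₁ (inj₁ q) = proj₁ (proj₂ au) (close dQ q (proj₁ au) (n≤1+n _ , ≤-refl))
    ...   | inj₁ (inj₂ (here ()))
    ...   | inj₂ (here ())
  both : ∀ k → Dir k u c → c ≡ east u ⊎ c ≡ south u → x ≡ east c ⊎ x ≡ south c → Dir k c x
  both dn (a , b) (inj₁ refl) _ = ⊥-elim (<-irrefl refl a)
  both dn _ (inj₂ refl) (inj₂ refl) = ≤-refl , ≤-refl
  both dn _ (inj₂ refl) (inj₁ refl) = ⊥-elim (corner (proj₂ (proj₂ ax) (row u , suc (col u)) (proj₁ (proj₁ au) , ≤-trans (proj₂ (proj₁ au)) (n≤1+n _)) (n≤1+n _ , ≤-refl) λ ()))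
    where
    corner : ¬ ((Q ∪ (u ∷ [])) ∪ (c ∷ [])) (row u , suc (col u))
    corner (inj₁ (inj₁ q)) = proj₁ (proj₂ au) (close dQ q (proj₁ au) (≤-refl , n≤1+n _))
    corner (inj₁ (inj₂ (here ())))
    corner (inj₂ (here ()))
  both up r e f = both↗ r e f
  both (vl b) r e f = both↗ r e f
link-dual {Q} {u} {c} {x} M dQ (au , ac , ax , _) (touch n) (apart m) k r ¬h = second k r (nb-cases (down-add dQ au) ac ax n)
  where
  u⋢c : ¬ u ⊑ c
  u⋢c = apart-⋢ dQ au ac m
  second↗ : u ↗ c → x ≡ east c ⊎ x ≡ south c → u ↗ x
  second↗ (a , b) (inj₁ refl) = a , <-trans b (n<1+n _)
  second↗ (a , b) (inj₂ refl) = ≤∧≢⇒< a (λ e → u⋢c (≤-reflexive (sym e) , <⇒≤ b)) , b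
  second : ∀ k → Dir k u c → x ≡ east c ⊎ x ≡ south c → Dir k u x
  second dn (a , b) (inj₁ refl) = a , ≤∧≢⇒< b λ e → u⋢c (<⇒≤ a , ≤-reflexive (sym e))
  second dn (a , b) (inj₂ refl) = <-trans a (n<1+n _) , b
  second up r e = second↗ r e
  second (vl b) r e = second↗ r e
link-dual {Q} {u} {c} {x} M dQ (au , ac , ax , _) (apart n) (touch m) k r ¬h = first k r (nb-cases′ m)
  where
  c⋢x : ¬ c ⊑ x
  c⋢x = apart-⋢ (down-add dQ au) ac ax n
  x⋢u : ¬ x ⊑ u
  x⋢u le = proj₁ (proj₂ ax) (inj₁ (close (down-add dQ au) (inj₂ (here refl)) (proj₁ ax) le))
  nb-cases′ : Nb u x → x ≡ east u ⊎ x ≡ south u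
  nb-cases′ (inj₁ e) = e
  nb-cases′ (inj₂ (inj₁ refl)) = ⊥-elim (x⋢u (≤-refl , n≤1+n _))
  nb-cases′ (inj₂ (inj₂ refl)) = ⊥-elim (x⋢u (n≤1+n _ , ≤-refl))
  first↗ : u ↗ c → x ≡ east u ⊎ x ≡ south u → x ↗ c
  first↗ (a , b) (inj₁ refl) = a , ≤∧≢⇒< b λ e → c⋢x (a , ≤-reflexive (sym e))
  first↗ (a , b) (inj₂ refl) = ≤-trans a (n≤1+n _) , b
  first : ∀ k → Dir k u c → x ≡ east u ⊎ x ≡ south u → Dir k x c
  first dn (a , b) (inj₁ refl) = a , ≤-trans b (n≤1+n _)
  first dn (a , b) (inj₂ refl) = ≤∧≢⇒< a (λ e → c⋢x (≤-reflexive (sym e) , b)) , b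
  first up r e = first↗ r e
  first (vl b) r e = first↗ r e
link-dual M dQ _ (apart _) (apart _) k r _ = r

-- The state of the switching process on a pair of bands A, B: the box at c with its kind k is on its way
-- through B. The boxes of A₁ (listed in reverse) have not moved, those of A₂ have passed all of B.
record State : Set where
  constructor state
  field
    A₁  : List Ent
    Bp  : List Ent
    c   : Pos
    k   : Kind
    Bq  : List Ent
    A₂  : List Ent

As Bs : State → List Ent
As (state A₁ Bp c k Bq A₂) = A₁ ʳ++ ((c , k) ∷ A₂)
Bs (state A₁ Bp c k Bq A₂) = Bp ʳ++ Bq

-- The last box of A₁ is compared with c only after it, too, has passed the boxes of Bp.
Virtual : List Ent → List Ent → Pos → Set
Virtual []             Bp c = ⊤
Virtual ((u , k) ∷ A₁) Bp c = ∃ λ X → ∃ λ u′ → Rowʳ u (positions Bp) X u′ × Dir k u′ c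

-- The boxes of `A₂` have already passed all of the other band, so the link to the first of them is
-- stated for the place that the travelling box is going to reach.
Final : Pos → Kind → List Ent → List Ent → Set
Final c k Bq A₂ = ∃ λ Y → ∃ λ c′ → Row c (positions Bq) Y c′ × Linked Link ((c′ , k) ∷ A₂)

record Inv (P : Pos → Set) (A B : List Ent) (s : State) : Set where
  constructor inv
  open State s
  field
    chain  : Chain P (positions A₁ ʳ++ (positions Bp ʳ++ (c ∷ positions Bq ++ positions A₂)))
    bandB  : Band (Bs s)
    flagsB : flags (Bs s) ≡ flags B
    okA    : Ok (map kind (As s))
    flagsA : flags (As s) ≡ flags A
    linkA₁ : Linked (flip Link) A₁
    virt   : Virtual A₁ Bp c
    fin    : Final c k Bq A₂
    -- The original places: `c₀` is where the travelling box started, `Z` where the boxes of `A₂`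
    -- started, and `X` consists of the passed boxes as they were before `c₀` met them.
    grid   : ∃ λ c₀ → ∃ λ Z → ∃ λ X → positions A ≡ positions A₁ ʳ++ (c₀ ∷ Z) ×
             Grid Z (positions B) (X ʳ++ positions Bq) (positions A₂) × Rowʳ c₀ X (positions Bp) c

module _ {P : Pos → Set} (dP : Down P) {A B : List Ent} where

  module Base {s} (i : Inv P A B s) where
    open State s
    open Inv i

    Q₁ Q : Pos → Set
    Q₁ = P ∪ positions A₁
    Q  = Q₁ ∪ positions Bp

    chain₁ : Chain Q₁ (positions Bp ʳ++ (c ∷ positions Bq ++ positions A₂))
    chain₁ = chain-ʳ⁻ (positions A₁) chain

    dQ₁ : Down Q₁
    dQ₁ = down-ʳ (positions A₁) dP chain

    chain-c : Chain Q (c ∷ positions Bq ++ positions A₂)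
    chain-c = chain-ʳ⁻ (positions Bp) chain₁

    dQ : Down Q
    dQ = down-ʳ (positions Bp) dQ₁ chain₁

    boxB : ∀ {z} → z ∈ Bs s → Box (pos z)
    boxB {z} m with ∈-ʳ⁻ Bp m
    ... | inj₁ m′ = chain-Box _ chain₁ (∈-ʳ⁺ˡ (∈-map⁺ pos m′))
    ... | inj₂ m′ = chain-Box _ (proj₂ chain-c) (∈-++ (∈-map⁺ pos m′))
      where
      ∈-++ : ∀ {X Y : List Pos} {z} → z ∈ X → z ∈ X ++ Y
      ∈-++ (here e) = here e
      ∈-++ (there m) = there (∈-++ m)

  virtual-chain : ∀ {u ku A₁ Bp c k Bq A₂ X u′} → (i : Inv P A B (state ((u , ku) ∷ A₁) Bp c k Bq A₂)) →
    Rowʳ u (positions Bp) X u′ → ∃ λ Q → Down Q × Chain Q (u′ ∷ c ∷ positions Bq ++ positions A₂)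
  virtual-chain {u} {A₁ = A₁} {Bp} {X = X} i r =
    _ , down-ʳ X dQ₁ ch , chain-ʳ⁻ X ch
    where
    dQ₁ : Down (P ∪ positions A₁)
    dQ₁ = down-ʳ (positions A₁) dP (Inv.chain i)
    ch = chain-rowʳ {X = positions Bp} _ dQ₁ (chain-ʳ⁻ (positions A₁) (Inv.chain i)) r

  -- The situation of (S4) and (S7): the hook now lies in the moving band, so that its own turning
  -- point has to change.
  Flips : State → Pos → Set
  Flips (state [] Bp c k Bq A₂) x = ⊥
  Flips (state ((u , ku) ∷ A₁) Bp c k Bq A₂) x = ∃ λ X → ∃ λ u′ → Rowʳ u (positions Bp) X u′ × Hooked u′ c x

  private
    rowʳ-fun : ∀ {a X Z c Z′ c′} → Rowʳ a X Z c → Rowʳ a X Z′ c′ → Z ≡ Z′ × c ≡ c′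
    rowʳ-fun [] [] = refl , refl
    rowʳ-fun (l ∷ q) (l′ ∷ q′) with refl , refl ← rowʳ-fun q q′ with refl , refl ← swap-fun l l′ = refl , refl

  virt-pass : ∀ {Q u ku Bp X u′ c x x₁ c′} M → Down Q → Chain Q (u′ ∷ c ∷ x ∷ M) → Rowʳ u (positions Bp) X u′ → Dir ku u′ c →
    Swap c x x₁ c′ → ¬ Hooked u′ c x →
    ∃ λ z → ∃ λ u″ → Swap u′ x₁ z u″ × Dir ku u″ c′
  virt-pass {ku = ku} {u′ = u′} {x₁ = x₁} M dQ ch r d l ¬h with z , u″ , l′ ← swap u′ x₁ =
    z , u″ , l′ , link-dual M dQ ch l l′ ku d ¬h

  -- The hook would force `u″` to be `c`. But a rising link cannot end on the diagonal, and a link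
  -- to the east neighbour does not descend.
  no-flip : ∀ {u′ c} ku {u″} → Dir ku u′ c → Box u′ → row c ≡ col c → Dir ku u″ (east c) → ¬ Hooked u″ (east c) (south (east c))
  no-flip {u′} {c} ku d b e d′ (e′ , refl , _) = impossible ku d d′
    where
    impossible : ∀ k → Dir k u′ c → Dir k c (east c) → ⊥
    impossible dn _ (a , _) = <-irrefl refl a
    impossible up (a , b′) _ = <-irrefl e (≤-<-trans a (≤-<-trans (proj₂ b) b′))
    impossible (vl _) (a , b′) _ = <-irrefl e (≤-<-trans a (≤-<-trans (proj₂ b) b′))

  virt-next : ∀ {A₁ Bp c k Bq A₂ N c′ Bq′} → (i : Inv P A B (state A₁ Bp c k Bq A₂)) → Next c Bq N c′ Bq′ →
    (∀ {x k₁ Y} → Bq ≡ (x , k₁) ∷ Y → ¬ Flips (state A₁ Bp c k Bq A₂) x) → Virtual A₁ (N ++ Bp) c′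
  virt-next {[]} i n ¬f = tt
  virt-next {(u , ku) ∷ A₁} {Bp} {A₂ = A₂} i (apart {Y = Y} ¬n) ¬f with X , u′ , r , d ← Inv.virt i with Q , dQ , ch ← virtual-chain i r
    with z , u″ , l , d′ ← virt-pass {ku = ku} {Bp = Bp} _ dQ ch r d (apart ¬n) (λ h → ¬f refl (_ , _ , r , h)) = _ , _ , l ∷ r , d′
  virt-next {(u , ku) ∷ A₁} {Bp} i (touch n _) ¬f with X , u′ , r , d ← Inv.virt i with Q , dQ , ch ← virtual-chain i r
    with z , u″ , l , d′ ← virt-pass {ku = ku} {Bp = Bp} _ dQ ch r d (touch n) (λ h → ¬f refl (_ , _ , r , h)) = _ , _ , l ∷ r , d′
  virt-next {(u , ku) ∷ A₁} {Bp} {c} i (hook {x} {y} h@(e , refl , refl)) ¬f with X , u′ , r , d ← Inv.virt i with Q , dQ , ch ← virtual-chain i r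
    with z , u″ , l , d′ ← virt-pass {ku = ku} {Bp = Bp} _ dQ ch r d (touch (hook-nb₁ h)) (λ h → ¬f refl (_ , _ , r , h))
    with z₂ , u‴ , l₂ , d″ ← virt-pass {ku = ku} {Bp = (c , up) ∷ Bp} _ (down-add dQ (proj₁ (chain-swap dQ ch l))) (proj₂ (chain-swap dQ ch l)) (l ∷ r) d′ (touch (hook-nb₂ h)) (no-flip ku d (proj₁ (proj₁ ch)) e d′)
    = _ , _ , l₂ ∷ l ∷ r , d″

  fin-next : ∀ {c k Bq A₂ N c′ Bq′} → Next c Bq N c′ Bq′ → Final c k Bq A₂ → Final c′ k Bq′ A₂
  fin-next (apart n) (_ , _ , l ∷ r , f) with refl , refl ← swap-fun l (apart n) = _ , _ , r , f
  fin-next (touch n _) (_ , _ , l ∷ r , f) with refl , refl ← swap-fun l (touch n) = _ , _ , r , f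
  fin-next (hook h) (_ , _ , l ∷ l′ ∷ r , f) with refl , refl ← swap-fun l (touch (hook-nb₁ h))
    with refl , refl ← swap-fun l′ (touch (hook-nb₂ h)) = _ , _ , r , f

  row-next : ∀ {c₀ X c Bq N c′ Bq′} Bp → Next c Bq N c′ Bq′ → Rowʳ c₀ X (positions Bp) c →
    ∃ λ X′ → Rowʳ c₀ X′ (positions (N ++ Bp)) c′ × X ʳ++ positions Bq ≡ X′ ʳ++ positions Bq′
  row-next Bp (apart n) r = _ , apart n ∷ r , refl
  row-next Bp (touch n _) r = _ , touch n ∷ r , refl
  row-next Bp (hook h) r = _ , touch (hook-nb₂ h) ∷ touch (hook-nb₁ h) ∷ r , refl

  chain-next : ∀ {c Bq N c′ Bq′ A₁ A₂} Bp → Next c Bq N c′ Bq′ →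
    Chain P (positions A₁ ʳ++ (positions Bp ʳ++ (c ∷ positions Bq ++ A₂))) →
    Chain P (positions A₁ ʳ++ (positions (N ++ Bp) ʳ++ (c′ ∷ positions Bq′ ++ A₂)))
  chain-next {A₁ = A₁} Bp (touch _ _) ch = ch
  chain-next {A₁ = A₁} Bp (hook _) ch = ch
  chain-next {A₁ = A₁} Bp n@(apart ¬n) ch = chain-ʳ-map (positions A₁) (λ f g c → chain-ʳ-map (positions Bp)
    (λ f′ g′ c′ → next-chain _ (down-resp f′ g′ (down-ʳ (positions Bp) (down-resp f g (down-ʳ (positions A₁) dP ch)) c)) c′ n) c) ch

  advance : ∀ {A₁ Bp c k Bq A₂ N c′ Bq′} → Inv P A B (state A₁ Bp c k Bq A₂) → Next c Bq N c′ Bq′ →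
    (∀ {x k₁ Y} → Bq ≡ (x , k₁) ∷ Y → ¬ Flips (state A₁ Bp c k Bq A₂) x) → Inv P A B (state A₁ (N ++ Bp) c′ k Bq′ A₂)
  advance {A₁} {Bp} {c} {k} {A₂ = A₂} i n ¬f with c₀ , Z , X , eA , g , r ← Inv.grid i with X′ , r′ , e ← row-next Bp n r = inv
    (chain-next {A₁ = A₁} Bp n (Inv.chain i))
    (next-band dQ Bp _ (λ m → inj₂ (∈-map⁺ pos m)) chain-c n (Inv.bandB i))
    (trans (next-flags Bp n) (Inv.flagsB i))
    (ok-ent A₁ {c , k} {A₂} (λ { (vl∷ us) → vl∷ us ; (dn∷ t) → dn∷ t }) (λ { (up∷ us) → up∷ us }) (Inv.okA i))
    (trans (flags-ʳ A₁ (flags-head k)) (Inv.flagsA i))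
    (Inv.linkA₁ i)
    (virt-next i n ¬f)
    (fin-next n (Inv.fin i))
    (c₀ , Z , X′ , eA , subst (λ b → Grid Z (positions B) b (positions A₂)) e g , r′)
    where
    open Base i
    flags-head : ∀ k {p q E} → flags ((p , k) ∷ E) ≡ flags ((q , k) ∷ E)
    flags-head dn = refl
    flags-head up = refl
    flags-head (vl _) = refl

  -- With all of the other band passed, what `Virtual` says about `u` is what `Final` demands when
  -- `u` sets out; the new `Virtual` is a link between boxes that have not moved yet.
  retire : ∀ {u ku A₁ Bp c k A₂} → Inv P A B (state ((u , ku) ∷ A₁) Bp c k [] A₂) →
    Inv P A B (state A₁ [] u ku (Bp ʳ++ []) ((c , k) ∷ A₂))
  retire {u} {ku} {A₁} {Bp} {c} {k} {A₂} i with c₀ , Z , X , eA , g , r ← Inv.grid i | X′ , u′ , r′ , d ← Inv.virt i | _ , _ , [] , f ← Inv.fin i = inv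
    (subst (λ L → Chain P (positions A₁ ʳ++ (u ∷ L))) (trans (ʳ++-++ (positions Bp)) (cong (_++ c ∷ positions A₂) (sym (map-ʳ pos Bp)))) (Inv.chain i))
    (Inv.bandB i) (Inv.flagsB i) (Inv.okA i) (Inv.flagsA i)
    (linked-tail (Inv.linkA₁ i))
    (virt₀ (Inv.linkA₁ i))
    (X′ ʳ++ [] , u′ , subst (λ L → Row u L (X′ ʳ++ []) u′) (sym (map-ʳ pos Bp)) (rowʳ-row r′ []) , d ∷ f)
    (u , c₀ ∷ Z , [] , eA , subst (λ b → Grid (c₀ ∷ Z) (positions B) b (c ∷ positions A₂)) (sym (map-ʳ pos Bp)) (rowʳ-row r [] ∷ g) , [])
    where
    ʳ++-++ : ∀ (X : List Pos) {Y Z} → X ʳ++ (Y ++ Z) ≡ (X ʳ++ Y) ++ Z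
    ʳ++-++ [] = refl
    ʳ++-++ (x ∷ X) {Y} = ʳ++-++ X {x ∷ Y}
    virt₀ : ∀ {A₁} → Linked (flip Link) ((u , ku) ∷ A₁) → Virtual A₁ [] u
    virt₀ [-] = tt
    virt₀ (l ∷ _) = _ , _ , [] , l

  -- The simultaneous move of two boxes on the diagonal (S4, S7), seen from c: the turning point of A moves on.
  flip-turn : ∀ {u ku A₁ Bp c k x k₁ Y A₂ X u′} → Inv P A B (state ((u , ku) ∷ A₁) Bp c k ((x , k₁) ∷ Y) A₂) →
    Rowʳ u (positions Bp) X u′ → Hooked u′ c x →
    u ≡ u′ × ∃ λ b → ku ≡ vl b × k ≡ up × Inv P A B (state ((u , dn) ∷ A₁) ((c , k₁) ∷ Bp) x (vl b) Y ((A₂)))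
  flip-turn {u} {ku} {A₁} {Bp} {c} {k} {x} {k₁} {Y} {A₂} {X} {u′} i r h@(e , refl , refl) with rowʳ-stays r
  ... | inj₂ m = ⊥-elim (two-diagonals m)
    where
    open Base i
    -- A band has at most one box on the diagonal, and `x` is one. So `u` touches nothing in `Bp`,
    -- and its virtual place is its real one.
    two-diagonals : u′ ∉ positions Bp
    two-diagonals m with (_ , kz) , m′ , refl ← ∈-map⁻ pos m
      with s ← allPairs-ʳ Bp (stars (Inv.bandB i)) m′ (here refl)
      with rising s (diagonal-not-dn (Inv.bandB i) boxB (subst (λ j → ((row u′ , j) , kz) ∈ Bp ʳ++ ((x , k₁) ∷ Y)) (sym e) (∈-ʳ⁺ˡ m′)))
    ... | (le , _) , _ = <-irrefl refl le
  ... | inj₁ refl with X′ , u″ , r′ , d ← Inv.virt i with refl , refl ← rowʳ-fun r r′ = refl , turn ku k d (Inv.linkA₁ i) (Inv.okA i) (Inv.flagsA i) (Inv.fin i)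
    where
    open Base i
    n : Next c ((x , k₁) ∷ Y) ((c , k₁) ∷ []) x Y
    n = touch (hook-nb₂ h) λ { _ _ (_ , () , _) }
    box-A₁ : ∀ {w kw A₁′} → A₁ ≡ (w , kw) ∷ A₁′ → Box w
    box-A₁ {A₁′ = A₁′} refl = chain-Box _ (Inv.chain i) (∈-ʳ⁺ (positions A₁′) (here refl))
    turn : ∀ ku k → Dir ku u c → Linked (flip Link) ((u , ku) ∷ A₁) → Ok (map kind (A₁ ʳ++ ((u , ku) ∷ (c , k) ∷ A₂))) →
      flags (A₁ ʳ++ ((u , ku) ∷ (c , k) ∷ A₂)) ≡ flags A → Final c k ((x , k₁) ∷ Y) A₂ →
      ∃ λ b → ku ≡ vl b × k ≡ up × Inv P A B (state ((u , dn) ∷ A₁) ((c , k₁) ∷ Bp) x (vl b) Y A₂)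
    turn dn k d l o f fi = ⊥-elim (<-irrefl refl (proj₁ d))
    turn up k d [-] (some ()) f fi
    turn up k d (_∷_ {y = w , dn} {xs = V} l _) o f fi with ok-suffix (map kind V) (subst Ok (map-ʳ kind V) o)
    ... | inj₁ (dn∷ ())
    ... | inj₂ ()
    turn up k d (_∷_ {y = w , up} (a , b) _) o f fi = ⊥-elim (<-irrefl e (≤-<-trans a (≤-<-trans (proj₂ (box-A₁ refl)) b)))
    turn up k d (_∷_ {y = w , vl _} (a , b) _) o f fi = ⊥-elim (<-irrefl e (≤-<-trans a (≤-<-trans (proj₂ (box-A₁ refl)) b)))
    turn (vl b) k d l o f fi with ok-suffix (map kind A₁) (subst Ok (map-ʳ kind A₁) o)
    turn (vl b) up d l o f fi | inj₁ (vl∷ (up∷ us)) with c₀ , Z , X , eA , g , r₀ ← Inv.grid i with X′ , r′ , e′ ← row-next Bp n r₀ =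
      b , refl , refl , inv
      (chain-next {A₁ = (u , ku) ∷ A₁} Bp n (Inv.chain i))
      (next-band dQ Bp _ (λ m → inj₂ (∈-map⁺ pos m)) chain-c n (Inv.bandB i))
      (trans (next-flags Bp n) (Inv.flagsB i))
      (ok-ent A₁ {u , vl b} {(c , up) ∷ A₂} (λ { (vl∷ (up∷ us)) → dn∷ (vl∷ us) }) (λ ()) o)
      (trans (flags-ʳ A₁ {(u , dn) ∷ (x , vl b) ∷ A₂} {(u , vl b) ∷ (c , up) ∷ A₂} refl) f)
      (relink l)
      (_ , _ , touch (hook-nb₁ h) ∷ r , (≤-refl , ≤-refl))
      (refinal (fin-next n fi))
      (c₀ , Z , X′ , eA , subst (λ b → Grid Z (positions B) b (positions A₂)) e′ g , r′)
      where
      relink : ∀ {A₁} → Linked (flip Link) ((u , vl b) ∷ A₁) → Linked (flip Link) ((u , dn) ∷ A₁)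
      relink [-] = [-]
      relink (r ∷ l) = r ∷ l
      refinal : Final x up Y A₂ → Final x (vl b) Y A₂
      refinal (Y , c , r , [-]) = Y , c , r , [-]
      refinal (Y , c , r , d ∷ f) = Y , c , r , d ∷ f
    turn (vl b) dn d l o f fi | inj₁ (vl∷ ())
    turn (vl b) (vl _) d l o f fi | inj₁ (vl∷ ())
    turn (vl b) k d l o f fi | inj₂ ()

-- Fillings and single switches

letter : ℕ → Kind → Letter
letter a dn         = pr a
letter a (vl true)  = pr a
letter a (vl false) = un a
letter a up         = un a

size-letter : ∀ a k → ∣ letter a k ∣ ≡ a
size-letter a dn = refl
size-letter a (vl true) = refl
size-letter a (vl false) = refl
size-letter a up = refl

Val : Set
Val = Label × Letter

Rep : (Pos → Val → Set) → List (Pos × Val) → LFilling → Set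
Rep O W G = ∀ p v → (G p ≡ just v → O p v ⊎ (p , v) ∈ W) × (O p v ⊎ (p , v) ∈ W → G p ≡ just v)

≡ᵇ-refl : ∀ n → (n ≡ᵇ n) ≡ true
≡ᵇ-refl zero = refl
≡ᵇ-refl (suc n) = ≡ᵇ-refl n

eqPos-refl : ∀ p → eqPos p p ≡ true
eqPos-refl (i , j) rewrite ≡ᵇ-refl i | ≡ᵇ-refl j = refl

eqPos-sound : ∀ p q → eqPos p q ≡ true → p ≡ q
eqPos-sound (i , j) (i′ , j′) e with i ≡ᵇ i′ in e₁ | j ≡ᵇ j′ in e₂
... | true | true = cong₂ _,_ (≡ᵇ⇒≡ i i′ (subst T (sym e₁) tt)) (≡ᵇ⇒≡ j j′ (subst T (sym e₂) tt))

upd-same : ∀ p v G → upd p v G p ≡ v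
upd-same p v G rewrite eqPos-refl p = refl

upd-other : ∀ {p q} v G → q ≢ p → upd p v G q ≡ G q
upd-other {p} {q} v G n with eqPos q p in e
... | true = ⊥-elim (n (eqPos-sound q p e))
... | false = refl

rep-update : ∀ {O W W′ G G′} → Rep O W G → (∀ p v → O p v → p ∉ map proj₁ W′) → (∀ {p v} → (p , v) ∈ W → p ∈ map proj₁ W′) →
  (∀ {p v} → (p , v) ∈ W′ → G′ p ≡ just v) → (∀ {p} → p ∉ map proj₁ W′ → G′ p ≡ G p) → Rep O W′ G′
rep-update {O} {W} {W′} {G} {G′} r o w g g′ p v = to , from
  where
  to : G′ p ≡ just v → O p v ⊎ (p , v) ∈ W′
  to e with _∈ₚ?_ p (map proj₁ W′)
  ... | yes m with (_ , v′) , m′ , refl ← ∈-map⁻ proj₁ m = inj₂ (subst (λ v → (p , v) ∈ W′) (just-injective (trans (sym (g m′)) e)) m′)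
  ... | no n with proj₁ (r p v) (trans (sym (g′ n)) e)
  ...   | inj₁ x = inj₁ x
  ...   | inj₂ m = ⊥-elim (n (w m))
  from : O p v ⊎ (p , v) ∈ W′ → G′ p ≡ just v
  from (inj₁ x) = trans (g′ (o p v x)) (proj₂ (r p v) (inj₁ x))
  from (inj₂ m) = g m

∉₂ : ∀ {p q r : Pos} → r ∉ p ∷ q ∷ [] → r ≢ p × r ≢ q
∉₂ n = (λ e → n (here e)) , λ e → n (there (here e))

rep-swap : ∀ {O c x vc vx G} → c ≢ x → (∀ p v → O p v → p ≢ c × p ≢ x) →
  Rep O ((c , vc) ∷ (x , vx) ∷ []) G → Rep O ((x , vc) ∷ (c , vx) ∷ []) (swapP c x G)
rep-swap {O} {c} {x} {vc} {vx} {G} n o r = rep-update r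
  (λ { p v op (here e) → proj₂ (o p v op) e ; p v op (there (here e)) → proj₁ (o p v op) e })
  (λ { (here refl) → there (here refl) ; (there (here refl)) → here refl })
  (λ { (here refl) → trans (upd-other (G x) G₁ (λ e → n (sym e))) (trans (upd-same x (G c) G) (proj₂ (r c vc) (inj₂ (here refl))))
     ; (there (here refl)) → trans (upd-same c (G x) G₁) (proj₂ (r x vx) (inj₂ (there (here refl)))) })
  (λ m → let a , b = ∉₂ m in trans (upd-other (G x) G₁ b) (upd-other (G c) G a))
  where
  G₁ = upd x (G c) G

rep-three : ∀ {O p q s v₁ v₂ v₃ w₁ w₂ w₃ G} → p ≢ q → p ≢ s → q ≢ s → (∀ r v → O r v → r ≢ p × r ≢ q × r ≢ s) →
  Rep O ((p , v₁) ∷ (q , v₂) ∷ (s , v₃) ∷ []) G →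
  Rep O ((p , w₁) ∷ (q , w₂) ∷ (s , w₃) ∷ []) (upd p (just w₁) (upd q (just w₂) (upd s (just w₃) G)))
rep-three {O} {p} {q} {s} {w₁ = w₁} {w₂} {w₃} {G} pq ps qs o r = rep-update r
  (λ { r v x (here e) → proj₁ (o r v x) e ; r v x (there (here e)) → proj₁ (proj₂ (o r v x)) e
     ; r v x (there (there (here e))) → proj₂ (proj₂ (o r v x)) e })
  (λ { (here refl) → here refl ; (there (here refl)) → there (here refl) ; (there (there (here refl))) → there (there (here refl)) })
  (λ { (here refl) → upd-same p (just w₁) G₁
     ; (there (here refl)) → trans (upd-other (just w₁) G₁ (λ e → pq (sym e))) (upd-same q (just w₂) G₂)
     ; (there (there (here refl))) → trans (upd-other (just w₁) G₁ (λ e → ps (sym e)))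
         (trans (upd-other (just w₂) G₂ (λ e → qs (sym e))) (upd-same s (just w₃) G)) })
  (λ m → trans (upd-other (just w₁) G₁ (λ e → m (here e)))
    (trans (upd-other (just w₂) G₂ (λ e → m (there (here e)))) (upd-other (just w₃) G (λ e → m (there (there (here e)))))))
  where
  G₂ = upd s (just w₃) G
  G₁ = upd q (just w₂) G₂

Tag : Label → ℕ → List Ent → Pos → Val → Set
Tag lab n E p v = ∃ λ k → (p , k) ∈ E × v ≡ (lab , letter n k)

-- The frame `F` contains everything outside the two bands; the hypotheses keep its letters from
-- being taken for boxes of either band.
module Pair (a b : ℕ) (F : Pos → Val → Set)
  (frame-S : ∀ {p l} → F p (SL , l) → ∣ l ∣ ≢ a) (frame-T : ∀ {p l} → F p (TL , l) → ∣ l ∣ ≢ b) where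

  Content : List Ent → List Ent → Pos → Val → Set
  Content A B p v = F p v ⊎ Tag SL a A p v ⊎ Tag TL b B p v

  RepAB : List Ent → List Ent → LFilling → Set
  RepAB A B G = ∀ p v → (G p ≡ just v → Content A B p v) × (Content A B p v → G p ≡ just v)

  module _ {A B G} (r : RepAB A B G) where

    a-box : ∀ {p k} → (p , k) ∈ A → G p ≡ just (SL , letter a k)
    a-box m = proj₂ (r _ _) (inj₂ (inj₁ (_ , m , refl)))

    b-box : ∀ {p k} → (p , k) ∈ B → G p ≡ just (TL , letter b k)
    b-box m = proj₂ (r _ _) (inj₂ (inj₂ (_ , m , refl)))

    a-box⁻ : ∀ {p l} → G p ≡ just (SL , l) → ∣ l ∣ ≡ a → ∃ λ k → (p , k) ∈ A × l ≡ letter a k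
    a-box⁻ e s with proj₁ (r _ _) e
    ... | inj₁ f = ⊥-elim (frame-S f s)
    ... | inj₂ (inj₁ (k , m , refl)) = k , m , refl
    ... | inj₂ (inj₂ (_ , _ , ()))

    b-box⁻ : ∀ {p l} → G p ≡ just (TL , l) → ∣ l ∣ ≡ b → ∃ λ k → (p , k) ∈ B × l ≡ letter b k
    b-box⁻ e s with proj₁ (r _ _) e
    ... | inj₁ f = ⊥-elim (frame-T f s)
    ... | inj₂ (inj₁ (_ , _ , ()))
    ... | inj₂ (inj₂ (k , m , refl)) = k , m , refl

    isA : ∀ {p k} → (p , k) ∈ A → IsABox a G p
    isA {k = k} m = _ , a-box m , size-letter a k

    isB : ∀ {p k} → (p , k) ∈ B → IsBBox b G p
    isB {k = k} m = _ , b-box m , size-letter b k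

    isB⁻ : ∀ {p} → IsBBox b G p → p ∈ positions B
    isB⁻ (_ , e , s) = let _ , m , _ = b-box⁻ e s in ∈-map⁺ pos m

    frame-∉A : ∀ {p v} → F p v → p ∉ positions A
    frame-∉A {p} f m with (_ , k) , m′ , refl ← ∈-map⁻ pos m
      with refl ← just-injective (trans (sym (proj₂ (r _ _) (inj₁ f))) (a-box m′)) = frame-S f (size-letter a k)

    frame-∉B : ∀ {p v} → F p v → p ∉ positions B
    frame-∉B {p} f m with (_ , k) , m′ , refl ← ∈-map⁻ pos m
      with refl ← just-injective (trans (sym (proj₂ (r _ _) (inj₁ f))) (b-box m′)) = frame-T f (size-letter b k)

    A∩B : ∀ {p} → p ∈ positions A → p ∉ positions B
    A∩B m n with (_ , k) , m′ , refl ← ∈-map⁻ pos m with (_ , k′) , n′ , refl ← ∈-map⁻ pos n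
      with () ← trans (sym (a-box m′)) (b-box n′)

  tagged : Label → ℕ → List Ent → List (Pos × Val)
  tagged lab n = map λ (p , k) → p , (lab , letter n k)

  tag-∈ : ∀ {lab n E p v} → Tag lab n E p v → (p , v) ∈ tagged lab n E
  tag-∈ (k , m , refl) = ∈-map⁺ _ m

  ∈-tag : ∀ {lab n E p v} → (p , v) ∈ tagged lab n E → Tag lab n E p v
  ∈-tag m with (_ , k) , m′ , refl ← ∈-map⁻ _ m = k , m′ , refl

  module _ (X E Y : List Ent) where

    mid⁺ : ∀ {e} → e ∈ X ʳ++ Y ⊎ e ∈ E → e ∈ X ʳ++ (E ++ Y)
    mid⁺ (inj₁ m) with ∈-ʳ⁻ X m
    ... | inj₁ m′ = ∈-ʳ⁺ˡ m′
    ... | inj₂ m′ = ∈-ʳ⁺ X (∈-++⁺ʳ E m′)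
    mid⁺ (inj₂ m) = ∈-ʳ⁺ X (∈-++⁺ˡ m)

    mid⁻ : ∀ {e} → e ∈ X ʳ++ (E ++ Y) → e ∈ X ʳ++ Y ⊎ e ∈ E
    mid⁻ m with ∈-ʳ⁻ X m
    ... | inj₁ m′ = inj₁ (∈-ʳ⁺ˡ m′)
    ... | inj₂ m′ with ∈-++⁻ E m′
    ...   | inj₁ n = inj₂ n
    ...   | inj₂ n = inj₁ (∈-ʳ⁺ X n)

  module _ (X E Y X′ E′ Y′ : List Ent) where

    private
      O = Content (X ʳ++ Y) (X′ ʳ++ Y′)
      W = tagged SL a E ++ tagged TL b E′

      Whole = Content (X ʳ++ (E ++ Y)) (X′ ʳ++ (E′ ++ Y′))

      open-up : ∀ {p v} → Whole p v → O p v ⊎ (p , v) ∈ W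
      open-up (inj₁ f) = inj₁ (inj₁ f)
      open-up (inj₂ (inj₁ (k , m , e))) with mid⁻ X E Y m
      ... | inj₁ n = inj₁ (inj₂ (inj₁ (k , n , e)))
      ... | inj₂ n = inj₂ (∈-++⁺ˡ (tag-∈ (k , n , e)))
      open-up (inj₂ (inj₂ (k , m , e))) with mid⁻ X′ E′ Y′ m
      ... | inj₁ n = inj₁ (inj₂ (inj₂ (k , n , e)))
      ... | inj₂ n = inj₂ (∈-++⁺ʳ (tagged SL a E) (tag-∈ (k , n , e)))

      close-up : ∀ {p v} → O p v ⊎ (p , v) ∈ W → Whole p v
      close-up (inj₁ (inj₁ f)) = inj₁ f
      close-up (inj₁ (inj₂ (inj₁ (k , m , e)))) = inj₂ (inj₁ (k , mid⁺ X E Y (inj₁ m) , e))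
      close-up (inj₁ (inj₂ (inj₂ (k , m , e)))) = inj₂ (inj₂ (k , mid⁺ X′ E′ Y′ (inj₁ m) , e))
      close-up (inj₂ m) with ∈-++⁻ (tagged SL a E) m
      ... | inj₁ n with k , m′ , e ← ∈-tag n = inj₂ (inj₁ (k , mid⁺ X E Y (inj₂ m′) , e))
      ... | inj₂ n with k , m′ , e ← ∈-tag n = inj₂ (inj₂ (k , mid⁺ X′ E′ Y′ (inj₂ m′) , e))

    -- A switch changes only the entries `E` and `E′` at the cursors. Everything else is frozen into
    -- one predicate while they change, and thawed by `unfocus`.
    focus : ∀ {G} → RepAB (X ʳ++ (E ++ Y)) (X′ ʳ++ (E′ ++ Y′)) G → Rep O W G
    focus r p v = (λ e → open-up (proj₁ (r p v) e)) , λ x → proj₂ (r p v) (close-up x)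

    unfocus : ∀ {G} → Rep O W G → RepAB (X ʳ++ (E ++ Y)) (X′ ʳ++ (E′ ++ Y′)) G
    unfocus r p v = (λ e → close-up (proj₁ (r p v) e)) , λ x → proj₂ (r p v) (open-up x)

module _ {A : Set} {R : A → A → Set} where

  pairs-ʳ⁻ : ∀ X {Y} → AllPairs R (X ʳ++ Y) → AllPairs (flip R) X × AllPairs R Y
  pairs-ʳ⁻ [] p = [] , p
  pairs-ʳ⁻ (x ∷ X) p with q , r ∷ rs ← pairs-ʳ⁻ X p = All.tabulate (λ m → allPairs-ʳ X p m (here refl)) ∷ q , rs

  pairs-ʳ⁺ : ∀ X {Y} → AllPairs (flip R) X → AllPairs R Y → (∀ {x y} → x ∈ X → y ∈ Y → R x y) → AllPairs R (X ʳ++ Y)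
  pairs-ʳ⁺ [] _ q _ = q
  pairs-ʳ⁺ (x ∷ X) (p ∷ ps) q f = pairs-ʳ⁺ X ps (All.tabulate (λ m → f (here refl) m) ∷ q)
    λ { m (here refl) → All.lookup p m ; m (there n) → f (there m) n }

  pairs-++⁻ : ∀ X {Y} → AllPairs R (X ++ Y) → AllPairs R X × AllPairs R Y × (∀ {x y} → x ∈ X → y ∈ Y → R x y)
  pairs-++⁻ [] p = [] , p , λ ()
  pairs-++⁻ (x ∷ X) (p ∷ ps) with q , r , f ← pairs-++⁻ X ps =
    All.tabulate (λ m → All.lookup p (∈-++⁺ˡ m)) ∷ q , r ,
    λ { (here refl) m → All.lookup p (∈-++⁺ʳ X m) ; (there m) n → f m n }

avoid : ∀ X E {Y : List Pos} {p} → AllPairs _≢_ (X ʳ++ (E ++ Y)) → p ∈ X ʳ++ Y → p ∉ E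
avoid X E ps m n with ∈-ʳ⁻ X m | pairs-ʳ⁻ X ps
... | inj₁ m′ | _ = allPairs-ʳ X ps m′ (∈-++⁺ˡ n) refl
... | inj₂ m′ | _ , q = proj₂ (proj₂ (pairs-++⁻ E q)) n m′ refl

chain-distinct : ∀ {P} L → Chain P L → AllPairs _≢_ L
chain-distinct [] _ = []
chain-distinct (y ∷ L) (_ , c) = All.tabulate (λ { m refl → chain-fresh L c m (inj₂ (here refl)) }) ∷ chain-distinct L c

-- A travelling box changes its place only by touching the next one, and then it goes one step east
-- or south.
row-⊒ : ∀ {Q a X Z c} M → Down Q → Chain Q (a ∷ (X ʳ++ M)) → Rowʳ a X Z c → a ⊑ c
row-⊒ M dQ ch [] = ⊑-refl
row-⊒ {X = x ∷ X} {z ∷ Z} M dQ ch (apart n ∷ q) = row-⊒ {X = X} (x ∷ M) dQ ch q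
row-⊒ {X = x ∷ X} {z ∷ Z} M dQ ch (touch n ∷ q) with row-⊒ {X = X} (x ∷ M) dQ ch q | chain-rowʳ {X = X} (x ∷ M) dQ ch q
... | le | ch′ with ch″@(ac , ax , _) ← chain-ʳ⁻ Z ch′ with nb-cases (down-ʳ Z dQ ch′) ac ax n
...   | inj₁ refl = ⊑-trans le (≤-refl , n≤1+n _)
...   | inj₂ refl = ⊑-trans le (n≤1+n _ , ≤-refl)

dn-before : ∀ X {k K} → Ok (X ʳ++ (k ∷ K)) → k ≢ up → All (_≡ dn) X
dn-before [] o n = []
dn-before (x ∷ X) o n with ok-suffix X o
... | inj₁ (vl∷ (up∷ _)) = ⊥-elim (n refl)
... | inj₁ (dn∷ _) = refl ∷ dn-before X o (λ ())
... | inj₂ (up∷ (up∷ _)) = ⊥-elim (n refl)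

rises-before : ∀ X {e y Y} → Ok (map kind (X ʳ++ (y ∷ Y))) → Linked (flip Link) (y ∷ X) → e ∈ X → kind e ≢ dn → pos e ↗ pos y × kind y ≡ up
rises-before ((w , kw) ∷ X) {e} {y} {Y} o (l ∷ ls) m n = go′ (ok-suffix (map kind X) (subst Ok (map-ʳ kind X) o)) m kw refl l
  where
  go′ : Turn (kw ∷ kind y ∷ map kind Y) ⊎ Ups (kw ∷ kind y ∷ map kind Y) → e ∈ (w , kw) ∷ X → ∀ k → kw ≡ k → Dir k w (pos y) → pos e ↗ pos y × kind y ≡ up
  go′ t (here refl) dn refl _ = ⊥-elim (n refl)
  go′ (inj₁ (dn∷ t)) (there m) k refl d with () ← proj₂ (rises-before X o ls m n)
  go′ (inj₁ (vl∷ us)) (there m) k refl d with () ← proj₂ (rises-before X o ls m n)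
  go′ (inj₂ (up∷ us)) (there m) k refl d = ↗-trans (proj₁ (rises-before X o ls m n)) d , head-up us
    where
    head-up : Ups (kind y ∷ map kind Y) → kind y ≡ up
    head-up us with kind y | us
    ... | _ | up∷ _ = refl
  go′ (inj₁ (vl∷ us)) (here refl) (vl _) refl d = d , head-up us
    where
    head-up : Ups (kind y ∷ map kind Y) → kind y ≡ up
    head-up us with kind y | us
    ... | _ | up∷ _ = refl
  go′ (inj₂ (up∷ us)) (here refl) up refl d = d , head-up us
    where
    head-up : Ups (kind y ∷ map kind Y) → kind y ≡ up
    head-up us with kind y | us
    ... | _ | up∷ _ = refl
  go′ (inj₂ ()) (here refl) (vl _) refl d
  go′ (inj₁ ()) (here refl) up refl d

falls-before : ∀ {e} X {y} → All (_≡ dn) (map kind X) → Linked (flip Link) (y ∷ X) → e ∈ X → pos e ↙ pos y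
falls-before (x ∷ X) (refl ∷ _) (l ∷ _) (here refl) = l
falls-before (x ∷ X) (refl ∷ ds) (l ∷ ls) (there m) = ↙-trans (falls-before X ds ls m) l

module Simulation (a b : ℕ) (F : Pos → Val → Set)
  (frame-S : ∀ {p l} → F p (SL , l) → ∣ l ∣ ≢ a) (frame-T : ∀ {p l} → F p (TL , l) → ∣ l ∣ ≢ b)
  {P : Pos → Set} (dP : Down P) {A B : List Ent} where

  open Pair a b F frame-S frame-T public

  -- Lexicographic decrease of the number of unmoved and of unpassed boxes.
  data _≺_ (s t : State) : Set where
    fewer  : length (State.A₁ s) < length (State.A₁ t) → s ≺ t
    sooner : length (State.A₁ s) ≤ length (State.A₁ t) → length (State.Bq s) < length (State.Bq t) → s ≺ t

  data _≼_ (s t : State) : Set where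
    fewer  : length (State.A₁ s) < length (State.A₁ t) → s ≼ t
    sooner : length (State.A₁ s) ≤ length (State.A₁ t) → length (State.Bq s) ≤ length (State.Bq t) → s ≼ t

  ≺-≼-trans : ∀ {s t u} → s ≺ t → t ≼ u → s ≺ u
  ≺-≼-trans (fewer x) (fewer y) = fewer (<-trans x y)
  ≺-≼-trans (fewer x) (sooner y _) = fewer (<-≤-trans x y)
  ≺-≼-trans (sooner x _) (fewer y) = fewer (≤-<-trans x y)
  ≺-≼-trans (sooner x x′) (sooner y y′) = sooner (≤-trans x y) (<-≤-trans x′ y′)

  ≼-refl : ∀ {s} → s ≼ s
  ≼-refl = sooner ≤-refl ≤-refl

  ≼-trans : ∀ {s t u} → s ≼ t → t ≼ u → s ≼ u
  ≼-trans (fewer x) (fewer y) = fewer (<-trans x y)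
  ≼-trans (fewer x) (sooner y _) = fewer (<-≤-trans x y)
  ≼-trans (sooner x _) (fewer y) = fewer (≤-<-trans x y)
  ≼-trans (sooner x x′) (sooner y y′) = sooner (≤-trans x y) (≤-trans x′ y′)

  flips-nb : ∀ {A₁ Bp c k Bq A₂ x} → Flips dP {A} {B} (state A₁ Bp c k Bq A₂) x → Nb c x
  flips-nb {_ ∷ _} (_ , _ , _ , h) = hook-nb₂ h

  pass-apart : ∀ {A₁ Bp c k x k₁ Y A₂} → ¬ Nb c x → Inv P A B (state A₁ Bp c k ((x , k₁) ∷ Y) A₂) →
    Inv P A B (state A₁ ((x , k₁) ∷ Bp) c k Y A₂)
  pass-apart ¬n i = advance dP i (apart ¬n) λ { refl f → ¬n (flips-nb f) }

  Ready Over : State → Set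
  Ready s = ∃ λ x → ∃ λ k → ∃ λ Y → State.Bq s ≡ (x , k) ∷ Y × Nb (State.c s) x
  Over s = State.A₁ s ≡ [] × State.Bq s ≡ []

  -- Exchanges of boxes that do not touch alter the state but not the filling. They are performed
  -- silently until a real switch is due or the process is over.
  settle : ∀ A₁ Bp c k Bq A₂ → let s = state A₁ Bp c k Bq A₂ in Inv P A B s →
    ∃ λ s′ → Inv P A B s′ × As s′ ≡ As s × Bs s′ ≡ Bs s × s′ ≼ s × (Ready s′ ⊎ Over s′)
  settle [] Bp c k [] A₂ i = _ , i , refl , refl , ≼-refl , inj₂ (refl , refl)
  settle ((u , ku) ∷ A₁) Bp c k [] A₂ i with s′ , i′ , e , f , le , r ← settle A₁ [] u ku (Bp ʳ++ []) ((c , k) ∷ A₂) (retire dP i) =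
    s′ , i′ , e , f , ≼-trans le (fewer ≤-refl) , r
  settle A₁ Bp c k ((x , k₁) ∷ Y) A₂ i with nb? c x
  ... | yes n = _ , i , refl , refl , ≼-refl , inj₁ (x , k₁ , Y , refl , n)
  ... | no ¬n with s′ , i′ , e , f , le , r ← settle A₁ ((x , k₁) ∷ Bp) c k Y A₂ (pass-apart ¬n i) =
    s′ , i′ , e , f , ≼-trans le (sooner ≤-refl (n≤1+n _)) , r

  pass-all : ∀ {A₁ Bp c k A₂} Y → (∀ {y} → y ∈ positions Y → ¬ Nb c y) → Inv P A B (state A₁ Bp c k Y A₂) →
    Inv P A B (state A₁ (Y ʳ++ Bp) c k [] A₂)
  pass-all [] f i = i
  pass-all ((y , _) ∷ Y) f i = pass-all Y (λ m → f (there m)) (pass-apart (f (here refl)) i)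

  pass-to : ∀ {A₁ Bp c k A₂} X {Y} → (∀ {y} → y ∈ positions X → ¬ Nb c y) → Inv P A B (state A₁ Bp c k (X ʳ++ Y) A₂) →
    Inv P A B (state A₁ (X ++ Bp) c k Y A₂)
  pass-to [] f i = i
  pass-to ((x , _) ∷ X) f i = pass-apart (f (here refl)) (pass-to X (λ m → f (there m)) i)

  Stepped : State → LFilling → Set
  Stepped s G = ∃ λ s′ → Inv P A B s′ × RepAB (As s′) (Bs s′) G × s′ ≺ s

  module Facts {s} (i : Inv P A B s) where
    open State s
    open Base dP i public

    total : AllPairs _≢_ (positions A₁ ʳ++ (positions Bp ʳ++ (c ∷ positions Bq ++ positions A₂)))
    total = chain-distinct (positions A₁ ʳ++ _) (Inv.chain i)

    private
      tail₁ = pairs-ʳ⁻ (positions A₁) total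
      tail₂ = pairs-ʳ⁻ (positions Bp) (proj₂ tail₁)
      tail₃ : AllPairs _≢_ (positions Bq ++ positions A₂)
      tail₃ with _ ∷ p ← proj₂ tail₂ = p

    distinctA : AllPairs _≢_ (positions A₁ ʳ++ (c ∷ positions A₂))
    distinctA = pairs-ʳ⁺ (positions A₁) (proj₁ tail₁)
      (head (proj₂ tail₂) ∷ proj₁ (proj₂ (pairs-++⁻ (positions Bq) tail₃)))
      λ { m (here refl) → allPairs-ʳ (positions A₁) total m (∈-ʳ⁺ (positions Bp) (here refl))
        ; m (there n) → allPairs-ʳ (positions A₁) total m (∈-ʳ⁺ (positions Bp) (there (∈-++⁺ʳ (positions Bq) n))) }
      where
      head : AllPairs _≢_ (c ∷ positions Bq ++ positions A₂) → All (c ≢_) (positions A₂)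
      head (p ∷ _) = All.tabulate λ m → All.lookup p (∈-++⁺ʳ (positions Bq) m)

    distinctB : AllPairs _≢_ (positions Bp ʳ++ positions Bq)
    distinctB = pairs-ʳ⁺ (positions Bp) (proj₁ tail₂) (proj₁ (pairs-++⁻ (positions Bq) tail₃))
      λ m n → allPairs-ʳ (positions Bp) (proj₂ tail₁) m (there (∈-++⁺ˡ n))

    c⋢ : ∀ {z} → Q z → ¬ c ⊑ z
    c⋢ q = chain-⋢ _ dQ chain-c (here refl) q

    later⋢ : ∀ {z} → z ∈ positions Bq ++ positions A₂ → ¬ z ⊑ c
    later⋢ m = chain-⋢ _ (down-add dQ (proj₁ chain-c)) (proj₂ chain-c) m (inj₂ (here refl))

    later⋢Q : ∀ {z w} → z ∈ positions Bq ++ positions A₂ → Q w → ¬ z ⊑ w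
    later⋢Q m q = chain-⋢ _ dQ chain-c (there m) q

    A₂⋢Bq : ∀ {z w} → z ∈ positions A₂ → w ∈ positions Bq → ¬ z ⊑ w
    A₂⋢Bq {z} {w} m n with c₁ , c₂ ← chain-++⁻ (positions Bq) (proj₂ chain-c) =
      chain-⋢ _ (down-chain (positions Bq) (down-add dQ (proj₁ chain-c)) c₁) c₂ m (inj₂ n)

    box-c : Box c
    box-c = proj₁ (proj₁ chain-c)

  others : ∀ X {E} Y X′ {E′} Y′ {G} → RepAB (X ʳ++ (E ++ Y)) (X′ ʳ++ (E′ ++ Y′)) G →
    AllPairs _≢_ (positions X ʳ++ (positions E ++ positions Y)) → AllPairs _≢_ (positions X′ ʳ++ (positions E′ ++ positions Y′)) →
    ∀ p v → Content (X ʳ++ Y) (X′ ʳ++ Y′) p v → p ∉ positions E × p ∉ positions E′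
  others X {E} Y X′ {E′} Y′ r dA dB p v o = noA o , noB o
    where
    inside : ∀ (X : List Ent) {E} Z {p} → p ∈ positions E → p ∈ positions (X ʳ++ (E ++ Z))
    inside X {E} Z m with _ , m′ , refl ← ∈-map⁻ pos m = ∈-map⁺ pos (mid⁺ X E Z (inj₂ m′))
    noA : Content (X ʳ++ Y) (X′ ʳ++ Y′) p v → p ∉ positions E
    noA (inj₁ f) m = frame-∉A r f (inside X Y m)
    noA (inj₂ (inj₁ (_ , m , _))) n = avoid (positions X) (positions E) dA (subst (p ∈_) (map-ʳ pos X) (∈-map⁺ pos m)) n
    noA (inj₂ (inj₂ (_ , m , _))) n = A∩B r (inside X Y n) (∈-map⁺ pos (mid⁺ X′ E′ Y′ (inj₁ m)))
    noB : Content (X ʳ++ Y) (X′ ʳ++ Y′) p v → p ∉ positions E′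
    noB (inj₁ f) m = frame-∉B r f (inside X′ Y′ m)
    noB (inj₂ (inj₁ (_ , m , _))) n = A∩B r (∈-map⁺ pos (mid⁺ X E Y (inj₁ m))) (inside X′ Y′ n)
    noB (inj₂ (inj₂ (_ , m , _))) n = avoid (positions X′) (positions E′) dB (subst (p ∈_) (map-ʳ pos X′) (∈-map⁺ pos m)) n

  rep-same : ∀ {O W W′ G} → (∀ {e} → e ∈ W → e ∈ W′) → (∀ {e} → e ∈ W′ → e ∈ W) → Rep O W G → Rep O W′ G
  rep-same f g r p v = (λ e → [ inj₁ , (λ m → inj₂ (f m)) ]′ (proj₁ (r p v) e)) , λ o → proj₂ (r p v) ([ inj₁ , (λ m → inj₂ (g m)) ]′ o)

  A≢B : ∀ {A₁ Bp c k x k₁ Y A₂ G} → RepAB (A₁ ʳ++ ((c , k) ∷ A₂)) (Bp ʳ++ ((x , k₁) ∷ Y)) G →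
    ∀ {y} → y ∈ positions ((x , k₁) ∷ Y) → c ≢ y
  A≢B {A₁} {Bp} r m refl with _ , m′ , refl ← ∈-map⁻ pos m = A∩B r (∈-map⁺ pos (∈-ʳ⁺ A₁ (here refl))) (∈-map⁺ pos (∈-ʳ⁺ Bp m′))

  move-swap : ∀ {A₁ Bp c k x k₁ Y A₂ G} (i : Inv P A B (state A₁ Bp c k ((x , k₁) ∷ Y) A₂)) →
    RepAB (A₁ ʳ++ ((c , k) ∷ A₂)) (Bp ʳ++ ((x , k₁) ∷ Y)) G →
    Nb c x → (∀ {y Z} → Y ≡ y ∷ Z → k₁ ≡ dn → ¬ Hooked c x (pos y)) →
    ¬ Flips dP {A} {B} (state A₁ Bp c k ((x , k₁) ∷ Y) A₂) x → Stepped (state A₁ Bp c k ((x , k₁) ∷ Y) A₂) (swapP c x G)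
  move-swap {A₁} {Bp} {c} {k} {x} {k₁} {Y} {A₂} i r n ¬h ¬f = _ , advance dP i (touch n ¬h) (λ { refl → ¬f }) ,
    unfocus A₁ ((x , k) ∷ []) A₂ Bp ((c , k₁) ∷ []) Y
      (rep-swap (A≢B {A₁} {Bp} r (here refl)) (λ p v o → let p∉ , p∉′ = others A₁ A₂ Bp Y r distinctA distinctB p v o in (λ e → p∉ (here e)) , λ e → p∉′ (here e))
        (focus A₁ ((c , k) ∷ []) A₂ Bp ((x , k₁) ∷ []) Y r)) ,
    sooner ≤-refl ≤-refl
    where open Facts i

  move-hook : ∀ {A₁ Bp c k x y b′ Y A₂ G} (i : Inv P A B (state A₁ Bp c k ((x , dn) ∷ (y , vl b′) ∷ Y) A₂)) →
    RepAB (A₁ ʳ++ ((c , k) ∷ A₂)) (Bp ʳ++ ((x , dn) ∷ (y , vl b′) ∷ Y)) G → Hooked c x y →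
    Stepped (state A₁ Bp c k ((x , dn) ∷ (y , vl b′) ∷ Y) A₂)
      (upd c (just (TL , letter b (vl b′))) (upd x (just (TL , un b)) (upd y (just (SL , letter a k)) G)))
  move-hook {A₁} {Bp} {c} {k} {x} {y} {b′} {Y} {A₂} i r h@(e , refl , refl) = _ , advance dP i (hook h) (λ { refl → no-flips }) ,
    unfocus A₁ ((y , k) ∷ []) A₂ Bp ((c , vl b′) ∷ (x , up) ∷ []) Y
      (rep-same rotate rotate⁻ (rep-three (A≢B {A₁} {Bp} r (here refl)) (A≢B {A₁} {Bp} r (there (here refl))) (λ ())
        (λ p v o → let p∉ , p∉′ = others A₁ A₂ Bp Y r distinctA distinctB p v o in (λ e → p∉ (here e)) , (λ e → p∉′ (here e)) , λ e → p∉′ (there (here e)))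
        (focus A₁ ((c , k) ∷ []) A₂ Bp ((x , dn) ∷ (y , vl b′) ∷ []) Y r))) ,
    sooner ≤-refl (n≤1+n _)
    where
    open Facts i
    no-flips : ¬ Flips dP {A} {B} (state A₁ Bp c k ((x , dn) ∷ (y , vl b′) ∷ Y) A₂) x
    no-flips f = not-east A₁ f
      where
      not-east : ∀ A₁ → ¬ Flips dP {A} {B} (state A₁ Bp c k ((x , dn) ∷ (y , vl b′) ∷ Y) A₂) x
      not-east (_ ∷ _) (_ , _ , _ , (e′ , refl , ()))
    rotate : ∀ {v₁ v₂ v₃ : Pos × Val} {e} → e ∈ v₁ ∷ v₂ ∷ v₃ ∷ [] → e ∈ v₃ ∷ v₁ ∷ v₂ ∷ []
    rotate (here e) = there (here e)
    rotate (there (here e)) = there (there (here e))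
    rotate (there (there (here e))) = here e
    rotate⁻ : ∀ {v₁ v₂ v₃ : Pos × Val} {e} → e ∈ v₃ ∷ v₁ ∷ v₂ ∷ [] → e ∈ v₁ ∷ v₂ ∷ v₃ ∷ []
    rotate⁻ (here e) = there (there (here e))
    rotate⁻ (there (here e)) = here e
    rotate⁻ (there (there (here e))) = there (here e)

  -- The switch stands for two touches, of `c` with `x` and later of `u` with `c`. In between, the
  -- box now at `x` passes `Y` and retires, and `u` passes `Bp`; neither touches anything there, so
  -- both exchanges fit into one step.
  move-flip : ∀ {u ku A₁ Bp c k x k₁ Y A₂ X u′ G} (i : Inv P A B (state ((u , ku) ∷ A₁) Bp c k ((x , k₁) ∷ Y) A₂)) →
    RepAB (A₁ ʳ++ ((u , ku) ∷ (c , k) ∷ A₂)) (Bp ʳ++ ((x , k₁) ∷ Y)) G →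
    Rowʳ u (positions Bp) X u′ → Hooked u′ c x → (∀ {y} → y ∈ positions Y → ¬ Nb x y) →
    Stepped (state ((u , ku) ∷ A₁) Bp c k ((x , k₁) ∷ Y) A₂)
      (upd u (just (TL , letter b k₁)) (upd c (just (SL , pr a)) (upd x (just (SL , letter a ku)) G)))
  move-flip {u} {ku} {A₁} {Bp} {c} {k} {x} {k₁} {Y} {A₂} i r q h ¬n with refl , b′ , refl , refl , i₁ ← flip-turn dP i q h | h | q
  ... | e , refl , refl | _ = _ , i₅ ,
    unfocus A₁ ((c , dn) ∷ (x , vl b′) ∷ []) A₂ Bp ((u , k₁) ∷ []) Y
      (rep-same rotate rotate⁻ (rep-three (λ ()) (λ ()) (A≢B {(u , vl b′) ∷ A₁} {Bp} r (here refl))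
        (λ p v o → let p∉ , p∉′ = others A₁ A₂ Bp Y r distinctA distinctB p v o in (λ e → p∉ (here e)) , (λ e → p∉ (there (here e))) , λ e → p∉′ (here e))
        (focus A₁ ((u , vl b′) ∷ (c , up) ∷ []) A₂ Bp ((x , k₁) ∷ []) Y r))) ,
    fewer ≤-refl
    where
    open Facts i
    rotate : ∀ {v₁ v₂ v₃ : Pos × Val} {e} → e ∈ v₁ ∷ v₂ ∷ v₃ ∷ [] → e ∈ v₂ ∷ v₃ ∷ v₁ ∷ []
    rotate (here e) = there (there (here e))
    rotate (there (here e)) = here e
    rotate (there (there (here e))) = there (here e)
    rotate⁻ : ∀ {v₁ v₂ v₃ : Pos × Val} {e} → e ∈ v₂ ∷ v₃ ∷ v₁ ∷ [] → e ∈ v₁ ∷ v₂ ∷ v₃ ∷ []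
    rotate⁻ (here e) = there (here e)
    rotate⁻ (there (here e)) = there (there (here e))
    rotate⁻ (there (there (here e))) = here e
    ʳ++-[] : ∀ (X : List Ent) {Y} → (Y ʳ++ X) ʳ++ [] ≡ X ʳ++ Y
    ʳ++-[] X {[]} = refl
    ʳ++-[] X {y ∷ Y} = ʳ++-[] (y ∷ X) {Y}
    i₂ : Inv P A B (state A₁ [] u dn ((Y ʳ++ ((c , k₁) ∷ Bp)) ʳ++ []) ((x , vl b′) ∷ A₂))
    i₂ = retire dP (pass-all Y ¬n i₁)
    i₃ : Inv P A B (state A₁ [] u dn (Bp ʳ++ ((c , k₁) ∷ Y)) ((x , vl b′) ∷ A₂))
    i₃ = subst (λ L → Inv P A B (state A₁ [] u dn L ((x , vl b′) ∷ A₂))) (ʳ++-[] ((c , k₁) ∷ Bp) {Y}) i₂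
    after-u : ∀ {y} → y ∈ positions Bp → ¬ y ⊑ u
    after-u m with au , ch ← chain-ʳ⁻ (positions A₁) (Inv.chain i) =
      chain-⋢ _ (down-add (down-ʳ (positions A₁) dP (Inv.chain i)) au) ch (∈-ʳ⁺ˡ m) (inj₂ (here refl))
    u-apart : ∀ {y} → y ∈ positions Bp → ¬ Nb u y
    u-apart m (inj₁ (inj₁ refl)) = A≢B′ m
      where
      A≢B′ : c ∉ positions Bp
      A≢B′ m with _ , m′ , refl ← ∈-map⁻ pos m = c⋢ (inj₂ m) ⊑-refl
    -- The south neighbour of a diagonal box lies outside the shifted plane.
    u-apart m (inj₁ (inj₂ refl)) = <-irrefl refl (≤-<-trans (proj₂ (chain-Box _ chain₁ (∈-ʳ⁺ˡ m))) (s≤s (≤-reflexive (sym e))))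
    u-apart m (inj₂ (inj₁ refl)) = after-u m (≤-refl , n≤1+n _)
    u-apart m (inj₂ (inj₂ refl)) = after-u m (n≤1+n _ , ≤-refl)
    i₄ : Inv P A B (state A₁ Bp u dn ((c , k₁) ∷ Y) ((x , vl b′) ∷ A₂))
    i₄ = subst (λ L → Inv P A B (state A₁ L u dn ((c , k₁) ∷ Y) ((x , vl b′) ∷ A₂))) (++-identityʳ Bp) (pass-to Bp u-apart i₃)
    k₁≢dn : k₁ ≢ dn
    k₁≢dn = diagonal-not-dn (Inv.bandB i) boxB (subst (λ j → ((suc (row u) , suc j) , k₁) ∈ Bp ʳ++ ((x , k₁) ∷ Y)) (sym e) (∈-ʳ⁺ Bp (here refl)))
    i₅ : Inv P A B (state A₁ ((u , k₁) ∷ Bp) c dn Y ((x , vl b′) ∷ A₂))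
    i₅ = advance dP i₄ (touch (hook-nb₁ {u} {c} {x} (e , refl , refl)) λ _ d → ⊥-elim (k₁≢dn d)) λ { refl → no-flips A₁ }
      where
      no-flips : ∀ A₁ → ¬ Flips dP {A} {B} (state A₁ Bp u dn ((c , k₁) ∷ Y) ((x , vl b′) ∷ A₂)) c
      no-flips (_ ∷ _) (_ , _ , _ , (_ , refl , ()))

module _ {A : Set} {R : A → A → Set} where

  pairs-order : ∀ {L x y} → AllPairs R L → x ∈ L → y ∈ L → x ≡ y ⊎ R x y ⊎ R y x
  pairs-order (p ∷ ps) (here refl) (here refl) = inj₁ refl
  pairs-order (p ∷ ps) (here refl) (there n) = inj₂ (inj₁ (All.lookup p n))
  pairs-order (p ∷ ps) (there m) (here refl) = inj₂ (inj₂ (All.lookup p m))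
  pairs-order (p ∷ ps) (there m) (there n) = pairs-order ps m n

Sorted : List Ent → Set
Sorted = AllPairs λ e f → ¬ pos f ⊑ pos e

chain-sorted : ∀ {P} L {M} → Down P → Chain P (positions L ++ M) → Sorted L
chain-sorted [] dP ch = []
chain-sorted (e ∷ L) dP (a , ch) =
  All.tabulate (λ m → chain-⋢ _ (down-add dP a) ch (∈-++⁺ˡ (∈-map⁺ pos m)) (inj₂ (here refl))) ∷ chain-sorted L (down-add dP a) ch

letter-un : ∀ n k → letter n k ≡ un n → k ≢ dn
letter-un n dn () refl

letter-pr : ∀ n k → letter n k ≡ pr n → k ≢ up
letter-pr n up () refl

-- The box selected by the switching process

module Block (a b : ℕ) (F : Pos → Val → Set)
  (frame-S : ∀ {p l} → F p (SL , l) → ∣ l ∣ ≢ a) (frame-T : ∀ {p l} → F p (TL , l) → ∣ l ∣ ≢ b)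
  {P : Pos → Set} (dP : Down P) {A B : List Ent} where

  open Simulation a b F frame-S frame-T dP {A} {B} public

  module Priority {A₁ Bp c k x k₁ Y A₂ G} (i : Inv P A B (state A₁ Bp c k ((x , k₁) ∷ Y) A₂))
    (r : RepAB (A₁ ʳ++ ((c , k) ∷ A₂)) (Bp ʳ++ ((x , k₁) ∷ Y)) G) (nb : Nb c x) where

    open Facts i

    ac = proj₁ chain-c
    ax = proj₁ (proj₂ chain-c)

    c∈ : (c , k) ∈ A₁ ʳ++ ((c , k) ∷ A₂)
    c∈ = ∈-ʳ⁺ A₁ (here refl)

    x∈ : (x , k₁) ∈ Bp ʳ++ ((x , k₁) ∷ Y)
    x∈ = ∈-ʳ⁺ Bp (here refl)

    x-cases : x ≡ east c ⊎ x ≡ south c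
    x-cases = nb-cases dQ ac ax nb

    has-nbr : HasBNbr b G c
    has-nbr with x-cases
    ... | inj₁ e = inj₁ (subst (IsBBox b G) e (isB r x∈))
    ... | inj₂ e = inj₂ (subst (IsBBox b G) e (isB r x∈))

    -- The comparison is made at the virtual place: passing boxes only takes `u` east or south, so
    -- `u` is at least as far west as `u′`, which is west of `c`. Earlier boxes that do not descend
    -- are west of `u`.
    up-prio : k ≡ up → ∀ {e} → e ∈ A₁ → kind e ≢ dn → col (pos e) < col c
    up-prio refl = go′ A₁ i
      where
      below : ∀ ku {u u′} → u ⊑ u′ → Dir ku u′ c → ku ≢ dn → col u < col c
      below dn _ _ n = ⊥-elim (n refl)
      below up le d _ = ≤-<-trans (proj₂ le) (proj₂ d)
      below (vl _) le d _ = ≤-<-trans (proj₂ le) (proj₂ d)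
      go′ : ∀ A₁ → Inv P A B (state A₁ Bp c up ((x , k₁) ∷ Y) A₂) → ∀ {e} → e ∈ A₁ → kind e ≢ dn → col (pos e) < col c
      go′ ((u , ku) ∷ A₁) i m n with X , u′ , q , d ← Inv.virt i
        with le ← row-⊒ {X = positions Bp} _ (down-ʳ (positions A₁) dP (Inv.chain i)) (chain-ʳ⁻ (positions A₁) (Inv.chain i)) q | m
      ... | here refl = below ku le d n
      ... | there m′ with (_ , lt) , refl ← rises-before A₁ (Inv.okA i) (Inv.linkA₁ i) m′ n = <-trans lt (below up le d (λ ()))

    dn-prio : k ≢ up → ∀ {e} → e ∈ A₁ → kind e ≡ dn × row (pos e) < row c
    dn-prio n = go′ A₁ i (dn-before (map kind A₁) (subst Ok (map-ʳ kind A₁) (Inv.okA i)) n)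
      where
      go′ : ∀ A₁ → Inv P A B (state A₁ Bp c k ((x , k₁) ∷ Y) A₂) → All (_≡ dn) (map kind A₁) → ∀ {e} → e ∈ A₁ → kind e ≡ dn × row (pos e) < row c
      go′ ((u , .dn) ∷ A₁) i (refl ∷ ds) m with X , u′ , q , d ← Inv.virt i
        with le ← row-⊒ {X = positions Bp} _ (down-ʳ (positions A₁) dP (Inv.chain i)) (chain-ʳ⁻ (positions A₁) (Inv.chain i)) q | m
      ... | here refl = refl , ≤-<-trans (proj₁ le) (proj₁ d)
      ... | there m′ = All.lookup (map⁻ ds) m′ , <-trans (proj₁ (falls-before A₁ ds (Inv.linkA₁ i) m′)) (≤-<-trans (proj₁ le) (proj₁ d))

    -- The boxes of `A₂` come after the whole other band in the chain, so no box of that band can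
    -- lie to the east or south of them.
    not-done : ∀ {e} → e ∈ A₂ → ¬ HasBNbr b G (pos e)
    not-done {e} m h = no-nbr (≤-refl , n≤1+n _) (n≤1+n _ , ≤-refl) h
      where
      behind : ∀ {z} → pos e ⊑ z → ¬ IsBBox b G z
      behind le h with ∈-ʳ⁻ (positions Bp) (subst (_ ∈_) (map-ʳ pos Bp) (isB⁻ r h))
      ... | inj₁ m′ = later⋢Q (∈-++⁺ʳ (positions ((x , k₁) ∷ Y)) (∈-map⁺ pos m)) (inj₂ m′) le
      ... | inj₂ m′ = A₂⋢Bq (∈-map⁺ pos m) m′ le
      no-nbr : ∀ {y z} → pos e ⊑ y → pos e ⊑ z → IsBBox b G y ⊎ IsBBox b G z → ⊥
      no-nbr le le′ (inj₁ h) = behind le h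
      no-nbr le le′ (inj₂ h) = behind le′ h

    candidate : ∀ {c′ l} → G c′ ≡ just (SL , l) → ∣ l ∣ ≡ a → HasBNbr b G c′ →
      (∃ λ k′ → (c′ , k′) ∈ A₁ × l ≡ letter a k′) ⊎ (c′ ≡ c × l ≡ letter a k)
    candidate e s h with k′ , m , f ← a-box⁻ r e s with ∈-ʳ⁻ A₁ m
    ... | inj₁ m′ = inj₁ (k′ , m′ , f)
    ... | inj₂ (here refl) = inj₂ (refl , f)
    ... | inj₂ (there m′) = ⊥-elim (not-done m′ h)

    -- Boxes of `A₂` have nothing left to switch with. If `c` is `up`, the unprimed boxes of `A₁`
    -- are further west; otherwise all of `A₁` is primed and further north. So the order of the
    -- band, read backwards, is the priority rule of the process.
    box-spec : IsBox a b G c × (∀ {c′} → IsBox a b G c′ → c′ ≡ c)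
    box-spec = spec k refl
      where
      from-un : letter a k ≡ un a → (∀ {e} → e ∈ A₁ → kind e ≢ dn → col (pos e) < col c) →
        IsBox a b G c × (∀ {c′} → IsBox a b G c′ → c′ ≡ c)
      from-un l f = inj₁ (cu , λ c′ (e , h) → leq (candidate e refl h)) , unique
        where
        cu : CandU a b G c
        cu = subst (λ l → G c ≡ just (SL , l)) l (a-box r c∈) , has-nbr
        leq : ∀ {c′} → (∃ λ k′ → (c′ , k′) ∈ A₁ × un a ≡ letter a k′) ⊎ (c′ ≡ c × un a ≡ letter a k) → col c′ ≤ col c
        leq (inj₁ (k′ , m , e)) = <⇒≤ (f m (letter-un a k′ (sym e)))
        leq (inj₂ (refl , _)) = ≤-refl
        unique : ∀ {c′} → IsBox a b G c′ → c′ ≡ c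
        unique (inj₂ (noU , _)) = ⊥-elim (noU c cu)
        unique (inj₁ ((e , h) , mx)) with candidate e refl h
        ... | inj₁ (k′ , m , e′) = ⊥-elim (<-irrefl refl (<-≤-trans (f m (letter-un a k′ (sym e′))) (mx c cu)))
        ... | inj₂ (e′ , _) = e′
      from-pr : letter a k ≡ pr a → k ≢ up → IsBox a b G c × (∀ {c′} → IsBox a b G c′ → c′ ≡ c)
      from-pr l n = inj₂ (noU , cp , λ c′ (e , h) → leq (candidate e refl h)) , unique
        where
        cp : CandP a b G c
        cp = subst (λ l → G c ≡ just (SL , l)) l (a-box r c∈) , has-nbr
        noU : ∀ c′ → ¬ CandU a b G c′
        noU c′ (e , h) with candidate e refl h
        ... | inj₁ (k′ , m , e′) = letter-un a k′ (sym e′) (proj₁ (dn-prio n m))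
        ... | inj₂ (_ , e′) with () ← trans e′ l
        leq : ∀ {c′} → (∃ λ k′ → (c′ , k′) ∈ A₁ × pr a ≡ letter a k′) ⊎ (c′ ≡ c × pr a ≡ letter a k) → row c′ ≤ row c
        leq (inj₁ (k′ , m , e)) = <⇒≤ (proj₂ (dn-prio n m))
        leq (inj₂ (refl , _)) = ≤-refl
        unique : ∀ {c′} → IsBox a b G c′ → c′ ≡ c
        unique (inj₁ (cu , _)) = ⊥-elim (noU _ cu)
        unique (inj₂ (_ , (e , h) , mx)) with candidate e refl h
        ... | inj₁ (k′ , m , e′) = ⊥-elim (<-irrefl refl (<-≤-trans (proj₂ (dn-prio n m)) (mx c cp)))
        ... | inj₂ (e′ , _) = e′
      spec : ∀ k′ → k ≡ k′ → IsBox a b G c × (∀ {c′} → IsBox a b G c′ → c′ ≡ c)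
      spec up e = from-un (cong (letter a) e) (up-prio e)
      spec (vl false) e = from-un (cong (letter a) e) λ m n → ⊥-elim (n (proj₁ (dn-prio (λ f → case trans (sym e) f of λ ()) m)))
      spec (vl true) e = from-pr (cong (letter a) e) λ f → case trans (sym e) f of λ ()
      spec dn e = from-pr (cong (letter a) e) λ f → case trans (sym e) f of λ ()

    x-star : ∀ {e} → e ∈ Y → Star (x , k₁) e
    x-star m with s ∷ _ ← proj₂ (pairs-ʳ⁻ Bp (stars (Inv.bandB i))) = All.lookup s m

    ahead : ∀ {p l} → G p ≡ just (TL , l) → ∣ l ∣ ≡ b → c ⊑ p → ∃ λ k′ → (p , k′) ∈ (x , k₁) ∷ Y × l ≡ letter b k′
    ahead e s le with k′ , m , f ← b-box⁻ r e s with ∈-ʳ⁻ Bp m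
    ... | inj₁ m′ = ⊥-elim (c⋢ (inj₂ (∈-map⁺ pos m′)) le)
    ... | inj₂ m′ = k′ , m′ , f

    x-letter : ∀ {l} → G x ≡ just (TL , l) → letter b k₁ ≡ l
    x-letter e with refl ← trans (sym (b-box r x∈)) e = refl

    -- With b-boxes both to the east and to the south, the letter to the east tells which of them comes first.
    east-first : G (east c) ≡ just (TL , pr b) → x ≡ east c
    east-first e with x-cases
    ... | inj₁ e′ = e′
    ... | inj₂ refl with ahead e refl (≤-refl , n≤1+n _)
    ...   | k′ , there m , f = ⊥-elim (1+n≰n (<⇒≤ (proj₁ (proj₁ (falling (x-star m) (letter-pr b k′ (sym f)))))))

    south-first : G (east c) ≡ just (TL , un b) → IsBBox b G (south c) → x ≡ south c
    south-first e (_ , e′ , s) with x-cases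
    ... | inj₂ f = f
    ... | inj₁ refl with ahead e′ s (n≤1+n _ , ≤-refl)
    ...   | k′ , there m , f = ⊥-elim (1+n≰n (proj₁ (proj₁ (rising (x-star m) (letter-un b k₁ (x-letter e))))))

    flips-S47 : Flips dP {A} {B} (state A₁ Bp c k ((x , k₁) ∷ Y) A₂) x → S47cond a b G c
    flips-S47 f = go′ A₁ i r f
      where
      go′ : ∀ A₁ → Inv P A B (state A₁ Bp c k ((x , k₁) ∷ Y) A₂) → RepAB (A₁ ʳ++ ((c , k) ∷ A₂)) (Bp ʳ++ ((x , k₁) ∷ Y)) G →
        Flips dP {A} {B} (state A₁ Bp c k ((x , k₁) ∷ Y) A₂) x → S47cond a b G c
      go′ ((u , ku) ∷ A₁) i r (_ , _ , q , h) with refl , b′ , refl , refl , _ ← flip-turn dP i q h | h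
      ... | e , refl , _ = cong suc (sym e) , a-box r (∈-ʳ⁺ A₁ (there (here refl))) , subst (IsABox a G) (cong (row u ,_) (sym e)) (isA r (∈-ʳ⁺ A₁ (here refl)))

    not-flips-east : x ≡ east c → ¬ Flips dP {A} {B} (state A₁ Bp c k ((x , k₁) ∷ Y) A₂) x
    not-flips-east refl f = go′ A₁ f
      where
      go′ : ∀ A₁ → ¬ Flips dP {A} {B} (state A₁ Bp c k ((x , k₁) ∷ Y) A₂) (east c)
      go′ (_ ∷ _) (_ , _ , _ , (_ , refl , ()))

same-letter : ∀ {lab : Label} {l m : Letter} → just (lab , l) ≡ just (lab , m) → l ≡ m
same-letter refl = refl

un? : ∀ n k → Dec (letter n k ≡ un n)
un? n dn = no λ ()
un? n (vl true) = no λ ()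
un? n (vl false) = yes refl
un? n up = yes refl

dn-successor : ∀ {d} X {y} → Linked (flip Link) (y ∷ X) → (d , dn) ∈ X → ∃ λ w → w ∈ y ∷ X × d ↙ pos w
dn-successor (x ∷ X) (l ∷ _) (here refl) = _ , here refl , l
dn-successor (x ∷ X) (_ ∷ ls) (there m) with w , n , r ← dn-successor X ls m = w , there n , r

-- Each switch is a move of the simulation

module Steps (a b : ℕ) (F : Pos → Val → Set)
  (frame-S : ∀ {p l} → F p (SL , l) → ∣ l ∣ ≢ a) (frame-T : ∀ {p l} → F p (TL , l) → ∣ l ∣ ≢ b)
  {P : Pos → Set} (dP : Down P) {A B : List Ent} where

  open Block a b F frame-S frame-T dP {A} {B} public

  module Active {A₁ Bp c k x k₁ Y A₂ G} (i : Inv P A B (state A₁ Bp c k ((x , k₁) ∷ Y) A₂))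
    (r : RepAB (A₁ ʳ++ ((c , k) ∷ A₂)) (Bp ʳ++ ((x , k₁) ∷ Y)) G) (nb : Nb c x) where

    open Facts i
    open Priority i r nb

    s = state A₁ Bp c k ((x , k₁) ∷ Y) A₂

    go-east : x ≡ east c → ¬ S3cond a b G c → Stepped s (swapP c (east c) G)
    go-east refl ¬h with next-total dQ Bp (positions A₂) chain-c (Inv.bandB i) boxB
    ... | _ , _ , _ , apart ¬n = ⊥-elim (¬n nb)
    ... | _ , _ , _ , touch _ n = move-swap i r nb n (not-flips-east refl)
    ... | _ , _ , _ , hook {b = b′} (e , refl , refl) = ⊥-elim (¬h (sym e , b-box r x∈ ,
        subst (λ j → IsBBox b G (suc (row c) , suc j)) (sym e) (isB r (∈-ʳ⁺ Bp (there (here refl))))))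

    go-south : x ≡ south c → ¬ S47cond a b G c → Stepped s (swapP c (south c) G)
    go-south refl ¬f with next-total dQ Bp (positions A₂) chain-c (Inv.bandB i) boxB
    ... | _ , _ , _ , apart ¬n = ⊥-elim (¬n nb)
    ... | _ , _ , _ , touch _ n = move-swap i r nb n λ f → ¬f (flips-S47 f)
    ... | _ , _ , _ , hook (_ , () , _)

    no-south-box : row c ≡ col c → ¬ IsBBox b G (south c)
    no-south-box e (_ , f , z) with _ , m , _ ← ahead f z (n≤1+n _ , ≤-refl) =
      1+n≰n (≤-trans (proj₂ (boxB (∈-ʳ⁺ Bp m))) (≤-reflexive (sym e)))

    go-hook : ∀ {l β} → row c ≡ col c → G c ≡ just (SL , l) → G (east c) ≡ just (TL , pr b) → G (south (east c)) ≡ just (TL , β) → ∣ β ∣ ≡ b →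
      Stepped s (upd c (just (TL , β)) (upd (east c) (just (TL , un b)) (upd (south (east c)) (just (SL , l)) G)))
    go-hook {l} {β} e gc ge gd z with east-first ge | ahead gd z (n≤1+n _ , n≤1+n _)
    ... | refl | _ , here () , _
    ... | refl | kβ , there m , eβ = result k₁ refl Y refl
      where
      body : ∀ {k₁ Y} → state A₁ Bp c k ((east c , k₁) ∷ Y) A₂ ≡ s → k₁ ≢ up → (southeast : (south (east c) , kβ) ∈ Y) → k₁ ≡ dn ⊎ ⊥
      body {dn} _ _ _ = inj₁ refl
      body {up} _ n _ = ⊥-elim (n refl)
      body {vl _} refl _ m′ = ⊥-elim (1+n≰n (proj₁ (proj₁ (rising (x-star m′) (λ ())))))
      result : ∀ k₁′ → k₁ ≡ k₁′ → ∀ Y′ → Y ≡ Y′ →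
        Stepped s (upd c (just (TL , β)) (upd (east c) (just (TL , un b)) (upd (south (east c)) (just (SL , l)) G)))
      result k₁′ refl Y′ refl with body refl (λ u → letter-pr b k₁ (x-letter ge) u) m
      ... | inj₁ refl with next-total dQ Bp (positions A₂) chain-c (Inv.bandB i) boxB
      ...   | _ , _ , _ , apart ¬n = ⊥-elim (¬n nb)
      ...   | _ , _ , _ , hook {b = b′} h@(_ , _ , refl) with refl ← trans (sym (b-box r (∈-ʳ⁺ Bp (there (here refl))))) gd | refl ← trans (sym (a-box r c∈)) gc =
        move-hook i r h
      result k₁′ refl (y ∷ Z) refl | inj₁ refl | _ , _ , _ , touch _ n with linked-ʳ⁻ Bp (links (Inv.bandB i))
      ...   | _ , (lt , le) ∷ _ = ⊥-elim (n refl refl (e , refl , cong₂ _,_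
        (≤-antisym (≤-trans (≤-trans (proj₂ (boxB (∈-ʳ⁺ Bp (there (here refl))))) le) (s≤s (≤-reflexive (sym e)))) lt)
        (≤-antisym le (≤-trans (s≤s (≤-reflexive (sym e))) (≤-trans lt (proj₂ (boxB (∈-ʳ⁺ Bp (there (here refl))))))))))

    -- Above `east x` lies `east c`, which would have to belong to the band as well. (S4) excludes
    -- this. In (S7) it is unprimed, and after an unprimed box the band never goes down to the row
    -- of `x`. This is the role of the condition on the east neighbour: the box that lands on `x`
    -- stops there.
    nothing-east : x ≡ south c → (¬ IsBBox b G (east c)) ⊎ G (east c) ≡ just (TL , un b) → ∀ {y} → y ∈ Y → pos y ≢ east x
    nothing-east refl ex {y} m e with c₁ , _ ← chain-++⁻ (c ∷ positions ((x , k₁) ∷ Y)) chain-c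
      with chain-below {r = east c} (c ∷ positions ((x , k₁) ∷ Y)) c₁ (there (there (∈-map⁺ pos m)))
             (proj₁ box-c , ≤-trans (proj₂ box-c) (n≤1+n _)) (subst (east c ⊑_) (sym e) (n≤1+n _ , ≤-refl))
    ... | inj₁ q = c⋢ q (≤-refl , n≤1+n _)
    ... | inj₂ (here f) = 1+n≢n (cong col f)
    ... | inj₂ (there (here f)) = 1+n≢n (sym (cong row f))
    ... | inj₂ (there (there q)) with (_ , kq) , q′ , refl ← ∈-map⁻ pos q | ex
    ...   | inj₁ ¬E = ¬E (isB r (∈-ʳ⁺ Bp (there q′)))
    ...   | inj₂ E with pairs-order (AllPairs.zip (proj₂ (pairs-ʳ⁻ Bp (stars (Inv.bandB i))) , chain-sorted ((x , k₁) ∷ Y) (down-add dQ ac) (proj₂ chain-c))) (there q′) (there m)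
    ...     | inj₁ refl = 1+n≢n (sym (cong row e))
    ...     | inj₂ (inj₂ (_ , n)) = n (subst (east c ⊑_) (sym e) (n≤1+n _ , ≤-refl))
    ...     | inj₂ (inj₁ (st , _)) = 1+n≰n (subst (_≤ row c) (cong row e)
                (proj₁ (proj₁ (rising st (letter-un b kq (same-letter (trans (sym (b-box r (∈-ʳ⁺ Bp (there q′)))) E)))))))

    south-apart : x ≡ south c → col c ≡ suc (row c) → (¬ IsBBox b G (east c)) ⊎ G (east c) ≡ just (TL , un b) →
      ∀ {y} → y ∈ positions Y → ¬ Nb x y
    south-apart refl e ex m nb with (_ , _ , chY) ← chain-c | _ , q , refl ← ∈-map⁻ pos m | nb
    ... | inj₁ (inj₁ f) = nothing-east refl ex q f
    ... | inj₁ (inj₂ refl) = 1+n≰n (≤-trans (proj₂ (boxB (∈-ʳ⁺ Bp (there q)))) (≤-reflexive e))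
    ... | inj₂ f = chain-⋢ _ (down-add (down-add dQ ac) ax) chY (∈-++⁺ˡ m) (inj₂ (here refl)) (before f)
      where
      before : ∀ {y} → x ≡ east y ⊎ x ≡ south y → y ⊑ x
      before (inj₁ refl) = ≤-refl , n≤1+n _
      before (inj₂ refl) = n≤1+n _ , ≤-refl

    -- The diagonal box `d` must be the next one to set out. Were `u` to come between, then either
    -- `d` descends, which is impossible on the diagonal, or `u` lies strictly between the adjacent
    -- columns of `d` and `c`.
    not-deeper : ∀ {u ku A₁ u′ d} → (i : Inv P A B (state ((u , ku) ∷ A₁) Bp c k ((x , k₁) ∷ Y) A₂)) →
      u ⊑ u′ → Dir ku u′ c → col c ≡ suc (col d) → row d ≡ col d → ∀ kd → (d , kd) ∉ A₁
    not-deeper {u} {A₁ = A₁} i le dd ec e dn m with w , n , (lt , le′) ← dn-successor A₁ (Inv.linkA₁ i) m =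
      <-irrefl refl (<-≤-trans lt (≤-trans (proj₂ (chain-Box _ (Inv.chain i) (∈-ʳ⁺ˡ {X = u ∷ positions A₁} (∈-map⁺ pos n)))) (≤-trans le′ (≤-reflexive (sym e)))))
    not-deeper {A₁ = A₁} i le dd ec e up m with (_ , lt) , refl ← rises-before A₁ (Inv.okA i) (Inv.linkA₁ i) m (λ ()) =
      <-irrefl refl (<-≤-trans lt (≤-trans (proj₂ le) (≤-pred (≤-trans (proj₂ dd) (≤-reflexive ec)))))
    not-deeper {A₁ = A₁} i le dd ec e (vl _) m with (_ , lt) , refl ← rises-before A₁ (Inv.okA i) (Inv.linkA₁ i) m (λ ()) =
      <-irrefl refl (<-≤-trans lt (≤-trans (proj₂ le) (≤-pred (≤-trans (proj₂ dd) (≤-reflexive ec)))))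

    go-flip : ∀ {α₀ β d} → x ≡ south c → east d ≡ c → row d ≡ col d → G c ≡ just (SL , un a) → G d ≡ just (SL , α₀) → ∣ α₀ ∣ ≡ a →
      G x ≡ just (TL , β) → (¬ IsBBox b G (east c)) ⊎ G (east c) ≡ just (TL , un b) →
      Stepped s (upd d (just (TL , β)) (upd c (just (SL , pr a)) (upd x (just (SL , α₀)) G)))
    go-flip {α₀} {β} {d} refl refl e gc gd z gx ex with kd , m , refl ← a-box⁻ r gd z | ∈-ʳ⁻ A₁ m
    ... | inj₂ (here ())
    ... | inj₂ (there m′) = ⊥-elim (later⋢ (∈-++⁺ʳ (positions ((x , k₁) ∷ Y)) (∈-map⁺ pos m′)) (≤-refl , n≤1+n _))
    ... | inj₁ m′ = found A₁ i r m′
      where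
      found : ∀ A₁ → (i : Inv P A B (state A₁ Bp c k ((x , k₁) ∷ Y) A₂)) → RepAB (A₁ ʳ++ ((c , k) ∷ A₂)) (Bp ʳ++ ((x , k₁) ∷ Y)) G → (d , kd) ∈ A₁ →
        Stepped (state A₁ Bp c k ((x , k₁) ∷ Y) A₂) (upd d (just (TL , β)) (upd c (just (SL , pr a)) (upd x (just (SL , letter a kd)) G)))
      found ((u , ku) ∷ A₁) i r m with X , u′ , q , dd ← Inv.virt i
        with le ← row-⊒ {X = positions Bp} _ (down-ʳ (positions A₁) dP (Inv.chain i)) (chain-ʳ⁻ (positions A₁) (Inv.chain i)) q
        | _ , _ , (bu , _) , _ ← virtual-chain dP i q | m
      ... | here refl with refl ← same-letter (trans (sym gx) (b-box r x∈)) =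
              move-flip i r q (hooked ku dd) (south-apart refl (cong suc (sym e)) ex)
        where
        at-u : u′ ↗ c → Hooked u′ c x
        at-u (a≤ , b<) with refl ← ⊑-antisym (≤-trans (proj₂ bu) (≤-trans (≤-pred b<) (≤-reflexive (sym e))) , ≤-pred b<) le = e , refl , refl
        hooked : ∀ ku → Dir ku u′ c → Hooked u′ c x
        hooked dn (lt , _) = ⊥-elim (<-irrefl refl (≤-<-trans (proj₁ le) lt))
        hooked up = at-u
        hooked (vl _) = at-u
      ... | there m′ = ⊥-elim (not-deeper i le dd refl e kd m′)

  open Active

  module _ {A₁ Bp c k x k₁ Y A₂ G} (i : Inv P A B (state A₁ Bp c k ((x , k₁) ∷ Y) A₂))
    (r : RepAB (A₁ ʳ++ ((c , k) ∷ A₂)) (Bp ʳ++ ((x , k₁) ∷ Y)) G) (nb : Nb c x) where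

    open Facts i
    open Priority i r nb

    -- The neighbour of `c` with which it switches has to be the next box `x` of the chain. With a
    -- single neighbour this is clear; with two, the letter to the east decides.
    preserve : ∀ {G′} → SwStep a b G G′ → Stepped (state A₁ Bp c k ((x , k₁) ∷ Y) A₂) G′
    preserve (s1 ib E ¬S ¬h) with refl ← proj₂ box-spec ib | x-cases
    ... | inj₁ e = go-east i r nb e ¬h
    ... | inj₂ refl = ⊥-elim (¬S (isB r x∈))
    preserve (s2 ib ¬E S ¬f) with refl ← proj₂ box-spec ib | x-cases
    ... | inj₁ refl = ⊥-elim (¬E (isB r x∈))
    ... | inj₂ e = go-south i r nb e ¬f
    preserve (s5 ib E S) with refl ← proj₂ box-spec ib = go-east i r nb (east-first E) λ (e , _) → no-south-box i r nb (sym e) S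
    preserve (s6 ib E S ¬f) with refl ← proj₂ box-spec ib = go-south i r nb (south-first E S) ¬f
    preserve (s3 ib gc ge gd z) with refl ← proj₂ box-spec ib = go-hook i r nb refl gc ge gd z
    preserve (s4 ib gc gd z gx z′ ¬E) with refl ← proj₂ box-spec ib | x-cases
    ... | inj₁ refl = ⊥-elim (¬E (isB r x∈))
    ... | inj₂ refl = go-flip i r nb refl refl refl gc gd z gx (inj₁ ¬E)
    preserve (s7 ib gc gd z gx z′ E) with refl ← proj₂ box-spec ib | south-first E (_ , gx , z′)
    ... | refl = go-flip i r nb refl refl refl gc gd z gx (inj₂ E)

    isB? : ∀ p → Dec (IsBBox b G p)
    isB? p with G p in e
    ... | nothing = no λ { (_ , () , _) }
    ... | just (SL , _) = no λ { (_ , () , _) }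
    ... | just (TL , l) with ∣ l ∣ ≟ b
    ...   | yes z = yes (l , refl , z)
    ...   | no n = no λ { (_ , refl , z) → n z }

    S3? : IsBBox b G (east c) → Dec (S3cond a b G c)
    S3? (l , e , z) with col c ≟ row c | l | isB? (suc (row c) , suc (row c))
    ... | no n | _ | _ = no λ (d , _) → n d
    ... | yes _ | un _ | _ = no λ (_ , f , _) → case trans (sym e) f of λ ()
    ... | yes _ | pr _ | no n = no λ (_ , _ , f) → n f
    ... | yes d | pr m | yes f with refl ← z = yes (d , e , f)

    S47? : Dec (S47cond a b G c)
    S47? with col c ≟ suc (row c) | un? a k | (row c , row c) ∈ₚ? positions (A₁ ʳ++ ((c , k) ∷ A₂))
    ... | no n | _ | _ = no λ (d , _) → n d
    ... | yes d | no n | _ = no λ (_ , f , _) → n (same-letter (trans (sym (a-box r c∈)) f))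
    ... | yes d | yes _ | no n = no λ { (_ , _ , _ , f , z) → n (∈-map⁺ pos (proj₁ (proj₂ (a-box⁻ r f z)))) }
    ... | yes d | yes l | yes m with _ , m′ , f ← ∈-map⁻ pos m =
      yes (d , trans (a-box r c∈) (cong (λ l → just (SL , l)) l) , subst (IsABox a G) (sym f) (isA r m′))

    progress : ∃ λ G′ → SwStep a b G G′
    progress with isB? (east c) | isB? (south c)
    ... | no ¬E | no ¬S = ⊥-elim ([ ¬E , ¬S ]′ has-nbr)
    ... | yes E | no ¬S with S3? E
    ...   | no ¬h = _ , s1 (proj₁ box-spec) E ¬S ¬h
    ...   | yes h = diagonal (proj₁ h) (proj₁ box-spec) (a-box r c∈) (proj₁ (proj₂ h)) (proj₂ (proj₂ h))
      where
      diagonal : ∀ {i j α} → j ≡ i → IsBox a b G (i , j) → G (i , j) ≡ just (SL , α) → G (i , suc j) ≡ just (TL , pr b) →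
        IsBBox b G (suc i , suc i) → ∃ λ G′ → SwStep a b G G′
      diagonal refl ib gc ge (_ , gd , z) = _ , s3 ib gc ge gd z
    progress | no ¬E | yes S with S47?
    ...   | no ¬f = _ , s2 (proj₁ box-spec) ¬E S ¬f
    ...   | yes f = beside (proj₁ f) (proj₁ box-spec) ¬E S (proj₁ (proj₂ f)) (proj₂ (proj₂ f))
      where
      beside : ∀ {i j} → j ≡ suc i → IsBox a b G (i , j) → ¬ IsBBox b G (i , suc j) → IsBBox b G (suc i , j) →
        G (i , j) ≡ just (SL , un a) → IsABox a G (i , i) → ∃ λ G′ → SwStep a b G G′
      beside refl ib ¬E (_ , gx , z) gc (_ , gd , z′) = _ , s4 ib gc gd z′ gx z ¬E
    progress | yes (un m , E , z) | yes S with refl ← z with S47?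
    ...   | no ¬f = _ , s6 (proj₁ box-spec) E S ¬f
    ...   | yes f = beside (proj₁ f) (proj₁ box-spec) E S (proj₁ (proj₂ f)) (proj₂ (proj₂ f))
      where
      beside : ∀ {i j} → j ≡ suc i → IsBox a m G (i , j) → G (i , suc j) ≡ just (TL , un m) → IsBBox m G (suc i , j) →
        G (i , j) ≡ just (SL , un a) → IsABox a G (i , i) → ∃ λ G′ → SwStep a m G G′
      beside refl ib E (_ , gx , z) gc (_ , gd , z′) = _ , s7 ib gc gd z′ gx z E
    progress | yes (pr m , E , z) | yes S with refl ← z = _ , s5 (proj₁ box-spec) E S

  record Result (H : LFilling) : Set where
    constructor result
    field
      {A′ B′}  : List Ent
      swapped  : Grid (positions A) (positions B) (positions B′) (positions A′)
      bandA′   : Band A′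
      bandB′   : Band B′
      flagsA′  : flags A′ ≡ flags A
      flagsB′  : flags B′ ≡ flags B
      rep′     : RepAB A′ B′ H

  finish : ∀ {s G} → Inv P A B s → Over s → RepAB (As s) (Bs s) G → Result G
  finish {state .[] Bp c k .[] A₂} i (refl , refl) r with c₀ , Z , X , eA , g , q ← Inv.grid i | _ , _ , [] , l ← Inv.fin i =
    result (subst (λ L → Grid L (positions B) (positions (Bp ʳ++ [])) (c ∷ positions A₂)) (sym eA)
             (subst (λ L → Row c₀ (X ʳ++ []) L c) (sym (map-ʳ pos Bp)) (rowʳ-row q []) ∷ g))
      (band l (Inv.okA i)) (Inv.bandB i) (Inv.flagsA i) (Inv.flagsB i) r

  rep-cast : ∀ {A A′ B B′ G} → A′ ≡ A → B′ ≡ B → RepAB A B G → RepAB A′ B′ G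
  rep-cast refl refl r = r

  selected : ∀ {G G′} → SwStep a b G G′ → ∃ λ c → IsABox a G c × HasBNbr b G c
  selected t = _ , chosen (proj₂ (where-box t))
    where
    where-box : ∀ {G G′} → SwStep a b G G′ → ∃ λ c → IsBox a b G c
    where-box (s1 ib _ _ _) = _ , ib
    where-box (s2 ib _ _ _) = _ , ib
    where-box (s3 ib _ _ _ _) = _ , ib
    where-box (s4 ib _ _ _ _ _ _) = _ , ib
    where-box (s5 ib _ _) = _ , ib
    where-box (s6 ib _ _ _) = _ , ib
    where-box (s7 ib _ _ _ _ _ _) = _ , ib
    chosen : ∀ {G c} → IsBox a b G c → IsABox a G c × HasBNbr b G c
    chosen (inj₁ ((e , h) , _)) = (_ , e , refl) , h
    chosen (inj₂ (_ , (e , h) , _)) = (_ , e , refl) , h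

  over-switched : ∀ {s G} → Inv P A B s → Over s → RepAB (As s) (Bs s) G → FullySwitched a b G
  over-switched {state .[] Bp c k .[] A₂} {G} i (refl , refl) r c′ (_ , e , z) h with _ , m , _ ← a-box⁻ r e z = behind m h
    where
    open Facts i
    passed : ∀ {z} → IsBBox b G z → Q z
    passed h with ∈-ʳ⁻ (positions Bp) (subst (_ ∈_) (map-ʳ pos Bp) (isB⁻ r h))
    ... | inj₁ m = inj₂ m
    behind : ∀ {k′} → (c′ , k′) ∈ (c , k) ∷ A₂ → ¬ HasBNbr b G c′
    behind (here refl) (inj₁ h) = c⋢ (passed h) (≤-refl , n≤1+n _)
    behind (here refl) (inj₂ h) = c⋢ (passed h) (n≤1+n _ , ≤-refl)
    behind (there m) (inj₁ h) = later⋢Q (∈-map⁺ pos m) (passed h) (≤-refl , n≤1+n _)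
    behind (there m) (inj₂ h) = later⋢Q (∈-map⁺ pos m) (passed h) (n≤1+n _ , ≤-refl)

  sound : ∀ {s G H} → Inv P A B s → RepAB (As s) (Bs s) G → Process a b G H → Result H
  sound {state A₁ Bp c k Bq A₂} i r p with settle A₁ Bp c k Bq A₂ i
  ... | s′ , i′ , e , f , _ , inj₂ o with p
  ...   | done _ = finish i′ o (rep-cast e f r)
  ...   | step t p′ = let _ , x , h = selected t in ⊥-elim (over-switched i′ o (rep-cast e f r) _ x h)
  sound {state A₁ Bp c k Bq A₂} i r p | state A₁′ Bp′ c′ k′ _ A₂′ , i′ , e , f , _ , inj₁ (x , k₁ , Y , refl , n) with p
  ...   | done fs = ⊥-elim (fs c′ (isA (rep-cast e f r) (Priority.c∈ i′ (rep-cast e f r) n)) (Priority.has-nbr i′ (rep-cast e f r) n))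
  ...   | step t p′ with s″ , i″ , r″ , _ ← preserve i′ (rep-cast e f r) n t = sound i″ r″ p′

  complete : ∀ n m {s G} → length (State.A₁ s) ≤ n → length (State.Bq s) ≤ m → Inv P A B s → RepAB (As s) (Bs s) G →
    ∃ λ H → Process a b G H × Result H
  complete n m {state A₁ Bp c k Bq A₂} ln lm i r with settle A₁ Bp c k Bq A₂ i
  ... | s′ , i′ , e , f , _ , inj₂ o = _ , done (over-switched i′ o (rep-cast e f r)) , finish i′ o (rep-cast e f r)
  ... | state A₁′ Bp′ c′ k′ _ A₂′ , i′ , e , f , le , inj₁ (x , k₁ , Y , refl , ν)
    with G′ , t ← progress i′ (rep-cast e f r) ν
    with s″ , i″ , r″ , lt ← preserve i′ (rep-cast e f r) ν t = continue n m ln lm (≺-≼-trans lt le)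
    where
    continue : ∀ n m → length A₁ ≤ n → length Bq ≤ m → s″ ≺ state A₁ Bp c k Bq A₂ → ∃ λ H → Process a b _ H × Result H
    continue zero m ln lm (fewer x) = ⊥-elim (<-irrefl refl (<-≤-trans (≤-<-trans z≤n x) ln))
    -- When a box retires, the bound on unpassed boxes starts afresh.
    continue (suc n) m ln lm (fewer x) = let H , p , q = complete n _ (≤-pred (≤-trans x ln)) ≤-refl i″ r″ in H , step t p , q
    continue n zero ln lm (sooner x y) = ⊥-elim (<-irrefl refl (<-≤-trans (≤-<-trans z≤n y) lm))
    continue n (suc m) ln lm (sooner x y) = let H , p , q = complete n m (≤-trans x ln) (≤-pred (≤-trans y lm)) i″ r″ in H , step t p , q

  module _ (bA : Band A) (bB : Band B) (ch : Chain P (positions A ++ positions B)) where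

    start : ∀ A₁ c k → A ≡ A₁ ʳ++ ((c , k) ∷ []) → Inv P A B (state A₁ [] c k B [])
    start A₁ c k refl with Y , c′ , q ← row! c (positions B) = inv
      (subst (Chain P) chain-eq ch) bB refl (kinds bA) refl
      (linked-tail (proj₁ (linked-ʳ⁻ A₁ (links bA))))
      (virt₀ (proj₁ (linked-ʳ⁻ A₁ (links bA))))
      (Y , c′ , q , [-])
      (c , [] , [] , map-ʳ pos A₁ , [] , [])
      where
      ʳ++-++ : ∀ (X : List Pos) {Y Z} → X ʳ++ (Y ++ Z) ≡ (X ʳ++ Y) ++ Z
      ʳ++-++ [] = refl
      ʳ++-++ (x ∷ X) {Y} = ʳ++-++ X {x ∷ Y}
      chain-eq : positions (A₁ ʳ++ ((c , k) ∷ [])) ++ positions B ≡ positions A₁ ʳ++ (c ∷ positions B ++ [])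
      chain-eq = trans (cong (_++ positions B) (map-ʳ pos A₁)) (trans (sym (ʳ++-++ (positions A₁))) (cong (λ L → positions A₁ ʳ++ (c ∷ L)) (sym (++-identityʳ (positions B)))))
      virt₀ : ∀ {A₁} → Linked (flip Link) ((c , k) ∷ A₁) → Virtual A₁ [] c
      virt₀ [-] = tt
      virt₀ (l ∷ _) = _ , _ , [] , l

    last-entry : ∀ (X : List Ent) e L → ∃ λ X′ → ∃ λ c → ∃ λ k → X ʳ++ (e ∷ L) ≡ X′ ʳ++ ((c , k) ∷ [])
    last-entry X (c , k) [] = X , c , k , refl
    last-entry X e (f ∷ L) = last-entry (e ∷ X) f L

    -- The statement about every run serves the given switching; the existence of a run serves the
    -- way back in (a).
    process : ∀ {G} → RepAB A B G → (∃ λ H → Process a b G H × Result H) × (∀ {H} → Process a b G H → Result H)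
    process {G} r = by-cases A refl
      where
      by-cases : ∀ A′ → A ≡ A′ → (∃ λ H → Process a b G H × Result H) × (∀ {H} → Process a b G H → Result H)
      by-cases [] refl = (G , done no-box , same) , λ { (done _) → same ; (step t _) → let c , x , h = selected t in ⊥-elim (no-box c x h) }
        where
        no-box : FullySwitched a b G
        no-box c (_ , e , z) with _ , () , _ ← a-box⁻ r e z
        same : Result G
        same = result [] bA bB refl refl r
      by-cases (e ∷ L) refl with A₁ , c , k , eq ← last-entry [] e L =
        complete _ _ ≤-refl ≤-refl (start A₁ c k eq) (rep-cast (sym eq) refl r) , sound (start A₁ c k eq) (rep-cast (sym eq) refl r)

-- The whole switching run

ups-unique : ∀ {E E′} → Ups (map kind E) → Ups (map kind E′) → positions E ≡ positions E′ → E ≡ E′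
ups-unique {[]} {[]} _ _ _ = refl
ups-unique {(p , up) ∷ E} {(p′ , up) ∷ E′} (up∷ u) (up∷ u′) e =
  cong₂ _∷_ (cong (_, up) (∷-injectiveˡ e)) (ups-unique u u′ (∷-injectiveʳ e))

clash : ∀ {p q p′ q′ : Pos} → p ≡ p′ → q ≡ q′ → p ↗ q → p′ ↙ q′ → ⊥
clash refl refl r r′ = <-irrefl refl (<-≤-trans (proj₁ r′) (proj₁ r))

turn-unique : ∀ {E E′} → Turn (map kind E) → Turn (map kind E′) → Linked Link E → Linked Link E′ →
  positions E ≡ positions E′ → flags E ≡ flags E′ → E ≡ E′
turn-unique {(p , vl b) ∷ E} {(p′ , vl b′) ∷ E′} (vl∷ u) (vl∷ u′) l l′ e f =
  cong₂ _∷_ (cong₂ (λ p b → p , vl b) (∷-injectiveˡ e) (∷-injectiveˡ f)) (ups-unique u u′ (∷-injectiveʳ e))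
turn-unique {(p , dn) ∷ E} {(p′ , dn) ∷ E′} (dn∷ t) (dn∷ t′) l l′ e f =
  cong₂ _∷_ (cong (_, dn) (∷-injectiveˡ e)) (turn-unique t t′ (linked-tail l) (linked-tail l′) (∷-injectiveʳ e) f)
turn-unique {(p , vl b) ∷ (q , _) ∷ E} {(p′ , dn) ∷ (q′ , _) ∷ E′} (vl∷ u) (dn∷ t) (r ∷ _) (r′ ∷ _) e f =
  ⊥-elim (clash (∷-injectiveˡ e) (∷-injectiveˡ (∷-injectiveʳ e)) r r′)
turn-unique {(p , vl b) ∷ []} {(p′ , dn) ∷ []} (vl∷ u) (dn∷ ()) l l′ e f
turn-unique {(p , dn) ∷ (q , _) ∷ E} {(p′ , vl b) ∷ (q′ , _) ∷ E′} (dn∷ t) (vl∷ u) (r ∷ _) (r′ ∷ _) e f =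
  ⊥-elim (clash (sym (∷-injectiveˡ e)) (sym (∷-injectiveˡ (∷-injectiveʳ e))) r′ r)
turn-unique {(p , dn) ∷ []} {(p′ , vl b) ∷ []} (dn∷ ()) (vl∷ u) l l′ e f

-- No link points both south-west and north-east, so the positions show where the band turns. The
-- flag then supplies the only letter that is still open.
band-unique : ∀ {E E′} → Band E → Band E′ → positions E ≡ positions E′ → flags E ≡ flags E′ → E ≡ E′
band-unique {[]} {[]} _ _ _ _ = refl
band-unique {_ ∷ _} {_ ∷ _} (band l (some t)) (band l′ (some t′)) e f = turn-unique t t′ l l′ e f

-- The local rule on the level of bands. It mentions no fillings, and it inherits symmetry and
-- determinism from the rule for boxes.
record Exchange (A B B′ A′ : List Ent) : Set where
  constructor exchange
  field
    grid            : Grid (positions A) (positions B) (positions B′) (positions A′)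
    bA              : Band A
    bB              : Band B
    bB′             : Band B′
    bA′             : Band A′
    fA              : flags A′ ≡ flags A
    fB              : flags B′ ≡ flags B

exchange-sym : ∀ {A B B′ A′} → Exchange A B B′ A′ → Exchange B′ A′ A B
exchange-sym (exchange g a b b′ a′ f f′) = exchange (grid-sym swap-sym g) b′ a′ a b (sym f′) (sym f)

exchange-fun : ∀ {A B B′ A′ B″ A″} → Exchange A B B′ A′ → Exchange A B B″ A″ → B′ ≡ B″ × A′ ≡ A″
exchange-fun (exchange g _ _ b′ a′ f f′) (exchange h _ _ b″ a″ k k′) with e , e′ ← grid-fun swap-fun g h =
  band-unique b′ b″ e (trans f′ (sym k′)) , band-unique a′ a″ e′ (trans f (sym k))

module X = Grids Exchange
open Flatten Swap Exchange positions Exchange.grid public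

positions* : List (List Ent) → List Pos
positions* = concatMap positions

Tags : Label → ℕ → List (List Ent) → Pos → Val → Set
Tags lab n []       p v = ⊥
Tags lab n (E ∷ Es) p v = Tag lab n E p v ⊎ Tags lab (suc n) Es p v

tag-size : ∀ {lab n E p lab′ l} → Tag lab n E p (lab′ , l) → lab′ ≡ lab × ∣ l ∣ ≡ n
tag-size {n = n} (k , _ , refl) = refl , size-letter n k

tags-size : ∀ {lab n} Es {p lab′ l} → Tags lab n Es p (lab′ , l) → lab′ ≡ lab × n ≤ ∣ l ∣ × ∣ l ∣ < n + length Es
tags-size {n = n} (E ∷ Es) (inj₁ t) with refl , refl ← tag-size {E = E} t = refl , ≤-refl , m<m+n n (s≤s z≤n)
tags-size {n = n} (E ∷ Es) (inj₂ t) with e , a , b ← tags-size Es t = e , <⇒≤ a , ≤-trans b (≤-reflexive (sym (+-suc n (length Es))))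

Reps : (Pos → Val → Set) → LFilling → Set
Reps R G = ∀ p v → (G p ≡ just v → R p v) × (R p v → G p ≡ just v)

reps-map : ∀ {R R′ G} → (∀ {p v} → R p v → R′ p v) → (∀ {p v} → R′ p v → R p v) → Reps R G → Reps R′ G
reps-map f g r p v = (λ e → f (proj₁ (r p v) e)) , λ x → proj₂ (r p v) (g x)

chain-row* : ∀ {P A Ts Ts′ A′} → Down P → Chain P (positions A ++ positions* Ts) → X.Row A Ts Ts′ A′ → Chain P (positions* Ts′)
chain-row* {P} {A} {Ts} {Ts′} {A′} dP ch r =
  proj₁ (chain-++⁻ (positions* Ts′) (chain-grid {L = []} dP (subst (λ L → Chain P (positions A ++ L)) (sym (++-identityʳ (positions* Ts))) ch) (row-flat r)))

module RowRun (a n : ℕ) where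

  RowPost : (O : Pos → Val → Set) → ℕ → List Ent → List (List Ent) → LFilling → Set
  RowPost O j A Ts H = ∃ λ Ts′ → ∃ λ A′ → X.Row A Ts Ts′ A′ × Band A′ × All Band Ts′ ×
    Reps (λ p v → O p v ⊎ Tag SL a A′ p v ⊎ Tags TL j Ts′ p v) H

  -- `O` collects the content that is out of play: bands already passed, with letters below `j`, and
  -- the entries of the first tableau outside `A`.
  run-row : ∀ {P O G} j Ts {A} → Down P → Chain P (positions A ++ positions* Ts) → Band A → All Band Ts →
    (∀ {p l} → O p (SL , l) → ∣ l ∣ ≢ a) → (∀ {p l} → O p (TL , l) → ∣ l ∣ < j) → j + length Ts ≡ suc n →
    Reps (λ p v → O p v ⊎ Tag SL a A p v ⊎ Tags TL j Ts p v) G →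
    (∃ λ H → RunJ a n j G H × RowPost O j A Ts H) × (∀ {H} → RunJ a n j G H → RowPost O j A Ts H)
  run-row j [] dP ch bA _ oS oT e r with refl ← trans (sym (+-identityʳ j)) e =
    (_ , stop ≤-refl , [] , _ , X.[] , bA , [] , r) ,
    λ { (stop _) → [] , _ , X.[] , bA , [] , r ; (go j≤n _ _) → ⊥-elim (1+n≰n j≤n) }
  run-row {P} {O} {G} j (T ∷ Ts) {A} dP ch bA (bT ∷ bTs) oS oT e r = (H₂ , go j≤n p₁ p₂ , post q₁ q₂) , all
    where
    F : Pos → Val → Set
    F p v = O p v ⊎ Tags TL (suc j) Ts p v
    frame-S : ∀ {p l} → F p (SL , l) → ∣ l ∣ ≢ a
    frame-S (inj₁ o) = oS o
    frame-S (inj₂ t) with () ← proj₁ (tags-size Ts t)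
    frame-T : ∀ {p l} → F p (TL , l) → ∣ l ∣ ≢ j
    frame-T (inj₁ o) x = <-irrefl x (oT o)
    frame-T (inj₂ t) x = <-irrefl (sym x) (proj₁ (proj₂ (tags-size Ts t)))
    module S = Steps a j F frame-S frame-T dP {A} {T}
    chT : Chain P ((positions A ++ positions T) ++ positions* Ts)
    chT = subst (Chain P) (sym (++-assoc (positions A) (positions T) (positions* Ts))) ch
    blk = S.process bA bT (proj₁ (chain-++⁻ (positions A ++ positions T) chT))
      (reps-map (λ { (inj₁ o) → inj₁ (inj₁ o) ; (inj₂ (inj₁ t)) → inj₂ (inj₁ t) ; (inj₂ (inj₂ (inj₁ t))) → inj₂ (inj₂ t) ; (inj₂ (inj₂ (inj₂ t))) → inj₁ (inj₂ t) })
                (λ { (inj₁ (inj₁ o)) → inj₁ o ; (inj₁ (inj₂ t)) → inj₂ (inj₂ (inj₂ t)) ; (inj₂ (inj₁ t)) → inj₂ (inj₁ t) ; (inj₂ (inj₂ t)) → inj₂ (inj₂ (inj₁ t)) }) r)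
    j≤n : j ≤ n
    j≤n = ≤-pred (subst (suc j ≤_) (trans (sym (+-suc j (length Ts))) e) (s≤s (m≤m+n j (length Ts))))
    O′ : List Ent → Pos → Val → Set
    O′ T′ p v = O p v ⊎ Tag TL j T′ p v
    rest : ∀ {G₁} (q : S.Result G₁) → let open S.Result q in
      (∃ λ H → RunJ a n (suc j) G₁ H × RowPost (O′ B′) (suc j) A′ Ts H) × (∀ {H} → RunJ a n (suc j) G₁ H → RowPost (O′ B′) (suc j) A′ Ts H)
    rest q = run-row (suc j) Ts (down-chain (positions B′) dP (proj₁ parts)) (proj₂ parts) bandA′ bTs
      (λ { (inj₁ o) → oS o ; (inj₂ t) → ⊥-elim (case proj₁ (tag-size {E = B′} t) of λ ()) })
      (λ { (inj₁ o) → ≤-trans (oT o) (n≤1+n j) ; (inj₂ t) → s≤s (≤-reflexive (proj₂ (tag-size {E = B′} t))) })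
      (trans (sym (+-suc j (length Ts))) e)
      (reps-map (λ { (inj₁ (inj₁ o)) → inj₁ (inj₁ o) ; (inj₁ (inj₂ t)) → inj₂ (inj₂ t) ; (inj₂ (inj₁ t)) → inj₂ (inj₁ t) ; (inj₂ (inj₂ t)) → inj₁ (inj₂ t) })
                (λ { (inj₁ (inj₁ o)) → inj₁ (inj₁ o) ; (inj₁ (inj₂ t)) → inj₂ (inj₂ t) ; (inj₂ (inj₁ t)) → inj₂ (inj₁ t) ; (inj₂ (inj₂ t)) → inj₁ (inj₂ t) }) rep′)
      where
      open S.Result q
      parts = chain-++⁻ (positions B′) (chain-grid {L = positions* Ts} dP ch swapped)
    post : ∀ {G₁ H} (q : S.Result G₁) → RowPost (O′ (S.Result.B′ q)) (suc j) (S.Result.A′ q) Ts H → RowPost O j A (T ∷ Ts) H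
    post q (Ts′ , A″ , row , bA″ , bTs′ , r′) = _ ∷ Ts′ , A″ , exchange swapped bA bT bandB′ bandA′ flagsA′ flagsB′ X.∷ row , bA″ , bandB′ ∷ bTs′ ,
      reps-map (λ { (inj₁ (inj₁ o)) → inj₁ o ; (inj₁ (inj₂ t)) → inj₂ (inj₂ (inj₁ t)) ; (inj₂ (inj₁ t)) → inj₂ (inj₁ t) ; (inj₂ (inj₂ t)) → inj₂ (inj₂ (inj₂ t)) })
               (λ { (inj₁ o) → inj₁ (inj₁ o) ; (inj₂ (inj₁ t)) → inj₂ (inj₁ t) ; (inj₂ (inj₂ (inj₁ t))) → inj₁ (inj₂ t) ; (inj₂ (inj₂ (inj₂ t))) → inj₂ (inj₂ t) }) r′
      where open S.Result q
    p₁ = proj₁ (proj₂ (proj₁ blk))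
    q₁ = proj₂ (proj₂ (proj₁ blk))
    H₂ = proj₁ (proj₁ (rest q₁))
    p₂ = proj₁ (proj₂ (proj₁ (rest q₁)))
    q₂ = proj₂ (proj₂ (proj₁ (rest q₁)))
    all : ∀ {H} → RunJ a n j G H → RowPost O j A (T ∷ Ts) H
    all (stop n<j) = ⊥-elim (<⇒≱ n<j j≤n)
    all (go _ p ps) = let q = proj₂ blk p in post q (proj₂ (rest q) ps)

tags-ʳ⁻ : ∀ {lab p v} Sr D → Tags lab 1 (Sr ʳ++ D) p v → Tags lab 1 (Sr ʳ++ []) p v ⊎ Tags lab (suc (length Sr)) D p v
tags-ʳ⁻ [] D t = inj₂ t
tags-ʳ⁻ (E ∷ Sr) D t with tags-ʳ⁻ Sr (E ∷ D) t
... | inj₂ (inj₂ u) = inj₂ u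
... | inj₂ (inj₁ u) = inj₁ (tags-ʳ⁺ʳ Sr (E ∷ []) (inj₁ u))
  where
  tags-ʳ⁺ʳ : ∀ {lab p v} Sr D → Tags lab (suc (length Sr)) D p v → Tags lab 1 (Sr ʳ++ D) p v
  tags-ʳ⁺ʳ [] D u = u
  tags-ʳ⁺ʳ (E ∷ Sr) D u = tags-ʳ⁺ʳ Sr (E ∷ D) (inj₂ u)
... | inj₁ u = inj₁ (widen Sr {[]} {E ∷ []} (λ ()) u)
  where
  widen : ∀ {lab p v} Sr {D D′} → (∀ {n} → Tags lab n D p v → Tags lab n D′ p v) → Tags lab 1 (Sr ʳ++ D) p v → Tags lab 1 (Sr ʳ++ D′) p v
  widen [] f t = f t
  widen (E ∷ Sr) f t = widen Sr (λ { (inj₁ u) → inj₁ u ; (inj₂ u) → inj₂ (f u) }) t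

tags-ʳ⁺ : ∀ {lab p v} Sr D → Tags lab 1 (Sr ʳ++ []) p v ⊎ Tags lab (suc (length Sr)) D p v → Tags lab 1 (Sr ʳ++ D) p v
tags-ʳ⁺ [] D (inj₂ t) = t
tags-ʳ⁺ (E ∷ Sr) D (inj₂ t) = tags-ʳ⁺ Sr (E ∷ D) (inj₂ (inj₂ t))
tags-ʳ⁺ (E ∷ Sr) D (inj₁ t) with tags-ʳ⁻ Sr (E ∷ []) t
... | inj₁ u = tags-ʳ⁺ Sr (E ∷ D) (inj₁ u)
... | inj₂ (inj₁ u) = tags-ʳ⁺ Sr (E ∷ D) (inj₂ (inj₁ u))

positions*-++ : ∀ As Bs → positions* (As ++ Bs) ≡ positions* As ++ positions* Bs
positions*-++ [] Bs = refl
positions*-++ (A ∷ As) Bs = trans (cong (positions A ++_) (positions*-++ As Bs)) (sym (++-assoc (positions A) _ _))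

RunPost : List (List Ent) → List (List Ent) → LFilling → Set
RunPost Ss Ts H = ∃ λ Ts′ → ∃ λ Ss′ → X.Grid Ss Ts Ts′ Ss′ × All Band Ts′ × All Band Ss′ ×
  Reps (λ p v → Tags SL 1 Ss′ p v ⊎ Tags TL 1 Ts′ p v) H

-- `Sr` lists, last one first, the bands that have not moved. `D` and `D′` are the others before and
-- after their passage, which has turned `Ts₀` into `Ts`.
run-rows : ∀ {P n G} Sr {D D′ Ts₀ Ts} → Down P → Chain P (positions* (Sr ʳ++ []) ++ positions* Ts) → All Band Sr → All Band D′ → All Band Ts →
  X.Grid D Ts₀ Ts D′ → length Ts ≡ n →
  Reps (λ p v → Tags SL 1 (Sr ʳ++ D′) p v ⊎ Tags TL 1 Ts p v) G →
  (∃ λ H → RunI n (length Sr) G H × RunPost (Sr ʳ++ D) Ts₀ H) × (∀ {H} → RunI n (length Sr) G H → RunPost (Sr ʳ++ D) Ts₀ H)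
run-rows [] dP ch _ bD bT g e r = (_ , base , _ , _ , g , bT , bD , r) , λ { base → _ , _ , g , bT , bD , r }
run-rows {P} {n} {G} (A ∷ Sr) {D} {D′} {Ts₀} {Ts} dP ch (bA ∷ bSr) bD bT g e r = (_ , next p₁ p₂ , q₂) , λ { (next p ps) → proj₂ (rest (proj₂ row₁ p)) ps }
  where
  X₀ : List Pos
  X₀ = positions* (Sr ʳ++ [])
  a = suc (length Sr)
  O : Pos → Val → Set
  O p v = Tags SL 1 (Sr ʳ++ []) p v ⊎ Tags SL (suc a) D′ p v
  ʳ++-++ : ∀ (Sr : List (List Ent)) {X} → Sr ʳ++ X ≡ (Sr ʳ++ []) ++ X
  ʳ++-++ [] = refl
  ʳ++-++ (A ∷ Sr) {X} = trans (ʳ++-++ Sr {A ∷ X}) (trans (sym (++-assoc (Sr ʳ++ []) (A ∷ []) X)) (cong (_++ X) (sym (ʳ++-++ Sr {A ∷ []}))))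
  length-ʳ : ∀ (Sr : List (List Ent)) {X} → length (Sr ʳ++ X) ≡ length Sr + length X
  length-ʳ [] = refl
  length-ʳ (A ∷ Sr) {X} = trans (length-ʳ Sr {A ∷ X}) (+-suc (length Sr) (length X))
  ch′ : Chain P (X₀ ++ (positions A ++ positions* Ts))
  ch′ = subst (Chain P) (trans (cong (_++ positions* Ts) (trans (cong positions* (ʳ++-++ Sr {A ∷ []}))
    (trans (positions*-++ (Sr ʳ++ []) (A ∷ [])) (cong (X₀ ++_) (++-identityʳ (positions A)))))) (++-assoc X₀ (positions A) (positions* Ts))) ch
  parts = chain-++⁻ X₀ ch′
  dX : Down (P ∪ X₀)
  dX = down-chain X₀ dP (proj₁ parts)
  oS : ∀ {p l} → O p (SL , l) → ∣ l ∣ ≢ a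
  oS {l = l} (inj₁ t) x = <-irrefl x (subst (∣ l ∣ <_) (cong suc (trans (length-ʳ Sr {[]}) (+-identityʳ _))) (proj₂ (proj₂ (tags-size (Sr ʳ++ []) t))))
  oS (inj₂ t) x = <-irrefl (sym x) (proj₁ (proj₂ (tags-size D′ t)))
  oT : ∀ {p l} → O p (TL , l) → ∣ l ∣ < 1
  oT (inj₁ t) with () ← proj₁ (tags-size (Sr ʳ++ []) t)
  oT (inj₂ t) with () ← proj₁ (tags-size D′ t)
  row₁ = RowRun.run-row a n 1 Ts dX (proj₂ parts) bA bT oS oT (cong suc e)
    (reps-map (λ { (inj₁ t) → case tags-ʳ⁻ Sr (A ∷ D′) t of λ { (inj₁ u) → inj₁ (inj₁ u) ; (inj₂ (inj₁ u)) → inj₂ (inj₁ u) ; (inj₂ (inj₂ u)) → inj₁ (inj₂ u) } ; (inj₂ t) → inj₂ (inj₂ t) })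
              (λ { (inj₁ (inj₁ u)) → inj₁ (tags-ʳ⁺ Sr (A ∷ D′) (inj₁ u)) ; (inj₁ (inj₂ u)) → inj₁ (tags-ʳ⁺ Sr (A ∷ D′) (inj₂ (inj₂ u)))
                 ; (inj₂ (inj₁ u)) → inj₁ (tags-ʳ⁺ Sr (A ∷ D′) (inj₂ (inj₁ u))) ; (inj₂ (inj₂ t)) → inj₂ t }) r)
  row-length : ∀ {A Ts Ts′ A′} → X.Row A Ts Ts′ A′ → length Ts ≡ length Ts′
  row-length X.[] = refl
  row-length (_ X.∷ r) = cong suc (row-length r)
  rest : ∀ {G₁} → RowRun.RowPost a n O 1 A Ts G₁ →
    (∃ λ H → RunI n (length Sr) G₁ H × RunPost (Sr ʳ++ (A ∷ D)) Ts₀ H) × (∀ {H} → RunI n (length Sr) G₁ H → RunPost (Sr ʳ++ (A ∷ D)) Ts₀ H)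
  rest (Ts′ , A′ , rw , bA′ , bT′ , r′) = run-rows Sr dP (chain-++⁺ X₀ (proj₁ parts) (chain-row* dX (proj₂ parts) rw)) bSr (bA′ ∷ bD) bT′ (rw X.∷ g)
    (trans (sym (row-length rw)) e)
    (reps-map (λ { (inj₁ (inj₁ u)) → inj₁ (tags-ʳ⁺ Sr (A′ ∷ D′) (inj₁ u)) ; (inj₁ (inj₂ u)) → inj₁ (tags-ʳ⁺ Sr (A′ ∷ D′) (inj₂ (inj₂ u)))
                 ; (inj₂ (inj₁ u)) → inj₁ (tags-ʳ⁺ Sr (A′ ∷ D′) (inj₂ (inj₁ u))) ; (inj₂ (inj₂ t)) → inj₂ t })
              (λ { (inj₁ t) → case tags-ʳ⁻ Sr (A′ ∷ D′) t of λ { (inj₁ u) → inj₁ (inj₁ u) ; (inj₂ (inj₁ u)) → inj₂ (inj₁ u) ; (inj₂ (inj₂ u)) → inj₁ (inj₂ u) } ; (inj₂ t) → inj₂ (inj₂ t) }) r′)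
  p₁ = proj₁ (proj₂ (proj₁ row₁))
  p₂ = proj₁ (proj₂ (proj₁ (rest (proj₂ (proj₂ (proj₁ row₁))))))
  q₂ = proj₂ (proj₂ (proj₁ (rest (proj₂ (proj₂ (proj₁ row₁))))))

switching : ∀ {P G} Ss Ts → Down P → Chain P (positions* Ss ++ positions* Ts) → All Band Ss → All Band Ts →
  Reps (λ p v → Tags SL 1 Ss p v ⊎ Tags TL 1 Ts p v) G →
  (∃ λ H → RunI (length Ts) (length Ss) G H × RunPost Ss Ts H) × (∀ {H} → RunI (length Ts) (length Ss) G H → RunPost Ss Ts H)
switching {P} {G} Ss Ts dP ch bS bT r = subst Goal (reverse-involutive Ss) (run-rows (reverse Ss) dP
    (subst (λ L → Chain P (positions* L ++ positions* Ts)) (sym (reverse-involutive Ss)) ch)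
    (reverse⁺ bS) [] bT X.[] refl
    (subst (λ L → Reps (λ p v → Tags SL 1 L p v ⊎ Tags TL 1 Ts p v) G) (sym (reverse-involutive Ss)) r)) ′
  where
  Goal : List (List Ent) → Set
  Goal L = (∃ λ H → RunI (length Ts) (length (reverse Ss)) G H × RunPost L Ts H) × (∀ {H} → RunI (length Ts) (length (reverse Ss)) G H → RunPost L Ts H)
  _′ : Goal Ss → (∃ λ H → RunI (length Ts) (length Ss) G H × RunPost Ss Ts H) × (∀ {H} → RunI (length Ts) (length Ss) G H → RunPost Ss Ts H)
  _′ x rewrite length-reverse Ss = x
  reverse⁺ : ∀ {L} → All Band L → All Band (reverse L)
  reverse⁺ {L} b = All.tabulate λ m → [ All.lookup b , (λ ()) ]′ (∈-ʳ⁻ L m)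

-- The lattice condition on two bands

ι : Bool → ℕ
ι true  = 1
ι false = 0

cnt : (Ent → Bool) → List Ent → ℕ
cnt f []      = 0
cnt f (e ∷ L) = ι (f e) + cnt f L

primed : Kind → Bool
primed dn = true
primed up = false
primed (vl _) = false

lt eq ge : ℕ → ℕ → ℕ
lt a r = ι (a <ᵇ r)
eq a r = ι (a ≡ᵇ r)
ge a r = ι (not (a <ᵇ r))

-- lo, at and all count unprimed boxes (in rows above r, in row r, and in total);
-- hi and on count primed boxes (in the rows from r on, and in row r).
loᵇ atᵇ hiᵇ onᵇ : ℕ → Ent → Bool
loᵇ r (p , k) = not (primed k) ∧ (row p <ᵇ r)
atᵇ r (p , k) = not (primed k) ∧ (row p ≡ᵇ r)
hiᵇ r (p , k) = primed k ∧ not (row p <ᵇ r)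
onᵇ r (p , k) = primed k ∧ (row p ≡ᵇ r)

allᵇ : Ent → Bool
allᵇ (p , k) = not (primed k)

lo at hi on : List Ent → ℕ → ℕ
lo X r = cnt (loᵇ r) X
at X r = cnt (atᵇ r) X
hi X r = cnt (hiᵇ r) X
on X r = cnt (onᵇ r) X

all : List Ent → ℕ
all X = cnt allᵇ X

-- `U` and `W` hold the letters i - 1 and i. `F` concerns the word itself, where the boxes of `W` in
-- row r are read before those of `U`. `G` and `G′` concern `hat`, read from the last row upwards:
-- primed boxes now count for their own letter, and an unprimed box of `U` acts as i′. `G` compares
-- the counts after row r, and `G′` is the strict inequality needed at such an i′. The turning point
-- counts as unprimed whatever its flag, so the condition does not depend on flags.
record Lat (U W : List Ent) : Set where
  constructor lat
  field
    F  : ∀ r → lo W (suc r) + on W r ≤ lo U r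
    G  : ∀ r → all W + hi W r ≤ all U + hi U r
    G′ : ∀ r → 1 ≤ at U r → suc (all W + hi W (suc r)) ≤ all U + hi U r
open Lat public

lt-true : ∀ {a r} → a < r → lt a r ≡ 1
lt-true {zero} {suc r} _ = refl
lt-true {suc a} {suc r} (s≤s l) = lt-true l

lt-false : ∀ {a r} → r ≤ a → lt a r ≡ 0
lt-false {a} {zero} _ = refl
lt-false {suc a} {suc r} (s≤s l) = lt-false l

ge-lt : ∀ a r → ge a r + lt a r ≡ 1
ge-lt a r with a <ᵇ r
... | true = refl
... | false = refl

lt-suc : ∀ a r → lt a r ≡ lt (suc a) r + eq (suc a) r
lt-suc a zero = refl
lt-suc zero (suc zero) = refl
lt-suc zero (suc (suc r)) = refl
lt-suc (suc a) (suc r) = lt-suc a r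

ltʳ-suc : ∀ a r → lt a (suc r) ≡ lt a r + eq a r
ltʳ-suc zero zero = refl
ltʳ-suc zero (suc r) = refl
ltʳ-suc (suc a) zero = refl
ltʳ-suc (suc a) (suc r) = ltʳ-suc a r

eq-refl : ∀ a → eq a a ≡ 1
eq-refl zero = refl
eq-refl (suc a) = eq-refl a

eq-≢ : ∀ {a r} → a ≢ r → eq a r ≡ 0
eq-≢ {zero} {zero} n = ⊥-elim (n refl)
eq-≢ {zero} {suc r} n = refl
eq-≢ {suc a} {zero} n = refl
eq-≢ {suc a} {suc r} n = eq-≢ (λ e → n (cong suc e))

lo-suc : ∀ X r → lo X (suc r) ≡ lo X r + at X r
lo-suc [] r = refl
lo-suc ((p , dn) ∷ X) r = lo-suc X r
lo-suc ((p , up) ∷ X) r = lia (lt (row p) (suc r) ∷ lt (row p) r ∷ eq (row p) r ∷ lo X (suc r) ∷ lo X r ∷ at X r ∷ [])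
  (λ a b c d e f → (a :≡ b :+ c) ∷ (d :≡ e :+ f) ∷ [] ⊢ a :+ d :≡ (b :+ e) :+ (c :+ f)) (ltʳ-suc (row p) r) (lo-suc X r)
lo-suc ((p , vl _) ∷ X) r = lia (lt (row p) (suc r) ∷ lt (row p) r ∷ eq (row p) r ∷ lo X (suc r) ∷ lo X r ∷ at X r ∷ [])
  (λ a b c d e f → (a :≡ b :+ c) ∷ (d :≡ e :+ f) ∷ [] ⊢ a :+ d :≡ (b :+ e) :+ (c :+ f)) (ltʳ-suc (row p) r) (lo-suc X r)

ge-suc : ∀ a r → ge a r ≡ eq a r + ge a (suc r)
ge-suc a r = lia (ge a r ∷ lt a r ∷ ge a (suc r) ∷ lt a (suc r) ∷ eq a r ∷ [])
  (λ g l g′ l′ e → (g :+ l :≡ lit 1) ∷ (g′ :+ l′ :≡ lit 1) ∷ (l′ :≡ l :+ e) ∷ [] ⊢ g :≡ e :+ g′) (ge-lt a r) (ge-lt a (suc r)) (ltʳ-suc a r)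

hi-suc : ∀ X r → hi X r ≡ on X r + hi X (suc r)
hi-suc [] r = refl
hi-suc ((p , up) ∷ X) r = hi-suc X r
hi-suc ((p , vl _) ∷ X) r = hi-suc X r
hi-suc ((p , dn) ∷ X) r = lia (ge (row p) r ∷ ge (row p) (suc r) ∷ eq (row p) r ∷ hi X r ∷ on X r ∷ hi X (suc r) ∷ [])
  (λ a b c d e f → (a :≡ c :+ b) ∷ (d :≡ e :+ f) ∷ [] ⊢ a :+ d :≡ (c :+ e) :+ (b :+ f)) (ge-suc (row p) r) (hi-suc X r)

ι≤1 : ∀ b → ι b ≤ 1
ι≤1 true = ≤-refl
ι≤1 false = z≤n

lo≤all : ∀ X r → lo X r ≤ all X
lo≤all [] r = z≤n
lo≤all ((p , dn) ∷ X) r = lo≤all X r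
lo≤all ((p , up) ∷ X) r = +-mono-≤ (ι≤1 (row p <ᵇ r)) (lo≤all X r)
lo≤all ((p , vl _) ∷ X) r = +-mono-≤ (ι≤1 (row p <ᵇ r)) (lo≤all X r)

lo-mono : ∀ X {r s} → r ≤ s → lo X r ≤ lo X s
lo-mono X {r} {s} l with m≤n⇒m<n∨m≡n l
... | inj₂ refl = ≤-refl
lo-mono X {r} {suc s} _ | inj₁ (s≤s l) = ≤-trans (lo-mono X l) (≤-trans (m≤m+n _ _) (≤-reflexive (sym (lo-suc X s))))

hi-anti : ∀ X {r s} → r ≤ s → hi X s ≤ hi X r
hi-anti X {r} {s} l with m≤n⇒m<n∨m≡n l
... | inj₂ refl = ≤-refl
hi-anti X {r} {suc s} _ | inj₁ (s≤s l) = ≤-trans (≤-trans (m≤n+m _ _) (≤-reflexive (sym (hi-suc X s)))) (hi-anti X l)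

cnt-mid : ∀ f Z E Y → cnt f (Z ʳ++ (E ++ Y)) ≡ cnt f E + cnt f (Z ʳ++ Y)
cnt-mid f [] [] Y = refl
cnt-mid f [] (e ∷ E) Y = trans (cong (ι (f e) +_) (cnt-mid f [] E Y)) (sym (+-assoc (ι (f e)) _ _))
cnt-mid f (z ∷ Z) E Y = trans (trans (cnt-front Z) (trans (cong (ι (f z) +_) (cnt-mid f Z E Y)) (exch (ι (f z)) (cnt f E) (cnt f (Z ʳ++ Y)))))
  (cong (cnt f E +_) (sym (cnt-front′ Z)))
  where
  exch : ∀ a b c → a + (b + c) ≡ b + (a + c)
  exch a b c = lia (a ∷ b ∷ c ∷ []) (λ a b c → [] ⊢ a :+ (b :+ c) :≡ b :+ (a :+ c))
  move : ∀ Z {V} → cnt f (Z ʳ++ (z ∷ V)) ≡ ι (f z) + cnt f (Z ʳ++ V)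
  move [] = refl
  move (y ∷ Z) {V} = trans (pair Z) (trans (move Z {y ∷ V}) refl)
    where
    pair : ∀ Z → cnt f (Z ʳ++ (y ∷ z ∷ V)) ≡ cnt f (Z ʳ++ (z ∷ y ∷ V))
    pair Z = congʳ Z (exch (ι (f y)) (ι (f z)) (cnt f V))
      where
      congʳ : ∀ Z {V V′} → cnt f V ≡ cnt f V′ → cnt f (Z ʳ++ V) ≡ cnt f (Z ʳ++ V′)
      congʳ [] e = e
      congʳ (w ∷ Z) e = congʳ Z (cong (ι (f w) +_) e)
  cnt-front : ∀ Z → cnt f (Z ʳ++ (z ∷ (E ++ Y))) ≡ ι (f z) + cnt f (Z ʳ++ (E ++ Y))
  cnt-front Z = move Z
  cnt-front′ : ∀ Z → cnt f (Z ʳ++ (z ∷ Y)) ≡ ι (f z) + cnt f (Z ʳ++ Y)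
  cnt-front′ Z = move Z

-- The effect of moving one box (or the two boxes of a hook) of U or W one row up; R is the unchanged rest.
_⊕_↦_ : List Ent → List Ent → List Ent → Set
E ⊕ R ↦ X = ∀ f → cnt f X ≡ cnt f E + cnt f R

⊕-mid : ∀ Z E Y → E ⊕ (Z ʳ++ Y) ↦ (Z ʳ++ (E ++ Y))
⊕-mid Z E Y f = cnt-mid f Z E Y

record PlusUn (a : ℕ) (R X : List Ent) : Set where
  field
    lo+  : ∀ r → lo X r ≡ lt a r + lo R r
    at+  : ∀ r → at X r ≡ eq a r + at R r
    all+ : all X ≡ suc (all R)
    hi+  : ∀ r → hi X r ≡ hi R r
    on+  : ∀ r → on X r ≡ on R r

record PlusPr (a : ℕ) (R X : List Ent) : Set where
  field
    lo+  : ∀ r → lo X r ≡ lo R r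
    at+  : ∀ r → at X r ≡ at R r
    all+ : all X ≡ all R
    hi+  : ∀ r → hi X r ≡ ge a r + hi R r
    on+  : ∀ r → on X r ≡ eq a r + on R r

plus-un : ∀ {R X a p k} → primed k ≡ false → row p ≡ a → ((p , k) ∷ []) ⊕ R ↦ X → PlusUn a R X
plus-un {R} {a = a} {p} {k} n refl u = record
  { lo+ = λ r → trans (u (loᵇ r)) (cong (_+ lo R r) (trans (+-identityʳ _) (cong (λ b → ι (not b ∧ (a <ᵇ r))) n)))
  ; at+ = λ r → trans (u (atᵇ r)) (cong (_+ at R r) (trans (+-identityʳ _) (cong (λ b → ι (not b ∧ (a ≡ᵇ r))) n)))
  ; all+ = trans (u allᵇ) (cong (λ b → ι (not b) + 0 + all R) n)
  ; hi+ = λ r → trans (u (hiᵇ r)) (cong (λ b → ι (b ∧ not (a <ᵇ r)) + 0 + hi R r) n)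
  ; on+ = λ r → trans (u (onᵇ r)) (cong (λ b → ι (b ∧ (a ≡ᵇ r)) + 0 + on R r) n) }

plus-pr : ∀ {R X a p} → row p ≡ a → ((p , dn) ∷ []) ⊕ R ↦ X → PlusPr a R X
plus-pr {R} refl u = record
  { lo+ = λ r → u (loᵇ r) ; at+ = λ r → u (atᵇ r) ; all+ = u allᵇ
  ; hi+ = λ r → trans (u (hiᵇ r)) (cong (_+ hi R r) (+-identityʳ _))
  ; on+ = λ r → trans (u (onᵇ r)) (cong (_+ on R r) (+-identityʳ _)) }

at⁺ : ∀ {a R X r} → PlusUn a R X → 1 ≤ at R r → 1 ≤ at X r
at⁺ {a} {R} {X} {r} u x = ≤-trans x (≤-trans (m≤n+m _ _) (≤-reflexive (sym (PlusUn.at+ u r))))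

at⁻ : ∀ {a R X r} → PlusUn a R X → 1 ≤ at X r → r ≢ a → 1 ≤ at R r
at⁻ {a} {R} {X} {r} u x n = ≤-trans x (≤-reflexive (trans (PlusUn.at+ u r) (cong (_+ at R r) (eq-≢ (λ e → n (sym e))))))

at-new : ∀ {a R X} → PlusUn a R X → 1 ≤ at X a
at-new {a} {R} u = ≤-trans (≤-trans (≤-reflexive (sym (eq-refl a))) (m≤m+n _ _)) (≤-reflexive (sym (PlusUn.at+ u a)))

module _ {R U U′ W : List Ent} {i : ℕ} (u : PlusUn (suc i) R U) (u′ : PlusUn i R U′) where

  private
    module u = PlusUn u
    module u′ = PlusUn u′
    lo-u = u.lo+
    lo-u′ = u′.lo+
    at-u = u.at+
    at-u′ = u′.at+
    all-u = u.all+
    all-u′ = u′.all+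
    hi-u = u.hi+
    hi-u′ = u′.hi+
    on-u = u.on+
    on-u′ = u′.on+

  -- Among the values of `lo U` only that at i + 1 changes. There `F` follows from `F` at i, because
  -- row i + 1 of `W` is outweighed by row i; the other two hypotheses carry the strictness in `G′`
  -- from one of the two rows to the other.
  U-un : (on W (suc i) + at W (suc i) ≤ at R i + on W i) →
    (1 ≤ on W (suc i) → 1 ≤ at R i ⊎ 1 ≤ on W i) → (1 ≤ on R i → 1 ≤ at R (suc i) ⊎ 1 ≤ on R (suc i)) →
    (Lat U W → Lat U′ W) × (Lat U′ W → Lat U W)
  U-un h1 h2 h3 = to , from
    where
    to : Lat U W → Lat U′ W
    to (lat F G G′) = lat
      (λ r → lia (lo W (suc r) ∷ on W r ∷ lo U r ∷ lo U′ r ∷ lt i r ∷ lt (suc i) r ∷ eq (suc i) r ∷ lo R r ∷ [])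
        (λ a b x x′ l l′ q z → (a :+ b :≤ x) ∷ (x :≡ l′ :+ z) ∷ (x′ :≡ l :+ z) ∷ (l :≡ l′ :+ q) ∷ [] ⊢ a :+ b :≤ x′)
        (F r) (lo-u r) (lo-u′ r) (lt-suc i r))
      (λ r → subst (all W + hi W r ≤_) (cong₂ _+_ (trans all-u (sym all-u′)) (trans (hi-u r) (sym (hi-u′ r)))) (G r))
      g′
      where
      g′ : ∀ r → 1 ≤ at U′ r → suc (all W + hi W (suc r)) ≤ all U′ + hi U′ r
      g′ r x = subst (suc (all W + hi W (suc r)) ≤_) (cong₂ _+_ (trans all-u (sym all-u′)) (trans (hi-u r) (sym (hi-u′ r)))) (inner r x)
        where
        inner : ∀ r → 1 ≤ at U′ r → suc (all W + hi W (suc r)) ≤ all U + hi U r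
        inner r x with 1 ≤? at R r | r ≟ i
        ... | yes y | _ = G′ r (≤-trans y (≤-trans (m≤n+m _ _) (≤-reflexive (sym (at-u r)))))
        ... | no n | no r≢i = ⊥-elim (n (≤-trans x (≤-reflexive (trans (at-u′ r) (cong (_+ at R r) (eq-≢ (λ e → r≢i (sym e))))))))
        ... | no n | yes refl with 1 ≤? on W (suc i)
        ...   | no z = lia (all W ∷ hi W (suc i) ∷ on W (suc i) ∷ hi W (suc (suc i)) ∷ all U ∷ hi U (suc i) ∷ hi U i ∷ [])
                   (λ w h o h′ u v v′ → (lit 1 :+ (w :+ h′) :≤ u :+ v) ∷ (h :≡ o :+ h′) ∷ (o :< lit 1) ∷ (v :≤ v′) ∷ [] ⊢ lit 1 :+ (w :+ h) :≤ u :+ v′)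
                   (G′ (suc i) (≤-trans (≤-trans (≤-reflexive (sym (eq-refl i))) (m≤m+n _ _)) (≤-reflexive (sym (at-u (suc i))))))
                   (hi-suc W (suc i)) (≰⇒> z) (hi-anti U (n≤1+n i))
        ...   | yes z with h2 z
        ...     | inj₁ y = ⊥-elim (n y)
        ...     | inj₂ y = lia (all W ∷ hi W (suc i) ∷ on W i ∷ hi W i ∷ all U ∷ hi U i ∷ [])
                   (λ w h o h′ u v → (w :+ h′ :≤ u :+ v) ∷ (h′ :≡ o :+ h) ∷ (lit 1 :≤ o) ∷ [] ⊢ lit 1 :+ (w :+ h) :≤ u :+ v) (G i) (hi-suc W i) y
    from : Lat U′ W → Lat U W
    from (lat F G G′) = lat f (λ r → subst (all W + hi W r ≤_) (cong₂ _+_ (trans all-u′ (sym all-u)) (trans (hi-u′ r) (sym (hi-u r)))) (G r)) g′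
      where
      f : ∀ r → lo W (suc r) + on W r ≤ lo U r
      f r with r ≟ suc i
      ... | no n = lia (lo W (suc r) ∷ on W r ∷ lo U r ∷ lo U′ r ∷ lt i r ∷ lt (suc i) r ∷ eq (suc i) r ∷ lo R r ∷ [])
        (λ a b x x′ l l′ q z → (a :+ b :≤ x′) ∷ (x :≡ l′ :+ z) ∷ (x′ :≡ l :+ z) ∷ (l :≡ l′ :+ q) ∷ (q :≡ lit 0) ∷ [] ⊢ a :+ b :≤ x)
        (F r) (lo-u r) (lo-u′ r) (lt-suc i r) (eq-≢ (λ e → n (sym e)))
      ... | yes refl = lia (lo W (suc (suc i)) ∷ on W (suc i) ∷ lo W (suc i) ∷ on W i ∷ at W (suc i) ∷ lo U (suc i) ∷ lo U′ i ∷ lo R i ∷ lo R (suc i) ∷ at R i ∷ lt (suc i) (suc i) ∷ lt i i ∷ [])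
        (λ w2 o1 w1 o0 a1 u1 u0 r0 r1 ar l l′ → (w1 :+ o0 :≤ u0) ∷ (u0 :≡ l′ :+ r0) ∷ (l′ :≡ lit 0) ∷ (w2 :≡ w1 :+ a1) ∷ (o1 :+ a1 :≤ ar :+ o0) ∷ (r1 :≡ r0 :+ ar) ∷ (u1 :≡ l :+ r1) ∷ []
          ⊢ w2 :+ o1 :≤ u1)
        (F i) (lo-u′ i) (lt-false (≤-refl {i})) (lo-suc W (suc i)) h1 (lo-suc R i) (lo-u (suc i))
      g′ : ∀ r → 1 ≤ at U r → suc (all W + hi W (suc r)) ≤ all U + hi U r
      g′ r x = subst (suc (all W + hi W (suc r)) ≤_) (cong₂ _+_ (trans all-u′ (sym all-u)) (trans (hi-u′ r) (sym (hi-u r)))) (inner r x)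
        where
        via : ∀ r → 1 ≤ at R r → suc (all W + hi W (suc r)) ≤ all U′ + hi U′ r
        via r y = G′ r (≤-trans y (≤-trans (m≤n+m _ _) (≤-reflexive (sym (at-u′ r)))))
        inner : ∀ r → 1 ≤ at U r → suc (all W + hi W (suc r)) ≤ all U′ + hi U′ r
        inner r x with 1 ≤? at R r | r ≟ suc i
        ... | yes y | _ = via r y
        ... | no n | no r≢ = ⊥-elim (n (≤-trans x (≤-reflexive (trans (at-u r) (cong (_+ at R r) (eq-≢ (λ e → r≢ (sym e))))))))
        ... | no n | yes refl with 1 ≤? on R i
        ...   | no z = lia (all W ∷ hi W (suc (suc i)) ∷ hi W (suc i) ∷ all U′ ∷ hi U′ i ∷ hi U′ (suc i) ∷ on U′ i ∷ on R i ∷ [])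
                 (λ w h2 h1 u v0 v1 o o′ → (lit 1 :+ (w :+ h1) :≤ u :+ v0) ∷ (h2 :≤ h1) ∷ (v0 :≡ o :+ v1) ∷ (o :≡ o′) ∷ (o′ :< lit 1) ∷ [] ⊢ lit 1 :+ (w :+ h2) :≤ u :+ v1)
                 (G′ i (≤-trans (≤-trans (≤-reflexive (sym (eq-refl i))) (m≤m+n _ _)) (≤-reflexive (sym (at-u′ i)))))
                 (hi-anti W (n≤1+n (suc i))) (hi-suc U′ i) (on-u′ i) (≰⇒> z)
        ...   | yes z with h3 z
        ...     | inj₁ y = ⊥-elim (n y)
        ...     | inj₂ y = lia (all W ∷ hi W (suc (suc i)) ∷ all U′ ∷ hi U′ (suc i) ∷ hi U′ (suc (suc i)) ∷ on U′ (suc i) ∷ on R (suc i) ∷ [])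
                 (λ w h u v1 v2 o o′ → (w :+ h :≤ u :+ v2) ∷ (v1 :≡ o :+ v2) ∷ (o :≡ o′) ∷ (lit 1 :≤ o′) ∷ [] ⊢ lit 1 :+ (w :+ h) :≤ u :+ v1)
                 (G (suc (suc i))) (hi-suc U′ (suc i)) (on-u′ (suc i)) y

module _ {R U U′ W : List Ent} {i : ℕ} (u : PlusPr (suc i) R U) (u′ : PlusPr i R U′) where

  private
    module u = PlusPr u
    module u′ = PlusPr u′

  -- Only `hi U (suc i)` changes, so `F` is untouched. The smaller value still satisfies `G` by one
  -- of `G` at i + 2, `G′` at i and `G` at i, depending on which boxes the rows i and i + 1 contain.
  U-dn : (1 ≤ on W (suc i) → 1 ≤ at R i ⊎ 1 ≤ on W i) → on R i ≡ 0 → at R (suc i) ≡ 0 → (Lat U W → Lat U′ W) × (Lat U′ W → Lat U W)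
  U-dn h1 h2 h3 = to , from
    where
    geq : ∀ r → hi U′ r ≤ hi U r
    geq r = lia (hi U′ r ∷ hi U r ∷ hi R r ∷ ge i r ∷ ge (suc i) r ∷ lt i r ∷ lt (suc i) r ∷ eq (suc i) r ∷ [])
      (λ h′ h hr g g′ l l′ q → (h′ :≡ g :+ hr) ∷ (h :≡ g′ :+ hr) ∷ (g :+ l :≡ lit 1) ∷ (g′ :+ l′ :≡ lit 1) ∷ (l :≡ l′ :+ q) ∷ [] ⊢ h′ :≤ h)
      (u′.hi+ r) (u.hi+ r) (ge-lt i r) (ge-lt (suc i) r) (lt-suc i r)
    same : ∀ r → r ≢ suc i → hi U′ r ≡ hi U r
    same r n = lia (hi U′ r ∷ hi U r ∷ hi R r ∷ ge i r ∷ ge (suc i) r ∷ lt i r ∷ lt (suc i) r ∷ eq (suc i) r ∷ [])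
      (λ h′ h hr g g′ l l′ q → (h′ :≡ g :+ hr) ∷ (h :≡ g′ :+ hr) ∷ (g :+ l :≡ lit 1) ∷ (g′ :+ l′ :≡ lit 1) ∷ (l :≡ l′ :+ q) ∷ (q :≡ lit 0) ∷ [] ⊢ h′ :≡ h)
      (u′.hi+ r) (u.hi+ r) (ge-lt i r) (ge-lt (suc i) r) (lt-suc i r) (eq-≢ (λ e → n (sym e)))
    all-same : all U′ ≡ all U
    all-same = trans u′.all+ (sym u.all+)
    lo-same : ∀ r → lo U′ r ≡ lo U r
    lo-same r = trans (u′.lo+ r) (sym (u.lo+ r))
    at-same : ∀ r → at U′ r ≡ at U r
    at-same r = trans (u′.at+ r) (sym (u.at+ r))
    hi-up : hi U i ≡ suc (hi R i)
    hi-up = trans (u.hi+ i) (cong (_+ hi R i) (trans (sym (+-identityʳ _)) (trans (cong (ge (suc i) i +_) (sym (lt-false (n≤1+n i)))) (ge-lt (suc i) i))))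
    hi-at : hi U′ (suc i) ≡ hi R (suc i)
    hi-at = trans (u′.hi+ (suc i)) (cong (_+ hi R (suc i)) (+-cancelʳ-≡ 1 _ _ (trans (cong (ge i (suc i) +_) (sym (lt-true (n<1+n i)))) (ge-lt i (suc i)))))
    hi-beyond : hi U (suc (suc i)) ≡ hi R (suc (suc i))
    hi-beyond = trans (u.hi+ (suc (suc i))) (cong (_+ hi R (suc (suc i))) (+-cancelʳ-≡ 1 _ _ (trans (cong (ge (suc i) (suc (suc i)) +_) (sym (lt-true (n<1+n (suc i))))) (ge-lt (suc i) (suc (suc i))))))
    to : Lat U W → Lat U′ W
    to (lat F G G′) = lat (λ r → subst (_ ≤_) (sym (lo-same r)) (F r)) g
      λ r x → subst₂ (λ t h → suc (all W + hi W (suc r)) ≤ t + h) (sym all-same)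
        (sym (same r λ { refl → <⇒≱ x (≤-reflexive (trans (u′.at+ (suc i)) h3)) })) (G′ r (subst (1 ≤_) (at-same r) x))
      where
      g : ∀ r → all W + hi W r ≤ all U′ + hi U′ r
      g r with r ≟ suc i
      ... | no n = subst₂ (λ t h → all W + hi W r ≤ t + h) (sym all-same) (sym (same r n)) (G r)
      ... | yes refl with 1 ≤? on W (suc i)
      ...   | no z = lia (all W ∷ hi W (suc i) ∷ on W (suc i) ∷ hi W (suc (suc i)) ∷ all U ∷ all U′ ∷ hi U (suc (suc i)) ∷ hi R (suc (suc i)) ∷ hi R (suc i) ∷ hi U′ (suc i) ∷ [])
               (λ w h1 o h2 t t′ v2 r2 r1 v1 → (w :+ h2 :≤ t :+ v2) ∷ (h1 :≡ o :+ h2) ∷ (o :< lit 1) ∷ (t′ :≡ t) ∷ (v2 :≡ r2) ∷ (r2 :≤ r1) ∷ (v1 :≡ r1) ∷ [] ⊢ w :+ h1 :≤ t′ :+ v1)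
               (G (suc (suc i))) (hi-suc W (suc i)) (≰⇒> z) all-same hi-beyond (hi-anti R (n≤1+n (suc i))) hi-at
      ...   | yes z with h1 z
      ...     | inj₁ y = lia (all W ∷ hi W (suc i) ∷ all U ∷ all U′ ∷ hi U i ∷ hi R i ∷ on R i ∷ hi R (suc i) ∷ hi U′ (suc i) ∷ [])
               (λ w h t t′ v r0 o r1 v1 → (lit 1 :+ (w :+ h) :≤ t :+ v) ∷ (t′ :≡ t) ∷ (v :≡ lit 1 :+ r0) ∷ (r0 :≡ o :+ r1) ∷ (o :≡ lit 0) ∷ (v1 :≡ r1) ∷ [] ⊢ w :+ h :≤ t′ :+ v1)
               (G′ i (subst (1 ≤_) (sym (u.at+ i)) y)) all-same hi-up (hi-suc R i) h2 hi-at
      ...     | inj₂ y = lia (all W ∷ hi W (suc i) ∷ hi W i ∷ on W i ∷ all U ∷ all U′ ∷ hi U i ∷ hi R i ∷ on R i ∷ hi R (suc i) ∷ hi U′ (suc i) ∷ [])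
               (λ w h h0 p t t′ v r0 o r1 v1 → (w :+ h0 :≤ t :+ v) ∷ (h0 :≡ p :+ h) ∷ (lit 1 :≤ p) ∷ (t′ :≡ t) ∷ (v :≡ lit 1 :+ r0) ∷ (r0 :≡ o :+ r1) ∷ (o :≡ lit 0) ∷ (v1 :≡ r1) ∷ [] ⊢ w :+ h :≤ t′ :+ v1)
               (G i) (hi-suc W i) y all-same hi-up (hi-suc R i) h2 hi-at
    from : Lat U′ W → Lat U W
    from (lat F G G′) = lat (λ r → subst (_ ≤_) (lo-same r) (F r))
      (λ r → ≤-trans (G r) (+-mono-≤ (≤-reflexive all-same) (geq r)))
      λ r x → ≤-trans (G′ r (subst (1 ≤_) (sym (at-same r)) x)) (+-mono-≤ (≤-reflexive all-same) (geq r))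

module _ {R U W W′ : List Ent} {i : ℕ} (w : PlusUn (suc i) R W) (w′ : PlusUn i R W′) where

  private
    module w = PlusUn w
    module w′ = PlusUn w′

  -- In the second alternative row i starts on the diagonal with a box of U.
  Covered : Set
  Covered = at U i + on R i ≤ at R (suc i) + on R (suc i) ⊎
    (at U i + on R i ≤ suc (at R (suc i) + on R (suc i)) × 1 ≤ at U i × hi U i ≡ 0 × all U ≤ lo U (suc i))

  -- The raised box makes `F` harder at row i only. It follows from `F` at i + 1 if row i + 1
  -- outweighs row i, and otherwise from `G′` at i, which the diagonal box of `U` makes available.
  W-un : Covered → (Lat U W → Lat U W′) × (Lat U W′ → Lat U W)
  W-un h = to , from
    where
    all-same : all W′ ≡ all W
    all-same = trans w′.all+ (sym w.all+)
    hi-same : ∀ r → hi W′ r ≡ hi W r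
    hi-same r = trans (w′.hi+ r) (sym (w.hi+ r))
    to : Lat U W → Lat U W′
    to (lat F G G′) = lat (f h) (λ r → subst₂ (λ t h → t + h ≤ all U + hi U r) (sym all-same) (sym (hi-same r)) (G r))
      λ r x → subst₂ (λ t h → suc (t + h) ≤ all U + hi U r) (sym all-same) (sym (hi-same (suc r))) (G′ r x)
      where
      f : Covered → ∀ r → lo W′ (suc r) + on W′ r ≤ lo U r
      f h r with r ≟ i
      ... | no n = lia (lo W′ (suc r) ∷ on W′ r ∷ lo W (suc r) ∷ on W r ∷ lo U r ∷ lo R (suc r) ∷ on R r ∷ lt i (suc r) ∷ lt (suc i) (suc r) ∷ eq (suc i) (suc r) ∷ [])
        (λ a b c d x p q l l′ e → (c :+ d :≤ x) ∷ (a :≡ l :+ p) ∷ (c :≡ l′ :+ p) ∷ (b :≡ q) ∷ (d :≡ q) ∷ (l :≡ l′ :+ e) ∷ (e :≡ lit 0) ∷ [] ⊢ a :+ b :≤ x)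
        (F r) (w′.lo+ (suc r)) (w.lo+ (suc r)) (w′.on+ r) (w.on+ r) (lt-suc i (suc r)) (eq-≢ (λ e → n (sym (suc-injective e))))
      ... | yes refl with h
      ...   | inj₁ h = lia (lo W′ (suc i) ∷ on W′ i ∷ lo R (suc i) ∷ on R i ∷ lt i (suc i) ∷ lo W (suc (suc i)) ∷ on W (suc i) ∷ lo R (suc (suc i)) ∷ at R (suc i) ∷ on R (suc i) ∷ lt (suc i) (suc (suc i)) ∷ lo U i ∷ lo U (suc i) ∷ at U i ∷ [])
        (λ a b r1 o0 l c d r2 a1 o1 l′ x y au → (a :≡ l :+ r1) ∷ (b :≡ o0) ∷ (l :≡ lit 1) ∷ (c :+ d :≤ y) ∷ (c :≡ l′ :+ r2) ∷ (l′ :≡ lit 1) ∷ (d :≡ o1) ∷ (r2 :≡ r1 :+ a1) ∷ (y :≡ x :+ au) ∷ (au :+ o0 :≤ a1 :+ o1) ∷ [] ⊢ a :+ b :≤ x)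
        (w′.lo+ (suc i)) (w′.on+ i) (lt-true (n<1+n i)) (F (suc i)) (w.lo+ (suc (suc i))) (lt-true (n<1+n (suc i))) (w.on+ (suc i)) (lo-suc R (suc i)) (lo-suc U i) h
      ...   | inj₂ (h , h1 , h0 , ht) = lia (lo W′ (suc i) ∷ on W′ i ∷ lo R (suc i) ∷ on R i ∷ lt i (suc i) ∷ all W ∷ hi W (suc i) ∷ lo R (suc (suc i)) ∷ at R (suc i) ∷ on R (suc i) ∷ all R ∷ hi R (suc (suc i)) ∷ lo U i ∷ lo U (suc i) ∷ at U i ∷ all U ∷ hi U i ∷ [])
        (λ a b r1 o0 l c d r2 a1 o1 t h2 x y au tu hu → (a :≡ l :+ r1) ∷ (b :≡ o0) ∷ (l :≡ lit 1) ∷ (lit 1 :+ (c :+ d) :≤ tu :+ hu) ∷ (c :≡ lit 1 :+ t) ∷ (r2 :≤ t) ∷ (d :≡ o1 :+ h2) ∷ (r2 :≡ r1 :+ a1) ∷ (y :≡ x :+ au) ∷ (au :+ o0 :≤ lit 1 :+ (a1 :+ o1)) ∷ (hu :≡ lit 0) ∷ (tu :≤ y) ∷ [] ⊢ a :+ b :≤ x)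
        (w′.lo+ (suc i)) (w′.on+ i) (lt-true (n<1+n i)) (G′ i h1) w.all+ (lo≤all R (suc (suc i))) (trans (w.hi+ (suc i)) (hi-suc R (suc i))) (lo-suc R (suc i)) (lo-suc U i) h h0 ht
    from : Lat U W′ → Lat U W
    from (lat F G G′) = lat
      (λ r → lia (lo W′ (suc r) ∷ on W′ r ∷ lo W (suc r) ∷ on W r ∷ lo U r ∷ lo R (suc r) ∷ on R r ∷ lt i (suc r) ∷ lt (suc i) (suc r) ∷ eq (suc i) (suc r) ∷ [])
        (λ a b c d x p q l l′ e → (a :+ b :≤ x) ∷ (a :≡ l :+ p) ∷ (c :≡ l′ :+ p) ∷ (b :≡ q) ∷ (d :≡ q) ∷ (l :≡ l′ :+ e) ∷ [] ⊢ c :+ d :≤ x)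
        (F r) (w′.lo+ (suc r)) (w.lo+ (suc r)) (w′.on+ r) (w.on+ r) (lt-suc i (suc r)))
      (λ r → subst₂ (λ t h → t + h ≤ all U + hi U r) all-same (hi-same r) (G r))
      λ r x → subst₂ (λ t h → suc (t + h) ≤ all U + hi U r) all-same (hi-same (suc r)) (G′ r x)

module _ {R U W W′ : List Ent} {i : ℕ} (w : PlusPr (suc i) R W) (w′ : PlusPr i R W′) where

  private
    module w = PlusPr w
    module w′ = PlusPr w′

  -- Going up, only `F` at row i is at stake, and `F` at i + 1 gives it. Going back down, `G` at i +
  -- 1 needs the spare unit `key`, found in `G` at i, `G′` at i + 1 or `G` at i + 2.
  W-dn : at U i ≡ 0 → on R i ≡ 0 → at R (suc i) ≡ 0 → on R (suc i) ≡ 0 → (1 ≤ on U i → 1 ≤ at U (suc i) ⊎ 1 ≤ on U (suc i)) →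
    (Lat U W → Lat U W′) × (Lat U W′ → Lat U W)
  W-dn n1 n2 n3 n4 n5 = to , from
    where
    all-same : all W′ ≡ all W
    all-same = trans w′.all+ (sym w.all+)
    raised : ∀ r → hi W r ≡ eq (suc i) r + hi W′ r
    raised r = lia (hi W′ r ∷ hi W r ∷ hi R r ∷ ge i r ∷ ge (suc i) r ∷ lt i r ∷ lt (suc i) r ∷ eq (suc i) r ∷ [])
      (λ h′ h hr g g′ l l′ q → (h′ :≡ g :+ hr) ∷ (h :≡ g′ :+ hr) ∷ (g :+ l :≡ lit 1) ∷ (g′ :+ l′ :≡ lit 1) ∷ (l :≡ l′ :+ q) ∷ [] ⊢ h :≡ q :+ h′)
      (w′.hi+ r) (w.hi+ r) (ge-lt i r) (ge-lt (suc i) r) (lt-suc i r)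
    geq : ∀ r → hi W′ r ≤ hi W r
    geq r = ≤-trans (m≤n+m _ _) (≤-reflexive (sym (raised r)))
    to : Lat U W → Lat U W′
    to (lat F G G′) = lat f (λ r → ≤-trans (+-mono-≤ (≤-reflexive all-same) (geq r)) (G r))
      λ r x → ≤-trans (s≤s (+-mono-≤ (≤-reflexive all-same) (geq (suc r)))) (G′ r x)
      where
      f : ∀ r → lo W′ (suc r) + on W′ r ≤ lo U r
      f r with r ≟ i
      ... | no n = lia (lo W′ (suc r) ∷ on W′ r ∷ lo W (suc r) ∷ on W r ∷ lo U r ∷ lo R (suc r) ∷ on R r ∷ eq i r ∷ eq (suc i) r ∷ [])
        (λ a b c d x p q e e′ → (c :+ d :≤ x) ∷ (a :≡ p) ∷ (c :≡ p) ∷ (b :≡ e :+ q) ∷ (d :≡ e′ :+ q) ∷ (e :≡ lit 0) ∷ [] ⊢ a :+ b :≤ x)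
        (F r) (w′.lo+ (suc r)) (w.lo+ (suc r)) (w′.on+ r) (w.on+ r) (eq-≢ (λ e → n (sym e)))
      ... | yes refl = lia (lo W′ (suc i) ∷ on W′ i ∷ lo R (suc i) ∷ on R i ∷ eq i i ∷ lo W (suc (suc i)) ∷ on W (suc i) ∷ lo R (suc (suc i)) ∷ at R (suc i) ∷ on R (suc i) ∷ eq (suc i) (suc i) ∷ lo U i ∷ lo U (suc i) ∷ at U i ∷ [])
        (λ a b r1 o0 e c d r2 a1 o1 e′ x y au → (a :≡ r1) ∷ (b :≡ e :+ o0) ∷ (e :≡ lit 1) ∷ (c :+ d :≤ y) ∷ (c :≡ r2) ∷ (e′ :≡ lit 1) ∷ (d :≡ e′ :+ o1) ∷ (r2 :≡ r1 :+ a1) ∷ (y :≡ x :+ au) ∷ (au :≡ lit 0) ∷ (o0 :≡ lit 0) ∷ [] ⊢ a :+ b :≤ x)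
        (w′.lo+ (suc i)) (w′.on+ i) (eq-refl i) (F (suc i)) (w.lo+ (suc (suc i))) (eq-refl (suc i)) (w.on+ (suc i)) (lo-suc R (suc i)) (lo-suc U i) n1 n2
    from : Lat U W′ → Lat U W
    from (lat F G G′) = lat f g g′
      where
      f : ∀ r → lo W (suc r) + on W r ≤ lo U r
      f r with r ≟ suc i
      ... | no n = lia (lo W′ (suc r) ∷ on W′ r ∷ lo W (suc r) ∷ on W r ∷ lo U r ∷ lo R (suc r) ∷ on R r ∷ eq i r ∷ eq (suc i) r ∷ [])
        (λ a b c d x p q e e′ → (a :+ b :≤ x) ∷ (a :≡ p) ∷ (c :≡ p) ∷ (b :≡ e :+ q) ∷ (d :≡ e′ :+ q) ∷ (e′ :≡ lit 0) ∷ [] ⊢ c :+ d :≤ x)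
        (F r) (w′.lo+ (suc r)) (w.lo+ (suc r)) (w′.on+ r) (w.on+ r) (eq-≢ (λ e → n (sym e)))
      ... | yes refl = lia (lo W′ (suc i) ∷ on W′ i ∷ lo R (suc i) ∷ on R i ∷ eq i i ∷ lo W (suc (suc i)) ∷ on W (suc i) ∷ lo R (suc (suc i)) ∷ at R (suc i) ∷ on R (suc i) ∷ eq (suc i) (suc i) ∷ lo U i ∷ lo U (suc i) ∷ [])
        (λ a b r1 o0 e c d r2 a1 o1 e′ x y → (a :≡ r1) ∷ (b :≡ e :+ o0) ∷ (e :≡ lit 1) ∷ (a :+ b :≤ x) ∷ (c :≡ r2) ∷ (e′ :≡ lit 1) ∷ (d :≡ e′ :+ o1) ∷ (r2 :≡ r1 :+ a1) ∷ (a1 :≡ lit 0) ∷ (o1 :≡ lit 0) ∷ (x :≤ y) ∷ [] ⊢ c :+ d :≤ y)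
        (w′.lo+ (suc i)) (w′.on+ i) (eq-refl i) (F i) (w.lo+ (suc (suc i))) (eq-refl (suc i)) (w.on+ (suc i)) (lo-suc R (suc i)) n3 n4 (lo-mono U (n≤1+n i))
      key : suc (all W + hi W′ (suc i)) ≤ all U + hi U (suc i)
      key with 1 ≤? on U i
      ... | no z = lia (all W′ ∷ all W ∷ hi W′ i ∷ on W′ i ∷ hi W′ (suc i) ∷ all U ∷ hi U i ∷ on U i ∷ hi U (suc i) ∷ eq i i ∷ on R i ∷ [])
               (λ t t′ h0 o h1 u v0 p v1 e q → (t :+ h0 :≤ u :+ v0) ∷ (t :≡ t′) ∷ (h0 :≡ o :+ h1) ∷ (o :≡ e :+ q) ∷ (e :≡ lit 1) ∷ (v0 :≡ p :+ v1) ∷ (p :< lit 1) ∷ [] ⊢ lit 1 :+ (t′ :+ h1) :≤ u :+ v1)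
               (G i) all-same (hi-suc W′ i) (w′.on+ i) (eq-refl i) (hi-suc U i) (≰⇒> z)
      ... | yes z with n5 z
      ...   | inj₁ y = lia (all W′ ∷ all W ∷ hi W′ (suc i) ∷ on W′ (suc i) ∷ hi W′ (suc (suc i)) ∷ eq i (suc i) ∷ on R (suc i) ∷ all U ∷ hi U (suc i) ∷ [])
               (λ t t′ h1 o h2 e q u v → (lit 1 :+ (t :+ h2) :≤ u :+ v) ∷ (t :≡ t′) ∷ (h1 :≡ o :+ h2) ∷ (o :≡ e :+ q) ∷ (e :≡ lit 0) ∷ (q :≡ lit 0) ∷ [] ⊢ lit 1 :+ (t′ :+ h1) :≤ u :+ v)
               (G′ (suc i) y) all-same (hi-suc W′ (suc i)) (w′.on+ (suc i)) (eq-≢ {i} (λ e → 1+n≢n (sym e))) n4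
      ...   | inj₂ y = lia (all W′ ∷ all W ∷ hi W′ (suc i) ∷ on W′ (suc i) ∷ hi W′ (suc (suc i)) ∷ eq i (suc i) ∷ on R (suc i) ∷ all U ∷ hi U (suc i) ∷ on U (suc i) ∷ hi U (suc (suc i)) ∷ [])
               (λ t t′ h1 o h2 e q u v p v2 → (t :+ h2 :≤ u :+ v2) ∷ (t :≡ t′) ∷ (h1 :≡ o :+ h2) ∷ (o :≡ e :+ q) ∷ (e :≡ lit 0) ∷ (q :≡ lit 0) ∷ (v :≡ p :+ v2) ∷ (lit 1 :≤ p) ∷ [] ⊢ lit 1 :+ (t′ :+ h1) :≤ u :+ v)
               (G (suc (suc i))) all-same (hi-suc W′ (suc i)) (w′.on+ (suc i)) (eq-≢ {i} (λ e → 1+n≢n (sym e))) n4 (hi-suc U (suc i)) y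
      g : ∀ r → all W + hi W r ≤ all U + hi U r
      g r with r ≟ suc i
      ... | no n = subst₂ (λ t h → t + h ≤ all U + hi U r) all-same (sym (trans (raised r) (cong (_+ hi W′ r) (eq-≢ (λ e → n (sym e)))))) (G r)
      ... | yes refl = lia (all W ∷ hi W (suc i) ∷ hi W′ (suc i) ∷ eq (suc i) (suc i) ∷ all U ∷ hi U (suc i) ∷ [])
        (λ t h h′ e u v → (lit 1 :+ (t :+ h′) :≤ u :+ v) ∷ (h :≡ e :+ h′) ∷ (e :≡ lit 1) ∷ [] ⊢ t :+ h :≤ u :+ v) key (raised (suc i)) (eq-refl (suc i))
      g′ : ∀ r → 1 ≤ at U r → suc (all W + hi W (suc r)) ≤ all U + hi U r
      g′ r x = subst₂ (λ t h → suc (t + h) ≤ all U + hi U r) all-same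
        (sym (trans (raised (suc r)) (cong (_+ hi W′ (suc r)) (eq-≢ {suc i} {suc r} λ { refl → <⇒≱ x (≤-reflexive n1) })))) (G′ r x)

module _ {R U₁ U U₁′ U′ W : List Ent} {i : ℕ} (u₁ : PlusUn (suc i) R U₁) (u : PlusPr i U₁ U) (u₁′ : PlusUn i R U₁′) (u′ : PlusUn i U₁′ U′) where

  private
    module u₁ = PlusUn u₁
    module u = PlusPr u
    module u₁′ = PlusUn u₁′
    module u′ = PlusUn u′
    loU : ∀ r → lo U r ≡ lt (suc i) r + lo R r
    loU r = trans (u.lo+ r) (u₁.lo+ r)
    loU′ : ∀ r → lo U′ r ≡ lt i r + (lt i r + lo R r)
    loU′ r = trans (u′.lo+ r) (cong (lt i r +_) (u₁′.lo+ r))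
    allU : all U ≡ suc (all R)
    allU = trans u.all+ u₁.all+
    allU′ : all U′ ≡ suc (suc (all R))
    allU′ = trans u′.all+ (cong suc u₁′.all+)
    hiU : ∀ r → hi U r ≡ ge i r + hi R r
    hiU r = trans (u.hi+ r) (cong (ge i r +_) (u₁.hi+ r))
    hiU′ : ∀ r → hi U′ r ≡ hi R r
    hiU′ r = trans (u′.hi+ r) (u₁′.hi+ r)
    ge≤1 : ∀ r → ge i r ≤ 1
    ge≤1 r = ι≤1 (not (i <ᵇ r))
    ge-true : ∀ {r} → r ≤ i → ge i r ≡ 1
    ge-true {r} l = trans (sym (+-identityʳ _)) (trans (cong (ge i r +_) (sym (lt-false l))) (ge-lt i r))

  -- A primed box in row i and an unprimed one in row i + 1 become two unprimed boxes in row i. The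
  -- rest of the band has no primed box from row i on and no unprimed box below row i + 1. So for
  -- the way back `G′` at i yields the bound `mid`, which controls the later rows.
  U-hook : on W (suc i) + at W (suc i) ≤ at R i + on W i → on W (suc i) ≤ 1 → hi R i ≡ 0 → all R ≤ lo R (suc (suc i)) →
    (on W (suc i) ≡ 0 → hi W (suc (suc i)) ≡ 0 × all W ≤ lo W (suc (suc i))) → (Lat U W → Lat U′ W) × (Lat U′ W → Lat U W)
  U-hook p1 p2 p3 p4 p5 = to , from
    where
    to : Lat U W → Lat U′ W
    to (lat F G G′) = lat
      (λ r → lia (lo W (suc r) ∷ on W r ∷ lo U r ∷ lo U′ r ∷ lo R r ∷ lt i r ∷ lt (suc i) r ∷ eq (suc i) r ∷ [])
        (λ a b x x′ z l l′ q → (a :+ b :≤ x) ∷ (x :≡ l′ :+ z) ∷ (x′ :≡ l :+ (l :+ z)) ∷ (l :≡ l′ :+ q) ∷ [] ⊢ a :+ b :≤ x′) (F r) (loU r) (loU′ r) (lt-suc i r))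
      (λ r → lia (all W ∷ hi W r ∷ all U ∷ hi U r ∷ all U′ ∷ hi U′ r ∷ all R ∷ hi R r ∷ ge i r ∷ [])
        (λ w h u v u′ v′ t z g → (w :+ h :≤ u :+ v) ∷ (u :≡ lit 1 :+ t) ∷ (v :≡ g :+ z) ∷ (u′ :≡ lit 2 :+ t) ∷ (v′ :≡ z) ∷ (g :≤ lit 1) ∷ [] ⊢ w :+ h :≤ u′ :+ v′)
        (G r) allU (hiU r) allU′ (hiU′ r) (ge≤1 r))
      g′
      where
      g′ : ∀ r → 1 ≤ at U′ r → suc (all W + hi W (suc r)) ≤ all U′ + hi U′ r
      g′ r x with r ≟ i
      ... | no n = lia (all W ∷ hi W (suc r) ∷ all U ∷ hi U r ∷ all U′ ∷ hi U′ r ∷ all R ∷ hi R r ∷ ge i r ∷ [])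
        (λ w h u v u′ v′ t z g → (lit 1 :+ (w :+ h) :≤ u :+ v) ∷ (u :≡ lit 1 :+ t) ∷ (v :≡ g :+ z) ∷ (u′ :≡ lit 2 :+ t) ∷ (v′ :≡ z) ∷ (g :≤ lit 1) ∷ [] ⊢ lit 1 :+ (w :+ h) :≤ u′ :+ v′)
        (G′ r (subst (1 ≤_) (sym (u.at+ r)) (at⁺ u₁ (at⁻ u₁′ (at⁻ u′ x n) n)))) allU (hiU r) allU′ (hiU′ r) (ge≤1 r)
      ... | yes refl = lia (all W ∷ hi W (suc i) ∷ on W (suc i) ∷ hi W (suc (suc i)) ∷ all U ∷ hi U (suc i) ∷ all U′ ∷ hi U′ i ∷ all R ∷ hi R i ∷ hi R (suc i) ∷ ge i (suc i) ∷ lt i (suc i) ∷ [])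
        (λ w h o h2 u v u′ v′ t z0 z1 g l → (lit 1 :+ (w :+ h2) :≤ u :+ v) ∷ (h :≡ o :+ h2) ∷ (o :≤ lit 1) ∷ (u :≡ lit 1 :+ t) ∷ (v :≡ g :+ z1) ∷ (g :+ l :≡ lit 1) ∷ (l :≡ lit 1) ∷ (u′ :≡ lit 2 :+ t) ∷ (v′ :≡ z0) ∷ (z1 :≤ z0) ∷ [] ⊢ lit 1 :+ (w :+ h) :≤ u′ :+ v′)
        (G′ (suc i) (subst (1 ≤_) (sym (u.at+ (suc i))) (at-new u₁))) (hi-suc W (suc i)) p2 allU (hiU (suc i)) (ge-lt i (suc i)) (lt-true (n<1+n i)) allU′ (hiU′ i) (hi-anti R (n≤1+n i))
    from : Lat U′ W → Lat U W
    from (lat F G G′) = lat f g g′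
      where
      mid : all W + hi W (suc i) ≤ suc (all R)
      mid = lia (all W ∷ hi W (suc i) ∷ all U′ ∷ hi U′ i ∷ all R ∷ hi R i ∷ [])
        (λ w h u v t z → (lit 1 :+ (w :+ h) :≤ u :+ v) ∷ (u :≡ lit 2 :+ t) ∷ (v :≡ z) ∷ (z :≡ lit 0) ∷ [] ⊢ w :+ h :≤ lit 1 :+ t)
        (G′ i (at-new u′)) allU′ (hiU′ i) p3
      f : ∀ r → lo W (suc r) + on W r ≤ lo U r
      f r with <-cmp r (suc i)
      ... | tri< l _ _ = lia (lo W (suc r) ∷ on W r ∷ lo U r ∷ lo U′ r ∷ lo R r ∷ lt i r ∷ [])
        (λ a b x x′ z l → (a :+ b :≤ x′) ∷ (z :≤ x) ∷ (x′ :≡ l :+ (l :+ z)) ∷ (l :≡ lit 0) ∷ [] ⊢ a :+ b :≤ x)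
        (F r) (≤-trans (m≤n+m _ _) (≤-reflexive (sym (loU r)))) (loU′ r) (lt-false (≤-pred l))
      ... | tri≈ _ refl _ = lia (lo W (suc (suc i)) ∷ on W (suc i) ∷ lo W (suc i) ∷ at W (suc i) ∷ on W i ∷ lo U′ i ∷ lo R i ∷ at R i ∷ lo R (suc i) ∷ lo U (suc i) ∷ lt i i ∷ [])
        (λ w2 o1 w1 a1 o0 u0 r0 ar r1 u1 l → (w1 :+ o0 :≤ u0) ∷ (u0 :≡ l :+ (l :+ r0)) ∷ (l :≡ lit 0) ∷ (w2 :≡ w1 :+ a1) ∷ (o1 :+ a1 :≤ ar :+ o0) ∷ (r1 :≡ r0 :+ ar) ∷ (r1 :≤ u1) ∷ [] ⊢ w2 :+ o1 :≤ u1)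
        (F i) (loU′ i) (lt-false (≤-refl {i})) (lo-suc W (suc i)) p1 (lo-suc R i) (≤-trans (m≤n+m _ _) (≤-reflexive (sym (loU (suc i)))))
      ... | tri> _ _ l = lia (lo W (suc r) ∷ on W r ∷ all W ∷ hi W r ∷ hi W (suc r) ∷ hi W (suc i) ∷ all R ∷ lo R (suc (suc i)) ∷ lo R r ∷ lo U r ∷ lt (suc i) r ∷ [])
        (λ a b w hr hr′ h t z z′ x l → (w :+ h :≤ lit 1 :+ t) ∷ (a :≤ w) ∷ (hr :≡ b :+ hr′) ∷ (hr :≤ h) ∷ (t :≤ z) ∷ (z :≤ z′) ∷ (x :≡ l :+ z′) ∷ (l :≡ lit 1) ∷ [] ⊢ a :+ b :≤ x)
        mid (lo≤all W (suc r)) (hi-suc W r) (hi-anti W (<⇒≤ l)) p4 (lo-mono R l) (loU r) (lt-true l)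
      g : ∀ r → all W + hi W r ≤ all U + hi U r
      g r with r ≤? i
      ... | yes l = lia (all W ∷ hi W r ∷ all U ∷ hi U r ∷ all U′ ∷ hi U′ r ∷ all R ∷ hi R r ∷ ge i r ∷ [])
        (λ w h u v u′ v′ t z g → (w :+ h :≤ u′ :+ v′) ∷ (u :≡ lit 1 :+ t) ∷ (v :≡ g :+ z) ∷ (u′ :≡ lit 2 :+ t) ∷ (v′ :≡ z) ∷ (g :≡ lit 1) ∷ [] ⊢ w :+ h :≤ u :+ v)
        (G r) allU (hiU r) allU′ (hiU′ r) (ge-true l)
      ... | no n = lia (all W ∷ hi W r ∷ hi W (suc i) ∷ all U ∷ hi U r ∷ all R ∷ [])
        (λ w h h1 u v t → (w :+ h1 :≤ lit 1 :+ t) ∷ (h :≤ h1) ∷ (u :≡ lit 1 :+ t) ∷ [] ⊢ w :+ h :≤ u :+ v) mid (hi-anti W (≰⇒> n)) allU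
      g′ : ∀ r → 1 ≤ at U r → suc (all W + hi W (suc r)) ≤ all U + hi U r
      g′ r x with <-cmp r (suc i)
      ... | tri< l n _ = lia (all W ∷ hi W (suc r) ∷ all U ∷ hi U r ∷ all U′ ∷ hi U′ r ∷ all R ∷ hi R r ∷ ge i r ∷ [])
        (λ w h u v u′ v′ t z g → (lit 1 :+ (w :+ h) :≤ u′ :+ v′) ∷ (u :≡ lit 1 :+ t) ∷ (v :≡ g :+ z) ∷ (u′ :≡ lit 2 :+ t) ∷ (v′ :≡ z) ∷ (g :≡ lit 1) ∷ [] ⊢ lit 1 :+ (w :+ h) :≤ u :+ v)
        (G′ r (at⁺ u′ (at⁺ u₁′ (at⁻ u₁ (subst (1 ≤_) (u.at+ r) x) n)))) allU (hiU r) allU′ (hiU′ r) (ge-true (≤-pred l))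
      ... | tri> _ n l = ⊥-elim (<⇒≱ (at⁻ u₁ (subst (1 ≤_) (u.at+ r) x) n)
        (lia (lo R (suc r) ∷ lo R r ∷ at R r ∷ all R ∷ lo R (suc (suc i)) ∷ []) (λ a b c t z → (a :≡ b :+ c) ∷ (a :≤ t) ∷ (t :≤ z) ∷ (z :≤ b) ∷ [] ⊢ c :≤ lit 0)
          (lo-suc R r) (lo≤all R (suc r)) p4 (lo-mono R l)))
      ... | tri≈ _ refl _ with 1 ≤? on W (suc i)
      ...   | yes z = lia (all W ∷ hi W (suc (suc i)) ∷ hi W (suc i) ∷ on W (suc i) ∷ all U ∷ hi U (suc i) ∷ all R ∷ [])
              (λ w h2 h1 o u v t → (w :+ h1 :≤ lit 1 :+ t) ∷ (h1 :≡ o :+ h2) ∷ (lit 1 :≤ o) ∷ (u :≡ lit 1 :+ t) ∷ [] ⊢ lit 1 :+ (w :+ h2) :≤ u :+ v) mid (hi-suc W (suc i)) z allU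
      ...   | no z with h0 , a0 ← p5 (n≤0⇒n≡0 (≤-pred (≰⇒> z))) =
              lia (all W ∷ hi W (suc (suc i)) ∷ lo W (suc (suc i)) ∷ on W (suc i) ∷ lo U (suc i) ∷ lo R (suc i) ∷ all U ∷ hi U (suc i) ∷ all R ∷ lt (suc i) (suc i) ∷ [])
              (λ w h w2 o x z u v t l → (w2 :+ o :≤ x) ∷ (x :≡ l :+ z) ∷ (l :≡ lit 0) ∷ (z :≤ t) ∷ (w :≤ w2) ∷ (h :≡ lit 0) ∷ (u :≡ lit 1 :+ t) ∷ [] ⊢ lit 1 :+ (w :+ h) :≤ u :+ v)
              (f (suc i)) (loU (suc i)) (lt-false (≤-refl {suc i})) (lo≤all R (suc i)) a0 h0 allU

module _ {R W₁ W W₁′ W′ U : List Ent} {i : ℕ} (w₁ : PlusUn (suc i) R W₁) (w : PlusPr i W₁ W) (w₁′ : PlusUn i R W₁′) (w′ : PlusUn i W₁′ W′) where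

  private
    module w₁ = PlusUn w₁
    module w = PlusPr w
    module w₁′ = PlusUn w₁′
    module w′ = PlusUn w′
    loW : ∀ r → lo W r ≡ lt (suc i) r + lo R r
    loW r = trans (w.lo+ r) (w₁.lo+ r)
    loW′ : ∀ r → lo W′ r ≡ lt i r + (lt i r + lo R r)
    loW′ r = trans (w′.lo+ r) (cong (lt i r +_) (w₁′.lo+ r))
    allW : all W ≡ suc (all R)
    allW = trans w.all+ w₁.all+
    allW′ : all W′ ≡ suc (suc (all R))
    allW′ = trans w′.all+ (cong suc w₁′.all+)
    hiW : ∀ r → hi W r ≡ ge i r + hi R r
    hiW r = trans (w.hi+ r) (cong (ge i r +_) (w₁.hi+ r))
    hiW′ : ∀ r → hi W′ r ≡ hi R r
    hiW′ r = trans (w′.hi+ r) (w₁′.hi+ r)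
    onW : ∀ r → on W r ≡ eq i r + on R r
    onW r = trans (w.on+ r) (cong (eq i r +_) (w₁.on+ r))
    onW′ : ∀ r → on W′ r ≡ on R r
    onW′ r = trans (w′.on+ r) (w₁′.on+ r)
    ge≤1 : ∀ r → ge i r ≤ 1
    ge≤1 r = ι≤1 (not (i <ᵇ r))
    ge-true : ∀ {r} → r ≤ i → ge i r ≡ 1
    ge-true {r} l = trans (sym (+-identityʳ _)) (trans (cong (ge i r +_) (sym (lt-false l))) (ge-lt i r))

  -- `U` lies above row i, so from row i on its counts are complete and the bound `mid`, which is
  -- `G` at i, settles all inequalities. Up to row i the primed box lost and the unprimed box gained
  -- balance in `G`.
  W-hook : all U ≤ lo U i → hi U i ≡ 0 → (Lat U W → Lat U W′) × (Lat U W′ → Lat U W)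
  W-hook q1 q2 = to , from
    where
    to : Lat U W → Lat U W′
    to (lat F G G′) = lat f g g′
      where
      mid : suc (suc (all R + hi R i)) ≤ lo U i
      mid = lia (all W ∷ hi W i ∷ all R ∷ hi R i ∷ ge i i ∷ all U ∷ hi U i ∷ lo U i ∷ [])
        (λ w h t z g u v x → (w :+ h :≤ u :+ v) ∷ (w :≡ lit 1 :+ t) ∷ (h :≡ g :+ z) ∷ (g :≡ lit 1) ∷ (v :≡ lit 0) ∷ (u :≤ x) ∷ [] ⊢ lit 2 :+ (t :+ z) :≤ x)
        (G i) allW (hiW i) (ge-true ≤-refl) q2 q1
      f : ∀ r → lo W′ (suc r) + on W′ r ≤ lo U r
      f r with i ≤? r
      ... | no n = lia (lo W′ (suc r) ∷ on W′ r ∷ lo W (suc r) ∷ on W r ∷ lo U r ∷ lo R (suc r) ∷ on R r ∷ lt i (suc r) ∷ lt (suc i) (suc r) ∷ eq i r ∷ [])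
        (λ a b c d x p q l l′ e → (c :+ d :≤ x) ∷ (a :≡ l :+ (l :+ p)) ∷ (c :≡ l′ :+ p) ∷ (b :≡ q) ∷ (d :≡ e :+ q) ∷ (l :≡ lit 0) ∷ [] ⊢ a :+ b :≤ x)
        (F r) (loW′ (suc r)) (loW (suc r)) (onW′ r) (onW r) (lt-false (≰⇒> n))
      ... | yes l = lia (lo W′ (suc r) ∷ on W′ r ∷ lo R (suc r) ∷ on R r ∷ all R ∷ hi R r ∷ hi R (suc r) ∷ hi R i ∷ lo U i ∷ lo U r ∷ lt i (suc r) ∷ [])
        (λ a b p q t hr hr′ h x x′ l → (lit 2 :+ (t :+ h) :≤ x) ∷ (a :≡ l :+ (l :+ p)) ∷ (l :≤ lit 1) ∷ (b :≡ q) ∷ (p :≤ t) ∷ (hr :≡ q :+ hr′) ∷ (hr :≤ h) ∷ (x :≤ x′) ∷ [] ⊢ a :+ b :≤ x′)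
        mid (loW′ (suc r)) (ι≤1 (i <ᵇ suc r)) (onW′ r) (lo≤all R (suc r)) (hi-suc R r) (hi-anti R l) (lo-mono U l)
      g : ∀ r → all W′ + hi W′ r ≤ all U + hi U r
      g r with r ≤? i
      ... | yes l = lia (all W ∷ hi W r ∷ all U ∷ hi U r ∷ all W′ ∷ hi W′ r ∷ all R ∷ hi R r ∷ ge i r ∷ [])
        (λ w h u v w′ h′ t z g → (w :+ h :≤ u :+ v) ∷ (w :≡ lit 1 :+ t) ∷ (h :≡ g :+ z) ∷ (w′ :≡ lit 2 :+ t) ∷ (h′ :≡ z) ∷ (g :≡ lit 1) ∷ [] ⊢ w′ :+ h′ :≤ u :+ v)
        (G r) allW (hiW r) allW′ (hiW′ r) (ge-true l)
      ... | no n = lia (all R ∷ hi R i ∷ lo U i ∷ all U ∷ hi U r ∷ all W′ ∷ hi W′ r ∷ hi R r ∷ [])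
        (λ t z x u v w′ h′ z′ → (lit 2 :+ (t :+ z) :≤ x) ∷ (x :≤ u) ∷ (w′ :≡ lit 2 :+ t) ∷ (h′ :≡ z′) ∷ (z′ :≤ z) ∷ [] ⊢ w′ :+ h′ :≤ u :+ v)
        mid (lo≤all U i) allW′ (hiW′ r) (hi-anti R (<⇒≤ (≰⇒> n)))
      g′ : ∀ r → 1 ≤ at U r → suc (all W′ + hi W′ (suc r)) ≤ all U + hi U r
      g′ r x with i ≤? r
      ... | yes l = ⊥-elim (<⇒≱ x (lia (lo U (suc r) ∷ lo U r ∷ at U r ∷ all U ∷ lo U i ∷ []) (λ a b c t z → (a :≡ b :+ c) ∷ (a :≤ t) ∷ (t :≤ z) ∷ (z :≤ b) ∷ [] ⊢ c :≤ lit 0)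
          (lo-suc U r) (lo≤all U (suc r)) q1 (lo-mono U l)))
      ... | no n = lia (all W ∷ hi W (suc r) ∷ all U ∷ hi U r ∷ all W′ ∷ hi W′ (suc r) ∷ all R ∷ hi R (suc r) ∷ ge i (suc r) ∷ [])
        (λ w h u v w′ h′ t z g → (lit 1 :+ (w :+ h) :≤ u :+ v) ∷ (w :≡ lit 1 :+ t) ∷ (h :≡ g :+ z) ∷ (w′ :≡ lit 2 :+ t) ∷ (h′ :≡ z) ∷ (g :≡ lit 1) ∷ [] ⊢ lit 1 :+ (w′ :+ h′) :≤ u :+ v)
        (G′ r x) allW (hiW (suc r)) allW′ (hiW′ (suc r)) (ge-true (≰⇒> n))
    from : Lat U W′ → Lat U W
    from (lat F G G′) = lat
      (λ r → lia (lo W′ (suc r) ∷ on W′ r ∷ lo W (suc r) ∷ on W r ∷ lo U r ∷ lo R (suc r) ∷ on R r ∷ lt i (suc r) ∷ lt (suc i) (suc r) ∷ eq i r ∷ [])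
        (λ a b c d x p q l l′ e → (a :+ b :≤ x) ∷ (a :≡ l :+ (l :+ p)) ∷ (c :≡ l′ :+ p) ∷ (b :≡ q) ∷ (d :≡ e :+ q) ∷ (l :≡ l′ :+ e) ∷ [] ⊢ c :+ d :≤ x)
        (F r) (loW′ (suc r)) (loW (suc r)) (onW′ r) (onW r) (lt-suc i (suc r)))
      (λ r → lia (all W ∷ hi W r ∷ all U ∷ hi U r ∷ all W′ ∷ hi W′ r ∷ all R ∷ hi R r ∷ ge i r ∷ [])
        (λ w h u v w′ h′ t z g → (w′ :+ h′ :≤ u :+ v) ∷ (w :≡ lit 1 :+ t) ∷ (h :≡ g :+ z) ∷ (w′ :≡ lit 2 :+ t) ∷ (h′ :≡ z) ∷ (g :≤ lit 1) ∷ [] ⊢ w :+ h :≤ u :+ v)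
        (G r) allW (hiW r) allW′ (hiW′ r) (ge≤1 r))
      λ r x → lia (all W ∷ hi W (suc r) ∷ all U ∷ hi U r ∷ all W′ ∷ hi W′ (suc r) ∷ all R ∷ hi R (suc r) ∷ ge i (suc r) ∷ [])
        (λ w h u v w′ h′ t z g → (lit 1 :+ (w′ :+ h′) :≤ u :+ v) ∷ (w :≡ lit 1 :+ t) ∷ (h :≡ g :+ z) ∷ (w′ :≡ lit 2 :+ t) ∷ (h′ :≡ z) ∷ (g :≤ lit 1) ∷ [] ⊢ lit 1 :+ (w :+ h) :≤ u :+ v)
        (G′ r x) allW (hiW (suc r)) allW′ (hiW′ (suc r)) (ge≤1 (suc r))

-- Counting boxes by injections

cnt-zero : ∀ f X → (∀ {e} → e ∈ X → f e ≡ true → ⊥) → cnt f X ≡ 0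
cnt-zero f [] h = refl
cnt-zero f (e ∷ X) h with f e in q
... | true = ⊥-elim (h (here refl) q)
... | false = cnt-zero f X (λ m → h (there m))

cnt-some : ∀ f X → 1 ≤ cnt f X → ∃ λ e → e ∈ X × f e ≡ true
cnt-some f (e ∷ X) l with f e in q
... | true = e , here refl , q
... | false with x , m , p ← cnt-some f X l = x , there m , p

cnt-one : ∀ f X {e} → e ∈ X → f e ≡ true → 1 ≤ cnt f X
cnt-one f (e ∷ X) (here refl) q rewrite q = s≤s z≤n
cnt-one f (x ∷ X) (there m) q = ≤-trans (cnt-one f X m q) (m≤n+m _ _)

cnt-≤ : ∀ f g X → (∀ {e} → e ∈ X → f e ≡ true → g e ≡ true) → cnt f X ≤ cnt g X
cnt-≤ f g [] h = z≤n
cnt-≤ f g (e ∷ X) h with f e in q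
... | true rewrite h (here refl) q = s≤s (cnt-≤ f g X (λ m → h (there m)))
... | false = ≤-trans (cnt-≤ f g X (λ m → h (there m))) (m≤n+m _ _)

cnt-≤1 : ∀ f X → AllPairs (λ x y → f x ≡ true → f y ≡ true → ⊥) X → cnt f X ≤ 1
cnt-≤1 f [] _ = z≤n
cnt-≤1 f (e ∷ X) (p ∷ ps) with f e in q
... | true = s≤s (≤-reflexive (cnt-zero f X λ m r → All.lookup p m refl r))
... | false = cnt-≤1 f X ps

-- Counts become lengths of lists without repetition, so that an inequality between them can be
-- proved by an injection of positions.
select : (Ent → Bool) → List Ent → List Pos
select f [] = []
select f (e ∷ X) with f e
... | true = pos e ∷ select f X
... | false = select f X

length-select : ∀ f X → length (select f X) ≡ cnt f X
length-select f [] = refl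
length-select f (e ∷ X) with f e
... | true = cong suc (length-select f X)
... | false = length-select f X

select⁻ : ∀ f X {p} → p ∈ select f X → ∃ λ k → (p , k) ∈ X × f (p , k) ≡ true
select⁻ f (e ∷ X) m with f e in q
select⁻ f (e ∷ X) (here refl) | true = _ , here refl , q
select⁻ f (e ∷ X) (there m) | true with k , n , r ← select⁻ f X m = k , there n , r
select⁻ f (e ∷ X) m | false with k , n , r ← select⁻ f X m = k , there n , r

select⁺ : ∀ f X {p k} → (p , k) ∈ X → f (p , k) ≡ true → p ∈ select f X
select⁺ f (e ∷ X) (here refl) q rewrite q = here refl
select⁺ f (e ∷ X) (there m) q with f e
... | true = there (select⁺ f X m q)
... | false = select⁺ f X m q

select-distinct : ∀ f X → AllPairs _≢_ (positions X) → AllPairs _≢_ (select f X)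
select-distinct f [] _ = []
select-distinct f (e ∷ X) (p ∷ ps) with f e
... | true = All.tabulate (λ m → let k , n , _ = select⁻ f X m in All.lookup p (∈-map⁺ pos n)) ∷ select-distinct f X ps
... | false = select-distinct f X ps

subset-length : ∀ (X Y : List Pos) → AllPairs _≢_ X → (∀ {p} → p ∈ X → p ∈ Y) → length X ≤ length Y
subset-length [] Y _ h = z≤n
subset-length (x ∷ X) Y (p ∷ ps) h with Y₁ , Y₂ , refl ← ∈-∃++ (h (here refl)) =
  ≤-trans (s≤s (subset-length X (Y₁ ++ Y₂) ps inner))
    (≤-reflexive (trans (cong suc (length-++ Y₁)) (sym (trans (length-++ Y₁) (+-suc _ _)))))
  where
  inner : ∀ {q} → q ∈ X → q ∈ Y₁ ++ Y₂
  inner m with ∈-++⁻ Y₁ (h (there m))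
  ... | inj₁ n = ∈-++⁺ˡ n
  ... | inj₂ (here refl) = ⊥-elim (All.lookup p m refl)
  ... | inj₂ (there n) = ∈-++⁺ʳ Y₁ n

rowᵇ : ℕ → Ent → Bool
rowᵇ r (p , k) = row p ≡ᵇ r

row-split₂ : ∀ X r → cnt (rowᵇ r) X ≡ on X r + at X r
row-split₂ [] r = refl
row-split₂ ((p , dn) ∷ X) r = trans (cong (ι (row p ≡ᵇ r) +_) (row-split₂ X r)) (sym (+-assoc (ι (row p ≡ᵇ r)) _ _))
row-split₂ ((p , up) ∷ X) r = trans (cong (ι (row p ≡ᵇ r) +_) (row-split₂ X r)) (exch (ι (row p ≡ᵇ r)) (on X r) (at X r))
  where
  exch : ∀ a b c → a + (b + c) ≡ b + (a + c)
  exch a b c = lia (a ∷ b ∷ c ∷ []) (λ a b c → [] ⊢ a :+ (b :+ c) :≡ b :+ (a :+ c))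
row-split₂ ((p , vl _) ∷ X) r = trans (cong (ι (row p ≡ᵇ r) +_) (row-split₂ X r)) (exch (ι (row p ≡ᵇ r)) (on X r) (at X r))
  where
  exch : ∀ a b c → a + (b + c) ≡ b + (a + c)
  exch a b c = lia (a ∷ b ∷ c ∷ []) (λ a b c → [] ⊢ a :+ (b :+ c) :≡ b :+ (a :+ c))

≡ᵇ-true : ∀ {m n} → (m ≡ᵇ n) ≡ true → m ≡ n
≡ᵇ-true {zero} {zero} e = refl
≡ᵇ-true {suc m} {suc n} e = cong suc (≡ᵇ-true e)

<ᵇ-true : ∀ {m n} → m < n → (m <ᵇ n) ≡ true
<ᵇ-true {zero} (s≤s _) = refl
<ᵇ-true {suc m} (s≤s l) = <ᵇ-true l

<ᵇ-not : ∀ {m n} → not (m <ᵇ n) ≡ true → n ≤ m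
<ᵇ-not {m} {zero} e = z≤n
<ᵇ-not {suc m} {suc n} e = s≤s (<ᵇ-not e)

at-sound : ∀ r p k → atᵇ r (p , k) ≡ true → k ≢ dn × row p ≡ r
at-sound r p up e = (λ ()) , ≡ᵇ-true e
at-sound r p (vl _) e = (λ ()) , ≡ᵇ-true e

on-sound : ∀ r p k → onᵇ r (p , k) ≡ true → k ≡ dn × row p ≡ r
on-sound r p dn e = refl , ≡ᵇ-true e

hi-sound : ∀ r p k → hiᵇ r (p , k) ≡ true → k ≡ dn × r ≤ row p
hi-sound r p dn e = refl , <ᵇ-not e

all-sound : ∀ p k → allᵇ (p , k) ≡ true → k ≢ dn
all-sound p up _ ()
all-sound p (vl _) _ ()

at-true : ∀ r p k → k ≢ dn → row p ≡ r → atᵇ r (p , k) ≡ true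
at-true r p dn n _ = ⊥-elim (n refl)
at-true r p up _ refl = ≡ᵇ-refl (row p)
at-true r p (vl _) _ refl = ≡ᵇ-refl (row p)

on-true : ∀ r p → row p ≡ r → onᵇ r (p , dn) ≡ true
on-true r p refl = ≡ᵇ-refl (row p)

lo-true : ∀ r p k → k ≢ dn → row p < r → loᵇ r (p , k) ≡ true
lo-true r p dn n _ = ⊥-elim (n refl)
lo-true r p up _ l = <ᵇ-true l
lo-true r p (vl _) _ l = <ᵇ-true l

on-some : ∀ X r → 1 ≤ on X r → ∃ λ p → (p , dn) ∈ X × row p ≡ r
on-some X r l with (p , k) , m , t ← cnt-some (onᵇ r) X l with refl , e ← on-sound r p k t = p , m , e

at-one : ∀ X r {p k} → (p , k) ∈ X → k ≢ dn → row p ≡ r → 1 ≤ at X r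
at-one X r {p} {k} m n e = cnt-one (atᵇ r) X m (at-true r p k n e)

on-one : ∀ X r {p} → (p , dn) ∈ X → row p ≡ r → 1 ≤ on X r
on-one X r {p} m e = cnt-one (onᵇ r) X m (on-true r p e)

at-zero : ∀ X r → (∀ {p k} → (p , k) ∈ X → k ≢ dn → row p ≢ r) → at X r ≡ 0
at-zero X r h = cnt-zero (atᵇ r) X λ { {p , k} m t → let n , e = at-sound r p k t in h m n e }

on-zero : ∀ X r → (∀ {p} → (p , dn) ∈ X → row p ≢ r) → on X r ≡ 0
on-zero X r h = cnt-zero (onᵇ r) X λ { {p , k} m t → inner m (on-sound r p k t) }
  where
  inner : ∀ {p k} → (p , k) ∈ X → k ≡ dn × row p ≡ r → ⊥
  inner m (refl , e) = h m e

hi-zero : ∀ X r → (∀ {p} → (p , dn) ∈ X → row p < r) → hi X r ≡ 0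
hi-zero X r h = cnt-zero (hiᵇ r) X λ { {p , k} m t → inner m (hi-sound r p k t) }
  where
  inner : ∀ {p k} → (p , k) ∈ X → k ≡ dn × r ≤ row p → ⊥
  inner m (refl , l) = <⇒≱ (h m) l

all≤lo : ∀ X r → (∀ {p k} → (p , k) ∈ X → k ≢ dn → row p < r) → all X ≤ lo X r
all≤lo X r h = cnt-≤ allᵇ (loᵇ r) X λ { {p , k} m t → lo-true r p k (all-sound p k t) (h m (all-sound p k t)) }

select-at : ∀ X r {p k} → (p , k) ∈ X → k ≢ dn → row p ≡ r → p ∈ select (atᵇ r) X
select-at X r {p} {k} m n e = select⁺ (atᵇ r) X m (at-true r p k n e)

select-on : ∀ X r {p} → (p , dn) ∈ X → row p ≡ r → p ∈ select (onᵇ r) X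
select-on X r {p} m e = select⁺ (onᵇ r) X m (on-true r p e)

Ordered : List Ent → Set
Ordered = AllPairs λ e f → Star e f × ¬ pos f ⊑ pos e

-- A band that has stopped descending never reaches a lower row again.
column : ∀ {X e f} → Ordered X → e ∈ X → f ∈ X → pos e ⊑ pos f → row (pos e) < row (pos f) → kind e ≡ dn
column {e = e} {f} o m n le lt with pairs-order o m n
... | inj₁ refl = ⊥-elim (<-irrefl refl lt)
... | inj₂ (inj₂ (_ , ¬le)) = ⊥-elim (¬le le)
... | inj₂ (inj₁ (st , _)) = by-kind (kind e) refl
  where
  by-kind : ∀ k → kind e ≡ k → kind e ≡ dn
  by-kind dn q = q
  by-kind up q = ⊥-elim (<⇒≱ lt (proj₁ (proj₁ (rising st (λ d → case trans (sym q) d of λ ())))))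
  by-kind (vl _) q = ⊥-elim (<⇒≱ lt (proj₁ (proj₁ (rising st (λ d → case trans (sym q) d of λ ())))))

_⇔′_ : Set → Set → Set
A ⇔′ B = (A → B) × (B → A)

⇔′-trans : ∀ {A B C} → A ⇔′ B → B ⇔′ C → A ⇔′ C
⇔′-trans (f , g) (h , k) = (λ x → h (f x)) , λ x → g (k x)

lat-same : ∀ {U U′ W W′} → (∀ r → lo U r ≡ lo U′ r) → (∀ r → at U r ≡ at U′ r) → (∀ r → hi U r ≡ hi U′ r) → all U ≡ all U′ →
  (∀ r → lo W r ≡ lo W′ r) → (∀ r → on W r ≡ on W′ r) → (∀ r → hi W r ≡ hi W′ r) → all W ≡ all W′ → Lat U W → Lat U′ W′
lat-same lu au hu tu lw ow hw tw (lat F G G′) = lat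
  (λ r → subst₂ _≤_ (cong₂ _+_ (lw (suc r)) (ow r)) (lu r) (F r))
  (λ r → subst₂ _≤_ (cong₂ _+_ tw (hw r)) (cong₂ _+_ tu (hu r)) (G r))
  (λ r x → subst₂ _≤_ (cong suc (cong₂ _+_ tw (hw (suc r)))) (cong₂ _+_ tu (hu r)) (G′ r (subst (1 ≤_) (sym (au r)) x)))

record Same (X X′ : List Ent) : Set where
  constructor same
  field
    los : ∀ r → lo X r ≡ lo X′ r
    ats : ∀ r → at X r ≡ at X′ r
    his : ∀ r → hi X r ≡ hi X′ r
    ons : ∀ r → on X r ≡ on X′ r
    alls : all X ≡ all X′

same-refl : ∀ {X} → Same X X
same-refl = same (λ _ → refl) (λ _ → refl) (λ _ → refl) (λ _ → refl) refl

same-sym : ∀ {X Y} → Same X Y → Same Y X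
same-sym (same a b c d e) = same (λ r → sym (a r)) (λ r → sym (b r)) (λ r → sym (c r)) (λ r → sym (d r)) (sym e)

lat-cong : ∀ {U U′ W W′} → Same U U′ → Same W W′ → Lat U W ⇔′ Lat U′ W′
lat-cong s t = half s t , half (same-sym s) (same-sym t)
  where
  half : ∀ {U U′ W W′} → Same U U′ → Same W W′ → Lat U W → Lat U′ W′
  half (same a b c d e) (same a′ b′ c′ d′ e′) = lat-same a b c e a′ d′ c′ e′

same-row : ∀ Z {p q k} Y → row p ≡ row q → Same (Z ʳ++ ((p , k) ∷ Y)) (Z ʳ++ ((q , k) ∷ Y))
same-row Z {p} {q} {k} Y e = same (λ r → go′ (loᵇ r) (cong (λ j → not (primed k) ∧ (j <ᵇ r)) e)) (λ r → go′ (atᵇ r) (cong (λ j → not (primed k) ∧ (j ≡ᵇ r)) e))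
  (λ r → go′ (hiᵇ r) (cong (λ j → primed k ∧ not (j <ᵇ r)) e)) (λ r → go′ (onᵇ r) (cong (λ j → primed k ∧ (j ≡ᵇ r)) e)) (go′ allᵇ refl)
  where
  go′ : ∀ f → f (p , k) ≡ f (q , k) → cnt f (Z ʳ++ ((p , k) ∷ Y)) ≡ cnt f (Z ʳ++ ((q , k) ∷ Y))
  go′ f h = trans (cnt-mid f Z ((p , k) ∷ []) Y) (trans (cong (λ b → ι b + 0 + cnt f (Z ʳ++ Y)) h) (sym (cnt-mid f Z ((q , k) ∷ []) Y)))

-- Invariance of the lattice condition

chain-ordered : ∀ {P} X Y {M} → Down P → Chain P (positions X ʳ++ (positions Y ++ M)) → Band (X ʳ++ Y) → Ordered (X ʳ++ Y)
chain-ordered {P} X Y {M} dP ch b = AllPairs.zip (stars b , chain-sorted (X ʳ++ Y) {M} dP (subst (Chain P) eq′ ch))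
  where
  ʳ++-++ : ∀ (X : List Pos) {Y Z} → X ʳ++ (Y ++ Z) ≡ (X ʳ++ Y) ++ Z
  ʳ++-++ [] = refl
  ʳ++-++ (x ∷ X) {Y} = ʳ++-++ X {x ∷ Y}
  eq′ : positions X ʳ++ (positions Y ++ M) ≡ positions (X ʳ++ Y) ++ M
  eq′ = trans (ʳ++-++ (positions X)) (cong (_++ M) (sym (map-ʳ pos X)))

module _ {P : Pos → Set} (dP : Down P) where

  -- The box at c is about to pass x and the rest Y of the band U, with W still ahead.
  module InU {Up : List Ent} {c x : Pos} {kx : Kind} {Y W : List Ent}
    (ch : Chain P (positions Up ʳ++ (c ∷ x ∷ positions Y ++ positions W)))
    (bU : Band (Up ʳ++ ((x , kx) ∷ Y))) (oW : Ordered W) where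

    Q : Pos → Set
    Q = P ∪ positions Up

    R : List Ent
    R = Up ʳ++ Y

    chQ : Chain Q (c ∷ x ∷ positions Y ++ positions W)
    chQ = chain-ʳ⁻ (positions Up) ch

    dQ : Down Q
    dQ = down-ʳ (positions Up) dP ch

    ac = proj₁ chQ
    ax = proj₁ (proj₂ chQ)

    1≤c : 1 ≤ row c
    1≤c = proj₁ (proj₁ ac)

    c≤ : row c ≤ col c
    c≤ = proj₂ (proj₁ ac)

    c⋢ : ∀ {z} → Q z → ¬ c ⊑ z
    c⋢ = chain-⋢ _ dQ chQ (here refl)

    x⋢ : ∀ {z} → z ∈ positions Y ++ positions W → ¬ z ⊑ x
    x⋢ m = chain-⋢ _ (down-add (down-add dQ ac) ax) (proj₂ (proj₂ chQ)) m (inj₂ (here refl))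

    Up-star : ∀ {e} → e ∈ Up → Star e (x , kx)
    Up-star m = allPairs-ʳ Up (stars bU) m (here refl)

    Y-star : ∀ {e} → e ∈ Y → Star (x , kx) e
    Y-star m with s ∷ _ ← proj₂ (pairs-ʳ⁻ Up (stars bU)) = All.lookup s m

    oY : Ordered Y
    oY with _ ∷ p ← AllPairs.zip (proj₂ (pairs-ʳ⁻ Up (stars bU)) , chain-sorted ((x , kx) ∷ Y) (down-add dQ ac) (proj₂ chQ)) = p

    boxU : ∀ {e} → e ∈ Up ʳ++ ((x , kx) ∷ Y) → Box (pos e)
    boxU {e} m with ∈-ʳ⁻ Up m
    ... | inj₁ m′ = chain-Box _ ch (∈-ʳ⁺ˡ (∈-map⁺ pos m′))
    ... | inj₂ m′ = chain-Box _ (proj₂ chQ) (∈-++⁺ˡ {xs = x ∷ positions Y} (∈-map⁺ pos m′))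

    up-of-Y : ∀ {e} → e ∈ Y → row (pos e) ≤ row x → kind e ≡ up
    up-of-Y {_ , up} m l = refl
    up-of-Y {_ , dn} m l = ⊥-elim (<⇒≱ (proj₁ (proj₁ (falling (Y-star m) (λ ())))) l)
    up-of-Y {_ , vl _} m l = ⊥-elim (<⇒≱ (proj₁ (proj₁ (falling (Y-star m) (λ ())))) l)

    after-c : ∀ {z r} → z ∈ x ∷ positions Y ++ positions W → Box r → r ⊑ z → c ⊑ r → r ≡ c ⊎ r ∈ x ∷ positions Y ++ positions W
    after-c m b le le′ with chain-below _ chQ (there m) b le
    ... | inj₁ q = ⊥-elim (c⋢ q le′)
    ... | inj₂ (here e) = inj₁ e
    ... | inj₂ (there n) = inj₂ n

    after-c-Y : ∀ {z r} → z ∈ x ∷ positions Y → Box r → r ⊑ z → c ⊑ r → r ≡ c ⊎ r ∈ x ∷ positions Y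
    after-c-Y m b le le′ with chain-below _ (proj₁ (chain-++⁻ (c ∷ x ∷ positions Y) chQ)) (there m) b le
    ... | inj₁ q = ⊥-elim (c⋢ q le′)
    ... | inj₂ (here e) = inj₁ e
    ... | inj₂ (there n) = inj₂ n

    above : ∀ {z k} → (z , k) ∈ W → row z ≡ suc (row c) → col c < col z → (row c , col z) ≢ x →
      (∃ λ k → ((row c , col z) , k) ∈ Y) ⊎ ((row c , col z) , dn) ∈ W
    above {z} m e l n with after-c (there (∈-++⁺ʳ (positions Y) (∈-map⁺ pos m))) (1≤c , ≤-trans c≤ (<⇒≤ l)) (≤-trans (n≤1+n _) (≤-reflexive (sym e)) , ≤-refl) (≤-refl , <⇒≤ l)
    ... | inj₁ q = ⊥-elim (<-irrefl (sym (cong col q)) l)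
    ... | inj₂ (here q) = ⊥-elim (n q)
    ... | inj₂ (there q) with ∈-++⁻ (positions Y) q
    ...   | inj₁ q′ with (_ , k) , q″ , refl ← ∈-map⁻ pos q′ = inj₁ (k , q″)
    ...   | inj₂ q′ with (_ , k) , q″ , refl ← ∈-map⁻ pos q′ with refl ← column oW q″ m (≤-trans (n≤1+n _) (≤-reflexive (sym e)) , ≤-refl) (≤-reflexive (sym e)) = inj₂ q″

    -- Each box of `W` in the row below `c` is charged to the box above it. That box has to be
    -- filled before it but after `c`, hence it belongs to `Y` or to `W`; in the latter case it has
    -- a box of its band below it and so is primed.
    W-covered : (∀ {z k} → (z , k) ∈ W → row z ≡ suc (row c) → col c < col z × (row c , col z) ≢ x) → (∀ {e} → e ∈ Y → row (pos e) ≡ row c → kind e ≢ dn) →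
      AllPairs _≢_ (positions W) → on W (suc (row c)) + at W (suc (row c)) ≤ at Y (row c) + on W (row c)
    W-covered f g dW = ≤-trans (≤-reflexive (trans (sym (row-split₂ W (suc (row c)))) (sym (length-select (rowᵇ (suc (row c))) W))))
      (≤-trans (subset-length _ (map south (select (atᵇ (row c)) Y ++ select (onᵇ (row c)) W)) (select-distinct _ W dW) inner)
        (≤-reflexive (trans (length-map south (select (atᵇ (row c)) Y ++ select (onᵇ (row c)) W)) (trans (length-++ (select (atᵇ (row c)) Y)) (cong₂ _+_ (length-select (atᵇ (row c)) Y) (length-select (onᵇ (row c)) W))))))
      where
      inner : ∀ {p} → p ∈ select (rowᵇ (suc (row c))) W → p ∈ map south (select (atᵇ (row c)) Y ++ select (onᵇ (row c)) W)
      inner {p} m with k , n , t ← select⁻ (rowᵇ (suc (row c))) W m with e ← ≡ᵇ-true {row p} t with l , ne ← f n e with above n e l ne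
      ... | inj₁ (k′ , q) = subst (_∈ _) (cong (_, col p) (sym e)) (∈-map⁺ south (∈-++⁺ˡ (select-at Y (row c) q (g q refl) refl)))
      ... | inj₂ q = subst (_∈ _) (cong (_, col p) (sym e)) (∈-map⁺ south (∈-++⁺ʳ (select (atᵇ (row c)) Y) (select-on W (row c) q refl)))

    Y⊆R : ∀ f → cnt f Y ≤ cnt f R
    Y⊆R f = go′ Up Y
      where
      go′ : ∀ Up Y → cnt f Y ≤ cnt f (Up ʳ++ Y)
      go′ [] Y = ≤-refl
      go′ (u ∷ Up) Y = ≤-trans (m≤n+m _ _) (go′ Up (u ∷ Y))

    R∈ : ∀ {e} → e ∈ R → e ∈ Up ⊎ e ∈ Y
    R∈ = ∈-ʳ⁻ Up

    module South (xs : x ≡ south c) where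

      rx : row x ≡ suc (row c)
      rx = cong row xs

      cx : col x ≡ col c
      cx = cong col xs

      later-col : ∀ {z} → z ∈ positions Y ++ positions W → row z ≡ suc (row c) → col c < col z
      later-col {z} m e = ≰⇒> λ l → x⋢ m (≤-reflexive (trans e (sym rx)) , ≤-trans l (≤-reflexive (sym cx)))

      not-x : ∀ {j} → (row c , j) ≢ x
      not-x e = 1+n≢n (trans (sym rx) (sym (cong row e)))

      Y-up : ∀ {e} → e ∈ Y → row (pos e) ≡ row c → kind e ≡ up
      Y-up m e = up-of-Y m (≤-trans (≤-reflexive e) (≤-trans (n≤1+n _) (≤-reflexive (sym rx))))

      h1 : AllPairs _≢_ (positions W) → on W (suc (row c)) + at W (suc (row c)) ≤ at R (row c) + on W (row c)
      h1 dW = ≤-trans (W-covered (λ m e → later-col (∈-++⁺ʳ (positions Y) (∈-map⁺ pos m)) e , not-x)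
        (λ m e d → case trans (sym d) (Y-up m e) of λ ()) dW) (+-monoˡ-≤ _ (Y⊆R (atᵇ (row c))))

      h2 : 1 ≤ on W (suc (row c)) → 1 ≤ at R (row c) ⊎ 1 ≤ on W (row c)
      h2 l with z , m , e ← on-some W (suc (row c)) l
        with above m e (later-col (∈-++⁺ʳ (positions Y) (∈-map⁺ pos m)) e) not-x
      ... | inj₁ (k′ , q) with refl ← Y-up q refl = inj₁ (≤-trans (at-one Y (row c) q (λ ()) refl) (Y⊆R (atᵇ (row c))))
      ... | inj₂ q = inj₂ (on-one W (row c) q refl)

      -- A primed box of `Up` in the row of `c` lies west of `c` and off the diagonal. The position
      -- below it is west of `x`, hence already filled, and it cannot have been filled before the
      -- band began.
      h3 : kx ≢ dn → 1 ≤ on R (row c) → 1 ≤ at R (suc (row c)) ⊎ 1 ≤ on R (suc (row c))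
      h3 n l with p , m , e ← on-some R (row c) l with R∈ m
      ... | inj₂ m′ with () ← proj₂ (rising (Y-star m′) n)
      ... | inj₁ m′ = found (proj₂ (proj₂ ax) q boxq q⊑x q≢x)
        where
        j<c : col p < col c
        j<c = ≰⇒> λ le → c⋢ (inj₂ (∈-map⁺ pos m′)) (≤-reflexive (sym e) , le)
        nd : row p ≢ col p
        nd d = diagonal-not-dn bU boxU (subst (λ j → ((row p , j) , dn) ∈ Up ʳ++ ((x , kx) ∷ Y)) (sym d) (∈-ʳ⁺ˡ m′)) refl
        q : Pos
        q = suc (row c) , col p
        boxp : Box p
        boxp = boxU (∈-ʳ⁺ˡ m′)
        boxq : Box q
        boxq = s≤s z≤n , ≤-trans (s≤s (≤-reflexive (sym e))) (≤∧≢⇒< (proj₂ boxp) nd)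
        q⊑x : q ⊑ x
        q⊑x = ≤-reflexive (sym rx) , ≤-trans (<⇒≤ j<c) (≤-reflexive (sym cx))
        q≢x : q ≢ x
        q≢x f = <-irrefl (trans (cong col f) cx) j<c
        p⊑q : p ⊑ q
        p⊑q = ≤-trans (≤-reflexive e) (n≤1+n _) , ≤-refl
        found : (Q ∪ (c ∷ [])) q → 1 ≤ at R (suc (row c)) ⊎ 1 ≤ on R (suc (row c))
        found (inj₂ (here f)) = ⊥-elim (1+n≢n (cong row f))
        found (inj₁ (inj₁ f)) = ⊥-elim (chain-fresh _ ch (∈-ʳ⁺ˡ (∈-map⁺ pos m′)) (close dP f boxp p⊑q))
        found (inj₁ (inj₂ f)) with (_ , kq) , g , refl ← ∈-map⁻ pos f with kq
        ... | dn = inj₂ (on-one R (suc (row c)) (∈-ʳ⁺ˡ g) refl)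
        ... | up = inj₁ (at-one R (suc (row c)) (∈-ʳ⁺ˡ g) (λ ()) refl)
        ... | vl _ = inj₁ (at-one R (suc (row c)) (∈-ʳ⁺ˡ g) (λ ()) refl)

      -- The box above a box of Y in the row below c would have to be unprimed in the same column.
      no-Y-right : ∀ {e} → e ∈ Y → row (pos e) ≢ suc (row c) ⊎ kind e ≡ dn
      no-Y-right {e} m with row (pos e) ≟ suc (row c)
      ... | no n = inj₁ n
      ... | yes e₁ with l ← later-col (∈-++⁺ˡ (∈-map⁺ pos m)) e₁
        with after-c-Y {r = row c , col (pos e)} (there (∈-map⁺ pos m)) (1≤c , ≤-trans c≤ (<⇒≤ l)) (≤-trans (n≤1+n _) (≤-reflexive (sym e₁)) , ≤-refl) (≤-refl , <⇒≤ l)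
      ...   | inj₁ f = ⊥-elim (<-irrefl (sym (cong col f)) l)
      ...   | inj₂ (here f) = ⊥-elim (not-x f)
      ...   | inj₂ (there f) with (_ , k) , g , refl ← ∈-map⁻ pos f with () ← trans (sym (column oY g m (≤-trans (n≤1+n _) (≤-reflexive (sym e₁)) , ≤-refl) (≤-reflexive (sym e₁)))) (Y-up g refl)

      d2 : kx ≡ dn → on R (row c) ≡ 0
      d2 refl = on-zero R (row c) absurd
        where
        absurd : ∀ {p} → (p , dn) ∈ R → row p ≢ row c
        absurd m e with R∈ m
        ... | inj₂ m′ with () ← Y-up m′ e
        ... | inj₁ m′ = c⋢ (inj₂ (∈-map⁺ pos m′)) (≤-reflexive (sym e) , ≤-trans (≤-reflexive (sym cx)) (proj₂ (proj₁ (falling (Up-star m′) (λ ())))))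

      d3 : kx ≡ dn → at R (suc (row c)) ≡ 0
      d3 refl = at-zero R (suc (row c)) absurd
        where
        absurd : ∀ {p k} → (p , k) ∈ R → k ≢ dn → row p ≢ suc (row c)
        absurd m n e with R∈ m
        ... | inj₁ m′ with () ← proj₂ (rising (Up-star m′) n)
        ... | inj₂ m′ with no-Y-right m′
        ...   | inj₁ ne = ne e
        ...   | inj₂ d = n d

plus-two : ∀ Z {e e′} Y → (e ∷ []) ⊕ (e′ ∷ (Z ʳ++ Y)) ↦ (Z ʳ++ (e ∷ e′ ∷ Y))
plus-two Z {e} {e′} Y f = trans (cnt-mid f Z (e ∷ e′ ∷ []) Y)
  (lia (ι (f e) ∷ ι (f e′) ∷ cnt f (Z ʳ++ Y) ∷ []) (λ a b c → [] ⊢ a :+ (b :+ lit 0) :+ c :≡ a :+ lit 0 :+ (b :+ c)))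

plus-one : ∀ {e X} → (e ∷ []) ⊕ X ↦ (e ∷ X)
plus-one {e} {X} f = cong (_+ cnt f X) (sym (+-identityʳ (ι (f e))))

module _ {P : Pos → Set} (dP : Down P) where

  -- Moves to the east keep all rows and hence all counts. Only a south neighbour and the hook need
  -- an argument.
  lat-U : ∀ {Up c Uq N c′ Uq′ W} → Chain P (positions Up ʳ++ (c ∷ positions Uq ++ positions W)) → Band (Up ʳ++ Uq) →
    Band W → Next c Uq N c′ Uq′ → Lat (Up ʳ++ Uq) W ⇔′ Lat ((N ++ Up) ʳ++ Uq′) W
  lat-U ch bU bW (apart _) = (λ l → l) , λ l → l
  lat-U {Up} {c} {W = W} ch bU bW (touch {x} {k} {Y} nb _) = by-dir (nb-cases (down-ʳ (positions Up) dP ch) (proj₁ chQ₁) (proj₁ (proj₂ chQ₁)) nb)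
    where
    chQ₁ = chain-ʳ⁻ (positions Up) ch
    chW = proj₂ (chain-++⁻ (positions Y) (proj₂ (proj₂ chQ₁)))
    dY = down-chain (positions Y) (down-add (down-add (down-ʳ (positions Up) dP ch) (proj₁ chQ₁)) (proj₁ (proj₂ chQ₁))) (proj₁ (chain-++⁻ (positions Y) (proj₂ (proj₂ chQ₁))))
    oW : Ordered W
    oW = chain-ordered [] W {[]} dY (subst (Chain _) (sym (++-identityʳ (positions W))) chW) bW
    dW : AllPairs _≢_ (positions W)
    dW = chain-distinct (positions W) chW
    open InU dP {Up} {c} {x} {k} {Y} {W} ch bU oW
    by-dir : x ≡ east c ⊎ x ≡ south c → Lat (Up ʳ++ ((x , k) ∷ Y)) W ⇔′ Lat (Up ʳ++ ((c , k) ∷ Y)) W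
    by-dir (inj₁ refl) = lat-cong (same-row Up Y refl) same-refl
    by-dir (inj₂ xs) = by-kind k refl
      where
      open South xs
      by-kind : ∀ k′ → k ≡ k′ → Lat (Up ʳ++ ((x , k) ∷ Y)) W ⇔′ Lat (Up ʳ++ ((c , k) ∷ Y)) W
      by-kind dn refl = U-dn {R = Up ʳ++ Y} (plus-pr rx (⊕-mid Up ((x , dn) ∷ []) Y)) (plus-pr refl (⊕-mid Up ((c , dn) ∷ []) Y)) h2 (d2 refl) (d3 refl)
      by-kind up refl = U-un {R = Up ʳ++ Y} (plus-un refl rx (⊕-mid Up ((x , up) ∷ []) Y)) (plus-un refl refl (⊕-mid Up ((c , up) ∷ []) Y)) (h1 dW) h2 (h3 (λ ()))
      by-kind (vl b) refl = U-un {R = Up ʳ++ Y} (plus-un refl rx (⊕-mid Up ((x , vl b) ∷ []) Y)) (plus-un refl refl (⊕-mid Up ((c , vl b) ∷ []) Y)) (h1 dW) h2 (h3 (λ ()))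
  lat-U {Up} {c} {W = W} ch bU bW (hook {x} {y} {b} {Y} (e , refl , refl)) =
    U-hook {R = R′} {U₁ = (y , vl b) ∷ R′} {U₁′ = (c , vl b) ∷ R′} (plus-un {k = vl b} refl refl (plus-one {X = R′})) (plus-pr refl (plus-two Up Y)) (plus-un {k = vl b} refl refl (plus-one {X = R′}))
      (plus-un {k = up} refl refl (λ f → trans (plus-two Up {(c , vl b)} {(x , up)} Y f) (lia (ι (f (c , vl b)) ∷ ι (f (x , up)) ∷ cnt f R′ ∷ []) (λ a b c → [] ⊢ a :+ lit 0 :+ (b :+ c) :≡ b :+ lit 0 :+ (a :+ c)))))
      p1 p2 p3 p4 p5
    where
    R′ = Up ʳ++ Y
    i = row c
    chQ₀ = chain-ʳ⁻ (positions Up) ch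
    chW = proj₂ (chain-++⁻ (positions Y) (proj₂ (proj₂ (proj₂ chQ₀))))
    dQ₀ = down-ʳ (positions Up) dP ch
    dy = down-add (down-add (down-add dQ₀ (proj₁ chQ₀)) (proj₁ (proj₂ chQ₀))) (proj₁ (proj₂ (proj₂ chQ₀)))
    dY = down-chain (positions Y) dy (proj₁ (chain-++⁻ (positions Y) (proj₂ (proj₂ (proj₂ chQ₀)))))
    oW : Ordered W
    oW = chain-ordered [] W {[]} dY (subst (Chain _) (sym (++-identityʳ (positions W))) chW) bW
    dW : AllPairs _≢_ (positions W)
    dW = chain-distinct (positions W) chW
    open InU dP {Up} {c} {x} {dn} {(y , vl b) ∷ Y} {W} ch bU oW
    y-star : ∀ {e} → e ∈ Y → y ↗ pos e × kind e ≡ up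
    y-star m with _ ∷ s ∷ _ ← proj₂ (pairs-ʳ⁻ Up (stars bU)) = rising (All.lookup s m) (λ ())
    y⋢ : ∀ {z} → z ∈ positions Y ++ positions W → ¬ z ⊑ y
    y⋢ m = chain-⋢ _ dy (proj₂ (proj₂ (proj₂ chQ₀))) m (inj₂ (here refl))
    right : ∀ {z} → z ∈ positions Y ++ positions W → row z ≡ suc i → suc (col c) < col z
    right m f = ≰⇒> λ l → y⋢ m (≤-reflexive f , l)
    W∈ : ∀ {z k} → (z , k) ∈ W → z ∈ positions Y ++ positions W
    W∈ m = ∈-++⁺ʳ (positions Y) (∈-map⁺ pos m)
    p1 : on W (suc i) + at W (suc i) ≤ at R′ i + on W i
    p1 = ≤-trans (W-covered (λ m f → <-trans (n<1+n _) (right (W∈ m) f) , λ q → <-irrefl (sym (cong col q)) (right (W∈ m) f))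
           (λ m f d → case trans (sym d) (up-of-Y m (≤-reflexive f)) of λ ()) dW)
         (+-monoˡ-≤ _ (≤-trans (≤-reflexive (cong (_+ at Y i) (eq-≢ {suc i} {i} 1+n≢n))) (Y⊆R′ Up Y)))
      where
      Y⊆R′ : ∀ Up Y → at Y i ≤ at (Up ʳ++ Y) i
      Y⊆R′ [] Y = ≤-refl
      Y⊆R′ (u ∷ Up) Y = ≤-trans (m≤n+m _ _) (Y⊆R′ Up (u ∷ Y))
    p2 : on W (suc i) ≤ 1
    p2 = cnt-≤1 (onᵇ (suc i)) W (AllPairs.map (λ { {p , k} {q , l} (st , _) s t → one-row st (on-sound (suc i) p k s) (on-sound (suc i) q l t) }) oW)
      where
      one-row : ∀ {p k q l} → Star (p , k) (q , l) → k ≡ dn × row p ≡ suc i → l ≡ dn × row q ≡ suc i → ⊥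
      one-row st (refl , f) (refl , g) = <-irrefl (trans f (sym g)) (proj₁ (proj₁ (falling st (λ ()))))
    p3 : hi R′ i ≡ 0
    p3 = hi-zero R′ i above-i
      where
      above-i : ∀ {p} → (p , dn) ∈ R′ → row p < i
      above-i m with ∈-ʳ⁻ Up m
      ... | inj₁ m′ = proj₁ (proj₁ (falling (Up-star m′) (λ ())))
      ... | inj₂ m′ with () ← proj₂ (y-star m′)
    p4 : all R′ ≤ lo R′ (suc (suc i))
    p4 = all≤lo R′ (suc (suc i)) below
      where
      below : ∀ {p k} → (p , k) ∈ R′ → k ≢ dn → row p < suc (suc i)
      below m n with ∈-ʳ⁻ Up m
      ... | inj₁ m′ with () ← proj₂ (rising (Up-star m′) n)
      below m n | inj₂ m′ = s≤s (proj₁ (proj₁ (y-star m′)))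
    -- A box of `W` this deep forces the diagonal position `d` to be filled, and then `n` above it.
    -- The band `U` reaches neither of them, so both belong to `W`; having `d` below it, `n` is
    -- primed.
    deep : ∀ {p k} → (p , k) ∈ W → suc (suc i) ≤ row p → 1 ≤ on W (suc i)
    deep {p} m l = from-d (after-c (there (there (W∈ m))) boxd (l , ≤-trans l (proj₂ (chain-Box _ chW (∈-map⁺ pos m)))) (≤-trans (n≤1+n _) (n≤1+n _) , ≤-trans (≤-reflexive (sym e)) (≤-trans (n≤1+n _) (n≤1+n _))))
      where
      d n u : Pos
      d = suc (suc i) , suc (suc i)
      n = suc i , suc (suc i)
      u = i , suc (suc i)
      boxd : Box d
      boxd = s≤s z≤n , ≤-refl
      cle : col c ≤ suc (suc i)
      cle = ≤-trans (≤-reflexive (sym e)) (≤-trans (n≤1+n _) (n≤1+n _))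
      n∉Y : ∀ {k} → (n , k) ∉ Y
      n∉Y q with after-c-Y {r = u} (there (there (∈-map⁺ pos q))) (1≤c , ≤-trans (n≤1+n _) (n≤1+n _)) (n≤1+n _ , ≤-refl) (≤-refl , cle)
      ... | inj₁ f = <-irrefl (trans e (sym (cong col f))) (≤-trans (n<1+n _) (n≤1+n _))
      ... | inj₂ (here f) = <-irrefl (cong suc e) (≤-reflexive (cong col f))
      ... | inj₂ (there (here f)) = 1+n≢n (sym (cong row f))
      ... | inj₂ (there (there f)) with (_ , k) , f′ , refl ← ∈-map⁻ pos f with column oY (there f′) (there q) (n≤1+n _ , ≤-refl) ≤-refl
      ...   | d with () ← trans (sym d) (proj₂ (y-star f′))
      from-n : ∀ {k} → (d , k) ∈ W → n ≡ c ⊎ n ∈ x ∷ y ∷ positions Y ++ positions W → 1 ≤ on W (suc i)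
      from-n q (inj₁ f) = ⊥-elim (1+n≢n (cong row f))
      from-n q (inj₂ (here f)) = ⊥-elim (1+n≢n (cong row f))
      from-n q (inj₂ (there (here f))) = ⊥-elim (<-irrefl (cong suc e) (≤-reflexive (cong col f)))
      from-n q (inj₂ (there (there f))) with ∈-++⁻ (positions Y) f
      ... | inj₁ g with (_ , k) , g′ , refl ← ∈-map⁻ pos g = ⊥-elim (n∉Y g′)
      ... | inj₂ g with (_ , k) , g′ , refl ← ∈-map⁻ pos g with refl ← column oW g′ q (n≤1+n _ , ≤-refl) ≤-refl = on-one W (suc i) g′ refl
      from-d : d ≡ c ⊎ d ∈ x ∷ y ∷ positions Y ++ positions W → 1 ≤ on W (suc i)
      from-d (inj₁ f) = ⊥-elim (<-irrefl (sym (cong row f)) (≤-trans (n<1+n _) (n≤1+n _)))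
      from-d (inj₂ (here f)) = ⊥-elim (<-irrefl (sym (cong row f)) (≤-trans (n<1+n _) (n≤1+n _)))
      from-d (inj₂ (there (here f))) = ⊥-elim (1+n≢n (cong row f))
      from-d (inj₂ (there (there f))) with ∈-++⁻ (positions Y) f
      ... | inj₁ g with _ , g′ , refl ← ∈-map⁻ pos g = ⊥-elim (<⇒≱ (n<1+n (suc i)) (proj₁ (proj₁ (y-star g′))))
      ... | inj₂ g with _ , g′ , refl ← ∈-map⁻ pos g =
        from-n g′ (after-c (there (there (W∈ g′))) (s≤s z≤n , n≤1+n _) (n≤1+n _ , ≤-refl) (n≤1+n _ , cle))
    p5 : on W (suc i) ≡ 0 → hi W (suc (suc i)) ≡ 0 × all W ≤ lo W (suc (suc i))
    p5 z = hi-zero W (suc (suc i)) (λ m → ≰⇒> λ l → <⇒≱ (deep m l) (≤-reflexive z)) ,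
           all≤lo W (suc (suc i)) λ m _ → ≰⇒> λ l → <⇒≱ (deep m l) (≤-reflexive z)

module _ {P : Pos → Set} (dP : Down P) where

  -- The box at c has passed the band U and the part Wp of the band W.
  module InW {U Wp : List Ent} {c x : Pos} {kx : Kind} {Y : List Ent}
    (ch : Chain P (positions U ++ (positions Wp ʳ++ (c ∷ x ∷ positions Y))))
    (bU : Band U) (bW : Band (Wp ʳ++ ((x , kx) ∷ Y))) where

    P₁ Q : Pos → Set
    P₁ = P ∪ positions U
    Q  = P₁ ∪ positions Wp

    R : List Ent
    R = Wp ʳ++ Y

    chU : Chain P (positions U)
    chU = proj₁ (chain-++⁻ (positions U) ch)

    chW : Chain P₁ (positions Wp ʳ++ (c ∷ x ∷ positions Y))
    chW = proj₂ (chain-++⁻ (positions U) ch)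

    dP₁ : Down P₁
    dP₁ = down-chain (positions U) dP chU

    chQ : Chain Q (c ∷ x ∷ positions Y)
    chQ = chain-ʳ⁻ (positions Wp) chW

    dQ : Down Q
    dQ = down-ʳ (positions Wp) dP₁ chW

    ac = proj₁ chQ
    ax = proj₁ (proj₂ chQ)

    1≤c : 1 ≤ row c
    1≤c = proj₁ (proj₁ ac)

    c≤ : row c ≤ col c
    c≤ = proj₂ (proj₁ ac)

    c⋢ : ∀ {z} → Q z → ¬ c ⊑ z
    c⋢ = chain-⋢ _ dQ chQ (here refl)

    oU : Ordered U
    oU = chain-ordered [] U {[]} dP (subst (Chain P) (sym (++-identityʳ (positions U))) chU) bU

    boxU : ∀ {e} → e ∈ U → Box (pos e)
    boxU m = chain-Box _ chU (∈-map⁺ pos m)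

    boxW : ∀ {e} → e ∈ Wp ʳ++ ((x , kx) ∷ Y) → Box (pos e)
    boxW {e} m with ∈-ʳ⁻ Wp m
    ... | inj₁ m′ = chain-Box _ chW (∈-ʳ⁺ˡ (∈-map⁺ pos m′))
    ... | inj₂ m′ = chain-Box _ (proj₂ chQ) (∈-map⁺ pos m′)

    Wp-star : ∀ {e} → e ∈ Wp → Star e (x , kx)
    Wp-star m = allPairs-ʳ Wp (stars bW) m (here refl)

    Y-star : ∀ {e} → e ∈ Y → Star (x , kx) e
    Y-star m with s ∷ _ ← proj₂ (pairs-ʳ⁻ Wp (stars bW)) = All.lookup s m

    oY : Ordered Y
    oY with _ ∷ p ← AllPairs.zip (proj₂ (pairs-ʳ⁻ Wp (stars bW)) , chain-sorted ((x , kx) ∷ Y) {[]} (down-add dQ ac) (subst (Chain _) (sym (++-identityʳ (x ∷ positions Y))) (proj₂ chQ))) = p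

    U-Q : ∀ {p k} → (p , k) ∈ U → Q p
    U-Q m = inj₁ (inj₂ (∈-map⁺ pos m))

    below-U : ∀ {p k q} → (p , k) ∈ U → p ⊑ q → Q q → (∃ λ l → (q , l) ∈ U) ⊎ (∃ λ l → (q , l) ∈ Wp)
    below-U m le (inj₁ (inj₁ f)) = ⊥-elim (chain-fresh _ chU (∈-map⁺ pos m) (close dP f (boxU m) le))
    below-U m le (inj₁ (inj₂ f)) with (_ , l) , g , refl ← ∈-map⁻ pos f = inj₁ (l , g)
    below-U m le (inj₂ f) with (_ , l) , g , refl ← ∈-map⁻ pos f = inj₂ (l , g)

    below-Wp : ∀ {p k q} → (p , k) ∈ Wp → p ⊑ q → Q q → ∃ λ l → (q , l) ∈ Wp
    below-Wp m le (inj₁ f) = ⊥-elim (chain-fresh _ chW (∈-ʳ⁺ˡ (∈-map⁺ pos m)) (close dP₁ f (boxW (∈-ʳ⁺ˡ m)) le))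
    below-Wp m le (inj₂ f) with (_ , l) , g , refl ← ∈-map⁻ pos f = l , g

    left : ∀ {z} → Q z → row c ≤ row z → col z < col c
    left q e = ≰⇒> λ l → c⋢ q (e , l)

    module South (xs : x ≡ south c) where

      rx : row x ≡ suc (row c)
      rx = cong row xs

      cx : col x ≡ col c
      cx = cong col xs

      beside : ∀ {j} → suc (row c) ≤ j → j < col c → Q (suc (row c) , j)
      beside {j} l l′ with proj₂ (proj₂ ax) (suc (row c) , j) (s≤s z≤n , l) (≤-reflexive (sym rx) , ≤-trans (<⇒≤ l′) (≤-reflexive (sym cx))) (λ f → <-irrefl (trans (cong col f) cx) l′)
      ... | inj₁ q = q
      ... | inj₂ (here f) = ⊥-elim (1+n≢n (cong row f))

      below-un : ∀ {p k j} → (p , k) ∈ U → k ≢ dn → row p ≡ row c → col p ≤ j → suc (row c) ≤ j → j < col c → ∃ λ l → ((suc (row c) , j) , l) ∈ Wp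
      below-un {p} {k} m n e le l l′ with below-U m (≤-trans (≤-reflexive e) (n≤1+n _) , le) (beside l l′)
      ... | inj₁ (_ , g) = ⊥-elim (n (column oU m g (≤-trans (≤-reflexive e) (n≤1+n _) , le) (s≤s (≤-reflexive e))))
      ... | inj₂ g = g

      R∈ : ∀ {e} → e ∈ R → e ∈ Wp ⊎ e ∈ Y
      R∈ = ∈-ʳ⁻ Wp

      Wp⊆R : ∀ {e} → e ∈ Wp → e ∈ R
      Wp⊆R = ∈-ʳ⁺ˡ

      off-diagonal : ∀ {p} → (p , dn) ∈ Wp → row p < col p
      off-diagonal {p} m = ≤∧≢⇒< (proj₂ (boxW (∈-ʳ⁺ˡ m))) λ d → diagonal-not-dn bW boxW (subst (λ j → ((row p , j) , dn) ∈ Wp ʳ++ ((x , kx) ∷ Y)) (sym d) (∈-ʳ⁺ˡ m)) refl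

      off-diagonalU : ∀ {p} → (p , dn) ∈ U → row p < col p
      off-diagonalU {p} m = ≤∧≢⇒< (proj₂ (boxU m)) λ d → diagonal-not-dn bU boxU (subst (λ j → ((row p , j) , dn) ∈ U) (sym d) m) refl

      not-dn : kx ≢ dn → ∀ {p} → (p , dn) ∈ R → (p , dn) ∈ Wp
      not-dn n m with R∈ m
      ... | inj₁ m′ = m′
      ... | inj₂ m′ with () ← proj₂ (rising (Y-star m′) n)

      upper : List Pos
      upper = select (atᵇ (row c)) U ++ select (onᵇ (row c)) R

      lower : List Pos
      lower = map (λ q → row c , col q) (select (rowᵇ (suc (row c))) R)

      length-upper : length upper ≡ at U (row c) + on R (row c)
      length-upper = trans (length-++ (select (atᵇ (row c)) U)) (cong₂ _+_ (length-select (atᵇ (row c)) U) (length-select (onᵇ (row c)) R))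

      length-lower : length lower ≡ at R (suc (row c)) + on R (suc (row c))
      length-lower = trans (length-map _ (select (rowᵇ (suc (row c))) R)) (trans (length-select (rowᵇ (suc (row c))) R) (trans (row-split₂ R (suc (row c))) (+-comm (on R (suc (row c))) _)))

      in-lower : ∀ {j l} → ((suc (row c) , j) , l) ∈ Wp → (row c , j) ∈ lower
      in-lower {j} {l} m = ∈-map⁺ (λ q → row c , col q) (select⁺ (rowᵇ (suc (row c))) R (Wp⊆R m) (≡ᵇ-refl (row c)))

      distinctR : AllPairs _≢_ (positions R)
      distinctR = subst (AllPairs _≢_) (sym (map-ʳ pos Wp))
        (pairs-ʳ⁺ (positions Wp) (proj₁ ds) (tail₂ (proj₂ ds)) λ m n → allPairs-ʳ (positions Wp) all-d m (there (there n)))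
        where
        all-d : AllPairs _≢_ (positions Wp ʳ++ (c ∷ x ∷ positions Y))
        all-d = chain-distinct _ chW
        ds = pairs-ʳ⁻ (positions Wp) all-d
        tail₂ : ∀ {a b : Pos} {L} → AllPairs _≢_ (a ∷ b ∷ L) → AllPairs _≢_ L
        tail₂ (_ ∷ _ ∷ p) = p

      disjoint : ∀ {p} → p ∈ positions U → p ∉ positions R
      disjoint {p} m n with ∈-ʳ⁻ (positions Wp) (subst (p ∈_) (map-ʳ pos Wp) n)
      ... | inj₁ q = chain-fresh _ chW (∈-ʳ⁺ˡ q) (inj₂ m)
      ... | inj₂ q = chain-fresh _ chW (∈-ʳ⁺ (positions Wp) (there (there q))) (inj₂ m)

      distinct-upper : AllPairs _≢_ upper
      distinct-upper = pairs-++⁺ (select (atᵇ (row c)) U) (select-distinct _ U (chain-distinct _ chU)) (select-distinct _ R distinctR)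
        λ { m n refl → disjoint (∈-map⁺ pos (proj₁ (proj₂ (select⁻ _ U m)))) (∈-map⁺ pos (proj₁ (proj₂ (select⁻ _ R n)))) }
        where
        pairs-++⁺ : ∀ X {Y : List Pos} → AllPairs _≢_ X → AllPairs _≢_ Y → (∀ {x y} → x ∈ X → y ∈ Y → x ≢ y) → AllPairs _≢_ (X ++ Y)
        pairs-++⁺ [] _ q _ = q
        pairs-++⁺ (x ∷ X) (p ∷ ps) q f = All.tabulate (λ m → [ All.lookup p , f (here refl) ]′ (∈-++⁻ X m)) ∷ pairs-++⁺ X ps q (λ m n → f (there m) n)

      -- Below each box of `upper` there is a box of `Wp` in the next row; on the diagonal alone
      -- there is no position below, and this is the exception.
      covered : kx ≢ dn → ∀ {p} → p ∈ upper → p ≡ (row c , row c) ⊎ p ∈ lower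
      covered n {p} m with ∈-++⁻ (select (atᵇ (row c)) U) m
      ... | inj₂ q with k , q′ , t ← select⁻ (onᵇ (row c)) R q with refl , e ← on-sound (row c) p k t with m′ ← not-dn n q′
        with _ , g ← below-Wp m′ (≤-trans (≤-reflexive e) (n≤1+n _) , ≤-refl)
          (beside (≤-trans (s≤s (≤-reflexive (sym e))) (off-diagonal m′)) (left (inj₂ (∈-map⁺ pos m′)) (≤-reflexive (sym e))))
        = inj₂ (subst (_∈ lower) (cong (_, col p) (sym e)) (in-lower g))
      covered n {p} m | inj₁ q with k , q′ , t ← select⁻ (atᵇ (row c)) U q with n′ , e ← at-sound (row c) p k t with suc (row c) ≤? col p
      ... | yes l with _ , g ← below-un q′ n′ e ≤-refl l (left (U-Q q′) (≤-reflexive (sym e))) = inj₂ (subst (_∈ lower) (cong (_, col p) (sym e)) (in-lower g))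
      ... | no l = inj₁ (cong₂ _,_ e (≤-antisym (≤-pred (≰⇒> l)) (≤-trans (≤-reflexive (sym e)) (proj₂ (boxU q′)))))

      w-un : kx ≢ dn → at U (row c) + on R (row c) ≤ at R (suc (row c)) + on R (suc (row c)) ⊎
         (at U (row c) + on R (row c) ≤ suc (at R (suc (row c)) + on R (suc (row c))) × 1 ≤ at U (row c) × hi U (row c) ≡ 0 × all U ≤ lo U (suc (row c)))
      w-un n with (row c , row c) ∈ₚ? select (atᵇ (row c)) U
      ... | no ∉U = inj₁ (subst₂ _≤_ length-upper length-lower (subset-length upper lower distinct-upper λ m → [ (λ { refl → ⊥-elim (not-upper m) }) , (λ x → x) ]′ (covered n m)))
        where
        not-upper : (row c , row c) ∉ upper
        not-upper m with ∈-++⁻ (select (atᵇ (row c)) U) m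
        ... | inj₁ q = ∉U q
        ... | inj₂ q with k , q′ , t ← select⁻ (onᵇ (row c)) R q with refl , e ← on-sound (row c) (row c , row c) k t = <-irrefl refl (off-diagonal (not-dn n q′))
      -- An unprimed diagonal box is lowest in its band: the others are not below it, and the primed
      -- ones are strictly above, since each has the turning point beneath it.
      ... | yes d with k , m , t ← select⁻ (atᵇ (row c)) U d with nk , _ ← at-sound (row c) (row c , row c) k t =
        inj₂ (subst₂ _≤_ length-upper (cong suc length-lower) (subset-length upper ((row c , row c) ∷ lower) distinct-upper λ m → [ here , there ]′ (covered n m)) ,
              at-one U (row c) m nk refl , hi-zero U (row c) (λ q → ≰⇒> (no-dn q)) , all≤lo U (suc (row c)) no-un)
        where
        no-un : ∀ {p l} → (p , l) ∈ U → l ≢ dn → row p < suc (row c)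
        no-un {p} q nl with pairs-order (stars bU) m q
        ... | inj₁ refl = ≤-refl
        ... | inj₂ (inj₁ st) = s≤s (proj₁ (proj₁ (rising st nk)))
        ... | inj₂ (inj₂ st) = s≤s (<⇒≤ (≤-<-trans (proj₂ (boxU q)) (proj₂ (proj₁ (rising st nl)))))
        no-dn : ∀ {p} → (p , dn) ∈ U → ¬ row c ≤ row p
        no-dn q l with _ , v , (lt , _) , nv , _ ← valley bU q refl = <⇒≱ lt (≤-trans (≤-pred (no-un v nv)) l)

      module Primed (kd : kx ≡ dn) where

        Wp-dn : ∀ {p k} → (p , k) ∈ Wp → p ↙ x × k ≡ dn
        Wp-dn m = falling (Wp-star m) λ e → case trans (sym kd) e of λ ()

        x-off : suc (row c) < col c
        x-off = subst₂ _<_ rx cx (≤∧≢⇒< (proj₂ (boxW (∈-ʳ⁺ Wp (here refl)))) λ d →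
          diagonal-not-dn bW boxW (subst (λ j → ((row x , j) , kx) ∈ Wp ʳ++ ((x , kx) ∷ Y)) (sym d) (∈-ʳ⁺ Wp (here refl))) kd)

        not-beside : ∀ {j l} → ((suc (row c) , j) , l) ∉ Wp
        not-beside m = <-irrefl (sym rx) (proj₁ (proj₁ (Wp-dn m)))

        n1 : at U (row c) ≡ 0
        n1 = at-zero U (row c) absurd
          where
          absurd : ∀ {p k} → (p , k) ∈ U → k ≢ dn → row p ≢ row c
          absurd {p} m n e with suc (row c) ≤? col p
          ... | yes l = not-beside (proj₂ (below-un m n e ≤-refl l (left (U-Q m) (≤-reflexive (sym e)))))
          ... | no l = not-beside (proj₂ (below-un m n e (<⇒≤ (≰⇒> l)) ≤-refl x-off))

        n2 : on R (row c) ≡ 0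
        n2 = on-zero R (row c) absurd
          where
          absurd : ∀ {p} → (p , dn) ∈ R → row p ≢ row c
          absurd m e with R∈ m
          ... | inj₁ m′ = c⋢ (inj₂ (∈-map⁺ pos m′)) (≤-reflexive (sym e) , ≤-trans (≤-reflexive (sym cx)) (proj₂ (proj₁ (Wp-dn m′))))
          ... | inj₂ m′ = <-asym (≤-reflexive (sym rx)) (subst (row x <_) e (proj₁ (proj₁ (falling (Y-star m′) (λ ())))))

        not-right : ∀ {p k} → (p , k) ∈ Y → row p ≢ suc (row c)
        not-right {p} {k} m e = found (chain-below {r = row c , col p} (c ∷ x ∷ positions Y) chQ (there (there (∈-map⁺ pos m)))
            (1≤c , ≤-trans c≤ (<⇒≤ l)) r⊑p)
          where
          l : col c < col p
          l = ≰⇒> λ l → chain-⋢ _ (down-add (down-add dQ ac) ax) (proj₂ (proj₂ chQ)) (∈-map⁺ pos m) (inj₂ (here refl)) (≤-reflexive (trans e (sym rx)) , ≤-trans l (≤-reflexive (sym cx)))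
          r⊑p : (row c , col p) ⊑ p
          r⊑p = ≤-trans (n≤1+n _) (≤-reflexive (sym e)) , ≤-refl
          found : (Q ∪ (c ∷ x ∷ positions Y)) (row c , col p) → ⊥
          found (inj₁ q) = c⋢ q (≤-refl , <⇒≤ l)
          found (inj₂ (here f)) = <-irrefl (sym (cong col f)) l
          found (inj₂ (there (here f))) = 1+n≢n (trans (sym rx) (sym (cong row f)))
          found (inj₂ (there (there q))) with (_ , k′) , g , refl ← ∈-map⁻ pos q with refl ← column oY g m r⊑p (≤-reflexive (sym e)) =
            <-asym (≤-reflexive (sym rx)) (proj₁ (proj₁ (falling (Y-star g) (λ ()))))

        n3 : at R (suc (row c)) ≡ 0
        n3 = at-zero R (suc (row c)) absurd
          where
          absurd : ∀ {p k} → (p , k) ∈ R → k ≢ dn → row p ≢ suc (row c)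
          absurd m n e with R∈ m
          ... | inj₁ m′ = n (proj₂ (Wp-dn m′))
          ... | inj₂ m′ = not-right m′ e

        n4 : on R (suc (row c)) ≡ 0
        n4 = on-zero R (suc (row c)) absurd
          where
          absurd : ∀ {p} → (p , dn) ∈ R → row p ≢ suc (row c)
          absurd m e with R∈ m
          ... | inj₁ m′ = <-irrefl (trans e (sym rx)) (proj₁ (proj₁ (Wp-dn m′)))
          ... | inj₂ m′ = <-irrefl (trans rx (sym e)) (proj₁ (proj₁ (falling (Y-star m′) (λ ()))))

        n5 : 1 ≤ on U (row c) → 1 ≤ at U (suc (row c)) ⊎ 1 ≤ on U (suc (row c))
        n5 h with p , m , e ← on-some U (row c) h
          with below-U m (≤-trans (≤-reflexive e) (n≤1+n _) , ≤-refl) (beside {col p} (≤-trans (s≤s (≤-reflexive (sym e))) (off-diagonalU m)) (left (U-Q m) (≤-reflexive (sym e))))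
        ... | inj₂ (_ , g) = ⊥-elim (not-beside g)
        ... | inj₁ (dn , g) = inj₂ (on-one U (suc (row c)) g refl)
        ... | inj₁ (up , g) = inj₁ (at-one U (suc (row c)) g (λ ()) refl)
        ... | inj₁ (vl _ , g) = inj₁ (at-one U (suc (row c)) g (λ ()) refl)

  lat-W : ∀ {U Wp c Wq N c′ Wq′} → Chain P (positions U ++ (positions Wp ʳ++ (c ∷ positions Wq))) → Band U → Band (Wp ʳ++ Wq) →
    Next c Wq N c′ Wq′ → Lat U (Wp ʳ++ Wq) ⇔′ Lat U ((N ++ Wp) ʳ++ Wq′)
  lat-W ch bU bW (apart _) = (λ l → l) , λ l → l
  lat-W {U} {Wp} {c} ch bU bW (touch {x} {k} {Y} nb _) = by-dir (nb-cases dQ ac ax nb)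
    where
    open InW {U} {Wp} {c} {x} {k} {Y} ch bU bW
    by-dir : x ≡ east c ⊎ x ≡ south c → Lat U (Wp ʳ++ ((x , k) ∷ Y)) ⇔′ Lat U (Wp ʳ++ ((c , k) ∷ Y))
    by-dir (inj₁ refl) = lat-cong same-refl (same-row Wp Y refl)
    by-dir (inj₂ xs) = by-kind k refl
      where
      open South xs
      by-kind : ∀ k′ → k ≡ k′ → Lat U (Wp ʳ++ ((x , k) ∷ Y)) ⇔′ Lat U (Wp ʳ++ ((c , k) ∷ Y))
      by-kind dn refl = W-dn {R = Wp ʳ++ Y} (plus-pr rx (⊕-mid Wp ((x , dn) ∷ []) Y)) (plus-pr refl (⊕-mid Wp ((c , dn) ∷ []) Y)) n1 n2 n3 n4 n5
        where open Primed refl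
      by-kind up refl = W-un {R = Wp ʳ++ Y} (plus-un refl rx (⊕-mid Wp ((x , up) ∷ []) Y)) (plus-un refl refl (⊕-mid Wp ((c , up) ∷ []) Y)) (w-un (λ ()))
      by-kind (vl b) refl = W-un {R = Wp ʳ++ Y} (plus-un refl rx (⊕-mid Wp ((x , vl b) ∷ []) Y)) (plus-un refl refl (⊕-mid Wp ((c , vl b) ∷ []) Y)) (w-un (λ ()))
  lat-W {U} {Wp} {c} ch bU bW (hook {x} {y} {b} {Y} (e , refl , refl)) =
    W-hook {R = R′} {W₁ = (y , vl b) ∷ R′} {W₁′ = (c , vl b) ∷ R′} (plus-un {k = vl b} refl refl (plus-one {X = R′})) (plus-pr refl (plus-two Wp Y)) (plus-un {k = vl b} refl refl (plus-one {X = R′}))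
      (plus-un {k = up} refl refl (λ f → trans (plus-two Wp {(c , vl b)} {(x , up)} Y f) (lia (ι (f (c , vl b)) ∷ ι (f (x , up)) ∷ cnt f R′ ∷ []) (λ a b c → [] ⊢ a :+ lit 0 :+ (b :+ c) :≡ b :+ lit 0 :+ (a :+ c)))))
      (all≤lo U (row c) (λ m _ → above-c m)) (hi-zero U (row c) above-c)
    where
    R′ = Wp ʳ++ Y
    open InW {U} {Wp} {c} {x} {dn} {(y , vl b) ∷ Y} ch bU bW
    above-c : ∀ {p k} → (p , k) ∈ U → row p < row c
    above-c m = ≰⇒> λ l → c⋢ (U-Q m) (l , ≤-trans (≤-reflexive (sym e)) (≤-trans l (proj₂ (boxU m))))

module _ {P : Pos → Set} (dP : Down P) (M : List Pos) (Φ : List Ent → Set)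
  (invariant : ∀ Up {c Uq N c′ Uq′} → Chain P (positions Up ʳ++ (c ∷ positions Uq ++ M)) → Band (Up ʳ++ Uq) →
    Next c Uq N c′ Uq′ → Φ (Up ʳ++ Uq) ⇔′ Φ ((N ++ Up) ʳ++ Uq′)) where

  -- `Φ` will be the lattice condition with one band held fixed: first the later band while the
  -- earlier one is passed, then the reverse.
  slide : ∀ Up c Uq → Chain P (positions Up ʳ++ (c ∷ positions Uq ++ M)) → Band (Up ʳ++ Uq) →
    ∃ λ V → ∃ λ c′ → Row c (positions Uq) (positions V) c′ × Band (Up ʳ++ V) × flags (Up ʳ++ V) ≡ flags (Up ʳ++ Uq) ×
      (Φ (Up ʳ++ Uq) ⇔′ Φ (Up ʳ++ V))
  slide Up c [] ch b = [] , c , [] , b , refl , (λ x → x) , λ x → x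
  slide Up c ((x , k) ∷ Y) ch b = onward (next-total dQ Up M chQ b box) ch b
    where
    chQ = chain-ʳ⁻ (positions Up) ch
    dQ = down-ʳ (positions Up) dP ch
    box : ∀ {z} → z ∈ Up ʳ++ ((x , k) ∷ Y) → Box (pos z)
    box {z} m with ∈-ʳ⁻ Up m
    ... | inj₁ m′ = chain-Box _ ch (∈-ʳ⁺ˡ (∈-map⁺ pos m′))
    ... | inj₂ m′ = chain-Box _ (proj₂ chQ) (∈-++⁺ˡ (∈-map⁺ pos m′))
    carry : ∀ {Uq N c′ Uq′} → Next c Uq N c′ Uq′ → Chain P (positions Up ʳ++ (c ∷ positions Uq ++ M)) → Band (Up ʳ++ Uq) →
      Chain P (positions (N ++ Up) ʳ++ (c′ ∷ positions Uq′ ++ M)) × Band ((N ++ Up) ʳ++ Uq′)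
    carry n ch b = chain-next dP {[]} {[]} {A₁ = []} Up n ch , next-band (down-ʳ (positions Up) dP ch) Up M (λ m → inj₂ (∈-map⁺ pos m)) (chain-ʳ⁻ (positions Up) ch) n b
    onward : ∀ {Y} → (∃ λ N → ∃ λ c′ → ∃ λ Y′ → Next c ((x , k) ∷ Y) N c′ Y′) → Chain P (positions Up ʳ++ (c ∷ x ∷ positions Y ++ M)) → Band (Up ʳ++ ((x , k) ∷ Y)) →
      ∃ λ V → ∃ λ c′ → Row c (x ∷ positions Y) (positions V) c′ × Band (Up ʳ++ V) × flags (Up ʳ++ V) ≡ flags (Up ʳ++ ((x , k) ∷ Y)) ×
        (Φ (Up ʳ++ ((x , k) ∷ Y)) ⇔′ Φ (Up ʳ++ V))
    onward (_ , _ , Y , n@(apart ¬n)) ch b with ch′ , b′ ← carry n ch b with V , c′ , r , bV , f , i ← slide ((x , k) ∷ Up) c Y ch′ b′ =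
      (x , k) ∷ V , c′ , apart ¬n ∷ r , bV , trans f (next-flags Up n) , ⇔′-trans (invariant Up ch b n) i
    onward (_ , _ , Y , n@(touch nb _)) ch b with ch′ , b′ ← carry n ch b with V , c′ , r , bV , f , i ← slide ((c , k) ∷ Up) x Y ch′ b′ =
      (c , k) ∷ V , c′ , touch nb ∷ r , bV , trans f (next-flags Up n) , ⇔′-trans (invariant Up ch b n) i
    onward (_ , _ , Y , n@(hook {y = y} {b = e} h)) ch b with ch′ , b′ ← carry n ch b with V , c′ , r , bV , f , i ← slide ((x , up) ∷ (c , vl e) ∷ Up) y Y ch′ b′ =
      (c , vl e) ∷ (x , up) ∷ V , c′ , touch (hook-nb₁ h) ∷ touch (hook-nb₂ h) ∷ r , bV , trans f (next-flags Up n) , ⇔′-trans (invariant Up ch b n) i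

record Moved (as : List Pos) (U W : List Ent) : Set where
  constructor moved
  field
    {U′ W′}   : List Ent
    {as₁ as₂} : List Pos
    gU      : Grid as (positions U) (positions U′) as₁
    gW      : Grid as₁ (positions W) (positions W′) as₂
    bU′     : Band U′
    bW′     : Band W′
    fU      : flags U′ ≡ flags U
    fW      : flags W′ ≡ flags W
    iff     : Lat U W ⇔′ Lat U′ W′

move-one : ∀ {P a U W} → Down P → Chain P (a ∷ positions U ++ positions W) → Band U → Band W →
  ∃ λ U′ → ∃ λ W′ → ∃ λ a₁ → ∃ λ a₂ → Row a (positions U) (positions U′) a₁ × Row a₁ (positions W) (positions W′) a₂ ×
    Band U′ × Band W′ × flags U′ ≡ flags U × flags W′ ≡ flags W × (Lat U W ⇔′ Lat U′ W′)
move-one {P} {a} {U} {W} dP ch bU bW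
  with U′ , c , r , bU′ , fU , i ← slide dP (positions W) (λ X → Lat X W) (λ Up ch b n → lat-U dP {Up} ch b bW n) [] a U ch bU
  with chU′ , chW ← chain-++⁻ (positions U′) (chain-row dP ch r)
  with W′ , c′ , s , bW′ , fW , j ← slide (down-chain (positions U′) dP chU′) [] (λ X → Lat U′ X)
    (λ Up {c} {Uq} ch b n → lat-W dP {Wp = Up} (chain-++⁺ (positions U′) chU′ (subst (λ L → Chain _ (positions Up ʳ++ (c ∷ L))) (++-identityʳ (positions Uq)) ch)) bU′ b n)
    [] c W (subst (λ L → Chain _ (c ∷ L)) (sym (++-identityʳ (positions W))) chW) bW
  = U′ , W′ , c , c′ , r , s , bU′ , bW′ , fU , fW , ⇔′-trans i j

chain-moved : ∀ {P as bs X Y as′} → Down P → Chain P (as ++ bs) → Grid as bs (X ++ Y) as′ → Chain P (X ++ Y)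
chain-moved {P} {as} {bs} {X} {Y} dP ch g =
  proj₁ (chain-++⁻ (X ++ Y) (chain-grid {L = []} dP (subst (λ L → Chain P (as ++ L)) (sym (++-identityʳ bs)) ch) g))

move-all : ∀ {P} as {U W} → Down P → Chain P (as ++ positions U ++ positions W) → Band U → Band W → Moved as U W
move-all [] dP ch bU bW = moved [] [] bU bW refl refl ((λ x → x) , λ x → x)
move-all {P} (a ∷ as) {U} {W} dP (aa , ch) bU bW with moved {U₁} {W₁} gU gW bU₁ bW₁ fU fW i ← move-all as (down-add dP aa) ch bU bW
  with U₂ , W₂ , a₁ , a₂ , r , s , bU₂ , bW₂ , fU₂ , fW₂ , j ← move-one dP (aa , chain-moved {X = positions U₁} (down-add dP aa) ch (grid-right gU gW)) bU₁ bW₁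
  = moved (r ∷ gU) (s ∷ gW) bU₂ bW₂ (trans fU₂ fU) (trans fW₂ fW) (⇔′-trans i j)

col-band : ∀ {As B B′ As′} → X.Col As B B′ As′ → Band B → Band B′ × flags B′ ≡ flags B
col-band X.[] b = b , refl
col-band (exchange _ _ _ b′ _ _ f X.∷ c) b = b′ , trans f (proj₂ (col-band c b))

col-grid₁ : ∀ {As B B′ As′} → X.Col As B B′ As′ → X.Grid As (B ∷ []) (B′ ∷ []) As′
col-grid₁ c = X.col-grid c (X.grid-[] _)

grid-cons : ∀ {As B Bs Z As′} → X.Grid As (B ∷ Bs) Z As′ → ∃ λ B′ → ∃ λ Bs′ → Z ≡ B′ ∷ Bs′
grid-cons X.[] = _ , _ , refl
grid-cons (r X.∷ g) with _ , _ , refl ← grid-cons g with _ X.∷ _ ← r = _ , _ , refl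

grid-nil : ∀ {As Z As′} → X.Grid As [] Z As′ → Z ≡ []
grid-nil X.[] = refl
grid-nil (r X.∷ g) with refl ← grid-nil g with X.[] ← r = refl

-- The columns of bands and the moves box by box describe the same grid of positions. Uniqueness
-- identifies the resulting bands, so the equivalence proved for single boxes transfers.
lat-columns : ∀ {P As U U′ As₁ W W′ As₂} → Down P → Chain P (positions* As ++ positions U ++ positions W) → Band U → Band W →
  X.Col As U U′ As₁ → X.Col As₁ W W′ As₂ → Lat U W ⇔′ Lat U′ W′
lat-columns {P} {As} {U} {U′} {As₁} {W} {W′} dP ch bU bW c₁ c₂ with moved {V} {V′} gU gW bV bV′ fV fV′ i ← move-all (positions* As) dP ch bU bW
  with e₁ , refl ← grid-fun swap-fun gU (subst₂ (λ X Y → Grid (positions* As) X Y (positions* As₁)) (++-identityʳ (positions U)) (++-identityʳ (positions U′)) (grid-flat (col-grid₁ c₁)))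
  with e₂ , _ ← grid-fun swap-fun gW (subst₂ (λ X Y → Grid (positions* As₁) X Y _) (++-identityʳ (positions W)) (++-identityʳ (positions W′)) (grid-flat (col-grid₁ c₂)))
  with bU′ , fU ← col-band c₁ bU | bW′ , fW ← col-band c₂ bW
  with refl ← band-unique bV bU′ e₁ (trans fV (sym fU)) | refl ← band-unique bV′ bW′ e₂ (trans fV′ (sym fW)) = i

chain-col : ∀ {P As U U′ As₁ L} → Down P → Chain P (positions* As ++ positions U ++ L) → X.Col As U U′ As₁ → Chain P (positions U′ ++ positions* As₁ ++ L)
chain-col {U = U} {U′} dP ch c = chain-grid dP ch (subst₂ (λ X Y → Grid _ X Y _) (++-identityʳ (positions U)) (++-identityʳ (positions U′)) (grid-flat (col-grid₁ c)))

lat-join : ∀ {P As U U′ As₁ Ts Ts′ As′} → Down P → Chain P (positions* As ++ positions U ++ positions* Ts) → Band U → All Band Ts →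
  X.Col As U U′ As₁ → X.Grid As₁ Ts Ts′ As′ → Linked Lat Ts ⇔′ Linked Lat Ts′ → Linked Lat (U ∷ Ts) ⇔′ Linked Lat (U′ ∷ Ts′)
lat-join {Ts = []} dP ch bU _ c g _ with refl ← grid-nil g = (λ _ → [-]) , λ _ → [-]
lat-join {P} {As} {U} {Ts = W ∷ Ts} dP ch bU (bW ∷ _) c g (h , h⁻) with _ , _ , refl ← grid-cons g with _ , c′ , _ ← X.grid-col g
  with f , f⁻ ← lat-columns {As = As} {U = U} {W = W} dP (proj₁ (chain-++⁻ (positions* As ++ positions U ++ positions W) (subst (Chain P)
        (sym (trans (++-assoc (positions* As) _ _) (cong (positions* As ++_) (++-assoc (positions U) _ _)))) ch))) bU bW c c′
  = (λ { (x ∷ l) → f x ∷ h l }) , λ { (x ∷ l) → f⁻ x ∷ h⁻ l }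

lat-grid : ∀ {P As Ts Ts′ As′} → Down P → Chain P (positions* As ++ positions* Ts) → All Band Ts → X.Grid As Ts Ts′ As′ →
  Linked Lat Ts ⇔′ Linked Lat Ts′
lat-grid {Ts = []} dP ch _ g with refl ← grid-nil g = (λ l → l) , λ l → l
lat-grid {P} {As} {U ∷ Ts} dP ch (bU ∷ bTs) g with U′ , _ , refl ← grid-cons g with _ , c , g′ ← X.grid-col g
  with chU′ , chR ← chain-++⁻ (positions U′) (chain-col {As = As} {U = U} dP ch c)
  = lat-join {As = As} {U = U} dP ch bU bTs c g′ (lat-grid (down-chain (positions U′) dP chU′) chR bTs g′)

flags-grid : ∀ {As Ts Ts′ As′} → All Band Ts → X.Grid As Ts Ts′ As′ → concatMap flags Ts′ ≡ concatMap flags Ts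
flags-grid {Ts = []} _ g with refl ← grid-nil g = refl
flags-grid {Ts = U ∷ Ts} (bU ∷ bTs) g with _ , _ , refl ← grid-cons g with _ , c , g′ ← X.grid-col g =
  cong₂ _++_ (proj₂ (col-band c bU)) (flags-grid bTs g′)

-- Bands of a tableau

part-drop : ∀ la → Linked (λ a b → b < a) la → ∀ i → 0 < part la (suc (suc i)) → part la (suc (suc i)) < part la (suc i)
part-drop (a ∷ b ∷ la) (r ∷ _) zero _ = r
part-drop (a ∷ b ∷ la) (_ ∷ l) (suc i) h = part-drop (b ∷ la) l i h

-- Row i of a shifted shape ends just before column `part la i + i`; strictness makes these ends
-- weakly decrease.
part-shift : ∀ {la} → Linked (λ a b → b < a) la → ∀ {i j} → 1 ≤ i → i ≤ j → 0 < part la j → part la j + j ≤ part la i + i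
part-shift {la} l {i} {j} 1≤i i≤j h with m≤n⇒m<n∨m≡n i≤j
... | inj₂ refl = ≤-refl
part-shift {la} l {suc i} {suc (suc j)} 1≤i _ h | inj₁ (s≤s i≤j) = ≤-trans (≤-trans (≤-reflexive (+-suc _ _)) (+-monoˡ-≤ (suc j) d))
    (part-shift l 1≤i i≤j (≤-trans (s≤s z≤n) (<-≤-trans h (<⇒≤ d))))
  where
  d : part la (suc (suc j)) < part la (suc j)
  d = part-drop la l j h
part-shift {la} l {suc i} {suc zero} 1≤i _ h | inj₁ (s≤s ())

shape-positive : ∀ {la i j} → InShape la (i , j) → 0 < part la i
shape-positive {la} {i} (_ , a , b) = +-cancelʳ-< i 0 (part la i) (≤-<-trans a b)

shape-box : ∀ {la p} → InShape la p → Box p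
shape-box (a , b , _) = a , b

down-shape : ∀ {la} → StrictPartition la → Down (InShape la)
close (down-shape {la} (_ , l)) {i , j} {i′ , j′} s@(_ , i≤j , lt) (1≤ , ≤j) (r , c) =
  1≤ , ≤j , ≤-<-trans c (<-≤-trans lt (part-shift l 1≤ r (shape-positive {la} {i} {j} s)))

module _ {A : Set} {R : A → A → Set} where

  pairs-++ : ∀ X {Y : List A} → AllPairs R X → AllPairs R Y → (∀ {x y} → x ∈ X → y ∈ Y → R x y) → AllPairs R (X ++ Y)
  pairs-++ [] _ q _ = q
  pairs-++ (x ∷ X) (p ∷ ps) q f = All.tabulate (λ m → [ All.lookup p , f (here refl) ]′ (∈-++⁻ X m)) ∷ pairs-++ X ps q (λ m n → f (there m) n)

  pairs-concatMap : ∀ {B : Set} {S : B → B → Set} (f : B → List A) {is} → (∀ i → AllPairs R (f i)) → AllPairs S is →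
    (∀ {i j x y} → S i j → x ∈ f i → y ∈ f j → R x y) → AllPairs R (concatMap f is)
  pairs-concatMap f {[]} p q h = []
  pairs-concatMap {S = S} f {i ∷ is} p (s ∷ ss) h = pairs-++ (f i) (p i) (pairs-concatMap f p ss h)
    λ {x} {y} m n → inner m (∈-concatMap⁻ f {xs = is} n) s
    where
    inner : ∀ {x y is} → x ∈ f i → Any.Any (λ j → y ∈ f j) is → All (S i) is → R x y
    inner m (here n) (s ∷ _) = h s m n
    inner m (there n) (_ ∷ ss) = inner m n ss

  pairs-linked : ∀ {X} → AllPairs R X → Linked R X
  pairs-linked [] = []
  pairs-linked (_ ∷ []) = [-]
  pairs-linked ((r ∷ _) ∷ ps@(_ ∷ _)) = r ∷ pairs-linked ps

-- A letter k′ occurs at most once in a row, so scanning by rows lists its boxes as a descending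
-- sequence. A letter k occurs at most once in a column, so scanning by columns lists its boxes as
-- an ascending one.
rowMajor colMajor : ℕ → List Pos
rowMajor N = concatMap (λ i → map (i ,_) (upTo N)) (upTo N)
colMajor N = concatMap (λ j → map (_, j) (upTo N)) (upTo N)

upTo-< : ∀ N → AllPairs _<_ (upTo N)
upTo-< N = AP.applyUpTo⁺₁ (λ i → i) N λ i<j _ → i<j

∈-rowMajor : ∀ {N i j} → i < N → j < N → (i , j) ∈ rowMajor N
∈-rowMajor {N} {i} {j} a b = ∈-concatMap⁺ (λ i → map (i ,_) (upTo N)) (lose (∈-upTo⁺ a) (∈-map⁺ (i ,_) (∈-upTo⁺ b)))

∈-colMajor : ∀ {N i j} → i < N → j < N → (i , j) ∈ colMajor N
∈-colMajor {N} {i} {j} a b = ∈-concatMap⁺ (λ j → map (_, j) (upTo N)) (lose (∈-upTo⁺ b) (∈-map⁺ (_, j) (∈-upTo⁺ a)))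

rowMajor-pairs : ∀ N → AllPairs (λ p q → row p < row q ⊎ (row p ≡ row q × col p < col q)) (rowMajor N)
rowMajor-pairs N = pairs-concatMap (λ i → map (i ,_) (upTo N)) (λ i → AP.map⁺ (AllPairs.map (λ l → inj₂ (refl , l)) (upTo-< N))) (upTo-< N)
  λ {i} {j} l m n → case ∈-map⁻ (i ,_) m , ∈-map⁻ (j ,_) n of λ { ((_ , _ , refl) , (_ , _ , refl)) → inj₁ l }

colMajor-pairs : ∀ N → AllPairs (λ p q → col p < col q ⊎ (col p ≡ col q × row p < row q)) (colMajor N)
colMajor-pairs N = pairs-concatMap (λ j → map (_, j) (upTo N)) (λ j → AP.map⁺ (AllPairs.map (λ l → inj₂ (refl , l)) (upTo-< N))) (upTo-< N)
  λ {i} {j} l m n → case ∈-map⁻ (_, i) m , ∈-map⁻ (_, j) n of λ { ((_ , _ , refl) , (_ , _ , refl)) → inj₁ l }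

_≟ₗ_ : (x y : Maybe Letter) → Dec (x ≡ y)
nothing ≟ₗ nothing = yes refl
nothing ≟ₗ just _ = no λ ()
just _ ≟ₗ nothing = no λ ()
just (pr m) ≟ₗ just (pr n) with m ≟ n
... | yes refl = yes refl
... | no k = no λ { refl → k refl }
just (un m) ≟ₗ just (un n) with m ≟ n
... | yes refl = yes refl
... | no k = no λ { refl → k refl }
just (pr _) ≟ₗ just (un _) = no λ ()
just (un _) ≟ₗ just (pr _) = no λ ()

-- Attaching kinds to the primed boxes D and the unprimed boxes A of a letter.
ups : List Pos → List Ent
ups = map (_, up)

assign : List Pos → List Pos → List Ent
assign [] [] = []
assign [] (a ∷ A) = (a , vl false) ∷ ups A
assign (d ∷ []) [] = (d , vl true) ∷ []
assign (d ∷ []) (a ∷ A) with row d <? row a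
... | yes _ = (d , dn) ∷ (a , vl false) ∷ ups A
... | no _  = (d , vl true) ∷ (a , up) ∷ ups A
assign (d ∷ e ∷ D) A = (d , dn) ∷ assign (e ∷ D) A

positions-ups : ∀ A → positions (ups A) ≡ A
positions-ups [] = refl
positions-ups (a ∷ A) = cong (a ∷_) (positions-ups A)

positions-assign : ∀ D A → positions (assign D A) ≡ D ++ A
positions-assign [] [] = refl
positions-assign [] (a ∷ A) = cong (a ∷_) (positions-ups A)
positions-assign (d ∷ []) [] = refl
positions-assign (d ∷ []) (a ∷ A) with row d <? row a
... | yes _ = cong (λ L → d ∷ a ∷ L) (positions-ups A)
... | no _  = cong (λ L → d ∷ a ∷ L) (positions-ups A)
positions-assign (d ∷ e ∷ D) A = cong (d ∷_) (positions-assign (e ∷ D) A)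

ups-Ups : ∀ A → Ups (map kind (ups A))
ups-Ups [] = []
ups-Ups (a ∷ A) = up∷ (ups-Ups A)

ups-links : ∀ {a k} A → k ≢ dn → Linked _↗_ (a ∷ A) → Linked Link ((a , k) ∷ ups A)
ups-links [] n _ = [-]
ups-links {k = up} (b ∷ A) n (r ∷ l) = r ∷ ups-links A (λ ()) l
ups-links {k = vl _} (b ∷ A) n (r ∷ l) = r ∷ ups-links A (λ ()) l
ups-links {k = dn} (b ∷ A) n _ = ⊥-elim (n refl)

-- At the junction the last primed box either still descends to the first unprimed box, which is
-- then the turning point, or rises to it and is the turning point itself. Comparing rows tells
-- which.
assign-band : ∀ D A → Linked _↙_ D → Linked _↗_ A → (∀ {d a} → d ∈ D → a ∈ A → d ↙ a ⊎ d ↗ a) → Band (assign D A)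
assign-band [] [] _ _ _ = band [] none
assign-band [] (a ∷ A) _ l _ = band (ups-links A (λ ()) l) (some (vl∷ (ups-Ups A)))
assign-band (d ∷ []) [] _ _ _ = band [-] (some (vl∷ []))
assign-band (d ∷ []) (a ∷ A) _ l h with row d <? row a | h (here refl) (here refl)
... | yes _ | inj₁ r = band (r ∷ ups-links A (λ ()) l) (some (dn∷ (vl∷ (ups-Ups A))))
... | yes lt | inj₂ (le , _) = ⊥-elim (<⇒≱ lt le)
... | no n | inj₁ (lt , _) = ⊥-elim (n lt)
... | no _ | inj₂ r = band (r ∷ ups-links A (λ ()) l) (some (vl∷ (up∷ (ups-Ups A))))
assign-band (d ∷ e ∷ D) A (r ∷ l) m h = band (front D A (links tail)) (some (dn∷ (turn D A (kinds tail))))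
  where
  tail = assign-band (e ∷ D) A l m (λ x y → h (there x) y)
  front : ∀ D A → Linked Link (assign (e ∷ D) A) → Linked Link ((d , dn) ∷ assign (e ∷ D) A)
  front [] [] l′ = r ∷ l′
  front [] (a ∷ A) l′ with row e <? row a
  ... | yes _ = r ∷ l′
  ... | no _ = r ∷ l′
  front (_ ∷ D) A l′ = r ∷ l′
  turn : ∀ D A → Ok (map kind (assign (e ∷ D) A)) → Turn (map kind (assign (e ∷ D) A))
  turn [] [] (some t) = t
  turn [] (a ∷ A) o with row e <? row a | o
  ... | yes _ | some t = t
  ... | no _ | some t = t
  turn (_ ∷ D) A (some t) = t

assign-letter : ∀ {n p k} D A → (p , k) ∈ assign D A → (p ∈ D × letter n k ≡ pr n) ⊎ (p ∈ A × letter n k ≡ un n)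
assign-letter [] (a ∷ A) (here refl) = inj₂ (here refl , refl)
assign-letter [] (a ∷ A) (there m) with _ , q , refl ← ∈-map⁻ (_, up) m = inj₂ (there q , refl)
assign-letter (d ∷ []) [] (here refl) = inj₁ (here refl , refl)
assign-letter (d ∷ []) (a ∷ A) m with row d <? row a | m
... | yes _ | here refl = inj₁ (here refl , refl)
... | yes _ | there (here refl) = inj₂ (here refl , refl)
... | yes _ | there (there m) with _ , q , refl ← ∈-map⁻ (_, up) m = inj₂ (there q , refl)
assign-letter (d ∷ []) (a ∷ A) m | no _ | here refl = inj₁ (here refl , refl)
assign-letter (d ∷ []) (a ∷ A) m | no _ | there (here refl) = inj₂ (here refl , refl)
assign-letter (d ∷ []) (a ∷ A) m | no _ | there (there m′) with _ , q , refl ← ∈-map⁻ (_, up) m′ = inj₂ (there q , refl)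
assign-letter (d ∷ e ∷ D) A (here refl) = inj₁ (here refl , refl)
assign-letter {n} (d ∷ e ∷ D) A (there m) with assign-letter {n} (e ∷ D) A m
... | inj₁ (q , l) = inj₁ (there q , l)
... | inj₂ x = inj₂ x

make-chain : ∀ {P} L → AllPairs (λ x y → ¬ y ⊑ x) L → (∀ {y} → y ∈ L → Box y × ¬ P y) →
  (∀ {y r} → y ∈ L → Box r → r ⊑ y → P r ⊎ r ∈ L) → Chain P L
make-chain [] _ _ _ = tt
make-chain {P} (y ∷ L) (p ∷ ps) b h = (proj₁ (b (here refl)) , proj₂ (b (here refl)) , below) ,
  make-chain L ps (λ m → proj₁ (b (there m)) , fresh m) later
  where
  below : ∀ r → Box r → r ⊑ y → r ≢ y → P r
  below r br le ne with h (here refl) br le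
  ... | inj₁ q = q
  ... | inj₂ (here e) = ⊥-elim (ne e)
  ... | inj₂ (there m) = ⊥-elim (All.lookup p m le)
  fresh : ∀ {z} → z ∈ L → ¬ (P ∪ (y ∷ [])) z
  fresh m (inj₁ q) = proj₂ (b (there m)) q
  fresh m (inj₂ (here refl)) = All.lookup p m ⊑-refl
  later : ∀ {z r} → z ∈ L → Box r → r ⊑ z → (P ∪ (y ∷ [])) r ⊎ r ∈ L
  later m br le with h (there m) br le
  ... | inj₁ q = inj₁ (inj₁ q)
  ... | inj₂ (here e) = inj₁ (inj₂ (here e))
  ... | inj₂ (there n) = inj₂ n

part-bound : ∀ {la} → All (0 <_) la → ∀ i → 0 < part la i → part la i + i ≤ suc (sum la)
part-bound {x ∷ la} (p ∷ ps) (suc zero) h = ≤-trans (≤-reflexive (+-comm x 1)) (s≤s (m≤m+n x (sum la)))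
part-bound {x ∷ la} (p ∷ ps) (suc (suc i)) h = ≤-trans (≤-reflexive (+-suc _ (suc i)))
  (s≤s (≤-trans (part-bound ps (suc i) h) (+-monoˡ-≤ (sum la) p)))

shape-bound : ∀ {la} → StrictPartition la → ∀ {i j} → InShape la (i , j) → j ≤ sum la
shape-bound {la} (ps , _) {i} {j} s@(_ , _ , c) = ≤-pred (≤-trans c (part-bound ps i (shape-positive {la} {i} {j} s)))

size-code : ∀ {x y} → ∣ x ∣ < ∣ y ∣ → code x < code y
size-code {x} {y} l = ≤-trans (s≤s (hi-code x)) (≤-trans (lia (∣ x ∣ ∷ ∣ y ∣ ∷ []) (λ a b → (a :< b) ∷ [] ⊢ lit 2 :+ (a :+ a) :≤ b :+ b) l) (lo-code y))
  where
  hi-code : ∀ x → code x ≤ suc (∣ x ∣ + ∣ x ∣)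
  hi-code (pr k) = n≤1+n _
  hi-code (un k) = ≤-refl
  lo-code : ∀ x → ∣ x ∣ + ∣ x ∣ ≤ code x
  lo-code (pr k) = ≤-refl
  lo-code (un k) = n≤1+n _

inShape? : ∀ mu r → Dec (InShape mu r)
inShape? mu (i , j) with 1 ≤? i | i ≤? j | j <? part mu i + i
... | yes a | yes b | yes c = yes (a , b , c)
... | no a | _ | _ = no λ x → a (proj₁ x)
... | yes _ | no b | _ = no λ x → b (proj₁ (proj₂ x))
... | yes _ | yes _ | no c = no λ x → c (proj₂ (proj₂ x))

module Tableau {la mu : List ℕ} {U : Filling} (sla : StrictPartition la) (smu : StrictPartition mu) (syt : IsSYT la mu U) where

  shaped = proj₁ syt
  positive = proj₁ (proj₂ syt)
  rows≤ = proj₁ (proj₂ (proj₂ syt))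
  cols≤ = proj₁ (proj₂ (proj₂ (proj₂ syt)))
  col-un = proj₁ (proj₂ (proj₂ (proj₂ (proj₂ syt))))
  row-pr = proj₂ (proj₂ (proj₂ (proj₂ (proj₂ syt))))

  cell : ∀ {p q r x y} → U p ≡ just x → U q ≡ just y → p ⊑ r → r ⊑ q → Box r → ∃ λ z → U r ≡ just z
  cell {p} {q} {r} {x} {y} up′ uq pr′ rq br = proj₂ shaped r
    (close (down-shape sla) (proj₁ (proj₁ shaped q y uq)) br rq ,
     λ m → proj₂ (proj₁ shaped p x up′) (close (down-shape smu) m (shape-box {la} (proj₁ (proj₁ shaped p x up′))) pr′))

  box : ∀ {p x} → U p ≡ just x → Box p
  box {p} {x} e = shape-box {la} (proj₁ (proj₁ shaped p x e))

  rows≤′ : ∀ {i j j′ x y} → j ≤ j′ → U (i , j) ≡ just x → U (i , j′) ≡ just y → code x ≤ code y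
  rows≤′ {j = j} {j′} le e f with m≤n⇒m<n∨m≡n le
  ... | inj₁ lt = rows≤ _ _ _ _ _ lt e f
  ... | inj₂ refl with refl ← trans (sym e) f = ≤-refl

  cols≤′ : ∀ {i i′ j x y} → i ≤ i′ → U (i , j) ≡ just x → U (i′ , j) ≡ just y → code x ≤ code y
  cols≤′ le e f with m≤n⇒m<n∨m≡n le
  ... | inj₁ lt = cols≤ _ _ _ _ _ lt e f
  ... | inj₂ refl with refl ← trans (sym e) f = ≤-refl

  corner : ∀ {p q x y} → U p ≡ just x → U q ≡ just y → p ⊑ q → ∃ λ z → U (row p , col q) ≡ just z × code x ≤ code z × code z ≤ code y
  corner {p} {q} e f (a , b) with z , g ← cell e f (≤-refl , b) (a , ≤-refl) (proj₁ (box e) , ≤-trans (proj₂ (box e)) b) =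
    z , g , rows≤′ b e g , cols≤′ a g f

  mono : ∀ {p q x y} → U p ≡ just x → U q ≡ just y → p ⊑ q → code x ≤ code y
  mono e f le with z , g , a , b ← corner e f le = ≤-trans a b

  code-between : ∀ {k z} → code (pr k) ≤ code z → code z ≤ code (un k) → z ≡ pr k ⊎ z ≡ un k
  code-between {k} {pr m} a b = inj₁ (cong pr (lia (k ∷ m ∷ []) (λ k m → (k :+ k :≤ m :+ m) ∷ (m :+ m :≤ lit 1 :+ (k :+ k)) ∷ [] ⊢ m :≡ k) a b))
  code-between {k} {un m} a b = inj₂ (cong un (half k m a (≤-pred b)))
    where
    half : ∀ k m → k + k ≤ suc (m + m) → m + m ≤ k + k → m ≡ k
    half k m a b with <-cmp m k
    ... | tri≈ _ e _ = e
    ... | tri< l _ _ = ⊥-elim (lia (k ∷ m ∷ []) (λ k m → (m :< k) ∷ (k :+ k :≤ lit 1 :+ (m :+ m)) ∷ [] ⊢ :⊥) l a)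
    ... | tri> _ _ l = ⊥-elim (lia (k ∷ m ∷ []) (λ k m → (k :< m) ∷ (m :+ m :≤ k :+ k) ∷ [] ⊢ :⊥) l b)

  -- The corner in the row of `p` and the column of `q` would carry k′ or k. Monotonicity together
  -- with the rule for rows excludes k′, and together with the rule for columns it excludes k.
  not-nested : ∀ {p q k x y} → U p ≡ just x → U q ≡ just y → (x ≡ pr k ⊎ x ≡ un k) → (y ≡ pr k ⊎ y ≡ un k) → ¬ (row p < row q × col p < col q)
  not-nested {p} {q} {k} {x} {y} e f hx hy (a , b) with z , g , c , d ← corner e f (<⇒≤ a , <⇒≤ b) = absurd hx hy (code-between {k} {z} (≤-trans (low hx) c) (≤-trans d (high hy)))
    where
    low : ∀ {x} → x ≡ pr k ⊎ x ≡ un k → code (pr k) ≤ code x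
    low (inj₁ refl) = ≤-refl
    low (inj₂ refl) = n≤1+n _
    high : ∀ {x} → x ≡ pr k ⊎ x ≡ un k → code x ≤ code (un k)
    high (inj₁ refl) = n≤1+n _
    high (inj₂ refl) = ≤-refl
    absurd : x ≡ pr k ⊎ x ≡ un k → y ≡ pr k ⊎ y ≡ un k → z ≡ pr k ⊎ z ≡ un k → ⊥
    absurd (inj₁ refl) _ (inj₁ refl) = <-irrefl (row-pr _ _ _ _ e g) b
    absurd (inj₂ refl) _ (inj₁ refl) = 1+n≰n c
    absurd _ (inj₂ refl) (inj₂ refl) = <-irrefl (col-un _ _ _ _ g f) a
    absurd _ (inj₁ refl) (inj₂ refl) = 1+n≰n d

  N : ℕ
  -- `upTo` stops below its argument, and the column index `sum la` can occur.
  N = suc (sum la)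

  D A : ℕ → List Pos
  D k = filter (λ p → U p ≟ₗ just (pr k)) (rowMajor N)
  A k = filter (λ p → U p ≟ₗ just (un k)) (colMajor N)

  inside : ∀ {p x} → U p ≡ just x → row p < N × col p < N
  inside {i , j} {x} e = let (a , b , c) = proj₁ (proj₁ shaped (i , j) x e) ; l = shape-bound sla {i} {j} (a , b , c) in s≤s (≤-trans b l) , s≤s l

  D⁺ : ∀ {k p} → U p ≡ just (pr k) → p ∈ D k
  D⁺ {k} e = ∈-filter⁺ (λ p → U p ≟ₗ just (pr k)) (∈-rowMajor (proj₁ (inside e)) (proj₂ (inside e))) e

  A⁺ : ∀ {k p} → U p ≡ just (un k) → p ∈ A k
  A⁺ {k} e = ∈-filter⁺ (λ p → U p ≟ₗ just (un k)) (∈-colMajor (proj₁ (inside e)) (proj₂ (inside e))) e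

  D⁻ : ∀ {k p} → p ∈ D k → U p ≡ just (pr k)
  D⁻ {k} m = proj₂ (∈-filter⁻ (λ p → U p ≟ₗ just (pr k)) {xs = rowMajor N} m)

  A⁻ : ∀ {k p} → p ∈ A k → U p ≡ just (un k)
  A⁻ {k} m = proj₂ (∈-filter⁻ (λ p → U p ≟ₗ just (un k)) {xs = colMajor N} m)

  refine : ∀ {R S : Pos → Pos → Set} {X} → AllPairs R X → (∀ {p q} → p ∈ X → q ∈ X → R p q → S p q) → AllPairs S X
  refine [] f = []
  refine (r ∷ rs) f = All.tabulate (λ m → f (here refl) (there m) (All.lookup r m)) ∷ refine rs (λ m n → f (there m) (there n))

  D-pairs : ∀ k → AllPairs _↙_ (D k)
  D-pairs k = refine (AP.filter⁺ (λ p → U p ≟ₗ just (pr k)) (rowMajor-pairs N)) turn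
    where
    turn : ∀ {p q} → p ∈ D k → q ∈ D k → row p < row q ⊎ (row p ≡ row q × col p < col q) → p ↙ q
    turn m n (inj₁ l) = l , ≮⇒≥ λ c → not-nested (D⁻ m) (D⁻ n) (inj₁ refl) (inj₁ refl) (l , c)
    turn m n (inj₂ (refl , c)) = ⊥-elim (<-irrefl (row-pr _ _ _ _ (D⁻ m) (D⁻ n)) c)

  A-pairs : ∀ k → AllPairs _↗_ (A k)
  A-pairs k = refine (AP.filter⁺ (λ p → U p ≟ₗ just (un k)) (colMajor-pairs N)) turn
    where
    turn : ∀ {p q} → p ∈ A k → q ∈ A k → col p < col q ⊎ (col p ≡ col q × row p < row q) → p ↗ q
    turn m n (inj₁ c) = ≮⇒≥ (λ l → not-nested (A⁻ m) (A⁻ n) (inj₂ refl) (inj₂ refl) (l , c)) , c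
    turn m n (inj₂ (refl , l)) = ⊥-elim (<-irrefl (col-un _ _ _ _ (A⁻ m) (A⁻ n)) l)

  D-A : ∀ {k d a} → d ∈ D k → a ∈ A k → d ↙ a ⊎ d ↗ a
  D-A {k} {d} {a} m n with row d <? row a | col d <? col a
  ... | yes l | yes c = ⊥-elim (not-nested (D⁻ m) (A⁻ n) (inj₁ refl) (inj₂ refl) (l , c))
  ... | yes l | no c = inj₁ (l , ≮⇒≥ c)
  ... | no l | yes c = inj₂ (≮⇒≥ l , c)
  ... | no l | no c = ⊥-elim (1+n≰n (mono (A⁻ n) (D⁻ m) (≮⇒≥ l , ≮⇒≥ c)))

  bandOf : ℕ → List Ent
  bandOf k = assign (D k) (A k)

  bandOf-Band : ∀ k → Band (bandOf k)
  bandOf-Band k = assign-band (D k) (A k) (pairs-linked (D-pairs k)) (pairs-linked (A-pairs k)) D-A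

  bandOf⁻ : ∀ {n p k} → (p , k) ∈ bandOf n → U p ≡ just (letter n k)
  bandOf⁻ {n} {p} {k} m with assign-letter {n} (D n) (A n) m
  ... | inj₁ (q , l) = trans (D⁻ q) (cong just (sym l))
  ... | inj₂ (q , l) = trans (A⁻ q) (cong just (sym l))

  bandOf⁺ : ∀ {n p x} → U p ≡ just x → ∣ x ∣ ≡ n → ∃ λ k → (p , k) ∈ bandOf n × x ≡ letter n k
  bandOf⁺ {n} {p} {x} e s with ∈-map⁻ pos (subst (p ∈_) (sym (positions-assign (D n) (A n))) (listed x e s))
    where
    listed : ∀ x → U p ≡ just x → ∣ x ∣ ≡ n → p ∈ D n ++ A n
    listed (pr n) e refl = ∈-++⁺ˡ (D⁺ e)
    listed (un n) e refl = ∈-++⁺ʳ (D n) (A⁺ e)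
  ... | (_ , k) , m , refl = k , m , just-injective (trans (sym e) (bandOf⁻ m))

  bandsFrom : ℕ → ℕ → List (List Ent)
  bandsFrom k zero = []
  bandsFrom k (suc n) = bandOf k ∷ bandsFrom (suc k) n

  bands-length : ∀ k n → length (bandsFrom k n) ≡ n
  bands-length k zero = refl
  bands-length k (suc n) = cong suc (bands-length (suc k) n)

  bands-Band : ∀ k n → All Band (bandsFrom k n)
  bands-Band k zero = []
  bands-Band k (suc n) = bandOf-Band k ∷ bands-Band (suc k) n

  bands⁻ : ∀ {lab p v} k n → Tags lab k (bandsFrom k n) p v → ∃ λ x → v ≡ (lab , x) × U p ≡ just x
  bands⁻ k (suc n) (inj₁ (_ , m , refl)) = _ , refl , bandOf⁻ m
  bands⁻ k (suc n) (inj₂ t) = bands⁻ (suc k) n t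

  bands⁺ : ∀ {lab p x} k n → U p ≡ just x → k ≤ ∣ x ∣ → ∣ x ∣ < k + n → Tags lab k (bandsFrom k n) p (lab , x)
  bands⁺ k zero e a b = ⊥-elim (<⇒≱ b (≤-trans (≤-reflexive (+-identityʳ k)) a))
  bands⁺ {x = x} k (suc n) e a b with ∣ x ∣ ≟ k
  ... | yes s = inj₁ (let kd , m , q = bandOf⁺ e s in kd , m , cong (_ ,_) q)
  ... | no s = inj₂ (bands⁺ (suc k) n e (≤∧≢⇒< a (λ f → s (sym f))) (≤-trans b (≤-reflexive (+-suc k n))))

  bands-pos : ∀ {p} k n → p ∈ positions* (bandsFrom k n) → ∃ λ x → U p ≡ just x × k ≤ ∣ x ∣
  bands-pos k (suc n) m with ∈-++⁻ (positions (bandOf k)) m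
  ... | inj₁ q with (_ , kd) , q′ , refl ← ∈-map⁻ pos q = _ , bandOf⁻ q′ , ≤-reflexive (sym (size-letter k kd))
  ... | inj₂ q with x , e , l ← bands-pos (suc k) n q = x , e , <⇒≤ l

  bands-pos⁺ : ∀ {p x} k n → U p ≡ just x → k ≤ ∣ x ∣ → ∣ x ∣ < k + n → p ∈ positions* (bandsFrom k n)
  bands-pos⁺ k zero e a b = ⊥-elim (<⇒≱ b (≤-trans (≤-reflexive (+-identityʳ k)) a))
  bands-pos⁺ {x = x} k (suc n) e a b with ∣ x ∣ ≟ k
  ... | yes s = ∈-++⁺ˡ (∈-map⁺ pos (proj₁ (proj₂ (bandOf⁺ e s))))
  ... | no s = ∈-++⁺ʳ (positions (bandOf k)) (bands-pos⁺ (suc k) n e (≤∧≢⇒< a (λ f → s (sym f))) (≤-trans b (≤-reflexive (+-suc k n))))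

  bandOf-sorted : ∀ k → AllPairs (λ x y → ¬ y ⊑ x) (positions (bandOf k))
  bandOf-sorted k = subst (AllPairs _) (sym (positions-assign (D k) (A k)))
    (pairs-++ (D k) (AllPairs.map (λ (l , _) (m , _) → <⇒≱ l m) (D-pairs k)) (AllPairs.map (λ (_ , l) (_ , m) → <⇒≱ l m) (A-pairs k))
      λ m n le → 1+n≰n (mono (A⁻ n) (D⁻ m) le))

  bands-sorted : ∀ k n → AllPairs (λ x y → ¬ y ⊑ x) (positions* (bandsFrom k n))
  bands-sorted k zero = []
  bands-sorted k (suc n) = pairs-++ (positions (bandOf k)) (bandOf-sorted k) (bands-sorted (suc k) n) cross
    where
    cross : ∀ {x y} → x ∈ positions (bandOf k) → y ∈ positions* (bandsFrom (suc k) n) → ¬ y ⊑ x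
    cross m q le with (_ , kd) , m′ , refl ← ∈-map⁻ pos m with z , e , l ← bands-pos (suc k) n q =
      <⇒≱ (size-code {letter k kd} {z} (subst (_< ∣ z ∣) (sym (size-letter k kd)) l)) (mono e (bandOf⁻ m′) le)

  bands-chain : ∀ n → (∀ p x → U p ≡ just x → ∣ x ∣ ≤ n) → Chain (InShape mu) (positions* (bandsFrom 1 n))
  bands-chain n mx = make-chain _ (bands-sorted 1 n)
    (λ {y} m → let x , e , _ = bands-pos 1 n m in box e , proj₂ (proj₁ shaped y x e))
    λ {y} {r} m br le → let x , e , _ = bands-pos 1 n m in inner r br (close (down-shape sla) (proj₁ (proj₁ shaped y x e)) br le)
    where
    inner : ∀ r → Box r → InShape la r → InShape mu r ⊎ r ∈ positions* (bandsFrom 1 n)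
    inner r br s with r ∈ₚ? positions* (bandsFrom 1 n)
    ... | yes m = inj₂ m
    ... | no m = inj₁ (decide (inShape? mu r))
      where
      decide : Dec (InShape mu r) → InShape mu r
      decide (yes x) = x
      decide (no x) with z , e ← proj₂ shaped r (s , x) = ⊥-elim (m (bands-pos⁺ 1 n e (positive r z e) (s≤s (mx r z e))))

-- Shapes grown by addable boxes

bump : List ℕ → ℕ → List ℕ
bump [] i = 1 ∷ []
bump (x ∷ la) (suc (suc i)) = x ∷ bump la (suc i)
bump (x ∷ la) _ = suc x ∷ la

Extendable : List ℕ → ℕ → Set
Extendable la (suc zero) = ⊤
Extendable la (suc (suc i)) = suc (part la (suc (suc i))) < part la (suc i)
Extendable la zero = ⊥

part-bump : ∀ la i → Extendable la i → part (bump la i) i ≡ suc (part la i)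
part-bump [] (suc zero) _ = refl
part-bump [] (suc (suc i)) ()
part-bump (x ∷ la) (suc zero) _ = refl
part-bump (x ∷ la) (suc (suc zero)) e = part-bump la (suc zero) tt
part-bump (x ∷ la) (suc (suc (suc i))) e = part-bump la (suc (suc i)) e

part-bump-≢ : ∀ la i → Extendable la i → ∀ r → r ≢ i → part (bump la i) r ≡ part la r
part-bump-≢ [] (suc zero) _ zero n = refl
part-bump-≢ [] (suc zero) _ (suc zero) n = ⊥-elim (n refl)
part-bump-≢ [] (suc zero) _ (suc (suc r)) n = refl
part-bump-≢ [] (suc (suc i)) () r n
part-bump-≢ (x ∷ la) (suc zero) _ zero n = refl
part-bump-≢ (x ∷ la) (suc zero) _ (suc zero) n = ⊥-elim (n refl)
part-bump-≢ (x ∷ la) (suc zero) _ (suc (suc r)) n = refl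
part-bump-≢ (x ∷ la) (suc (suc i)) e zero n = refl
part-bump-≢ (x ∷ la) (suc (suc i)) e (suc zero) n = refl
part-bump-≢ (x ∷ la) (suc (suc zero)) e (suc (suc r)) n = part-bump-≢ la (suc zero) tt (suc r) (λ f → n (cong suc f))
part-bump-≢ (x ∷ la) (suc (suc (suc i))) e (suc (suc r)) n = part-bump-≢ la (suc (suc i)) e (suc r) (λ f → n (cong suc f))

strict-bump : ∀ la i → Extendable la i → StrictPartition la → StrictPartition (bump la i)
strict-bump la i e (p , l) = positive la i p , decreasing la i e l
  where
  positive : ∀ la i → All (0 <_) la → All (0 <_) (bump la i)
  positive [] i _ = s≤s z≤n ∷ []
  positive (x ∷ la) zero (p ∷ ps) = s≤s z≤n ∷ ps
  positive (x ∷ la) (suc zero) (p ∷ ps) = s≤s z≤n ∷ ps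
  positive (x ∷ la) (suc (suc i)) (p ∷ ps) = p ∷ positive la (suc i) ps
  decreasing : ∀ la i → Extendable la i → Linked (λ a b → b < a) la → Linked (λ a b → b < a) (bump la i)
  decreasing [] i _ _ = [-]
  decreasing (x ∷ []) (suc zero) e [-] = [-]
  decreasing (x ∷ y ∷ la) (suc zero) e (r ∷ l) = ≤-trans r (n≤1+n _) ∷ l
  decreasing (x ∷ []) (suc (suc zero)) e [-] = e ∷ [-]
  decreasing (x ∷ []) (suc (suc (suc i))) () [-]
  decreasing (x ∷ y ∷ la) (suc (suc zero)) e (r ∷ l) = e ∷ decreasing (y ∷ la) (suc zero) tt l
  decreasing (x ∷ y ∷ la) (suc (suc (suc i))) e (r ∷ l) = r ∷ decreasing (y ∷ la) (suc (suc i)) e l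

-- The box to the west puts `y` at the end of its row, and the box above it leaves that row room to
-- grow in a strict partition.
extend-shape : ∀ la {y} → StrictPartition la → Addable (InShape la) y →
  ∃ λ la′ → StrictPartition la′ × (∀ p → InShape la′ p → InShape la p ⊎ p ≡ y) × (∀ p → InShape la p ⊎ p ≡ y → InShape la′ p)
extend-shape la {i , j} sla ((1≤i , i≤j) , ny , below) = bump la i , strict-bump la i ext sla , to , from
  where
  end : part la i + i ≡ j
  end = ≤-antisym (≮⇒≥ λ l → ny (1≤i , i≤j , l)) (inner j i≤j refl)
    where
    inner : ∀ j′ → i ≤ j′ → j ≡ j′ → j ≤ part la i + i
    inner j′ l refl with m≤n⇒m<n∨m≡n l
    ... | inj₂ refl = m≤n+m i (part la i)
    inner (suc j″) l refl | inj₁ (s≤s l′) = proj₂ (proj₂ (below (i , j″) (1≤i , l′) (≤-refl , n≤1+n _) λ f → 1+n≢n (sym (cong col f))))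
  ext : Extendable la i
  ext = inner i 1≤i refl
    where
    inner : ∀ i′ → 1 ≤ i′ → i ≡ i′ → Extendable la i′
    inner (suc zero) _ refl = tt
    inner (suc (suc r)) _ refl with (_ , _ , c) ← below (suc r , j) (s≤s z≤n , ≤-trans (n≤1+n _) i≤j) (n≤1+n _ , ≤-refl) (λ f → 1+n≢n (sym (cong row f))) =
      +-cancelʳ-< (suc r) _ _ (≤-trans (s≤s (≤-trans (≤-reflexive (trans (sym (+-suc _ (suc r))) refl)) (≤-reflexive end))) c)
  to : ∀ p → InShape (bump la i) p → InShape la p ⊎ p ≡ (i , j)
  to (r , s) (a , b , c) with r ≟ i
  ... | no n = inj₁ (a , b , subst (λ m → s < m + r) (part-bump-≢ la i ext r n) c)
  ... | yes refl with m≤n⇒m<n∨m≡n (≤-pred (subst (λ m → s < m + i) (part-bump la i ext) c))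
  ...   | inj₁ l = inj₁ (a , b , l)
  ...   | inj₂ e = inj₂ (cong (i ,_) (trans e end))
  from : ∀ p → InShape la p ⊎ p ≡ (i , j) → InShape (bump la i) p
  from (r , s) (inj₁ (a , b , c)) with r ≟ i
  ... | no n = a , b , subst (λ m → s < m + r) (sym (part-bump-≢ la i ext r n)) c
  ... | yes refl = a , b , subst (λ m → s < m + i) (sym (part-bump la i ext)) (≤-trans c (n≤1+n _))
  from _ (inj₂ refl) = 1≤i , i≤j , subst (λ m → j < m + i) (sym (part-bump la i ext)) (s≤s (≤-reflexive (sym end)))

grow-shape : ∀ la L → StrictPartition la → Chain (InShape la) L →
  ∃ λ la′ → StrictPartition la′ × (∀ p → InShape la′ p → (InShape la ∪ L) p) × (∀ p → (InShape la ∪ L) p → InShape la′ p)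
grow-shape la [] sla _ = la , sla , (λ _ → inj₁) , λ _ → ∪-[] {InShape la} _
grow-shape la (y ∷ L) sla (a , c) with la₁ , s₁ , f , g ← extend-shape la sla a
  with la₂ , s₂ , f₂ , g₂ ← grow-shape la₁ L s₁ (chain-resp L (λ { q (inj₁ x) → g q (inj₁ x) ; q (inj₂ (here e)) → g q (inj₂ e) ; q (inj₂ (there ())) }) (λ q x → [ inj₁ , (λ e → inj₂ (here e)) ]′ (f q x)) c)
  = la₂ , s₂ , (λ p x → to p (f₂ p x)) , λ p x → g₂ p (from p x)
  where
  to : ∀ p → (InShape la₁ ∪ L) p → (InShape la ∪ (y ∷ L)) p
  to p (inj₁ x) = [ inj₁ , (λ e → inj₂ (here e)) ]′ (f p x)
  to p (inj₂ m) = inj₂ (there m)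
  from : ∀ p → (InShape la ∪ (y ∷ L)) p → (InShape la₁ ∪ L) p
  from p (inj₁ x) = inj₁ (g p (inj₁ x))
  from p (inj₂ (here e)) = inj₁ (g p (inj₂ e))
  from p (inj₂ (there m)) = inj₂ m

tags-pos : ∀ {lab n p v} Ts → Tags lab n Ts p v → p ∈ positions* Ts
tags-pos (E ∷ Ts) (inj₁ (_ , m , _)) = ∈-++⁺ˡ (∈-map⁺ pos m)
tags-pos (E ∷ Ts) (inj₂ t) = ∈-++⁺ʳ (positions E) (tags-pos Ts t)

tags-order : ∀ {P lab n} Ts {p q x y} → Down P → Chain P (positions* Ts) → All Band Ts →
  Tags lab n Ts p (lab , x) → Tags lab n Ts q (lab , y) → p ⊑ q → p ≢ q →
  ∣ x ∣ < ∣ y ∣ ⊎ ∃ λ m → ∃ λ k → ∃ λ l → x ≡ letter m k × y ≡ letter m l × Star (p , k) (q , l)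
tags-order (E ∷ Ts) dP ch (bE ∷ bTs) (inj₂ s) (inj₂ t) le n with c₁ , c₂ ← chain-++⁻ (positions E) ch =
  tags-order Ts (down-chain (positions E) dP c₁) c₂ bTs s t le n
tags-order {n = n} (E ∷ Ts) dP ch b (inj₁ s) (inj₂ t) le ne with _ , e ← tag-size {E = E} s | _ , l , _ ← tags-size Ts t = inj₁ (subst (_< _) (sym e) l)
tags-order (E ∷ Ts) {p} {q} dP ch b (inj₂ s) (inj₁ (_ , m , _)) le n with c₁ , c₂ ← chain-++⁻ (positions E) ch =
  ⊥-elim (chain-⋢ _ (down-chain (positions E) dP c₁) c₂ (tags-pos Ts s) (inj₂ (∈-map⁺ pos m)) le)
tags-order {n = n} (E ∷ Ts) {p} {q} dP ch (bE ∷ _) (inj₁ (k , m , refl)) (inj₁ (l , m′ , refl)) le ne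
  = cases (pairs-order (chain-ordered [] E {positions* Ts} dP ch bE) m m′)
  where
  R : Ent → Ent → Set
  R e f = Star e f × ¬ pos f ⊑ pos e
  cases : (p , k) ≡ (q , l) ⊎ R (p , k) (q , l) ⊎ R (q , l) (p , k) →
    ∣ letter n k ∣ < ∣ letter n l ∣ ⊎ ∃ λ m → ∃ λ k′ → ∃ λ l′ → letter n k ≡ letter m k′ × letter n l ≡ letter m l′ × Star (p , k′) (q , l′)
  cases (inj₁ e) = ⊥-elim (ne (cong pos e))
  cases (inj₂ (inj₁ (st , _))) = inj₂ (n , k , l , refl , refl , st)
  cases (inj₂ (inj₂ (_ , n⊑))) = ⊥-elim (n⊑ le)

letter-code : ∀ {m k l p q} → Star (p , k) (q , l) → code (letter m k) ≤ code (letter m l)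
letter-code {k = dn} {dn} _ = ≤-refl
letter-code {k = dn} {up} _ = n≤1+n _
letter-code {k = dn} {vl true} _ = ≤-refl
letter-code {k = dn} {vl false} _ = n≤1+n _
letter-code {k = up} {l} st with refl ← proj₂ (rising st (λ ())) = ≤-refl
letter-code {k = vl true} {l} st with refl ← proj₂ (rising st (λ ())) = n≤1+n _
letter-code {k = vl false} {l} st with refl ← proj₂ (rising st (λ ())) = ≤-refl

-- Comparable boxes lie either in different bands, in increasing order, or in one band, where `Star`
-- applies. There a box following an unprimed one has another column and a box preceding a primed
-- one has another row, which gives the two rules on repeated letters.
bands-syt : ∀ {mu U lab} Ts → StrictPartition mu → Chain (InShape mu) (positions* Ts) → All Band Ts →
  (∀ p x → U p ≡ just x → Tags lab 1 Ts p (lab , x)) → (∀ p x → Tags lab 1 Ts p (lab , x) → U p ≡ just x) →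
  ∃ λ la → StrictPartition la × mu ⊆ˢ la × IsSYT la mu U × (∀ p → InShape la p → (InShape mu ∪ positions* Ts) p) × (∀ p → (InShape mu ∪ positions* Ts) p → InShape la p)
bands-syt {mu} {U} {lab} Ts smu ch bTs f g with la , sla , to , from ← grow-shape mu (positions* Ts) smu ch =
  la , sla , (λ p x → from p (inj₁ x)) ,
  (((λ p x e → from p (inj₂ (tags-pos Ts (f p x e))) , chain-fresh _ ch (tags-pos Ts (f p x e))) ,
    (λ p (s , n) → [ (λ x → ⊥-elim (n x)) , filled p ]′ (to p s))) ,
   (λ p x e → proj₁ (proj₂ (tags-size Ts (f p x e)))) ,
   (λ i j j′ x y l e e′ → weak (f _ _ e) (f _ _ e′) (≤-refl , <⇒≤ l) (λ q → <-irrefl (cong col q) l)) ,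
   (λ i i′ j x y l e e′ → weak (f _ _ e) (f _ _ e′) (<⇒≤ l , ≤-refl) (λ q → <-irrefl (cong row q) l)) ,
   same-col , same-row′) , to , from
  where
  dmu = down-shape smu
  filled : ∀ p → p ∈ positions* Ts → ∃ λ x → U p ≡ just x
  filled p m = let x , t = inner 1 Ts m in x , g p x t
    where
    inner : ∀ n Ts → p ∈ positions* Ts → ∃ λ x → Tags lab n Ts p (lab , x)
    inner n (E ∷ Ts) m with ∈-++⁻ (positions E) m
    ... | inj₁ q with (_ , k) , q′ , refl ← ∈-map⁻ pos q = letter n k , inj₁ (k , q′ , refl)
    ... | inj₂ q with x , t ← inner (suc n) Ts q = x , inj₂ t
  weak : ∀ {p q x y} → Tags lab 1 Ts p (lab , x) → Tags lab 1 Ts q (lab , y) → p ⊑ q → p ≢ q → code x ≤ code y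
  weak {x = x} {y} s t le n with tags-order Ts dmu ch bTs s t le n
  ... | inj₁ l = <⇒≤ (size-code {x} {y} l)
  ... | inj₂ (m , k , l , refl , refl , st) = letter-code {m} st
  un-col : ∀ {p q k} → Tags lab 1 Ts p (lab , un k) → Tags lab 1 Ts q (lab , un k) → col p ≡ col q → ¬ row p < row q
  un-col s t e l with tags-order Ts dmu ch bTs s t (<⇒≤ l , ≤-reflexive e) (λ q → <-irrefl (cong row q) l)
  ... | inj₁ l′ = <-irrefl refl l′
  ... | inj₂ (m , kp , kq , a , b , st) = <-irrefl e (proj₂ (proj₁ (rising st (letter-un m kp (trans (sym a) (cong un (unsize m kp a)))))))
    where
    unsize : ∀ {k} m kp → un k ≡ letter m kp → k ≡ m
    unsize m kp a = trans (cong ∣_∣ a) (size-letter m kp)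
  pr-row : ∀ {p q k} → Tags lab 1 Ts p (lab , pr k) → Tags lab 1 Ts q (lab , pr k) → row p ≡ row q → ¬ col p < col q
  pr-row s t e l with tags-order Ts dmu ch bTs s t (≤-reflexive e , <⇒≤ l) (λ q → <-irrefl (cong col q) l)
  ... | inj₁ l′ = <-irrefl refl l′
  ... | inj₂ (m , kp , kq , a , b , st) = <-irrefl e (proj₁ (proj₁ (falling st (letter-pr m kq (trans (sym b) (cong pr (unsize m kq b)))))))
    where
    unsize : ∀ {k} m kp → pr k ≡ letter m kp → k ≡ m
    unsize m kp a = trans (cong ∣_∣ a) (size-letter m kp)
  same-col : ∀ i i′ j k → U (i , j) ≡ just (un k) → U (i′ , j) ≡ just (un k) → i ≡ i′
  same-col i i′ j k e e′ with <-cmp i i′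
  ... | tri< l _ _ = ⊥-elim (un-col (f _ _ e) (f _ _ e′) refl l)
  ... | tri≈ _ q _ = q
  ... | tri> _ _ l = ⊥-elim (un-col (f _ _ e′) (f _ _ e) refl l)
  same-row′ : ∀ i j j′ k → U (i , j) ≡ just (pr k) → U (i , j′) ≡ just (pr k) → j ≡ j′
  same-row′ i j j′ k e e′ with <-cmp j j′
  ... | tri< l _ _ = ⊥-elim (pr-row (f _ _ e) (f _ _ e′) refl l)
  ... | tri≈ _ q _ = q
  ... | tri> _ _ l = ⊥-elim (pr-row (f _ _ e′) (f _ _ e) refl l)

-- Reading words

count : (Letter → Bool) → List Letter → ℕ
count f []      = 0
count f (x ∷ l) = ι (f x) + count f l

isUn isPr : ℕ → Letter → Bool
isUn i (un j) = j ≡ᵇ i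
isUn i (pr j) = false
isPr i (un j) = false
isPr i (pr j) = j ≡ᵇ i

countUn-count : ∀ i l → countUn i l ≡ count (isUn i) l
countUn-count i [] = refl
countUn-count i (pr j ∷ l) = countUn-count i l
countUn-count i (un j ∷ l) with j ≡ᵇ i
... | true = cong suc (countUn-count i l)
... | false = countUn-count i l

count-++ : ∀ f l {m} → count f (l ++ m) ≡ count f l + count f m
count-++ f [] = refl
count-++ f (x ∷ l) = trans (cong (ι (f x) +_) (count-++ f l)) (sym (+-assoc (ι (f x)) _ _))

count-zero : ∀ f {l} → All (λ x → f x ≡ false) l → count f l ≡ 0
count-zero f [] = refl
count-zero f (e ∷ es) rewrite e = count-zero f es

count-reverse : ∀ f l → count f (reverse l) ≡ count f l
count-reverse f [] = refl
count-reverse f (x ∷ l) = trans (cong (count f) (unfold-reverse x l))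
  (trans (count-++ f (reverse l)) (trans (cong₂ _+_ (count-reverse f l) (+-identityʳ (ι (f x)))) (+-comm (count f l) (ι (f x)))))

count-hat : ∀ i l → count (isUn i) (map hatL l) ≡ count (isPr i) l
count-hat i [] = refl
count-hat i (un j ∷ l) = count-hat i l
count-hat i (pr j ∷ l) = cong (ι (j ≡ᵇ i) +_) (count-hat i l)

≡ᵇ-false : ∀ {m n} → m ≢ n → (m ≡ᵇ n) ≡ false
≡ᵇ-false {m} {n} ne with m ≡ᵇ n in e
... | true = ⊥-elim (ne (≡ᵇ-true e))
... | false = refl

isUn-≢ : ∀ i x → ∣ x ∣ ≢ i → isUn i x ≡ false
isUn-≢ i (un j) n = ≡ᵇ-false n
isUn-≢ i (pr j) n = refl

isPr-≢ : ∀ i x → ∣ x ∣ ≢ i → isPr i x ≡ false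
isPr-≢ i (un j) n = refl
isPr-≢ i (pr j) n = ≡ᵇ-false n

-- Reading l from a point where the letters k + 1 and k have been counted a and b times, a letter of size k + 1
-- occurs only when a < b.
Runs : ℕ → ℕ → ℕ → List Letter → Set
Runs k a b []      = ⊤
Runs k a b (x ∷ l) = (∣ x ∣ ≡ suc k → a < b) × Runs k (ι (isUn (suc k) x) + a) (ι (isUn k x) + b) l

runs-step : ∀ k {a b} x → a ≤ b → (∣ x ∣ ≡ suc k → a < b) → ι (isUn (suc k) x) + a ≤ ι (isUn k x) + b
runs-step k {b = b} (pr j) l h = l
runs-step k {a} {b} (un j) l h with j ≡ᵇ suc k in e
... | true = ≤-trans (h (≡ᵇ-true e)) (m≤n+m b (ι (j ≡ᵇ k)))
... | false = ≤-trans l (m≤n+m b (ι (j ≡ᵇ k)))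

shift : ∀ x c a → c + (x + a) ≡ (x + c) + a
shift x c a = trans (sym (+-assoc c x a)) (cong (_+ a) (+-comm c x))

runs-≤ : ∀ k {a b} l → a ≤ b → Runs k a b l → count (isUn (suc k)) l + a ≤ count (isUn k) l + b
runs-≤ k [] le _ = le
runs-≤ k {a} {b} (x ∷ l) le (h , r) = subst₂ _≤_ (shift (ι (isUn (suc k) x)) _ a) (shift (ι (isUn k x)) _ b) (runs-≤ k l (runs-step k x le h) r)

runs-++ : ∀ k {a b} l {m} → Runs k a b (l ++ m) ⇔′ (Runs k a b l × Runs k (count (isUn (suc k)) l + a) (count (isUn k) l + b) m)
runs-++ k [] = (λ r → tt , r) , proj₂
runs-++ k {a} {b} (x ∷ l) {m} with f , g ← runs-++ k {ι (isUn (suc k) x) + a} {ι (isUn k x) + b} l {m} =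
  (λ { (h , r) → let p , q = f r in (h , p) , subst₂ (λ u v → Runs k u v m) (shift (ι (isUn (suc k) x)) _ a) (shift (ι (isUn k x)) _ b) q }) ,
  λ { ((h , p) , q) → h , g (p , subst₂ (λ u v → Runs k u v m) (sym (shift (ι (isUn (suc k) x)) _ a)) (sym (shift (ι (isUn k x)) _ b)) q) }

-- The definition excludes a letter only when two counts are equal. As they start equal and grow by
-- single units, the count of k + 1 never overtakes that of k, and "not equal" becomes a strict
-- inequality.
lattice-runs : ∀ w → Lattice w ⇔′ (∀ k → 1 ≤ k → Runs k 0 0 (w ++ hat w))
lattice-runs w = (λ L k 1≤k → to k (w ++ hat w) z≤n λ pre x suf e q → L (suc k) pre x suf e (s≤s 1≤k)
      (trans (countUn-count (suc k) pre) (trans (trans (sym (+-identityʳ _)) (trans q (+-identityʳ _))) (sym (countUn-count k pre))))) ,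
  λ { R (suc k) pre x suf e (s≤s 1≤k) q → from k pre (subst (Runs k 0 0) e (R k 1≤k))
      (cong (_+ 0) (trans (sym (countUn-count (suc k) pre)) (trans q (countUn-count k pre)))) }
  where
  to : ∀ k {a b} l → a ≤ b → (∀ pre x suf → l ≡ pre ++ x ∷ suf → count (isUn (suc k)) pre + a ≡ count (isUn k) pre + b → ∣ x ∣ ≢ suc k) → Runs k a b l
  to k [] le h = tt
  to k {a} {b} (x ∷ l) le h = first , to k l (runs-step k x le first) λ pre y suf e q → h (x ∷ pre) y suf (cong (x ∷_) e)
      (trans (sym (shift (ι (isUn (suc k) x)) _ a)) (trans q (shift (ι (isUn k x)) _ b)))
    where
    first : ∣ x ∣ ≡ suc k → a < b
    first s = ≤∧≢⇒< le λ e → h [] x l refl e s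
  from : ∀ k {a b} pre {x suf} → Runs k a b (pre ++ x ∷ suf) → count (isUn (suc k)) pre + a ≡ count (isUn k) pre + b → ∣ x ∣ ≢ suc k
  from k [] (h , _) e s = <-irrefl e (h s)
  from k {a} {b} (y ∷ pre) (_ , r) e = from k pre r (trans (shift (ι (isUn (suc k) y)) _ a) (trans e (sym (shift (ι (isUn k y)) _ b))))

runs-quiet : ∀ k {a b} l → All (λ x → ∣ x ∣ ≢ suc k) l → Runs k a b l
runs-quiet k [] _ = tt
runs-quiet k (x ∷ l) (n ∷ ns) = (λ e → ⊥-elim (n e)) , runs-quiet k l ns

code-size : ∀ {x y} → code x ≤ code y → ∣ x ∣ ≤ ∣ y ∣
code-size {x} {y} l = ≮⇒≥ λ s → <⇒≱ (size-code {y} {x} s) l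

-- y comes after x in a row of a tableau read from right to left.
Above : Letter → Letter → Set
Above x y = code y ≤ code x × (∀ j → x ≡ pr j → y ≢ pr j)

below-pr : ∀ {k y} → Above (pr k) y → ∣ y ∣ < k
below-pr {k} {pr j} (l , h) = ≤∧≢⇒< (code-size {pr j} {pr k} l) λ { refl → h k refl refl }
below-pr {k} {un j} (l , h) = ≤∧≢⇒< (code-size {un j} {pr k} l) λ { refl → 1+n≰n l }

un-quiet : ∀ i {l} → All (λ x → ∣ x ∣ ≢ i) l → count (isUn i) l ≡ 0
un-quiet i ns = count-zero (isUn i) (All.map (λ {x} → isUn-≢ i x) ns)

pr-quiet : ∀ i {l} → All (λ x → ∣ x ∣ ≢ i) l → count (isPr i) l ≡ 0
pr-quiet i ns = count-zero (isPr i) (All.map (λ {x} → isPr-≢ i x) ns)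

smaller : ∀ {i x l} → ∣ x ∣ < i → All (Above x) l → All (λ y → ∣ y ∣ ≢ i) l
smaller {x = x} s = All.map λ {y} (c , _) e → <-irrefl e (≤-<-trans (code-size {y} {x} c) s)

larger : ∀ {i x l} → i < ∣ x ∣ → All (λ y → Above y x) l → All (λ y → ∣ y ∣ ≢ i) l
larger {x = x} s = All.map λ {y} (c , _) e → <-irrefl (sym e) (<-≤-trans s (code-size {x} {y} c))

smaller-pr : ∀ {i l} → All (Above (pr i)) l → All (λ y → ∣ y ∣ ≢ i) l
smaller-pr = All.map λ h e → <-irrefl e (below-pr h)

module _ (k : ℕ) where

  private
    c₀ c₁ p₀ p₁ : List Letter → ℕ
    c₀ = count (isUn k)
    c₁ = count (isUn (suc k))
    p₀ = count (isPr k)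
    p₁ = count (isPr (suc k))

  -- From right to left a row shows the letters k + 1 and then at most one (k + 1)′, all before any
  -- k. No k is counted in between, so one inequality at the last of them suffices.
  row-run : ∀ {a b} l → AllPairs Above l → a ≤ b → Runs k a b l ⇔′ (c₁ l + p₁ l + a ≤ b)
  row-run [] _ le = (λ _ → le) , λ _ → tt
  row-run {a} {b} (x ∷ l) (us ∷ ps) le with <-cmp ∣ x ∣ (suc k)
  ... | tri< s n _ rewrite isUn-≢ (suc k) x n | isPr-≢ (suc k) x n | un-quiet (suc k) (smaller {x = x} s us) | pr-quiet (suc k) (smaller {x = x} s us) =
    (λ _ → le) , λ _ → (λ e → ⊥-elim (n e)) , runs-quiet k l (smaller {x = x} s us)
  ... | tri> _ n s rewrite isUn-≢ (suc k) x n | isPr-≢ (suc k) x n | isUn-≢ k x (λ e → <-irrefl (sym e) (<-trans ≤-refl s)) with f , g ← row-run {a} {b} l ps le =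
    (λ r → f (proj₂ r)) , λ r → (λ e → ⊥-elim (n e)) , g r
  row-run {a} {b} (pr j ∷ l) (us ∷ ps) le | tri≈ _ refl _ rewrite ≡ᵇ-refl k | un-quiet (suc k) (smaller-pr us) | pr-quiet (suc k) (smaller-pr us) =
    (λ r → proj₁ r refl) , λ h → (λ _ → h) , runs-quiet k l (smaller-pr us)
  row-run {a} {b} (un j ∷ l) (us ∷ ps) le | tri≈ _ refl _ rewrite ≡ᵇ-refl k | ≡ᵇ-false {suc k} {k} (λ e → 1+n≢n e) =
    (λ (h , r) → ≤-trans (≤-reflexive (sym (+-suc (c₁ l + p₁ l) a))) (proj₁ (row-run l ps (h refl)) r)) ,
    λ h → (λ _ → ≤-trans (s≤s (m≤n+m a (c₁ l + p₁ l))) h) ,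
      proj₂ (row-run l ps (≤-trans (s≤s (m≤n+m a (c₁ l + p₁ l))) h)) (≤-trans (≤-reflexive (+-suc (c₁ l + p₁ l) a)) h)

  -- In the reversed and replaced row, k′ counts first and for k; then each k acts as (k + 1)′;
  -- last, (k + 1)′ counts for k + 1. The two inequalities are the conditions at the last and the
  -- middle stage.
  hat-run : ∀ {a b} l → AllPairs (flip Above) l → a ≤ b → Runs k a b (map hatL l) ⇔′ ((p₁ l + a ≤ p₀ l + b) × (1 ≤ c₀ l → a < p₀ l + b))
  hat-run [] _ le = (λ _ → le , λ ()) , λ _ → tt
  hat-run {a} {b} (x ∷ l) (us ∷ ps) le with <-cmp ∣ x ∣ k
  hat-run {a} {b} (pr j ∷ l) (us ∷ ps) le | tri< s n _ rewrite ≡ᵇ-false n | ≡ᵇ-false {j} {suc k} (λ e → <-irrefl e (<-trans s ≤-refl)) with f , g ← hat-run {a} {b} l ps le =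
    (λ r → f (proj₂ r)) , λ r → (λ e → ⊥-elim (<-irrefl e (<-trans s ≤-refl))) , g r
  hat-run {a} {b} (un j ∷ l) (us ∷ ps) le | tri< s n _ rewrite ≡ᵇ-false n with f , g ← hat-run {a} {b} l ps le =
    (λ r → f (proj₂ r)) , λ r → (λ e → ⊥-elim (n (suc-injective e))) , g r
  hat-run {a} {b} (pr j ∷ l) (us ∷ ps) le | tri≈ _ refl _ rewrite ≡ᵇ-refl k | ≡ᵇ-false {k} {suc k} (λ e → 1+n≢n (sym e)) with f , g ← hat-run {a} {suc b} l ps (≤-trans le (n≤1+n _)) =
    (λ (_ , r) → let u , v = f r in ≤-trans u (≤-reflexive (+-suc (p₀ l) b)) , λ c → ≤-trans (v c) (≤-reflexive (+-suc (p₀ l) b))) ,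
    λ (u , v) → (λ e → ⊥-elim (1+n≢n (sym e))) , g (≤-trans u (≤-reflexive (sym (+-suc (p₀ l) b))) , λ c → ≤-trans (v c) (≤-reflexive (sym (+-suc (p₀ l) b))))
  hat-run {a} {b} (un j ∷ l) (us ∷ ps) le | tri≈ _ refl _ rewrite ≡ᵇ-refl k
    = turn zero′ (hat-run {a} {b} l ps le)
    where
    zero′ : p₀ l ≡ 0
    zero′ = count-zero (isPr k) (All.map (λ { {pr i} (c , _) → isPr-≢ k (pr i) (λ { refl → 1+n≰n c }) ; {un i} _ → refl }) us)
    turn : ∀ {R : Set} {p q c} → p ≡ 0 → R ⇔′ ((q + a ≤ p + b) × (1 ≤ c → a < p + b)) →
      ((suc k ≡ suc k → a < b) × R) ⇔′ ((q + a ≤ p + b) × (1 ≤ suc c → a < p + b))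
    turn refl (f , g) = (λ (h , r) → proj₁ (f r) , λ _ → h refl) , λ (u , v) → (λ _ → v (s≤s z≤n)) , g (u , λ _ → v (s≤s z≤n))
  ... | tri> _ n s rewrite isPr-≢ k x n | isUn-≢ k x n | pr-quiet k (larger {x = x} s us) | un-quiet k (larger {x = x} s us)
    = beyond x s us
    where
    tail-quiet : ∀ {l} → All (λ y → hatL y ≢ un (suc k) × k < ∣ y ∣) l → All (λ y → ∣ y ∣ ≢ suc k) (map hatL l)
    tail-quiet [] = []
    tail-quiet {pr j ∷ l} ((n , _) ∷ ns) = (λ e → n (cong un e)) ∷ tail-quiet ns
    tail-quiet {un j ∷ l} ((_ , s) ∷ ns) = (λ e → <-irrefl (sym (suc-injective e)) s) ∷ tail-quiet ns
    above-pr : ∀ {j l} → k < j → All (λ y → Above y (pr j)) l → All (λ y → hatL y ≢ un (suc k) × k < ∣ y ∣) l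
    above-pr s = All.map λ { {pr i} (c , h) → (λ { refl → h i refl (cong pr (≤-antisym (code-size {pr _} {pr i} c) s)) }) , <-≤-trans s (code-size {pr _} {pr i} c)
                           ; {un i} (c , h) → (λ ()) , <-≤-trans s (code-size {pr _} {un i} c) }
    above-un : ∀ {j l} → k < j → All (λ y → Above y (un j)) l → All (λ y → hatL y ≢ un (suc k) × k < ∣ y ∣) l
    above-un {j} s = All.map λ { {pr i} (c , h) → (λ { refl → <⇒≱ (s≤s (+-mono-≤ s s)) c }) , <-≤-trans s (code-size {un _} {pr i} c)
                               ; {un i} (c , h) → (λ ()) , <-≤-trans s (code-size {un _} {un i} c) }
    pr-zero : ∀ {l} → All (λ y → hatL y ≢ un (suc k) × k < ∣ y ∣) l → p₁ l ≡ 0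
    pr-zero ns = count-zero (isPr (suc k)) (All.map (λ { {pr i} (n , _) → ≡ᵇ-false (λ e → n (cong un e)) ; {un i} _ → refl }) ns)
    beyond : ∀ x → k < ∣ x ∣ → All (λ y → Above y x) l → Runs k a b (map hatL (x ∷ l)) ⇔′ ((p₁ (x ∷ l) + a ≤ b) × (1 ≤ 0 → a < b))
    beyond (pr j) s us rewrite pr-zero (above-pr s us) with j ≟ suc k
    ... | yes refl rewrite ≡ᵇ-refl k = (λ (h , _) → h refl , λ ()) , λ (h , _) → (λ _ → h) , runs-quiet k (map hatL l) (tail-quiet (above-pr s us))
    ... | no ne rewrite ≡ᵇ-false ne = (λ _ → le , λ ()) , λ _ → (λ e → ⊥-elim (ne e)) , runs-quiet k (map hatL l) (tail-quiet (above-pr s us))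
    beyond (un j) s us rewrite pr-zero (above-un s us) = (λ _ → le , λ ()) , λ _ → (λ e → ⊥-elim (<-irrefl (sym (suc-injective e)) s)) , runs-quiet k (map hatL l) (tail-quiet (above-un s us))

-- Beyond the list the empty band stands in, so that the lattice condition can be stated for every
-- k; by `lat-[]` this adds nothing.
bandAt : List (List Ent) → ℕ → List Ent
bandAt []       k       = []
bandAt (E ∷ Ts) zero    = E
bandAt (E ∷ Ts) (suc k) = bandAt Ts k

lat-[] : ∀ U → Lat U []
lat-[] U = lat (λ r → z≤n) (λ r → z≤n) λ r h → ≤-trans h (≤-trans (≤-trans (m≤n+m _ _) (≤-reflexive (sym (lo-suc U r)))) (≤-trans (lo≤all U (suc r)) (m≤m+n _ _)))

linked-at : ∀ Ts → Linked Lat Ts ⇔′ (∀ k → Lat (bandAt Ts k) (bandAt Ts (suc k)))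
linked-at Ts = to Ts , from Ts
  where
  to : ∀ Ts → Linked Lat Ts → ∀ k → Lat (bandAt Ts k) (bandAt Ts (suc k))
  to [] l k = lat-[] []
  to (U ∷ []) l zero = lat-[] U
  to (U ∷ []) l (suc k) = lat-[] []
  to (U ∷ W ∷ Ts) (h ∷ l) zero = h
  to (U ∷ W ∷ Ts) (h ∷ l) (suc k) = to (W ∷ Ts) l k
  from : ∀ Ts → (∀ k → Lat (bandAt Ts k) (bandAt Ts (suc k))) → Linked Lat Ts
  from [] h = []
  from (U ∷ []) h = [-]
  from (U ∷ W ∷ Ts) h = h 0 ∷ from (W ∷ Ts) (λ k → h (suc k))

flags-at : ∀ Ts → All (_≡ false) (concatMap flags Ts) ⇔′ (∀ k → All (_≡ false) (flags (bandAt Ts k)))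
flags-at Ts = to Ts , from Ts
  where
  to : ∀ Ts → All (_≡ false) (concatMap flags Ts) → ∀ k → All (_≡ false) (flags (bandAt Ts k))
  to [] h k = []
  to (U ∷ Ts) h zero = ++⁻ˡ (flags U) h
  to (U ∷ Ts) h (suc k) = to Ts (++⁻ʳ (flags U) h) k
  from : ∀ Ts → (∀ k → All (_≡ false) (flags (bandAt Ts k))) → All (_≡ false) (concatMap flags Ts)
  from [] h = []
  from (U ∷ Ts) h = ++⁺ (h 0) (from Ts (λ k → h (suc k)))

band-at : ∀ {Ts} → All Band Ts → ∀ k → Band (bandAt Ts k)
band-at [] k = band [] none
band-at (b ∷ bs) zero = b
band-at (b ∷ bs) (suc k) = band-at bs k

ordered-at : ∀ {P} Ts → Down P → Chain P (positions* Ts) → All Band Ts → ∀ k → Ordered (bandAt Ts k)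
ordered-at [] dP ch bs k = []
ordered-at (E ∷ Ts) dP ch (b ∷ bs) zero = chain-ordered [] E {positions* Ts} dP ch b
ordered-at (E ∷ Ts) dP ch (b ∷ bs) (suc k) with c₁ , c₂ ← chain-++⁻ (positions E) ch = ordered-at Ts (down-chain (positions E) dP c₁) c₂ bs k

tags-at⁻ : ∀ {lab n p x} Ts k → Tags lab n Ts p (lab , x) → ∣ x ∣ ≡ n + k → ∃ λ d → (p , d) ∈ bandAt Ts k × x ≡ letter (n + k) d
tags-at⁻ {n = n} (E ∷ Ts) zero (inj₁ (d , m , refl)) e = d , m , cong (λ i → letter i d) (sym (+-identityʳ n))
tags-at⁻ {n = n} (E ∷ Ts) zero (inj₂ t) e with _ , l , _ ← tags-size Ts t = ⊥-elim (<-irrefl (sym (trans e (+-identityʳ n))) l)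
tags-at⁻ {n = n} (E ∷ Ts) (suc k) (inj₁ (d , m , refl)) e = ⊥-elim (m+1+n≢m n (trans (sym e) (size-letter n d)))
tags-at⁻ {n = n} (E ∷ Ts) (suc k) (inj₂ t) e with d , m , q ← tags-at⁻ Ts k t (trans e (+-suc n k)) = d , m , trans q (cong (λ i → letter i d) (sym (+-suc n k)))

tags-at⁺ : ∀ {lab n p d} Ts k → (p , d) ∈ bandAt Ts k → Tags lab n Ts p (lab , letter (n + k) d)
tags-at⁺ {n = n} {d = d} (E ∷ Ts) zero m = inj₁ (d , m , cong (λ i → _ , letter i d) (+-identityʳ n))
tags-at⁺ {lab} {n} {p} {d} (E ∷ Ts) (suc k) m = inj₂ (subst (λ i → Tags lab (suc n) Ts p (lab , letter i d)) (sym (+-suc n k)) (tags-at⁺ Ts k m))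

flag-false : ∀ {X p b} → All (_≡ false) (flags X) → (p , vl b) ∈ X → b ≡ false
flag-false (e ∷ _) (here refl) = e
flag-false {(_ , dn) ∷ X} h (there m) = flag-false {X} h m
flag-false {(_ , up) ∷ X} h (there m) = flag-false {X} h m
flag-false {(_ , vl _) ∷ X} (_ ∷ h) (there m) = flag-false {X} h m

all-flags : ∀ X → (∀ {p b} → (p , vl b) ∈ X → b ≡ false) → All (_≡ false) (flags X)
all-flags [] h = []
all-flags ((_ , dn) ∷ X) h = all-flags X (λ m → h (there m))
all-flags ((_ , up) ∷ X) h = all-flags X (λ m → h (there m))
all-flags ((_ , vl _) ∷ X) h = h (here refl) ∷ all-flags X (λ m → h (there m))

unprimed-letter : ∀ {X p d} n → All (_≡ false) (flags X) → (p , d) ∈ X → d ≢ dn → letter n d ≡ un n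
unprimed-letter {d = dn} n h m ne = ⊥-elim (ne refl)
unprimed-letter {d = up} n h m ne = refl
unprimed-letter {X} {d = vl b} n h m ne with refl ← flag-false {X} h m = refl

same-length : ∀ {X Y : List Pos} → AllPairs _≢_ X → AllPairs _≢_ Y → (∀ {p} → p ∈ X → p ∈ Y) → (∀ {p} → p ∈ Y → p ∈ X) → length X ≡ length Y
same-length {X} {Y} dX dY f g = ≤-antisym (subset-length X Y dX f) (subset-length Y X dY g)

module _ (U : Filling) where

  chosen : (Letter → Bool) → List Pos → List Pos
  chosen h [] = []
  chosen h (p ∷ L) with U p
  ... | nothing = chosen h L
  ... | just x with h x
  ...   | true = p ∷ chosen h L
  ...   | false = chosen h L

  count-chosen : ∀ h L → count h (mapMaybe U L) ≡ length (chosen h L)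
  count-chosen h [] = refl
  count-chosen h (p ∷ L) with U p
  ... | nothing = count-chosen h L
  ... | just x with h x
  ...   | true = cong suc (count-chosen h L)
  ...   | false = count-chosen h L

  chosen⁻ : ∀ h L {p} → p ∈ chosen h L → p ∈ L × ∃ λ x → U p ≡ just x × h x ≡ true
  chosen⁻ h (q ∷ L) m with U q in e
  ... | nothing = let n , r = chosen⁻ h L m in there n , r
  ... | just x with h x in e′
  chosen⁻ h (q ∷ L) (here refl) | just x | true = here refl , x , e , e′
  chosen⁻ h (q ∷ L) (there m) | just x | true = let n , r = chosen⁻ h L m in there n , r
  ...   | false = let n , r = chosen⁻ h L m in there n , r

  chosen⁺ : ∀ h L {p x} → p ∈ L → U p ≡ just x → h x ≡ true → p ∈ chosen h L
  chosen⁺ h (q ∷ L) (here refl) e t rewrite e | t = here refl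
  chosen⁺ h (q ∷ L) (there m) e t with U q
  ... | nothing = chosen⁺ h L m e t
  ... | just y with h y
  ...   | true = there (chosen⁺ h L m e t)
  ...   | false = chosen⁺ h L m e t

  chosen-distinct : ∀ h L → AllPairs _≢_ L → AllPairs _≢_ (chosen h L)
  chosen-distinct h [] ps = []
  chosen-distinct h (q ∷ L) (p ∷ ps) with U q
  ... | nothing = chosen-distinct h L ps
  ... | just x with h x
  ...   | true = All.tabulate (λ m → All.lookup p (proj₁ (chosen⁻ h L m))) ∷ chosen-distinct h L ps
  ...   | false = chosen-distinct h L ps

  mapMaybe⁻ : ∀ L {x} → x ∈ mapMaybe U L → ∃ λ p → p ∈ L × U p ≡ just x
  mapMaybe⁻ (p ∷ L) m with U p in e
  ... | nothing = let q , n , r = mapMaybe⁻ L m in q , there n , r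
  mapMaybe⁻ (p ∷ L) (here refl) | just x = p , here refl , e
  mapMaybe⁻ (p ∷ L) (there m) | just x = let q , n , r = mapMaybe⁻ L m in q , there n , r

  mapMaybe-split : ∀ L {pre x suf} → mapMaybe U L ≡ pre ++ x ∷ suf →
    ∃ λ L₁ → ∃ λ p → ∃ λ L₂ → L ≡ L₁ ++ p ∷ L₂ × U p ≡ just x × mapMaybe U L₂ ≡ suf
  mapMaybe-split [] {[]} ()
  mapMaybe-split [] {_ ∷ _} ()
  mapMaybe-split (p ∷ L) {pre} e with U p in q
  ... | nothing = let L₁ , r , L₂ , a , b = mapMaybe-split L {pre} e in p ∷ L₁ , r , L₂ , cong (p ∷_) a , b
  mapMaybe-split (p ∷ L) {[]} refl | just x = [] , p , L , refl , q , refl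
  mapMaybe-split (p ∷ L) {y ∷ pre} e | just x = let L₁ , r , L₂ , a , b = mapMaybe-split L {pre} (∷-injectiveʳ e) in p ∷ L₁ , r , L₂ , cong (p ∷_) a , b

  mapMaybe-just : ∀ L₁ {p x L₂} → U p ≡ just x → mapMaybe U (L₁ ++ p ∷ L₂) ≡ mapMaybe U L₁ ++ x ∷ mapMaybe U L₂
  mapMaybe-just L₁ {p} {x} {L₂} e = trans (mapMaybe-++ U L₁ (p ∷ L₂)) (cong (mapMaybe U L₁ ++_) first)
    where
    first : mapMaybe U (p ∷ L₂) ≡ x ∷ mapMaybe U L₂
    first rewrite e = refl

  pairs-mapMaybe : ∀ {R : Pos → Pos → Set} {S : Letter → Letter → Set} L → (∀ {p q x y} → R p q → U p ≡ just x → U q ≡ just y → S x y) →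
    AllPairs R L → AllPairs S (mapMaybe U L)
  pairs-mapMaybe [] f [] = []
  pairs-mapMaybe (p ∷ L) f (r ∷ rs) with U p in e
  ... | nothing = pairs-mapMaybe L f rs
  ... | just x = All.tabulate (λ m → let q , n , e′ = mapMaybe⁻ L m in f (All.lookup r n) e e′) ∷ pairs-mapMaybe L f rs

pairs-reverse : ∀ {A : Set} {R : A → A → Set} l → AllPairs R l → AllPairs (flip R) (reverse l)
pairs-reverse [] _ = []
pairs-reverse {R = R} (x ∷ l) (r ∷ rs) = subst (AllPairs (flip R)) (sym (unfold-reverse x l))
  (pairs-++ (reverse l) (pairs-reverse l rs) ([] ∷ []) λ { m (here refl) → [ All.lookup r , (λ ()) ]′ (∈-ʳ⁻ l m) })

cells : ℕ → ℕ → List Pos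
cells B r = map (r ,_) (map suc (downFrom B))

reading : ℕ → ℕ → List Pos
reading B n = concatMap (cells B) (map suc (upTo n))

Before : Pos → Pos → Set
Before p q = row p < row q ⊎ (row p ≡ row q × col q < col p)

columns-pairs : ∀ B → AllPairs (flip _<_) (map suc (downFrom B))
columns-pairs B = AP.map⁺ (AP.applyDownFrom⁺₁ (λ i → i) B λ i<j _ → s≤s i<j)

cells-pairs : ∀ B r → AllPairs (λ p q → row p ≡ row q × col q < col p) (cells B r)
cells-pairs B r = AP.map⁺ (AllPairs.map (λ l → refl , l) (columns-pairs B))

reading-pairs : ∀ B n → AllPairs Before (reading B n)
reading-pairs B n = pairs-concatMap (cells B) (λ r → AllPairs.map inj₂ (cells-pairs B r)) (AP.map⁺ (AllPairs.map s≤s (upTo-< n)))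
  λ {i} {j} l m m′ → case ∈-map⁻ (i ,_) m , ∈-map⁻ (j ,_) m′ of λ { ((_ , _ , refl) , (_ , _ , refl)) → inj₁ l }

∈-cells : ∀ {B r p} → row p ≡ r → 1 ≤ col p → col p ≤ B → p ∈ cells B r
∈-cells {p = _ , suc c} refl _ l = ∈-map⁺ (_ ,_) (∈-map⁺ suc (∈-downFrom⁺ l))

∈-reading : ∀ {B n p} → 1 ≤ row p → row p ≤ n → 1 ≤ col p → col p ≤ B → p ∈ reading B n
∈-reading {B} {n} {suc r , c} _ l 1≤c c≤B = ∈-concatMap⁺ (cells B) (lose (∈-map⁺ suc (∈-upTo⁺ l)) (∈-cells {B} {suc r} refl 1≤c c≤B))

reading-word : ∀ B U → readingWord B U ≡ mapMaybe U (reading B B)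
reading-word B U = by-rows (map suc (upTo B))
  where
  by-rows : ∀ rs → concatMap (readRow B U) rs ≡ mapMaybe U (concatMap (cells B) rs)
  by-rows [] = refl
  by-rows (r ∷ rs) = sym (trans (mapMaybe-++ U (cells B r) (concatMap (cells B) rs)) (cong₂ _++_ (mapMaybe-map U (r ,_) (map suc (downFrom B))) (sym (by-rows rs))))

module Words {P : Pos → Set} {U : Filling} {lab : Label} (Ts : List (List Ent)) (B : ℕ) (dP : Down P) (ch : Chain P (positions* Ts)) (bTs : All Band Ts)
  (tag : ∀ p x → U p ≡ just x → Tags lab 1 Ts p (lab , x)) (tagged : ∀ p x → Tags lab 1 Ts p (lab , x) → U p ≡ just x)
  (bound : ∀ p x → U p ≡ just x → (1 ≤ row p × row p ≤ B) × (1 ≤ col p × col p ≤ B)) where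

  ordered : ∀ k → Ordered (bandAt Ts k)
  ordered = ordered-at Ts dP ch bTs

  in⁻ : ∀ {p d} k → (p , d) ∈ bandAt Ts k → U p ≡ just (letter (suc k) d)
  in⁻ k m = tagged _ _ (tags-at⁺ Ts k m)

  in⁺ : ∀ {p x} k → U p ≡ just x → ∣ x ∣ ≡ suc k → ∃ λ d → (p , d) ∈ bandAt Ts k × x ≡ letter (suc k) d
  in⁺ k e s = tags-at⁻ Ts k (tag _ _ e) s

  inside : ∀ {p d} k → (p , d) ∈ bandAt Ts k → (1 ≤ row p × row p ≤ B) × (1 ≤ col p × col p ≤ B)
  inside {p} {d} k m = bound p (letter (suc k) d) (in⁻ k m)

  listed : ∀ {p d} k → (p , d) ∈ bandAt Ts k → p ∈ reading B B
  listed {p} k m with (a , b) , (c , d) ← inside k m = ∈-reading {p = p} a b c d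

  -- The turning point of a band is the last of its boxes in reading order.
  before-valley : ∀ {p b q d} k → (p , vl b) ∈ bandAt Ts k → (q , d) ∈ bandAt Ts k → ¬ Before p q
  before-valley {p} {b} {q} {d} k m n h = cases (pairs-order (ordered k) m n)
    where
    cases : (p , vl b) ≡ (q , d) ⊎ (Star (p , vl b) (q , d) × ¬ q ⊑ p) ⊎ (Star (q , d) (p , vl b) × ¬ p ⊑ q) → ⊥
    cases (inj₁ refl) = [ <-irrefl refl , (λ (_ , l) → <-irrefl refl l) ]′ h
    cases (inj₂ (inj₁ (st , _))) with (a , c) , _ ← rising st (λ ()) = [ (λ l → <⇒≱ l a) , (λ (_ , l) → <-asym l c) ]′ h
    cases (inj₂ (inj₂ (st , _))) with (a , c) , _ ← falling st (λ ()) = [ (λ l → <-asym l a) , (λ (e , _) → <-irrefl (sym e) a) ]′ h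

  later : ∀ L₁ {p L₂ q} → reading B B ≡ L₁ ++ p ∷ L₂ → q ∈ L₂ → Before p q
  later L₁ {p} {L₂} e m = suffix L₁ (subst (AllPairs Before) e (reading-pairs B B))
    where
    suffix : ∀ L → AllPairs Before (L ++ p ∷ L₂) → Before p _
    suffix [] (ps ∷ _) = All.lookup ps m
    suffix (x ∷ L) (_ ∷ ps) = suffix L ps

  unflagged : RightmostUnprimed (readingWord B U) → ∀ k → All (_≡ false) (flags (bandAt Ts k))
  unflagged R k = all-flags (bandAt Ts k) λ {p} {b} m → let L₁ , L₂ , e = ∈-∃++ (listed k m) in
    unprimed b (R (mapMaybe U L₁) (letter (suc k) (vl b)) (mapMaybe U L₂)
      (trans (reading-word B U) (trans (cong (mapMaybe U) e) (mapMaybe-just U L₁ (in⁻ k m))))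
      (All.tabulate λ {y} n s → let q , n′ , e′ = mapMaybe⁻ U L₂ n
                                    d , m′ , _ = in⁺ k e′ (trans s (size-letter (suc k) (vl b)))
                                in before-valley k m m′ (later L₁ e n′)))
    where
    unprimed : ∀ b → IsUnprimed (letter (suc k) (vl b)) → b ≡ false
    unprimed false _ = refl
    unprimed true (_ , ())

  -- With all flags false a primed box descends, so the turning point of its band, being in a lower
  -- row, is read later. Hence the last letter of each size is unprimed.
  rightmost : (∀ k → All (_≡ false) (flags (bandAt Ts k))) → RightmostUnprimed (readingWord B U)
  rightmost h pre x suf e a with L₁ , p , L₂ , e′ , u , refl ← mapMaybe-split U (reading B B) {pre} (trans (sym (reading-word B U)) e) = by-size ∣ x ∣ refl (proj₁ (proj₂ (tags-size Ts (tag p x u))))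
    where
    by-size : ∀ n → ∣ x ∣ ≡ n → 1 ≤ ∣ x ∣ → IsUnprimed x
    by-size zero s 1≤ = ⊥-elim (<-irrefl (sym s) 1≤)
    by-size (suc k) s _ with d , m , refl ← in⁺ k u s = suc k , unprimed-letter (suc k) (h k) m λ { refl → descending m }
      where
      follows : ∀ {q} → q ∈ reading B B → Before p q → q ∈ L₂
      follows {q} n b = [ (λ n₁ → ⊥-elim (wrong n₁)) , (λ { (here refl) → ⊥-elim (irr b) ; (there n₂) → n₂ }) ]′ (∈-++⁻ L₁ (subst (q ∈_) e′ n))
        where
        irr : ∀ {q} → ¬ Before q q
        irr (inj₁ l) = <-irrefl refl l
        irr (inj₂ (_ , l)) = <-irrefl refl l
        asym : ∀ {q} → Before p q → ¬ Before q p
        asym (inj₁ l) (inj₁ l′) = <-asym l l′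
        asym (inj₁ l) (inj₂ (e , _)) = <-irrefl (sym e) l
        asym (inj₂ (e , _)) (inj₁ l) = <-irrefl (sym e) l
        asym (inj₂ (_ , l)) (inj₂ (_ , l′)) = <-asym l l′
        wrong : q ∈ L₁ → ⊥
        wrong n₁ = asym b (earlier L₁ (subst (AllPairs Before) e′ (reading-pairs B B)) n₁)
          where
          earlier : ∀ L → AllPairs Before (L ++ p ∷ L₂) → q ∈ L → Before q p
          earlier (x ∷ L) (ps ∷ _) (here refl) = All.lookup ps (∈-++⁺ʳ L (here refl))
          earlier (x ∷ L) (_ ∷ ps) (there n) = earlier L ps n
      descending : (p , dn) ∈ bandAt Ts k → ⊥
      descending m with (q , d) , m′ , (lt , _) , _ ← valley (band-at bTs k) m refl =
        All.lookup a (value L₂ (follows (listed k m′) (inj₁ lt)) (in⁻ k m′)) (trans (size-letter (suc k) d) (sym s))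
        where
        value : ∀ L {q y} → q ∈ L → U q ≡ just y → y ∈ mapMaybe U L
        value (q ∷ L) (here refl) e rewrite e = here refl
        value (q ∷ L) (there n) e with U q
        ... | nothing = value L n e
        ... | just _ = there (value L n e)

  -- When no flag is set, the kind of a box tells its letter: `at` and `on` count the letters k + 1
  -- and (k + 1)′ in a row of the word.
  module Counts (k : ℕ) (h : All (_≡ false) (flags (bandAt Ts k))) where

    private X′ = bandAt Ts k

    distinct : AllPairs _≢_ (positions X′)
    distinct = AP.map⁺ (AllPairs.map (λ (_ , n) e → n (≤-reflexive (cong row (sym e)) , ≤-reflexive (cong col (sym e)))) (ordered k))

    cells-distinct : ∀ r → AllPairs _≢_ (cells B r)
    cells-distinct r = AllPairs.map (λ (_ , l) e → <-irrefl (cong col (sym e)) l) (cells-pairs B r)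

    row-word : ∀ r → readRow B U r ≡ mapMaybe U (cells B r)
    row-word r = sym (mapMaybe-map U (r ,_) (map suc (downFrom B)))

    in-row : ∀ {r p} → p ∈ cells B r → row p ≡ r
    in-row {r} m with _ , _ , refl ← ∈-map⁻ (r ,_) m = refl

    in-cells : ∀ {r p d} → (p , d) ∈ X′ → row p ≡ r → p ∈ cells B r
    in-cells {r} {p} m e with _ , (c , d) ← inside k m = ∈-cells {B} {r} {p} e c d

    count-un : ∀ r → count (isUn (suc k)) (readRow B U r) ≡ at X′ r
    count-un r = trans (cong (count (isUn (suc k))) (row-word r)) (trans (count-chosen U (isUn (suc k)) (cells B r))
      (trans (same-length (chosen-distinct U (isUn (suc k)) (cells B r) (cells-distinct r)) (select-distinct (atᵇ r) X′ distinct) to from) (length-select (atᵇ r) X′)))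
      where
      is-un : ∀ x → isUn (suc k) x ≡ true → x ≡ un (suc k)
      is-un (un j) t = cong un (≡ᵇ-true t)
      to : ∀ {p} → p ∈ chosen U (isUn (suc k)) (cells B r) → p ∈ select (atᵇ r) X′
      to m with n , x , u , t ← chosen⁻ U (isUn (suc k)) (cells B r) m with refl ← is-un x t with d , m′ , e ← in⁺ k u refl =
        select-at X′ r m′ (letter-un (suc k) d (sym e)) (in-row n)
      from : ∀ {p} → p ∈ select (atᵇ r) X′ → p ∈ chosen U (isUn (suc k)) (cells B r)
      from {p} m with d , n , t ← select⁻ (atᵇ r) X′ m with ne , e ← at-sound r p d t =
        chosen⁺ U (isUn (suc k)) (cells B r) (in-cells n e) (trans (in⁻ k n) (cong just (unprimed-letter (suc k) h n ne))) (≡ᵇ-refl k)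

    count-pr : ∀ r → count (isPr (suc k)) (readRow B U r) ≡ on X′ r
    count-pr r = trans (cong (count (isPr (suc k))) (row-word r)) (trans (count-chosen U (isPr (suc k)) (cells B r))
      (trans (same-length (chosen-distinct U (isPr (suc k)) (cells B r) (cells-distinct r)) (select-distinct (onᵇ r) X′ distinct) to from) (length-select (onᵇ r) X′)))
      where
      is-pr : ∀ x → isPr (suc k) x ≡ true → x ≡ pr (suc k)
      is-pr (pr j) t = cong pr (≡ᵇ-true t)
      is-dn : ∀ {p} d → (p , d) ∈ X′ → pr (suc k) ≡ letter (suc k) d → d ≡ dn
      is-dn dn m e = refl
      is-dn up m ()
      is-dn (vl b) m e with refl ← flag-false {X′} h m with () ← e
      to : ∀ {p} → p ∈ chosen U (isPr (suc k)) (cells B r) → p ∈ select (onᵇ r) X′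
      to m with n , x , u , t ← chosen⁻ U (isPr (suc k)) (cells B r) m with refl ← is-pr x t with d , m′ , e ← in⁺ k u refl with refl ← is-dn d m′ e =
        select-on X′ r m′ (in-row n)
      from : ∀ {p} → p ∈ select (onᵇ r) X′ → p ∈ chosen U (isPr (suc k)) (cells B r)
      from {p} m with d , n , t ← select⁻ (onᵇ r) X′ m with refl , e ← on-sound r p d t =
        chosen⁺ U (isPr (suc k)) (cells B r) (in-cells n e) (in⁻ k n) (≡ᵇ-refl k)

    rows-above : ∀ r → B < r → at X′ r ≡ 0 × on X′ r ≡ 0 × hi X′ r ≡ 0
    rows-above r l = at-zero X′ r (λ { m _ refl → <⇒≱ l (proj₂ (proj₁ (inside k m))) }) , on-zero X′ r (λ { m refl → <⇒≱ l (proj₂ (proj₁ (inside k m))) }) ,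
      hi-zero X′ r λ m → ≤-<-trans (proj₂ (proj₁ (inside k m))) l

    row-zero : at X′ 0 ≡ 0 × on X′ 0 ≡ 0 × lo X′ 1 ≡ 0
    row-zero = at-zero X′ 0 (λ m _ e → <-irrefl (sym e) (proj₁ (proj₁ (inside k m)))) , on-zero X′ 0 (λ m e → <-irrefl (sym e) (proj₁ (proj₁ (inside k m)))) ,
      trans (lo-suc X′ 0) (cong₂ _+_ (lo-zero X′) (at-zero X′ 0 (λ m _ e → <-irrefl (sym e) (proj₁ (proj₁ (inside k m))))))
      where
      lo-zero : ∀ X → lo X 0 ≡ 0
      lo-zero X = cnt-zero (loᵇ 0) X λ { {p , dn} m () ; {p , up} m () ; {p , vl _} m () }

    lo-all : ∀ r → B < r → lo X′ r ≡ all X′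
    lo-all r l = ≤-antisym (lo≤all X′ r) (all≤lo X′ r λ m _ → ≤-<-trans (proj₂ (proj₁ (inside k m))) l)

    word : ℕ → List Letter
    word n = concatMap (readRow B U) (map suc (upTo n))

    word-suc : ∀ n → word (suc n) ≡ word n ++ readRow B U (suc n)
    word-suc n = trans (cong (λ l → concatMap (readRow B U) (map suc l)) (sym (upTo-∷ʳ n)))
      (trans (cong (concatMap (readRow B U)) (map-++ suc (upTo n) (n ∷ []))) (trans (concatMap-++ (readRow B U) (map suc (upTo n)) (suc n ∷ [])) (cong (word n ++_) (++-identityʳ _))))

    count-word : ∀ n → count (isUn (suc k)) (word n) ≡ lo X′ (suc n)
    count-word zero = sym (proj₂ (proj₂ row-zero))
    count-word (suc n) = trans (cong (count (isUn (suc k))) (word-suc n)) (trans (count-++ (isUn (suc k)) (word n))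
      (trans (cong₂ _+_ (count-word n) (count-un (suc n))) (sym (lo-suc X′ (suc n)))))

module LatticeWord {P : Pos → Set} {U : Filling} {lab : Label} (Ts : List (List Ent)) (B : ℕ) (dP : Down P) (ch : Chain P (positions* Ts)) (bTs : All Band Ts)
  (tag : ∀ p x → U p ≡ just x → Tags lab 1 Ts p (lab , x)) (tagged : ∀ p x → Tags lab 1 Ts p (lab , x) → U p ≡ just x)
  (bound : ∀ p x → U p ≡ just x → (1 ≤ row p × row p ≤ B) × (1 ≤ col p × col p ≤ B))
  (rows≤ : ∀ i j j′ x y → j < j′ → U (i , j) ≡ just x → U (i , j′) ≡ just y → code x ≤ code y)
  (row-pr : ∀ i j j′ k → U (i , j) ≡ just (pr k) → U (i , j′) ≡ just (pr k) → j ≡ j′) where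

  open Words {P} {U} {lab} Ts B dP ch bTs tag tagged bound

  row-above : ∀ r → AllPairs Above (readRow B U r)
  row-above r = subst (AllPairs Above) (mapMaybe-map U (r ,_) (map suc (downFrom B))) (pairs-mapMaybe U (cells B r) above (cells-pairs B r))
    where
    above : ∀ {p q x y} → row p ≡ row q × col q < col p → U p ≡ just x → U q ≡ just y → Above x y
    above (refl , l) e f = rows≤ _ _ _ _ _ l f e , λ { j refl refl → <-irrefl (row-pr _ _ _ _ f e) l }

  module _ (i : ℕ) (h : ∀ k → All (_≡ false) (flags (bandAt Ts k))) where

    V W : List Ent
    V = bandAt Ts i
    W = bandAt Ts (suc i)

    module CV = Counts i (h i)
    module CW = Counts (suc i) (h (suc i))

    k : ℕ
    k = suc i

    word : ℕ → List Letter
    word n = concatMap (readRow B U) (map suc (upTo n))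

    Fs : ℕ → Set
    Fs n = ∀ r → 1 ≤ r → r ≤ n → lo W (suc r) + on W r ≤ lo V r

    Gs : ℕ → Set
    Gs n = ∀ r → 1 ≤ r → r ≤ n → (all W + hi W r ≤ all V + hi V r) × (1 ≤ at V r → suc (all W + hi W (suc r)) ≤ all V + hi V r)

    row-F : ∀ r → lo W r ≤ lo V r → Runs k (lo W r) (lo V r) (readRow B U r) ⇔′ (lo W (suc r) + on W r ≤ lo V r)
    row-F r le with f , g ← row-run k (readRow B U r) (row-above r) le =
      (λ x → subst (_≤ lo V r) sums (f x)) , λ x → g (subst (_≤ lo V r) (sym sums) x)
      where
      sums : count (isUn (suc k)) (readRow B U r) + count (isPr (suc k)) (readRow B U r) + lo W r ≡ lo W (suc r) + on W r
      sums = lia (count (isUn (suc k)) (readRow B U r) ∷ count (isPr (suc k)) (readRow B U r) ∷ lo W r ∷ lo W (suc r) ∷ at W r ∷ on W r ∷ [])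
        (λ u p l l′ a o → (u :≡ a) ∷ (p :≡ o) ∷ (l′ :≡ l :+ a) ∷ [] ⊢ u :+ p :+ l :≡ l′ :+ o) (CW.count-un r) (CW.count-pr r) (lo-suc W r)

    runs-lo : ∀ n → Runs k 0 0 (word n) → lo W (suc n) ≤ lo V (suc n)
    runs-lo n r = subst₂ _≤_ (trans (+-identityʳ _) (CW.count-word n)) (trans (+-identityʳ _) (CV.count-word n)) (runs-≤ k (word n) z≤n r)

    at-end : ∀ n {m} → Runs k (count (isUn (suc k)) (word n) + 0) (count (isUn k) (word n) + 0) m ⇔′ Runs k (lo W (suc n)) (lo V (suc n)) m
    at-end n {m} = subst₂ (λ a b → Runs k a b m) (trans (+-identityʳ _) (CW.count-word n)) (trans (+-identityʳ _) (CV.count-word n)) ,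
      subst₂ (λ a b → Runs k a b m) (sym (trans (+-identityʳ _) (CW.count-word n))) (sym (trans (+-identityʳ _) (CV.count-word n)))

    -- After the first rows of the word the counts of unprimed letters are values of `lo`, so every
    -- further row contributes one instance of `F`.
    forward : ∀ n → Runs k 0 0 (word n) ⇔′ Fs n
    forward zero = (λ _ r a b → ⊥-elim (<⇒≱ a b)) , λ _ → tt
    forward (suc n) with f , g ← forward n = to , from
      where
      to : Runs k 0 0 (word (suc n)) → Fs (suc n)
      to x r 1≤r r≤ with r₁ , r₂ ← proj₁ (runs-++ k (word n)) (subst (Runs k 0 0) (CW.word-suc n) x) with m≤n⇒m<n∨m≡n r≤
      ... | inj₁ (s≤s l) = f r₁ r 1≤r l
      ... | inj₂ refl = proj₁ (row-F (suc n) (runs-lo n r₁)) (proj₁ (at-end n) r₂)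
      from : Fs (suc n) → Runs k 0 0 (word (suc n))
      from x = subst (Runs k 0 0) (sym (CW.word-suc n)) (proj₂ (runs-++ k (word n)) (r₁ , proj₂ (at-end n) (proj₂ (row-F (suc n) (runs-lo n r₁)) (x (suc n) (s≤s z≤n) ≤-refl))))
        where
        r₁ = g (λ r a b → x r a (≤-trans b (n≤1+n n)))

    hat-suc : ∀ n → hat (word (suc n)) ≡ map hatL (reverse (readRow B U (suc n))) ++ hat (word n)
    hat-suc n = trans (cong hat (CW.word-suc n)) (trans (cong (map hatL) (reverse-++ (word n) (readRow B U (suc n)))) (map-++ hatL (reverse (readRow B U (suc n))) _))

    back : ℕ → List Letter
    back r = map hatL (reverse (readRow B U r))

    back-W : ∀ r → count (isUn (suc k)) (back r) ≡ on W r
    back-W r = trans (count-hat (suc k) (reverse (readRow B U r))) (trans (count-reverse (isPr (suc k)) (readRow B U r)) (CW.count-pr r))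

    back-V : ∀ r → count (isUn k) (back r) ≡ on V r
    back-V r = trans (count-hat k (reverse (readRow B U r))) (trans (count-reverse (isPr k) (readRow B U r)) (CV.count-pr r))

    step-W : ∀ r → on W r + (all W + hi W (suc r)) ≡ all W + hi W r
    step-W r = lia (on W r ∷ all W ∷ hi W (suc r) ∷ hi W r ∷ []) (λ o a h h′ → (h′ :≡ o :+ h) ∷ [] ⊢ o :+ (a :+ h) :≡ a :+ h′) (hi-suc W r)

    step-V : ∀ r → on V r + (all V + hi V (suc r)) ≡ all V + hi V r
    step-V r = lia (on V r ∷ all V ∷ hi V (suc r) ∷ hi V r ∷ []) (λ o a h h′ → (h′ :≡ o :+ h) ∷ [] ⊢ o :+ (a :+ h) :≡ a :+ h′) (hi-suc V r)

    row-G : ∀ r → all W + hi W (suc r) ≤ all V + hi V (suc r) → Runs k (all W + hi W (suc r)) (all V + hi V (suc r)) (back r) ⇔′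
      ((all W + hi W r ≤ all V + hi V r) × (1 ≤ at V r → suc (all W + hi W (suc r)) ≤ all V + hi V r))
    row-G r le with f , g ← hat-run k (reverse (readRow B U r)) (pairs-reverse (readRow B U r) (row-above r)) le =
      (λ x → let u , v = f x in subst₂ _≤_ eW eV u , λ c → subst (suc (all W + hi W (suc r)) ≤_) eV (v (subst (1 ≤_) (sym eA) c))) ,
      λ (u , v) → g (subst₂ _≤_ (sym eW) (sym eV) u , λ c → subst (suc (all W + hi W (suc r)) ≤_) (sym eV) (v (subst (1 ≤_) eA c)))
      where
      eW = trans (cong (_+ (all W + hi W (suc r))) (trans (count-reverse (isPr (suc k)) (readRow B U r)) (CW.count-pr r))) (step-W r)
      eV = trans (cong (_+ (all V + hi V (suc r))) (trans (count-reverse (isPr k) (readRow B U r)) (CV.count-pr r))) (step-V r)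
      eA = trans (count-reverse (isUn k) (readRow B U r)) (CV.count-un r)

    -- The initial counts are those reached after the rows beyond n have been read back. The
    -- induction therefore peels off row n first and goes upwards.
    backward : ∀ n → all W + hi W (suc n) ≤ all V + hi V (suc n) → Runs k (all W + hi W (suc n)) (all V + hi V (suc n)) (hat (word n)) ⇔′ Gs n
    backward zero le = (λ _ r a b → ⊥-elim (<⇒≱ a b)) , λ _ → tt
    backward (suc n) le = to , from
      where
      s = suc n
      end : ∀ {m} → Runs k (count (isUn (suc k)) (back s) + (all W + hi W (suc s))) (count (isUn k) (back s) + (all V + hi V (suc s))) m ⇔′ Runs k (all W + hi W s) (all V + hi V s) m
      end {m} = subst₂ (λ a b → Runs k a b m) eW eV , subst₂ (λ a b → Runs k a b m) (sym eW) (sym eV)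
        where
        eW = trans (cong (_+ (all W + hi W (suc s))) (back-W s)) (step-W s)
        eV = trans (cong (_+ (all V + hi V (suc s))) (back-V s)) (step-V s)
      to : Runs k (all W + hi W (suc s)) (all V + hi V (suc s)) (hat (word s)) → Gs s
      to x r 1≤r r≤ = cases (m≤n⇒m<n∨m≡n r≤)
        where
        rs = proj₁ (runs-++ k {all W + hi W (suc s)} {all V + hi V (suc s)} (back s)) (subst (Runs k (all W + hi W (suc s)) (all V + hi V (suc s))) (hat-suc n) x)
        g₁ = proj₁ (row-G s le) (proj₁ rs)
        cases : r < s ⊎ r ≡ s → (all W + hi W r ≤ all V + hi V r) × (1 ≤ at V r → suc (all W + hi W (suc r)) ≤ all V + hi V r)
        cases (inj₁ (s≤s l)) = proj₁ (backward n (proj₁ g₁)) (proj₁ end (proj₂ rs)) r 1≤r l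
        cases (inj₂ refl) = g₁
      from : Gs s → Runs k (all W + hi W (suc s)) (all V + hi V (suc s)) (hat (word s))
      from x = subst (Runs k _ _) (sym (hat-suc n)) (proj₂ (runs-++ k (back s)) (proj₂ (row-G s le) (x s (s≤s z≤n) ≤-refl) ,
        proj₂ end (proj₂ (backward n (proj₁ (x s (s≤s z≤n) ≤-refl))) λ r a b → x r a (≤-trans b (n≤1+n n)))))

    hi-end : ∀ {X r} → hi X r ≡ 0 → all X + hi X r ≡ all X
    hi-end {X} e = trans (cong (all X +_) e) (+-identityʳ _)

    runs-lat : Runs k 0 0 (word B ++ hat (word B)) ⇔′ Lat V W
    runs-lat = to , from
      where
      topV = CV.rows-above (suc B) ≤-refl
      topW = CW.rows-above (suc B) ≤-refl
      turn-W : count (isUn (suc k)) (word B) + 0 ≡ all W + hi W (suc B)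
      turn-W = trans (+-identityʳ _) (trans (CW.count-word B) (trans (CW.lo-all (suc B) ≤-refl) (sym (hi-end {W} {suc B} (proj₂ (proj₂ topW))))))
      turn-V : count (isUn k) (word B) + 0 ≡ all V + hi V (suc B)
      turn-V = trans (+-identityʳ _) (trans (CV.count-word B) (trans (CV.lo-all (suc B) ≤-refl) (sym (hi-end {V} {suc B} (proj₂ (proj₂ topV))))))
      turn-≤ : Runs k 0 0 (word B) → all W + hi W (suc B) ≤ all V + hi V (suc B)
      turn-≤ r = subst₂ _≤_ turn-W turn-V (runs-≤ k (word B) z≤n r)
      to : Runs k 0 0 (word B ++ hat (word B)) → Lat V W
      to x with r₁ , r₂ ← proj₁ (runs-++ k (word B)) x = lat F₀ (λ r → proj₁ (G₀ r)) (λ r → proj₂ (G₀ r))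
        where
        fs = proj₁ (forward B) r₁
        gs = proj₁ (backward B (turn-≤ r₁)) (subst₂ (λ a b → Runs k a b (hat (word B))) turn-W turn-V r₂)
        alls : all W ≤ all V
        alls = subst₂ _≤_ (CW.lo-all (suc B) ≤-refl) (CV.lo-all (suc B) ≤-refl) (runs-lo B r₁)
        F₀ : ∀ r → lo W (suc r) + on W r ≤ lo V r
        F₀ zero = ≤-trans (≤-reflexive (cong₂ _+_ (proj₂ (proj₂ CW.row-zero)) (proj₁ (proj₂ CW.row-zero)))) z≤n
        -- Rows beyond `B` are empty and the counts are final there, so the comparison of the totals
        -- suffices.
        F₀ (suc r) with suc r ≤? B
        ... | yes l = fs (suc r) (s≤s z≤n) l
        ... | no l = ≤-trans (≤-reflexive (trans (cong (lo W (suc (suc r)) +_) (proj₁ (proj₂ (CW.rows-above (suc r) (≰⇒> l))))) (+-identityʳ _)))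
                (≤-trans (lo≤all W (suc (suc r))) (≤-trans alls (≤-reflexive (sym (CV.lo-all (suc r) (≰⇒> l))))))
        G₁ : ∀ r → 1 ≤ r → (all W + hi W r ≤ all V + hi V r) × (1 ≤ at V r → suc (all W + hi W (suc r)) ≤ all V + hi V r)
        G₁ r 1≤r with r ≤? B
        ... | yes l = gs r 1≤r l
        ... | no l = subst₂ _≤_ (sym (hi-end {W} {r} (proj₂ (proj₂ (CW.rows-above r (≰⇒> l)))))) (sym (hi-end {V} {r} (proj₂ (proj₂ (CV.rows-above r (≰⇒> l)))))) alls ,
                     λ c → ⊥-elim (<-irrefl (sym (proj₁ (CV.rows-above r (≰⇒> l)))) c)
        G₀ : ∀ r → (all W + hi W r ≤ all V + hi V r) × (1 ≤ at V r → suc (all W + hi W (suc r)) ≤ all V + hi V r)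
        G₀ zero = subst₂ _≤_ (cong (all W +_) (sym (trans (hi-suc W 0) (cong (_+ hi W 1) (proj₁ (proj₂ CW.row-zero))))))
                             (cong (all V +_) (sym (trans (hi-suc V 0) (cong (_+ hi V 1) (proj₁ (proj₂ CV.row-zero)))))) (proj₁ (G₁ 1 ≤-refl)) ,
                  λ c → ⊥-elim (<-irrefl (sym (proj₁ CV.row-zero)) c)
        G₀ (suc r) = G₁ (suc r) (s≤s z≤n)
      from : Lat V W → Runs k 0 0 (word B ++ hat (word B))
      from (lat F₀ G₀ G₀′) = proj₂ (runs-++ k (word B)) (r₁ , subst₂ (λ a b → Runs k a b (hat (word B))) (sym turn-W) (sym turn-V)
          (proj₂ (backward B (turn-≤ r₁)) λ r _ _ → G₀ r , G₀′ r))
        where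
        r₁ = proj₂ (forward B) λ r _ _ → F₀ r

  lrs-word : IsLRSWord (readingWord B U) ⇔′ (Linked Lat Ts × All (_≡ false) (concatMap flags Ts))
  lrs-word = (λ (L , R) → let h = unflagged R in
      proj₂ (linked-at Ts) (λ i → proj₁ (runs-lat i h) (proj₁ (lattice-runs (readingWord B U)) L (suc i) (s≤s z≤n))) , proj₂ (flags-at Ts) h) ,
    λ (l , f) → let h = proj₁ (flags-at Ts) f in
      proj₂ (lattice-runs (readingWord B U)) (λ { (suc i) _ → proj₂ (runs-lat i h) (proj₁ (linked-at Ts) l i) }) , rightmost h

-- From bands back to tableaux: the three statements

grid-length : ∀ {A : Set} {L : A → A → A → A → Set} (let module G = Grids L) {as bs bs′ as′} → G.Grid as bs bs′ as′ → length bs′ ≡ length bs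
grid-length {A} {L} = by-rows
  where
  module G = Grids L
  by-row : ∀ {a bs bs′ a′} → G.Row a bs bs′ a′ → length bs′ ≡ length bs
  by-row G.[] = refl
  by-row (_ G.∷ r) = cong suc (by-row r)
  by-rows : ∀ {as bs bs′ as′} → G.Grid as bs bs′ as′ → length bs′ ≡ length bs
  by-rows G.[] = refl
  by-rows (r G.∷ g) = trans (by-row r) (by-rows g)

grid-sizes : ∀ {As Ts Ts′ As′} → X.Grid As Ts Ts′ As′ → ∀ k → length (bandAt Ts′ k) ≡ length (bandAt Ts k)
grid-sizes X.[] k = refl
grid-sizes (r X.∷ g) k = trans (by-row r k) (grid-sizes g k)
  where
  by-row : ∀ {A Ts Ts′ A′} → X.Row A Ts Ts′ A′ → ∀ k → length (bandAt Ts′ k) ≡ length (bandAt Ts k)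
  by-row X.[] k = refl
  by-row (X._∷_ {b = B} {b′ = B′} (exchange g _ _ _ _ _ _) r) zero = trans (sym (length-map pos B′)) (trans (grid-length {L = Swap} g) (length-map pos B))
  by-row (_ X.∷ r) (suc k) = by-row r k

Banded : Label → Filling → List (List Ent) → Set
Banded lab U Ts = (∀ p x → U p ≡ just x → Tags lab 1 Ts p (lab , x)) × (∀ p x → Tags lab 1 Ts p (lab , x) → U p ≡ just x)

relabel : ∀ {lab lab′ n p x} Ts → Tags lab n Ts p (lab , x) → Tags lab′ n Ts p (lab′ , x)
relabel (E ∷ Ts) (inj₁ (k , m , refl)) = inj₁ (k , m , refl)
relabel (E ∷ Ts) (inj₂ t) = inj₂ (relabel Ts t)

-- On the way back the two tableaux trade labels.
banded-relabel : ∀ {lab lab′ U} Ts → Banded lab U Ts → Banded lab′ U Ts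
banded-relabel Ts (f , g) = (λ p x e → relabel Ts (f p x e)) , λ p x t → g p x (relabel Ts t)

banded-resp : ∀ {lab U V} Ts → (∀ p → U p ≡ V p) → Banded lab U Ts → Banded lab V Ts
banded-resp Ts h (f , g) = (λ p x e → f p x (trans (h p) e)) , λ p x t → trans (sym (h p)) (g p x t)

banded-unique : ∀ {lab U V} Ts → Banded lab U Ts → Banded lab V Ts → ∀ p → U p ≡ V p
banded-unique {lab} {U} {V} Ts (f , g) (f′ , g′) p with U p in e | V p in e′
... | just x | just y = trans (sym (g′ p x (f p x e))) e′ ⟫ λ { refl → refl }
  where
  _⟫_ : ∀ {A B : Set} → A → (A → B) → B
  a ⟫ f = f a
... | just x | nothing with () ← trans (sym e′) (g′ p x (f p x e))
... | nothing | just y with () ← trans (sym e) (g p y (f′ p y e′))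
... | nothing | nothing = refl

part-SL : ∀ H p x → (partL SL H p ≡ just x → H p ≡ just (SL , x)) × (H p ≡ just (SL , x) → partL SL H p ≡ just x)
part-SL H p x with H p
... | nothing = (λ ()) , λ ()
... | just (SL , y) = (λ { refl → refl }) , λ { refl → refl }
... | just (TL , y) = (λ ()) , λ ()

part-TL : ∀ H p x → (partL TL H p ≡ just x → H p ≡ just (TL , x)) × (H p ≡ just (TL , x) → partL TL H p ≡ just x)
part-TL H p x with H p
... | nothing = (λ ()) , λ ()
... | just (SL , y) = (λ ()) , λ ()
... | just (TL , y) = (λ { refl → refl }) , λ { refl → refl }

tags-label : ∀ {lab n p lab′ x} Ts → Tags lab n Ts p (lab′ , x) → lab′ ≡ lab
tags-label Ts t = proj₁ (tags-size Ts t)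

reps-init : ∀ {P S T} Ss Ts → Chain P (positions* Ss ++ positions* Ts) → Banded SL S Ss → Banded TL T Ts →
  Reps (λ p v → Tags SL 1 Ss p v ⊎ Tags TL 1 Ts p v) (initL S T)
reps-init {P} {S} {T} Ss Ts ch (f , g) (f′ , g′) p v = to v , from v
  where
  disjoint : ∀ {v w} → Tags SL 1 Ss p v → Tags TL 1 Ts p w → ⊥
  disjoint s t = chain-fresh (positions* Ts) (proj₂ (chain-++⁻ (positions* Ss) ch)) (tags-pos Ts t) (inj₂ (tags-pos Ss s))
  to : ∀ v → initL S T p ≡ just v → Tags SL 1 Ss p v ⊎ Tags TL 1 Ts p v
  to v e with S p in q
  to v refl | just x = inj₁ (f p x q)
  ... | nothing with T p in q′
  to v refl | nothing | just y = inj₂ (f′ p y q′)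
  from : ∀ v → Tags SL 1 Ss p v ⊎ Tags TL 1 Ts p v → initL S T p ≡ just v
  from (l , x) (inj₁ s) with refl ← tags-label Ss s rewrite g p x s = refl
  from (l , y) (inj₂ t) with refl ← tags-label Ts t with S p in q
  ... | just x = ⊥-elim (disjoint (f p x q) t)
  ... | nothing rewrite g′ p y t = refl

Outcome : List (List Ent) → List (List Ent) → LFilling → Set
Outcome Ss Ts H = ∃ λ Ts′ → ∃ λ Ss′ → X.Grid Ss Ts Ts′ Ss′ × All Band Ts′ × All Band Ss′ × Banded TL (partL TL H) Ts′ × Banded SL (partL SL H) Ss′

outcome : ∀ {Ss Ts H} → RunPost Ss Ts H → Outcome Ss Ts H
outcome {Ss} {Ts} {H} (Ts′ , Ss′ , g , bT , bS , r) = Ts′ , Ss′ , g , bT , bS ,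
  ((λ p x e → only-T (proj₁ (r p (TL , x)) (proj₁ (part-TL H p x) e))) , λ p x t → proj₂ (part-TL H p x) (proj₂ (r p (TL , x)) (inj₂ t))) ,
  ((λ p x e → only-S (proj₁ (r p (SL , x)) (proj₁ (part-SL H p x) e))) , λ p x t → proj₂ (part-SL H p x) (proj₂ (r p (SL , x)) (inj₁ t)))
  where
  only-T : ∀ {p x} → Tags SL 1 Ss′ p (TL , x) ⊎ Tags TL 1 Ts′ p (TL , x) → Tags TL 1 Ts′ p (TL , x)
  only-T (inj₁ s) with () ← tags-label Ss′ s
  only-T (inj₂ t) = t
  only-S : ∀ {p x} → Tags SL 1 Ss′ p (SL , x) ⊎ Tags TL 1 Ts′ p (SL , x) → Tags SL 1 Ss′ p (SL , x)
  only-S (inj₁ s) = s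
  only-S (inj₂ t) with () ← tags-label Ts′ t

module _ {P : Pos → Set} {S T : Filling} (Ss Ts : List (List Ent)) (dP : Down P) (ch : Chain P (positions* Ss ++ positions* Ts)) (bS : All Band Ss) (bT : All Band Ts)
  (S-Ss : Banded SL S Ss) (T-Ts : Banded TL T Ts) where

  private
    runs = switching Ss Ts dP ch bS bT (reps-init {P} Ss Ts ch S-Ss T-Ts)

  switch : ∃ λ H → RunI (length Ts) (length Ss) (initL S T) H × Outcome Ss Ts H
  switch = let H , r , o = proj₁ runs in H , r , outcome o

  switched : ∀ {H} → RunI (length Ts) (length Ss) (initL S T) H → Outcome Ss Ts H
  switched r = outcome (proj₂ runs r)

-- Exchanges keep the size of every band, so the last nonempty one keeps its index. The way back
-- thus runs over the same ranges of letters.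
banded-max : ∀ {lab lab′ U V m} Ts Ts′ → length Ts ≡ m → length Ts′ ≡ length Ts → (∀ k → length (bandAt Ts′ k) ≡ length (bandAt Ts k)) →
  Banded lab U Ts → Banded lab′ V Ts′ → IsMax U m → IsMax V m
banded-max {lab} {lab′} {U} {V} {m} Ts Ts′ l l′ sizes (f , _) (f′ , g′) (_ , least) =
  (λ p x e → ≤-trans (≤-pred (proj₂ (proj₂ (tags-size Ts′ (f′ p x e))))) (≤-reflexive (trans l′ l))) ,
  λ k h → least k λ p x e → by-size k h p x e ∣ x ∣ refl
  where
  by-size : ∀ k → (∀ p x → V p ≡ just x → ∣ x ∣ ≤ k) → ∀ p x → U p ≡ just x → ∀ j → ∣ x ∣ ≡ j → ∣ x ∣ ≤ k
  by-size k h p x e zero s = ≤-trans (≤-reflexive s) z≤n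
  by-size k h p x e (suc j) s with _ , n , _ ← tags-at⁻ Ts j (f p x e) s with bandAt Ts j | bandAt Ts′ j in q | sizes j
  by-size k h p x e (suc j) s | (_ ∷ _) | ((r , d) ∷ _) | _ =
    ≤-trans (≤-reflexive (trans s (sym (size-letter (suc j) d)))) (h r _ (g′ r _ (tags-at⁺ Ts′ j (subst ((r , d) ∈_) (sym q) (here refl)))))

module _ {P : Pos → Set} {lab : Label} {U : Filling} (Ts : List (List Ent)) (dP : Down P) (ch : Chain P (positions* Ts)) (bTs : All Band Ts) (b : Banded lab U Ts) where

  lrs-bands : ∀ {la mu} → StrictPartition la → IsSYT la mu U → IsLRSWord (readingWord (sum la) U) ⇔′ (Linked Lat Ts × All (_≡ false) (concatMap flags Ts))
  lrs-bands {la} {mu} sla (shaped , _ , rows≤ , _ , _ , row-pr) = LatticeWord.lrs-word {P} {U} {lab} Ts (sum la) dP ch bTs (proj₁ b) (proj₂ b) bound rows≤ row-pr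
    where
    bound : ∀ p x → U p ≡ just x → (1 ≤ row p × row p ≤ sum la) × (1 ≤ col p × col p ≤ sum la)
    bound (i , j) x e with s@(1≤i , i≤j , _) ← proj₁ (proj₁ shaped (i , j) x e) =
      (1≤i , ≤-trans i≤j (shape-bound sla {i} {j} s)) , ≤-trans 1≤i i≤j , shape-bound sla {i} {j} s

  bands-of-lrs : IsLRSTableau U → Linked Lat Ts × All (_≡ false) (concatMap flags Ts)
  bands-of-lrs (la , mu , sla , _ , _ , syt , w) = proj₁ (lrs-bands {la} {mu} sla syt) w

lrs-of-bands : ∀ {mu lab U} Ts → StrictPartition mu → Chain (InShape mu) (positions* Ts) → All Band Ts → Banded lab U Ts →
  Linked Lat Ts × All (_≡ false) (concatMap flags Ts) → IsLRSTableau U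
lrs-of-bands {mu} Ts smu ch bTs b l with la , sla , sub , syt , _ ← bands-syt Ts smu ch bTs (proj₁ b) (proj₂ b) =
  la , mu , sla , smu , sub , syt , proj₂ (lrs-bands Ts (down-shape smu) ch bTs b {la} {mu} sla syt) l

module _ {la mu : List ℕ} {U : Filling} (sla : StrictPartition la) (smu : StrictPartition mu) (syt : IsSYT la mu U) {n : ℕ} (mx : IsMax U n) where

  open Tableau sla smu syt

  tableau-banded : ∀ lab → Banded lab U (bandsFrom 1 n)
  tableau-banded lab = (λ p x e → bands⁺ 1 n e (positive p x e) (s≤s (proj₁ mx p x e))) , λ p x t → value (bands⁻ 1 n t)
    where
    value : ∀ {p x} → (∃ λ y → (lab , x) ≡ (lab , y) × U p ≡ just y) → U p ≡ just x
    value (_ , refl , e) = e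

  tableau-shape : mu ⊆ˢ la → ∀ q → InShape la q ⇔′ (InShape mu ∪ positions* (bandsFrom 1 n)) q
  tableau-shape sub q = to , from
    where
    to : InShape la q → (InShape mu ∪ positions* (bandsFrom 1 n)) q
    to s with inShape? mu q
    ... | yes t = inj₁ t
    ... | no t with x , e ← proj₂ shaped q (s , t) = inj₂ (bands-pos⁺ 1 n e (positive q x e) (s≤s (proj₁ mx q x e)))
    from : (InShape mu ∪ positions* (bandsFrom 1 n)) q → InShape la q
    from (inj₁ t) = sub q t
    from (inj₂ m) = let x , e , _ = bands-pos 1 n m in proj₁ (proj₁ shaped q x e)

module _ {nu : List ℕ} {S T S' T' : Filling} {H : LFilling} {m n : ℕ} (Ss Ts : List (List Ent)) (snu : StrictPartition nu) (ch : Chain (InShape nu) (positions* Ss ++ positions* Ts)) (bSs : All Band Ss) (bTs : All Band Ts)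
  (S-Ss : Banded SL S Ss) (T-Ts : Banded TL T Ts) (lenS : length Ss ≡ m) (lenT : length Ts ≡ n) (maxS : IsMax S m) (maxT : IsMax T n)
  (run : RunI n m (initL S T) H) (S'-part : ∀ p → partL TL H p ≡ S' p) (T'-part : ∀ p → partL SL H p ≡ T' p) where

  private
    dnu = down-shape snu

  switching-bands : Switching S' T' S T × (IsLRSTableau T → IsLRSTableau S') × (IsLRSTableau S → IsLRSTableau T')
  switching-bands = conclude (switched Ss Ts dnu ch bSs bTs S-Ss T-Ts (subst₂ (λ u v → RunI u v (initL S T) H) (sym lenT) (sym lenS) run))
    where
    chS = proj₁ (chain-++⁻ (positions* Ss) ch)
    chT = proj₂ (chain-++⁻ (positions* Ss) ch)

    conclude : Outcome Ss Ts H → Switching S' T' S T × (IsLRSTableau T → IsLRSTableau S') × (IsLRSTableau S → IsLRSTableau T')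
    conclude (Ts′ , Ss′ , g , bTs′ , bSs′ , part-T , part-S) = back , lrs-b , lrs-c
      where
      g⁻ = X.grid-sym exchange-sym g
      S'-Ts′ : Banded TL S' Ts′
      S'-Ts′ = banded-resp Ts′ S'-part part-T
      T'-Ss′ : Banded SL T' Ss′
      T'-Ss′ = banded-resp Ss′ T'-part part-S
      ch′ : Chain (InShape nu) (positions* Ts′ ++ positions* Ss′)
      ch′ = subst (λ L → Chain (InShape nu) (positions* Ts′ ++ L)) (++-identityʳ (positions* Ss′))
        (chain-grid {L = []} dnu (subst (λ L → Chain (InShape nu) (positions* Ss ++ L)) (sym (++-identityʳ (positions* Ts))) ch) (grid-flat g))
      chTs′ = proj₁ (chain-++⁻ (positions* Ts′) ch′)
      chSs′ = proj₂ (chain-++⁻ (positions* Ts′) ch′)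
      lenT′ = grid-length {L = Exchange} g
      lenS′ = sym (grid-length {L = Exchange} g⁻)

      back : Switching S' T' S T
      back with H′ , run′ , Ss″ , Ts″ , g′ , _ , _ , S-part , T-part ← switch Ts′ Ss′ dnu ch′ bTs′ bSs′ (banded-relabel Ts′ S'-Ts′) (banded-relabel Ss′ T'-Ss′)
        -- The grid of the way back and the reversed grid start from the same bands; by determinism
        -- they end in the same ones, which are those of `S` and `T`.
        with refl , refl ← X.grid-fun exchange-fun g′ g⁻ =
        n , m ,
        banded-max Ts Ts′ lenT lenT′ (grid-sizes g) T-Ts S'-Ts′ maxT ,
        banded-max Ss Ss′ lenS lenS′ (λ k → sym (grid-sizes g⁻ k)) S-Ss T'-Ss′ maxS ,
        H′ , subst₂ (λ u v → RunI u v (initL S' T') H′) (trans lenS′ lenS) (trans lenT′ lenT) run′ ,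
        banded-unique Ss S-part (banded-relabel Ss S-Ss) , banded-unique Ts T-part (banded-relabel Ts T-Ts)

      lrs-b : IsLRSTableau T → IsLRSTableau S'
      lrs-b h with l , f ← bands-of-lrs Ts (down-chain (positions* Ss) dnu chS) chT bTs T-Ts h =
        lrs-of-bands Ts′ snu chTs′ bTs′ S'-Ts′ (proj₁ (lat-grid {As = Ss} dnu ch bTs g) l , subst (All (_≡ false)) (sym (flags-grid bTs g)) f)

      lrs-c : IsLRSTableau S → IsLRSTableau T'
      -- The inner shape of `T'` is nu together with the boxes of `S'`. In the grid read backwards
      -- the bands of `T'` are turned into those of `S`, so the equivalence is applied from the
      -- result to the start.
      lrs-c h with l , f ← bands-of-lrs Ss dnu chS bSs S-Ss h with rho , srho , to , from ← grow-shape nu (positions* Ts′) snu chTs′ =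
        lrs-of-bands Ss′ srho (chain-resp (positions* Ss′) from to chSs′) bSs′ T'-Ss′
          (proj₂ (lat-grid {As = Ts′} dnu ch′ bSs′ g⁻) l , subst (All (_≡ false)) (flags-grid bSs′ g⁻) f)
theorem4p3 : (nu mu la : List ℕ) →
    StrictPartition nu → StrictPartition mu → StrictPartition la →
    nu ⊆ˢ mu → mu ⊆ˢ la →
    (S T : Filling) → IsSYT mu nu S → IsSYT la mu T →
    (S' T' : Filling) → Switching S T S' T' →
    Switching S' T' S T ×
    (IsLRSTableau T → IsLRSTableau S') ×
    (IsLRSTableau S → IsLRSTableau T')
theorem4p3 nu mu la snu smu sla nu⊆mu mu⊆la S T sytS sytT S' T' (m , n , maxS , maxT , H , run , S'-part , T'-part) =
  switching-bands Ss Ts snu ch (BS.bands-Band 1 m) (BT.bands-Band 1 n) (tableau-banded smu snu sytS maxS SL) (tableau-banded sla smu sytT maxT TL)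
    (BS.bands-length 1 m) (BT.bands-length 1 n) maxS maxT run S'-part T'-part
  where
  module BS = Tableau smu snu sytS
  module BT = Tableau sla smu sytT
  Ss = BS.bandsFrom 1 m
  Ts = BT.bandsFrom 1 n
  ch : Chain (InShape nu) (positions* Ss ++ positions* Ts)
  -- The boxes of `S` complete nu to mu, where the chain of `T` begins.
  ch = chain-++⁺ (positions* Ss) (BS.bands-chain m (proj₁ maxS)) (chain-resp (positions* Ts)
    (λ q → proj₁ (tableau-shape smu snu sytS maxS nu⊆mu q)) (λ q → proj₂ (tableau-shape smu snu sytS maxS nu⊆mu q)) (BT.bands-chain n (proj₁ maxT)))
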